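{- Let $k\in\mathbb{N}$ with $k\geq 3$. There exists $c>0$ such that for every $\alpha>0$ the following hold (where "almost all ... on $n$ vertices have property $P$" means that the proportion of such labelled objects on vertex set $[n]$ having property $P$ tends to $1$ as $n\to\infty$). (i) Almost all $C_k$-free oriented graphs on $n$ vertices have between $cn/\log n$ and $\alpha n^2$ backwards edges in a transitive-optimal ordering. (ii) Almost all $C_k$-free digraphs on $n$ vertices have at least $cn/\log n$ backwards edges in a transitive-optimal ordering. Moreover, (a) if $k$ is even then almost all $C_k$-free digraphs on $n$ vertices have at most $\alpha n^2$ backwards edges in a transitive-optimal ordering; (b) if $k$ is odd then almost all $C_k$-free digraphs on $n$ vertices can be made into a subgraph of a transitive-bipartite blow up by changing at most $\alpha n^2$ edges.
   Context: A digraph is a pair $(V,E)$ with $E$ a set of ordered pairs of distinct vertices (edges in both directions between a pair are allowed, no loops, no parallel edges in the same direction); an oriented graph is a digraph with at most one edge between any two vertices. $C_k$ is the directed cycle on $k$ vertices; $H$-free means containing no (not necessarily induced) copy of $H$. $\log$ denotes $\log_2$. Given a digraph $G$ with vertex labels $1,\dots,n$ and an ordering $\sigma:[n]\to[n]$ (a bijection), a backwards edge with respect to $\sigma$ is an edge directed from $i$ to $j$ with $\sigma(i)>\sigma(j)$. A transitive-optimal ordering of $G$ is an ordering minimising the number of backwards edges. A digraph $G=(V,E)$ is a transitive-bipartite blow up if $V$ admits a partition $A_1,\dots,A_t$ such that each $G[A_i]$ is either a single vertex or a complete balanced bipartite digraph (all edges in both directions between the two classes), and for all $i<j$ the edges between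 $A_i$ and $A_j$ are precisely all edges directed from $A_i$ to $A_j$. "Changing" an edge means adding, deleting, or reversing its orientation. -}

module Defs where

open import Data.Nat using (ℕ; zero; suc; _+_; _*_; _^_; _≤_; _<_; _<ᵇ_)
open import Data.Nat.Properties using ()
open import Data.Bool using (Bool; true; false; _∧_; if_then_else_)
import Data.Bool as Bool
open import Data.Fin using (Fin; toℕ) renaming (_≟_ to _≟F_)
open import Data.Fin.Permutation using (Permutation′; _⟨$⟩ʳ_)
open import Data.List using (List; []; _∷_; [_]; map; concatMap; length; filter; allFin)
open import Data.Nat.ListAction using (sum)
open import Data.List.Relation.Unary.All using (All)
open import Data.List.Relation.Binary.Sublist.Propositional using (_⊆_)
open import Data.Vec using (Vec; lookup) renaming ([] to []ᵥ; _∷_ to _∷ᵥ_)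
open import Data.Product using (Σ; ∃; _×_; _,_)
open import Data.Sum using (_⊎_)
open import Relation.Nullary using (¬_)
open import Relation.Nullary.Decidable using (_×-dec_)
open import Relation.Binary.PropositionalEquality using (_≡_; _≢_)
open import Function.Definitions using (Injective)
open import Function.Bundles using (_⇔_)

-- Labelled (di)graphs on vertex set Fin n, encoded as Boolean adjacency
-- matrices: Edge G i j  means the edge i → j is present.

Mat : ℕ → Set
Mat n = Vec (Vec Bool n) n

edge : ∀ {n} → Mat n → Fin n → Fin n → Bool
edge G i j = lookup (lookup G i) j

Edge : ∀ {n} → Mat n → Fin n → Fin n → Set
Edge G i j = edge G i j ≡ true

allVecs : ∀ {A : Set} → List A → (m : ℕ) → List (Vec A m)
allVecs xs zero    = [ []ᵥ ]
allVecs xs (suc m) = concatMap (λ x → map (x ∷ᵥ_) (allVecs xs m)) xs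

allMats : (n : ℕ) → List (Mat n)
allMats n = allVecs (allVecs (true ∷ false ∷ []) n) n

-- a digraph: no loops (at most one edge in each direction is automatic)
IsDigraph : ∀ {n} → Mat n → Set
IsDigraph G = ∀ i → ¬ Edge G i i

IsOriented : ∀ {n} → Mat n → Set
IsOriented G = IsDigraph G × (∀ i j → Edge G i j → ¬ Edge G j i)

ContainsCycle : ∀ {n} → ℕ → Mat n → Set
ContainsCycle {n} k G =
  Σ (Fin k → Fin n) λ f → Injective _≡_ _≡_ f ×
    (∀ (i j : Fin k) →
       (suc (toℕ i) ≡ toℕ j ⊎ (suc (toℕ i) ≡ k × toℕ j ≡ 0)) →
       Edge G (f i) (f j))

CkFree : ∀ {n} → ℕ → Mat n → Set
CkFree k G = ¬ ContainsCycle k G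

backwards : ∀ {n} → Mat n → Permutation′ n → ℕ
backwards {n} G σ =
  sum (map (λ i → sum (map (λ j →
         if edge G i j ∧ (toℕ (σ ⟨$⟩ʳ j) <ᵇ toℕ (σ ⟨$⟩ʳ i)) then 1 else 0)
       (allFin n))) (allFin n))

TransitiveOptimal : ∀ {n} → Mat n → Permutation′ n → Set
TransitiveOptimal G σ = ∀ τ → backwards G σ ≤ backwards G τ

-- "b ≥ c n / log₂ n" with c = p / q, written without reals:
-- b · log₂ n ≥ (p/q) n  ⇔  n ^ (q b) ≥ 2 ^ (p n)   (for n ≥ 2)
AtLeastCNOverLog : (p q n b : ℕ) → Set
AtLeastCNOverLog p q n b = 2 ^ (p * n) ≤ n ^ (q * b)

-- "b ≤ α n²" with α = a / d
AtMostAlphaN² : (a d n b : ℕ) → Set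
AtMostAlphaN² a d n b = d * b ≤ a * (n * n)

-- Transitive-bipartite blow ups.
-- part v : index of the class A_t containing v (classes ordered by index;
-- empty indices are allowed and ignored), side v : which side of the
-- bipartition of its class v lies on.

classCount : ∀ {n} → (Fin n → Fin n) → (Fin n → Bool) → Fin n → Bool → ℕ
classCount {n} part side p b =
  length (filter (λ v → (part v ≟F p) ×-dec (side v Bool.≟ b)) (allFin n))

IsTransitiveBipartiteBlowUp : ∀ {n} → Mat n → Set
IsTransitiveBipartiteBlowUp {n} H =
  Σ (Fin n → Fin n) λ part → Σ (Fin n → Bool) λ side →
    (∀ p → (classCount part side p true + classCount part side p false ≤ 1)
           ⊎ (classCount part side p true ≡ classCount part side p false))
  × (∀ u v → part u ≡ part v → (Edge H u v ⇔ side u ≢ side v))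
  × (∀ u v → toℕ (part u) < toℕ (part v) → Edge H u v)
  × (∀ u v → toℕ (part v) < toℕ (part u) → ¬ Edge H u v)

SubgraphOf : ∀ {n} → Mat n → Mat n → Set
SubgraphOf G H = ∀ i j → Edge G i j → Edge H i j

-- minimum number of edge changes (add / delete / reverse) on the pair {i,j}
-- turning the states (x = i→j, y = j→i) into (x' , y')
pairCost : Bool → Bool → Bool → Bool → ℕ
pairCost true  false false true  = 1   -- reverse i→j
pairCost false true  true  false = 1   -- reverse j→i
pairCost x y x' y' = diff x x' + diff y y'
  where
  diff : Bool → Bool → ℕ
  diff true  true  = 0
  diff false false = 0
  diff _     _     = 1

changes : ∀ {n} → Mat n → Mat n → ℕ
changes {n} G G' =
  sum (map (λ i → sum (map (λ j →
         if toℕ i <ᵇ toℕ j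
         then pairCost (edge G i j) (edge G j i) (edge G' i j) (edge G' j i)
         else 0)
       (allFin n))) (allFin n))

NearBlowUp : ∀ {n} → (a d : ℕ) → Mat n → Set
NearBlowUp {n} a d G =
  Σ (Mat n) λ H → Σ (Mat n) λ G' →
    IsTransitiveBipartiteBlowUp H × IsDigraph G' × SubgraphOf G' H ×
    AtMostAlphaN² a d n (changes G G')

-- "Almost all" : among the matrices satisfying Cls, the proportion of those
-- satisfying P tends to 1.  Counts are expressed via sublists of the
-- repetition-free enumeration allMats n: for every ε = e / (suc f) > 0 there
-- is N such that for n ≥ N,
--   #{G : Cls G ∧ ¬ P G} ≤ ε · #{G : Cls G}.

AlmostAll : (Cls : ∀ {n} → Mat n → Set) (P : ∀ {n} → Mat n → Set) → Set
AlmostAll Cls P =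
  ∀ (e f : ℕ) → 0 < e → ∃ λ N → ∀ n → N ≤ n →
    ∀ (S : List (Mat n)) → S ⊆ allMats n → All (λ G → Cls G × ¬ P G) S →
    Σ (List (Mat n)) λ T → T ⊆ allMats n × All Cls T ×
      suc f * length S ≤ e * length T

Even Odd : ℕ → Set
Even k = ∃ λ m → k ≡ 2 * m
Odd k = ∃ λ m → k ≡ suc (2 * m)

{-# OPTIONS --safe #-}

-- Containers: an integer version of the Frieze–Kannan iteration attaches to every C_k-free digraph G one
-- of 2^O(n) digraphs D, such that D has o(n^k) closed walks of length k and misses o(n²) edges of G. A
-- family of graphs none of which has a container of nearly extremal weight therefore has size at most
-- 2^(n²/2 - δn²), while all subgraphs of a transitive tournament are C_k-free.
--
-- Stability: let D have nearly extremal weight and few closed k-walks. Alternating walks between the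
-- two ends of double edges show that few double edges lie in triangles (for k even, or for oriented
-- graphs, that there are few double edges at all). Averaging over a maximal matching of double edges
-- then bounds the degree sum, so almost all vertices have total degree about n, and hence D has few
-- directed triangles. It follows that ordering the vertices by in-degree minus out-degree leaves few
-- backwards single edges, and that the double edges split greedily into nearly complete bipartite
-- classes, which are balanced by turning surplus vertices into singletons.
--
-- Lower bound: cut an ordering of G with few backwards edges into blocks of k + 1 consecutive vertices,
-- delete the backwards edges, and in each of n / O(1) groups of blocks replace one block by a directed
-- (k+1)-cycle. The result is still C_k-free, its closed (k+1)-walks reveal the chosen blocks, and the
-- number of choices exceeds the number of ways to recover G unless there are Ω(n / log n) backwards edges.

module Submission where

open import Defs
open import Data.Nat using (ℕ; zero; suc; _+_; _*_; _∸_; _^_; _⊓_; _≤_; _<_; _≤ᵇ_; _<ᵇ_; _≡ᵇ_; z≤n; s≤s; >-nonZero)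
open import Data.Nat.Properties
open import Data.Nat.DivMod using (_/_; _%_; m≡m%n+[m/n]*n; m%n<n; m<n⇒m%n≡m; %-distribˡ-+; m%n%n≡m%n; [m+n]%n≡m%n; /-mono-≤)
open import Data.Nat.ListAction using (sum)
open import Data.Nat.Tactic.RingSolver using (solve-∀)
open import Data.Bool using (Bool; true; false; _∧_; _∨_; not; if_then_else_; T)
import Data.Bool as Bool
open import Data.Bool.Properties using (T-≡; ∧-comm)
import Data.Bool.Properties as BP
open import Data.Fin using (Fin; zero; suc; toℕ; fromℕ; fromℕ<; inject₁; punchOut)
open import Data.Fin.Induction using (<-weakInduction)
open import Data.Fin.Permutation using (Permutation′; permutation; _⟨$⟩ʳ_; _⟨$⟩ˡ_; inverseˡ; inverseʳ) renaming (id to idₚ)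
import Data.Fin.Properties as FP
open import Data.Product using (Σ; ∃; _×_; _,_; proj₁; proj₂; uncurry)
open import Data.Sum using (_⊎_; inj₁; inj₂)
open import Data.Empty using (⊥; ⊥-elim)
open import Data.Unit using (tt)
open import Data.Vec using (Vec; lookup; tabulate; toList; fromList) renaming ([] to []ᵥ; _∷_ to _∷ᵥ_)
open import Data.Vec.Properties using (lookup∘tabulate; tabulate∘lookup; tabulate-cong; toList∘fromList) renaming (∷-injective to ∷ᵥ-injective)
import Data.Vec.Properties as VP
open import Data.List using (List; []; _∷_; [_]; map; concatMap; length; filter; allFin; _++_; replicate; cartesianProductWith)
import Data.List as List
open import Data.List.Properties using (length-map; length-tabulate; map-tabulate; ∷-injective)
open import Data.List.Membership.Propositional using (_∈_; find; lose)
open import Data.List.Membership.Propositional.Properties using (∈-∃++; ∈-++⁺ˡ; ∈-++⁺ʳ; ∈-++⁻; ∈-map⁺; ∈-cartesianProductWith⁺; ∈-cartesianProductWith⁻; ∈-filter⁺; ∈-filter⁻; ∈-allFin)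
open import Data.List.Relation.Unary.Any using (Any; here; there; any?)
open import Data.List.Relation.Unary.All as All using (All; []; _∷_)
open import Data.List.Relation.Unary.All.Properties using (all-filter) renaming (map⁺ to All-map⁺)
open import Data.List.Relation.Unary.AllPairs using ([]; _∷_)
open import Data.List.Relation.Unary.Unique.Propositional using (Unique)
import Data.List.Relation.Unary.Unique.Propositional.Properties as Uniq
open import Data.List.Relation.Binary.Sublist.Propositional using (_⊆_)
open import Data.List.Relation.Binary.Sublist.Propositional.Properties using (filter-⊆)
open import Data.List.Relation.Binary.Sublist.Heterogeneous using (_∷ʳ_) renaming ([] to []ₛ; _∷_ to _∷ₛ_)
open import Relation.Nullary using (¬_; Dec; yes; no; contradiction)
open import Relation.Nullary.Decidable using (does; dec-true; map′; ¬?; _×-dec_; _→-dec_; _⊎-dec_; decidable-stable)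
open import Relation.Binary.Definitions using (tri<; tri≈; tri>)
open import Relation.Binary.PropositionalEquality using (_≡_; _≢_; refl; sym; trans; cong; cong₂; subst; subst₂; module ≡-Reasoning)
open import Function using (_∘_; id)
open import Function.Bundles using (_⇔_; Equivalence; mk⇔)

-- Sums and Boolean tautologies

-- All estimates are in natural numbers: `E * x ≤ n * n` says that x is at most the fraction 1/E of
-- n², and a result `∃ λ F → ...` turns smallness up to 1/F in its hypotheses into smallness up to
-- 1/E in its conclusion. Closed walks replace cycles because a trace is linear in each factor, so
-- that a cut approximation can be inserted factor by factor; the error made is small, since the
-- closed k-walks of a C_k-free graph all repeat a vertex and there are only O(n^(k-1)) of them.
-- What shapes the stability part is that the extremal weight does not determine the structure: a
-- balanced complete bipartite digraph has the same degree sum, up to O(n), as a tournament on its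
-- vertices. Double edges thus have to be excluded or organised by other means. In oriented graphs
-- the pair of a double edge of the container admits three states instead of four, and log 3 < 2
-- makes double edges too expensive. Choices that need excluded middle are made under a double
-- negation, which is removed once a decidable inequality between numbers is left.

infixr 1 _>>=_
_>>=_ : {A B : Set} → ¬ ¬ A → (A → ¬ ¬ B) → ¬ ¬ B
(m >>= f) k = m (λ a → f a k)

return : {A : Set} → A → ¬ ¬ A
return a k = k a

classical : (A : Set) → ¬ ¬ (A ⊎ ¬ A)
classical A k = k (inj₂ (λ a → k (inj₁ a)))

⟦_⟧ : Bool → ℕ
⟦ true ⟧ = 1
⟦ false ⟧ = 0

⟦⟧≤1 : ∀ b → ⟦ b ⟧ ≤ 1
⟦⟧≤1 true = ≤-refl
⟦⟧≤1 false = z≤n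

⟦∧⟧ : ∀ a b → ⟦ a ∧ b ⟧ ≡ ⟦ a ⟧ * ⟦ b ⟧
⟦∧⟧ true b = sym (+-identityʳ ⟦ b ⟧)
⟦∧⟧ false b = refl

-- Boolean identities and inequalities are checked by running through all valuations.
BoolFun : ℕ → Set
BoolFun zero = Bool
BoolFun (suc n) = Bool → BoolFun n

Tautology : ∀ n → BoolFun n → Set
Tautology zero b = T b
Tautology (suc n) f = ∀ b → Tautology n (f b)

check : ∀ n → BoolFun n → Bool
check zero b = b
check (suc n) f = check n (f true) ∧ check n (f false)

∧-fst : ∀ {a b} → T (a ∧ b) → T a
∧-fst {true} _ = tt

∧-snd : ∀ {a b} → T (a ∧ b) → T b
∧-snd {true} t = t

taut : ∀ n (f : BoolFun n) → T (check n f) → Tautology n f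
taut zero f c = c
taut (suc n) f c true = taut n (f true) (∧-fst {check n (f true)} c)
taut (suc n) f c false = taut n (f false) (∧-snd {check n (f true)} c)

+-interchange : ∀ a b c d → (a + b) + (c + d) ≡ (a + c) + (b + d)
+-interchange = solve-∀

opaque
  ∑ : ∀ {n} → (Fin n → ℕ) → ℕ
  ∑ {zero} f = 0
  ∑ {suc n} f = f zero + ∑ (f ∘ suc)

  ∑-cong : ∀ {n} {f g : Fin n → ℕ} → (∀ i → f i ≡ g i) → ∑ f ≡ ∑ g
  ∑-cong {zero} e = refl
  ∑-cong {suc n} e = cong₂ _+_ (e zero) (∑-cong (e ∘ suc))

  ∑-mono : ∀ {n} {f g : Fin n → ℕ} → (∀ i → f i ≤ g i) → ∑ f ≤ ∑ g
  ∑-mono {zero} e = z≤n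
  ∑-mono {suc n} e = +-mono-≤ (e zero) (∑-mono (e ∘ suc))

  ∑-+ : ∀ {n} (f g : Fin n → ℕ) → ∑ (λ i → f i + g i) ≡ ∑ f + ∑ g
  ∑-+ {zero} f g = refl
  ∑-+ {suc n} f g = trans (cong (f zero + g zero +_) (∑-+ (f ∘ suc) (g ∘ suc))) (+-interchange (f zero) (g zero) _ _)

  ∑-*ˡ : ∀ {n} c (f : Fin n → ℕ) → ∑ (λ i → c * f i) ≡ c * ∑ f
  ∑-*ˡ {zero} c f = sym (*-zeroʳ c)
  ∑-*ˡ {suc n} c f = trans (cong (c * f zero +_) (∑-*ˡ c (f ∘ suc))) (sym (*-distribˡ-+ c (f zero) _))

  ∑-const : ∀ n c → ∑ {n} (λ _ → c) ≡ n * c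
  ∑-const zero c = refl
  ∑-const (suc n) c = cong (c +_) (∑-const n c)

  ∑-zero : ∀ n → ∑ {n} (λ _ → 0) ≡ 0
  ∑-zero n = trans (∑-const n 0) (*-zeroʳ n)

  ∑-swap : ∀ {m n} (f : Fin m → Fin n → ℕ) → ∑ (λ i → ∑ (f i)) ≡ ∑ (λ j → ∑ (λ i → f i j))
  ∑-swap {zero} {n} f = sym (∑-zero n)
  ∑-swap {suc m} f = trans (cong (∑ (f zero) +_) (∑-swap (f ∘ suc))) (sym (∑-+ (f zero) _))

  ∑-term : ∀ {n} (f : Fin n → ℕ) i → f i ≤ ∑ f
  ∑-term f zero = m≤m+n (f zero) _
  ∑-term f (suc i) = ≤-trans (∑-term (f ∘ suc) i) (m≤n+m _ (f zero))

  ∑-empty : (f : Fin 0 → ℕ) → ∑ f ≡ 0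
  ∑-empty f = refl

  ∑-suc : ∀ {n} (f : Fin (suc n) → ℕ) → ∑ f ≡ f zero + ∑ (f ∘ suc)
  ∑-suc f = refl

∑-*ʳ : ∀ {n} c (f : Fin n → ℕ) → ∑ (λ i → f i * c) ≡ ∑ f * c
∑-*ʳ c f = trans (∑-cong (λ i → *-comm (f i) c)) (trans (∑-*ˡ c f) (*-comm c (∑ f)))

∑-bound : ∀ {n} {f : Fin n → ℕ} {c} → (∀ i → f i ≤ c) → ∑ f ≤ n * c
∑-bound {n} {c = c} h = ≤-trans (∑-mono h) (≤-reflexive (∑-const n c))

∑∑-mono : ∀ {m n} {f g : Fin m → Fin n → ℕ} → (∀ i j → f i j ≤ g i j) → ∑ (λ i → ∑ (f i)) ≤ ∑ (λ i → ∑ (g i))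
∑∑-mono h = ∑-mono (λ i → ∑-mono (h i))

∑∑-cong : ∀ {m n} {f g : Fin m → Fin n → ℕ} → (∀ i j → f i j ≡ g i j) → ∑ (λ i → ∑ (f i)) ≡ ∑ (λ i → ∑ (g i))
∑∑-cong h = ∑-cong (λ i → ∑-cong (h i))

∑∑-+ : ∀ {m n} (f g : Fin m → Fin n → ℕ) → ∑ (λ i → ∑ (λ j → f i j + g i j)) ≡ ∑ (λ i → ∑ (f i)) + ∑ (λ i → ∑ (g i))
∑∑-+ f g = trans (∑-cong (λ i → ∑-+ (f i) (g i))) (∑-+ _ _)

∑∑-*ˡ : ∀ {m n} c (f : Fin m → Fin n → ℕ) → ∑ (λ i → ∑ (λ j → c * f i j)) ≡ c * ∑ (λ i → ∑ (f i))
∑∑-*ˡ c f = trans (∑-cong (λ i → ∑-*ˡ c (f i))) (∑-*ˡ c _)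

∑∑-bound : ∀ {m n} {f : Fin m → Fin n → ℕ} {c} → (∀ i j → f i j ≤ c) → ∑ (λ i → ∑ (f i)) ≤ m * (n * c)
∑∑-bound h = ∑-bound (λ i → ∑-bound (h i))

∑-⟦⟧≤ : ∀ {n} (b : Fin n → Bool) → ∑ (λ i → ⟦ b i ⟧) ≤ n
∑-⟦⟧≤ {n} b = ≤-trans (∑-bound (λ i → ⟦⟧≤1 (b i))) (≤-reflexive (*-identityʳ n))

2ab≤ : ∀ a b → 2 * (a * b) ≤ a * a + b * b
2ab≤ a b with ≤-total a b
... | inj₁ a≤b = subst (λ b → 2 * (a * b) ≤ a * a + b * b) (m+[n∸m]≡n a≤b) (go a (b ∸ a))
  where
  go : ∀ a c → 2 * (a * (a + c)) ≤ a * a + (a + c) * (a + c)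
  go a c = ≤-trans (m≤m+n _ (c * c)) (≤-reflexive (eq a c))
    where
    eq : ∀ a c → 2 * (a * (a + c)) + c * c ≡ a * a + (a + c) * (a + c)
    eq = solve-∀
... | inj₂ b≤a = subst (λ a → 2 * (a * b) ≤ a * a + b * b) (m+[n∸m]≡n b≤a) (go b (a ∸ b))
  where
  go : ∀ a c → 2 * ((a + c) * a) ≤ (a + c) * (a + c) + a * a
  go a c = ≤-trans (m≤m+n _ (c * c)) (≤-reflexive (eq a c))
    where
    eq : ∀ a c → 2 * ((a + c) * a) + c * c ≡ (a + c) * (a + c) + a * a
    eq = solve-∀

∑-prod : ∀ {m n} (f : Fin m → ℕ) (g : Fin n → ℕ) → ∑ (λ i → ∑ (λ j → f i * g j)) ≡ ∑ f * ∑ g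
∑-prod f g = trans (∑-cong (λ i → ∑-*ˡ (f i) g)) (∑-*ʳ (∑ g) f)

cauchy-schwarz : ∀ {n} (f : Fin n → ℕ) → ∑ f * ∑ f ≤ n * ∑ (λ i → f i * f i)
cauchy-schwarz {n} f = *-cancelˡ-≤ 2 (begin
  2 * (∑ f * ∑ f) ≡⟨ cong (2 *_) (sym (∑-prod f f)) ⟩
  2 * ∑ (λ i → ∑ (λ j → f i * f j)) ≡⟨ sym (∑∑-*ˡ 2 (λ i j → f i * f j)) ⟩
  ∑ (λ i → ∑ (λ j → 2 * (f i * f j))) ≤⟨ ∑∑-mono (λ i j → 2ab≤ (f i) (f j)) ⟩
  ∑ (λ i → ∑ (λ j → f i * f i + f j * f j)) ≡⟨ ∑∑-+ (λ i j → f i * f i) (λ i j → f j * f j) ⟩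
  ∑ (λ i → ∑ {n} (λ j → f i * f i)) + ∑ {n} (λ i → ∑ (λ j → f j * f j)) ≡⟨ cong₂ _+_ (trans (∑-cong (λ i → ∑-const n (f i * f i))) (∑-*ˡ n _)) (∑-const n _) ⟩
  n * Q + n * Q ≡⟨ eq n Q ⟩
  2 * (n * Q) ∎)
  where
  open ≤-Reasoning
  Q = ∑ (λ i → f i * f i)
  eq : ∀ n q → n * q + n * q ≡ 2 * (n * q)
  eq = solve-∀

-- Reduces linear arithmetic to a semiring identity, in which c is the slack.
lin : ∀ {x y a b} c → x ≤ y → a + y + c ≡ b + x → a ≤ b
lin {x} {y} {a} {b} c x≤y e = +-cancelʳ-≤ y a b (begin
  a + y ≤⟨ m≤m+n _ c ⟩
  a + y + c ≡⟨ e ⟩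
  b + x ≤⟨ +-monoʳ-≤ b x≤y ⟩
  b + y ∎)
  where open ≤-Reasoning

-- A reverse Markov inequality. Since `f` never exceeds `N`, an average of at least N / F forces at
-- least n / (2F) indices to have `f w` at least N / (2F), and each of these contributes `m` to the
-- sum of `g`. It is used repeatedly to pass from dense configurations to many walks.
rich-average : ∀ {n} F N m (f g : Fin n → ℕ) → 0 < N → (∀ w → f w ≤ N) → n * N ≤ F * ∑ f →
  (∀ w → N ≤ 2 * F * f w → m ≤ g w) → n * m ≤ 2 * F * ∑ g
rich-average {n} F N m f g N>0 fN avg rich = begin
  n * m ≤⟨ *-monoˡ-≤ m many ⟩
  2 * F * ∑ ρ * m ≡⟨ trans (*-assoc (2 * F) _ m) (cong (2 * F *_) (sym (∑-*ʳ m ρ))) ⟩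
  2 * F * ∑ (λ w → ρ w * m) ≤⟨ *-monoʳ-≤ (2 * F) (∑-mono ρm≤g) ⟩
  2 * F * ∑ g ∎
  where
  open ≤-Reasoning
  ρ : Fin n → ℕ
  -- The indicator of the rich indices; `point` bounds a rich term by its maximum and any other term
  -- by the threshold.
  ρ w = ⟦ N ≤ᵇ 2 * F * f w ⟧
  ρm≤g : ∀ w → ρ w * m ≤ g w
  ρm≤g w with N ≤ᵇ 2 * F * f w in eq
  ... | true = ≤-trans (≤-reflexive (+-identityʳ m)) (rich w (≤ᵇ⇒≤ _ _ (Equivalence.from T-≡ eq)))
  ... | false = z≤n
  point : ∀ w → 2 * F * f w ≤ 2 * F * N * ρ w + N
  point w with N ≤ᵇ 2 * F * f w in eq
  ... | true = ≤-trans (*-monoʳ-≤ (2 * F) (fN w)) (≤-trans (≤-reflexive (sym (*-identityʳ _))) (m≤m+n _ N))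
  ... | false = ≤-trans (<⇒≤ (≰⇒> (λ le → subst T eq (≤⇒≤ᵇ le)))) (m≤n+m N _)
  many : n ≤ 2 * F * ∑ ρ
  many = *-cancelʳ-≤ n (2 * F * ∑ ρ) N {{>-nonZero N>0}} (lin 0 (≤-trans (≤-trans (+-mono-≤ avg avg) (≤-reflexive (eq₁ F (∑ f)))) tot) (eq₂ n N F (∑ ρ)))
    where
    tot : 2 * F * ∑ f ≤ 2 * F * N * ∑ ρ + n * N
    tot = begin
      2 * F * ∑ f ≡⟨ sym (∑-*ˡ (2 * F) f) ⟩
      ∑ (λ w → 2 * F * f w) ≤⟨ ∑-mono point ⟩
      ∑ (λ w → 2 * F * N * ρ w + N) ≡⟨ ∑-+ _ (λ _ → N) ⟩
      ∑ (λ w → 2 * F * N * ρ w) + ∑ {n} (λ _ → N) ≡⟨ cong₂ _+_ (∑-*ˡ (2 * F * N) ρ) (∑-const n N) ⟩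
      2 * F * N * ∑ ρ + n * N ∎
    eq₁ : ∀ F f → F * f + F * f ≡ 2 * F * f
    eq₁ = solve-∀
    eq₂ : ∀ n N F r → n * N + (2 * F * N * r + n * N) + 0 ≡ 2 * F * r * N + (n * N + n * N)
    eq₂ = solve-∀

^-distribʳ-* : ∀ k a b → (a * b) ^ k ≡ a ^ k * b ^ k
^-distribʳ-* zero a b = refl
^-distribʳ-* (suc k) a b = trans (cong (a * b *_) (^-distribʳ-* k a b)) (eq a b (a ^ k) (b ^ k))
  where
  eq : ∀ a b c d → a * b * (c * d) ≡ a * c * (b * d)
  eq = solve-∀

-- Kernels and traces

Kernel : ℕ → Set
Kernel n = Fin n → Fin n → ℕ

δ : ∀ {n} → Kernel n
δ x y = ⟦ does (x FP.≟ y) ⟧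

δ-suc : ∀ {n} (x y : Fin n) → δ (suc x) (suc y) ≡ δ x y
δ-suc x y with x FP.≟ y
... | yes refl = refl
... | no _ = refl

δ-refl : ∀ {n} (x : Fin n) → δ x x ≡ 1
δ-refl x with x FP.≟ x
... | yes _ = refl
... | no ¬p = contradiction refl ¬p

∑-δ : ∀ {n} (f : Fin n → ℕ) y → ∑ (λ z → f z * δ z y) ≡ f y
∑-δ {suc n} f zero = trans (∑-suc _) (trans (cong₂ _+_ (*-identityʳ (f zero)) (trans (∑-cong (λ z → *-zeroʳ (f (suc z)))) (∑-zero n))) (+-identityʳ (f zero)))
∑-δ {suc n} f (suc y) = trans (∑-suc _) (trans (cong₂ _+_ (*-zeroʳ (f zero)) (∑-cong (λ z → cong (f (suc z) *_) (δ-suc z y)))) (∑-δ (f ∘ suc) y))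

infixr 7 _·_
_·_ : ∀ {n} → Kernel n → Kernel n → Kernel n
(A · B) x y = ∑ (λ z → A x z * B z y)

infix 4 _≐_
_≐_ : ∀ {n} → Kernel n → Kernel n → Set
A ≐ B = ∀ x y → A x y ≡ B x y

·-cong : ∀ {n} {A A′ B B′ : Kernel n} → A ≐ A′ → B ≐ B′ → A · B ≐ A′ · B′
·-cong e f x y = ∑-cong (λ z → cong₂ _*_ (e x z) (f z y))

·-mono : ∀ {n} {A A′ B B′ : Kernel n} → (∀ x y → A x y ≤ A′ x y) → (∀ x y → B x y ≤ B′ x y) → ∀ x y → (A · B) x y ≤ (A′ · B′) x y
·-mono e f x y = ∑-mono (λ z → *-mono-≤ (e x z) (f z y))

·-assoc : ∀ {n} (A B C : Kernel n) → (A · B) · C ≐ A · (B · C)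
·-assoc A B C x y = begin
  ∑ (λ z → ∑ (λ w → A x w * B w z) * C z y) ≡⟨ ∑-cong (λ z → sym (∑-*ʳ (C z y) (λ w → A x w * B w z))) ⟩
  ∑ (λ z → ∑ (λ w → A x w * B w z * C z y)) ≡⟨ ∑-swap _ ⟩
  ∑ (λ w → ∑ (λ z → A x w * B w z * C z y)) ≡⟨ ∑∑-cong (λ w z → *-assoc (A x w) _ _) ⟩
  ∑ (λ w → ∑ (λ z → A x w * (B w z * C z y))) ≡⟨ ∑-cong (λ w → ∑-*ˡ (A x w) _) ⟩
  ∑ (λ w → A x w * ∑ (λ z → B w z * C z y)) ∎
  where open ≡-Reasoning

·-δ : ∀ {n} (A : Kernel n) → A · δ ≐ A
·-δ A x y = ∑-δ (A x) y

δ-· : ∀ {n} (A : Kernel n) → δ · A ≐ A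
δ-· A x y = trans (∑-cong (λ z → trans (*-comm (δ x z) (A z y)) (cong (A z y *_) (δ-sym x z)))) (∑-δ (λ z → A z y) x)
  where
  δ-sym : ∀ {n} (x z : Fin n) → δ x z ≡ δ z x
  δ-sym x z with x FP.≟ z | z FP.≟ x
  ... | yes _ | yes _ = refl
  ... | no _ | no _ = refl
  ... | yes refl | no q = contradiction refl q
  ... | no q | yes refl = contradiction refl q

tr : ∀ {n} → Kernel n → ℕ
tr A = ∑ (λ x → A x x)

tr-cong : ∀ {n} {A B : Kernel n} → A ≐ B → tr A ≡ tr B
tr-cong e = ∑-cong (λ x → e x x)

tr-comm : ∀ {n} (A B : Kernel n) → tr (A · B) ≡ tr (B · A)
tr-comm A B = trans (∑-swap _) (∑∑-cong (λ z x → *-comm (A x z) (B z x)))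

prodL : ∀ {n} → List (Kernel n) → Kernel n
prodL [] = δ
prodL (A ∷ L) = A · prodL L

prodL-snoc : ∀ {n} (L : List (Kernel n)) A → prodL (L ++ [ A ]) ≐ prodL L · A
prodL-snoc [] A x y = trans (·-δ A x y) (sym (δ-· A x y))
prodL-snoc (B ∷ L) A x y = trans (·-cong {A = B} (λ _ _ → refl) (prodL-snoc L A) x y) (sym (·-assoc B (prodL L) A x y))

Bounded : ∀ {n} → ℕ → Kernel n → Set
Bounded M A = ∀ x y → A x y ≤ M

prodL-bounded : ∀ {n} M (A : Kernel n) L → Bounded M A → All (Bounded M) L → Bounded (M ^ suc (length L) * n ^ length L) (prodL (A ∷ L))
prodL-bounded M A [] bA [] x y = ≤-trans (≤-reflexive (·-δ A x y)) (≤-trans (bA x y) (≤-reflexive (eq M)))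
  where
  eq : ∀ M → M ≡ M * 1 * 1
  eq = solve-∀
prodL-bounded {n} M A (B ∷ L) bA (bB ∷ bL) x y = ≤-trans (∑-bound (λ z → *-mono-≤ (bA x z) (prodL-bounded M B L bB bL z y))) (≤-reflexive (eq n M (M * M ^ length L) (n ^ length L)))
  where
  eq : ∀ n M p q → n * (M * (p * q)) ≡ M * p * (n * q)
  eq = solve-∀

-- Layer-cake decomposition: a weight with values at most `A` is a sum of `A` indicator functions,
-- of which the set where the weight is positive is split off at each stage. Every layer costs one
-- `C`.
∑-shift : ∀ {n} (p q : Fin n → ℕ) C → (∀ (S : Fin n → Bool) → ∑ (λ x → ⟦ S x ⟧ * p x) ≤ ∑ (λ x → ⟦ S x ⟧ * q x) + C) →
  ∀ A (a : Fin n → ℕ) → (∀ x → a x ≤ A) → ∑ (λ x → a x * p x) ≤ ∑ (λ x → a x * q x) + A * C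
∑-shift {n} p q C h zero a a≤ = ≤-trans (≤-reflexive (trans (∑-cong (λ x → cong (_* p x) (n≤0⇒n≡0 (a≤ x)))) (∑-zero n))) z≤n
∑-shift {n} p q C h (suc A) a a≤ = begin
  ∑ (λ x → a x * p x) ≡⟨ split p ⟩
  ∑ (λ x → ⟦ S x ⟧ * p x) + ∑ (λ x → (a x ∸ 1) * p x) ≤⟨ +-mono-≤ (h S) (∑-shift p q C h A (λ x → a x ∸ 1) (λ x → ∸-monoˡ-≤ 1 (a≤ x))) ⟩
  (∑ (λ x → ⟦ S x ⟧ * q x) + C) + (∑ (λ x → (a x ∸ 1) * q x) + A * C) ≡⟨ +-interchange (∑ (λ x → ⟦ S x ⟧ * q x)) C (∑ (λ x → (a x ∸ 1) * q x)) (A * C) ⟩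
  (∑ (λ x → ⟦ S x ⟧ * q x) + ∑ (λ x → (a x ∸ 1) * q x)) + (C + A * C) ≡⟨ cong (_+ (C + A * C)) (sym (split q)) ⟩
  ∑ (λ x → a x * q x) + suc A * C ∎
  where
  open ≤-Reasoning
  S : Fin n → Bool
  S x = 0 <ᵇ a x
  peel : ∀ a → a ≡ ⟦ 0 <ᵇ a ⟧ + (a ∸ 1)
  peel zero = refl
  peel (suc a) = refl
  split : ∀ (r : Fin n → ℕ) → ∑ (λ x → a x * r x) ≡ ∑ (λ x → ⟦ S x ⟧ * r x) + ∑ (λ x → (a x ∸ 1) * r x)
  split r = trans (∑-cong (λ x → trans (cong (_* r x) (peel (a x))) (*-distribʳ-+ (r x) ⟦ S x ⟧ (a x ∸ 1)))) (∑-+ _ _)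

-- One half of the cut distance: only the excess of W over U on rectangles is bounded, since closed
-- walks of W only have to be bounded from above.
CutBelow : ∀ {n} → ℕ → Kernel n → Kernel n → Set
CutBelow {n} C W U = ∀ (S R : Fin n → Bool) → ∑ (λ x → ∑ (λ y → ⟦ S x ∧ R y ⟧ * W x y)) ≤ ∑ (λ x → ∑ (λ y → ⟦ S x ∧ R y ⟧ * U x y)) + C

cut-rank-one : ∀ {n} C (W U : Kernel n) → CutBelow C W U → ∀ A B (a b : Fin n → ℕ) → (∀ x → a x ≤ A) → (∀ x → b x ≤ B) →
  ∑ (λ x → a x * ∑ (λ y → b y * W x y)) ≤ ∑ (λ x → a x * ∑ (λ y → b y * U x y)) + A * (B * C)
cut-rank-one {n} C W U cut A B a b a≤ b≤ = ∑-shift _ _ (B * C) inner A a a≤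
  where
  flip : ∀ (S : Fin n → Bool) (b : Fin n → ℕ) (V : Kernel n) → ∑ (λ x → ⟦ S x ⟧ * ∑ (λ y → b y * V x y)) ≡ ∑ (λ y → b y * ∑ (λ x → ⟦ S x ⟧ * V x y))
  flip S b V = begin
    ∑ (λ x → ⟦ S x ⟧ * ∑ (λ y → b y * V x y)) ≡⟨ ∑-cong (λ x → sym (∑-*ˡ ⟦ S x ⟧ _)) ⟩
    ∑ (λ x → ∑ (λ y → ⟦ S x ⟧ * (b y * V x y))) ≡⟨ ∑-swap _ ⟩
    ∑ (λ y → ∑ (λ x → ⟦ S x ⟧ * (b y * V x y))) ≡⟨ ∑∑-cong (λ y x → eq ⟦ S x ⟧ (b y) (V x y)) ⟩
    ∑ (λ y → ∑ (λ x → b y * (⟦ S x ⟧ * V x y))) ≡⟨ ∑-cong (λ y → ∑-*ˡ (b y) _) ⟩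
    ∑ (λ y → b y * ∑ (λ x → ⟦ S x ⟧ * V x y)) ∎
    where
    open ≡-Reasoning
    eq : ∀ a b c → a * (b * c) ≡ b * (a * c)
    eq = solve-∀
  unflip : ∀ (S R : Fin n → Bool) (V : Kernel n) → ∑ (λ y → ⟦ R y ⟧ * ∑ (λ x → ⟦ S x ⟧ * V x y)) ≡ ∑ (λ x → ∑ (λ y → ⟦ S x ∧ R y ⟧ * V x y))
  unflip S R V = trans (sym (flip S (λ y → ⟦ R y ⟧) V)) (∑-cong (λ x → trans (sym (∑-*ˡ ⟦ S x ⟧ _)) (∑-cong (λ y → trans (sym (*-assoc ⟦ S x ⟧ _ _)) (cong (_* V x y) (sym (⟦∧⟧ (S x) (R y))))))))
  inner : ∀ S → ∑ (λ x → ⟦ S x ⟧ * ∑ (λ y → b y * W x y)) ≤ ∑ (λ x → ⟦ S x ⟧ * ∑ (λ y → b y * U x y)) + B * C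
  inner S = subst₂ (λ u v → u ≤ v + B * C) (sym (flip S b W)) (sym (flip S b U))
    (∑-shift _ _ C (λ R → subst₂ (λ u v → u ≤ v + C) (sym (unflip S R W)) (sym (unflip S R U)) (cut S R)) B b b≤)

-- Once one further vertex z of the closed walk is fixed, the factors other than W become a function
-- of x times a function of y, so the cut bound applies with a rank-one test function. This
-- separation needs two factors besides W, hence closed walks of length at least three.
cut-trace : ∀ {n} C (W U : Kernel n) → CutBelow C W U → ∀ M (A B : Kernel n) L → Bounded M A → Bounded M B → All (Bounded M) L →
  tr (W · prodL (A ∷ B ∷ L)) ≤ tr (U · prodL (A ∷ B ∷ L)) + n * (M ^ suc (length L) * n ^ length L * (M * C))
cut-trace {n} C W U cut M A B L bA bB bL = begin
  tr (W · (A · R)) ≡⟨ expand W ⟩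
  ∑ (λ z → ∑ (λ x → R z x * ∑ (λ y → A y z * W x y))) ≤⟨ ∑-mono (λ z → cut-rank-one C W U cut K M (R z) (λ y → A y z) (λ x → prodL-bounded M B L bB bL z x) (λ y → bA y z)) ⟩
  ∑ (λ z → ∑ (λ x → R z x * ∑ (λ y → A y z * U x y)) + K * (M * C)) ≡⟨ trans (∑-+ _ _) (cong₂ _+_ (sym (expand U)) (∑-const n (K * (M * C)))) ⟩
  tr (U · (A · R)) + n * (K * (M * C)) ∎
  where
  open ≤-Reasoning
  R = prodL (B ∷ L)
  K = M ^ suc (length L) * n ^ length L
  expand : ∀ V → tr (V · (A · R)) ≡ ∑ (λ z → ∑ (λ x → R z x * ∑ (λ y → A y z * V x y)))
  expand V = trans (tr-cong (λ x y → sym (·-assoc V A R x y))) (trans (∑-swap _) (∑∑-cong (λ z x → trans (*-comm (∑ (λ y → V x y * A y z)) (R z x)) (cong (R z x *_) (∑-cong (λ y → *-comm (V x y) (A y z)))))))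

pow : ∀ {n} → Kernel n → ℕ → Kernel n
pow A k = prodL (replicate k A)

-- A hybrid argument: the factors W are exchanged for U one by one through the words W...WU...U, and
-- each exchange costs one application of `cut-trace`.
tr-pow-cut : ∀ {n} C (W U : Kernel n) → CutBelow C W U → ∀ M → Bounded M W → Bounded M U → ∀ m →
  tr (pow W (3 + m)) ≤ tr (pow U (3 + m)) + (3 + m) * (n * (M ^ suc m * n ^ m * (M * C)))
tr-pow-cut {n} C W U cut M bW bU m = subst (λ L → tr (prodL L) ≤ tr (pow U (3 + m)) + (3 + m) * err) (++-identityʳ′ (replicate (3 + m) W)) (go (3 + m) 0 (+-identityʳ _))
  where
  open ≤-Reasoning
  err = n * (M ^ suc m * n ^ m * (M * C))
  ++-identityʳ′ : ∀ (L : List (Kernel n)) → L ++ [] ≡ L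
  ++-identityʳ′ [] = refl
  ++-identityʳ′ (x ∷ L) = cong (x ∷_) (++-identityʳ′ L)
  word : ℕ → ℕ → List (Kernel n)
  word i j = replicate i W ++ replicate j U
  word-bounded : ∀ i j → All (Bounded M) (word i j)
  word-bounded zero zero = []
  word-bounded zero (suc j) = bU ∷ word-bounded zero j
  word-bounded (suc i) j = bW ∷ word-bounded i j
  word-length : ∀ i j → length (word i j) ≡ i + j
  word-length zero zero = refl
  word-length zero (suc j) = cong suc (word-length zero j)
  word-length (suc i) j = cong suc (word-length i j)
  word-snoc : ∀ i j → word i j ++ [ U ] ≡ word i (suc j)
  word-snoc zero zero = refl
  word-snoc zero (suc j) = cong (U ∷_) (word-snoc zero j)
  word-snoc (suc i) j = cong (W ∷_) (word-snoc i j)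
  step : ∀ L → All (Bounded M) L → length L ≡ 2 + m → tr (W · prodL L) ≤ tr (U · prodL L) + err
  step (A ∷ B ∷ L) (bA ∷ bB ∷ bL) refl = cut-trace C W U cut M A B L bA bB bL
  go : ∀ i j → i + j ≡ 3 + m → tr (prodL (word i j)) ≤ tr (pow U (3 + m)) + i * err
  go zero j refl = m≤m+n _ 0
  go (suc i) j e = begin
    tr (W · prodL (word i j)) ≤⟨ step (word i j) (word-bounded i j) (trans (word-length i j) (suc-injective e)) ⟩
    -- The new factor U stands in front; cyclic invariance of the trace moves it to the end and
    -- restores the shape of the word.
    tr (U · prodL (word i j)) + err ≡⟨ cong (_+ err) (trans (tr-comm U (prodL (word i j))) (trans (tr-cong (λ x y → sym (prodL-snoc (word i j) U x y))) (cong (tr ∘ prodL) (word-snoc i j)))) ⟩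
    tr (prodL (word i (suc j))) + err ≤⟨ +-monoˡ-≤ err (go i (suc j) (trans (+-suc i j) e)) ⟩
    tr (pow U (3 + m)) + i * err + err ≡⟨ eq (tr (pow U (3 + m))) (i * err) err ⟩
    tr (pow U (3 + m)) + (err + i * err) ∎
    where
    eq : ∀ a b c → a + b + c ≡ a + (c + b)
    eq = solve-∀

pow-mono : ∀ {n} {A B : Kernel n} → (∀ x y → A x y ≤ B x y) → ∀ k x y → pow A k x y ≤ pow B k x y
pow-mono h zero x y = ≤-refl
pow-mono h (suc k) = ·-mono h (pow-mono h k)

tr-mono : ∀ {n} {A B : Kernel n} → (∀ x y → A x y ≤ B x y) → tr A ≤ tr B
tr-mono h = ∑-mono (λ x → h x x)

pow-scale : ∀ {n} c (A : Kernel n) k x y → pow (λ x y → c * A x y) k x y ≡ c ^ k * pow A k x y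
pow-scale c A zero x y = sym (+-identityʳ _)
pow-scale c A (suc k) x y = trans (∑-cong (λ z → trans (cong (c * A x z *_) (pow-scale c A k z y)) (eq c (A x z) (c ^ k) (pow A k z y)))) (∑-*ˡ (c * c ^ k) _)
  where
  eq : ∀ c a d p → c * a * (d * p) ≡ c * d * (a * p)
  eq = solve-∀

tr-scale : ∀ {n} c (A : Kernel n) k → tr (pow (λ x y → c * A x y) k) ≡ c ^ k * tr (pow A k)
tr-scale c A k = trans (∑-cong (λ x → pow-scale c A k x x)) (∑-*ˡ (c ^ k) _)

-- Containers

∑V : ∀ {n} k → (Vec (Fin n) k → ℕ) → ℕ
∑V zero f = f []ᵥ
∑V (suc k) f = ∑ (λ x → ∑V k (λ v → f (x ∷ᵥ v)))

∑V-mono : ∀ {n} k {f g : Vec (Fin n) k → ℕ} → (∀ v → f v ≤ g v) → ∑V k f ≤ ∑V k g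
∑V-mono zero h = h []ᵥ
∑V-mono (suc k) h = ∑-mono (λ x → ∑V-mono k (λ v → h (x ∷ᵥ v)))

∑V-+ : ∀ {n} k (f g : Vec (Fin n) k → ℕ) → ∑V k (λ v → f v + g v) ≡ ∑V k f + ∑V k g
∑V-+ zero f g = refl
∑V-+ (suc k) f g = trans (∑-cong (λ x → ∑V-+ k (λ v → f (x ∷ᵥ v)) (λ v → g (x ∷ᵥ v)))) (∑-+ _ _)

∑V-*ˡ : ∀ {n} k c (f : Vec (Fin n) k → ℕ) → ∑V k (λ v → c * f v) ≡ c * ∑V k f
∑V-*ˡ zero c f = refl
∑V-*ˡ (suc k) c f = trans (∑-cong (λ x → ∑V-*ˡ k c _)) (∑-*ˡ c _)

∑V-const : ∀ n k c → ∑V {n} k (λ _ → c) ≡ n ^ k * c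
∑V-const n zero c = sym (+-identityʳ c)
∑V-const n (suc k) c = trans (∑-cong (λ _ → ∑V-const n k c)) (trans (∑-const n _) (sym (*-assoc n (n ^ k) c)))

∑-∑V : ∀ {m n} k (f : Fin m → Vec (Fin n) k → ℕ) → ∑ (λ x → ∑V k (f x)) ≡ ∑V k (λ v → ∑ (λ x → f x v))
∑-∑V zero f = refl
∑-∑V (suc k) f = trans (∑-swap _) (∑-cong (λ y → ∑-∑V k (λ x v → f x (y ∷ᵥ v))))

walk : ∀ {n k} → Kernel n → Fin n → Vec (Fin n) k → Fin n → ℕ
walk A x []ᵥ y = A x y
walk A x (z ∷ᵥ v) y = A x z * walk A z v y

pow-walk : ∀ {n} (A : Kernel n) k x y → pow A (suc k) x y ≡ ∑V k (λ v → walk A x v y)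
pow-walk A zero x y = ·-δ A x y
pow-walk A (suc k) x y = ∑-cong (λ z → trans (cong (A x z *_) (pow-walk A k z y)) (sym (∑V-*ˡ k (A x z) _)))

eqᵇ : ∀ {n} → Fin n → Fin n → Bool
eqᵇ x y = does (x FP.≟ y)

mem : ∀ {n k} → Fin n → Vec (Fin n) k → Bool
mem x []ᵥ = false
mem x (y ∷ᵥ v) = eqᵇ x y ∨ mem x v

repeats : ∀ {n k} → Vec (Fin n) k → Bool
repeats []ᵥ = false
repeats (x ∷ᵥ v) = mem x v ∨ repeats v

⟦∨⟧≤ : ∀ a b → ⟦ a ∨ b ⟧ ≤ ⟦ a ⟧ + ⟦ b ⟧
⟦∨⟧≤ true b = s≤s z≤n
⟦∨⟧≤ false b = ≤-refl

∑-mem : ∀ {n k} (v : Vec (Fin n) k) → ∑ (λ x → ⟦ mem x v ⟧) ≤ k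
∑-mem {n} []ᵥ = ≤-reflexive (∑-zero n)
∑-mem {n} (y ∷ᵥ v) = ≤-trans (∑-mono (λ x → ⟦∨⟧≤ (eqᵇ x y) (mem x v))) (≤-trans (≤-reflexive (∑-+ _ _)) (+-mono-≤ (≤-reflexive one) (∑-mem v)))
  where
  one : ∑ (λ x → δ x y) ≡ 1
  one = trans (∑-cong (λ x → sym (+-identityʳ (δ x y)))) (∑-δ (λ _ → 1) y)

-- A vertex put in front of k others coincides with one of them in at most k cases. The factor n on
-- the left replaces the exponent k - 1 on the right.
count-repeats : ∀ n k → n * ∑V {n} k (λ v → ⟦ repeats v ⟧) ≤ k * k * n ^ k
count-repeats n zero = ≤-trans (≤-reflexive (*-zeroʳ n)) z≤n
count-repeats n (suc k) = begin
  n * ∑ (λ x → ∑V k (λ v → ⟦ mem x v ∨ repeats v ⟧)) ≤⟨ *-monoʳ-≤ n (∑-mono (λ x → ∑V-mono k (λ v → ⟦∨⟧≤ (mem x v) (repeats v)))) ⟩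
  n * ∑ (λ x → ∑V k (λ v → ⟦ mem x v ⟧ + ⟦ repeats v ⟧)) ≡⟨ cong (n *_) (trans (∑-cong (λ x → ∑V-+ k (λ v → ⟦ mem x v ⟧) (λ v → ⟦ repeats v ⟧))) (trans (∑-+ _ _) (cong₂ _+_ (∑-∑V k _) (∑-const n R)))) ⟩
  n * (∑V k (λ v → ∑ (λ x → ⟦ mem x v ⟧)) + n * R) ≤⟨ *-monoʳ-≤ n (+-mono-≤ (≤-trans (∑V-mono k (λ v → ∑-mem v)) (≤-reflexive (∑V-const n k k))) (count-repeats n k)) ⟩
  n * (n ^ k * k + k * k * n ^ k) ≤⟨ ≤-trans (m≤m+n _ (n * n ^ k * (k + 1))) (≤-reflexive (eq n (n ^ k) k)) ⟩
  suc k * suc k * (n * n ^ k) ∎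
  where
  open ≤-Reasoning
  R = ∑V {n} k (λ v → ⟦ repeats v ⟧)
  eq : ∀ n p k → n * (p * k + k * k * p) + n * p * (k + 1) ≡ (1 + k) * (1 + k) * (n * p)
  eq = solve-∀

adj : ∀ {n} → Mat n → Kernel n
adj G x y = ⟦ edge G x y ⟧

private
  ⟦⟧-true : ∀ {b m} → 1 ≤ ⟦ b ⟧ * m → b ≡ true
  ⟦⟧-true {true} _ = refl

  ⟦⟧-rest : ∀ {b m} → 1 ≤ ⟦ b ⟧ * m → 1 ≤ m
  ⟦⟧-rest {true} {m} h = ≤-trans h (≤-reflexive (+-identityʳ m))

mem-lookup : ∀ {n k} x (v : Vec (Fin n) k) → mem x v ≡ false → ∀ i → x ≢ lookup v i
mem-lookup x (y ∷ᵥ v) h i e with x FP.≟ y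
mem-lookup x (y ∷ᵥ v) h zero e | no ¬p = ¬p e
mem-lookup x (y ∷ᵥ v) h (suc i) e | no ¬p = mem-lookup x v h i e

repeats-injective : ∀ {n k} (v : Vec (Fin n) k) → repeats v ≡ false → ∀ {i j} → lookup v i ≡ lookup v j → i ≡ j
repeats-injective (x ∷ᵥ v) h {zero} {zero} e = refl
repeats-injective (x ∷ᵥ v) h {zero} {suc j} e with mem x v in m
... | false = contradiction e (mem-lookup x v m j)
repeats-injective (x ∷ᵥ v) h {suc i} {zero} e with mem x v in m
... | false = contradiction (sym e) (mem-lookup x v m i)
repeats-injective (x ∷ᵥ v) h {suc i} {suc j} e with mem x v
... | false = cong suc (repeats-injective v h e)

walk-step : ∀ {n k} (G : Mat n) x (v : Vec (Fin n) k) y → 1 ≤ walk (adj G) x v y → ∀ (i j : Fin (suc k)) → suc (toℕ i) ≡ toℕ j → Edge G (lookup (x ∷ᵥ v) i) (lookup (x ∷ᵥ v) j)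
walk-step G x (z ∷ᵥ v) y h zero (suc zero) e = ⟦⟧-true h
walk-step G x (z ∷ᵥ v) y h (suc i) (suc j) e = walk-step G z v y (⟦⟧-rest {edge G x z} h) i j (suc-injective e)

walk-last : ∀ {n k} (G : Mat n) x (v : Vec (Fin n) k) y → 1 ≤ walk (adj G) x v y → ∀ (i : Fin (suc k)) → toℕ i ≡ k → Edge G (lookup (x ∷ᵥ v) i) y
walk-last G x []ᵥ y h zero e = ⟦⟧-true (≤-trans h (≤-reflexive (sym (*-identityʳ _))))
walk-last G x (z ∷ᵥ v) y h (suc i) e = walk-last G z v y (⟦⟧-rest {edge G x z} h) i (suc-injective e)

walk≤1 : ∀ {n k} (G : Mat n) x (v : Vec (Fin n) k) y → walk (adj G) x v y ≤ 1
walk≤1 G x []ᵥ y = ⟦⟧≤1 _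
walk≤1 G x (z ∷ᵥ v) y = *-mono-≤ (⟦⟧≤1 (edge G x z)) (walk≤1 G z v y)

-- The vertices of a closed walk without repetition would be a copy of the forbidden cycle, and the
-- walk weight is 0 or 1.
closed-walk-repeats : ∀ {n} k (G : Mat n) → CkFree (suc k) G → ∀ x (v : Vec (Fin n) k) → walk (adj G) x v x ≤ ⟦ repeats (x ∷ᵥ v) ⟧
closed-walk-repeats k G free x v with repeats (x ∷ᵥ v) in r
... | true = walk≤1 G x v x
... | false with 1 ≤? walk (adj G) x v x
... | no ¬p = ≤-pred (≰⇒> ¬p)
... | yes p = ⊥-elim (free (lookup (x ∷ᵥ v) , (λ {i} {j} → repeats-injective (x ∷ᵥ v) r {i} {j}) , λ { i j (inj₁ e) → walk-step G x v x p i j e ; i zero (inj₂ (e , _)) → walk-last G x v x p i (suc-injective e) }))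

tr-CkFree : ∀ {n} k (G : Mat n) → CkFree (suc k) G → n * tr (pow (adj G) (suc k)) ≤ suc k * suc k * n ^ suc k
tr-CkFree {n} k G free = ≤-trans (*-monoʳ-≤ n (≤-trans (≤-reflexive (∑-cong (λ x → pow-walk (adj G) k x x))) (∑-mono (λ x → ∑V-mono k (closed-walk-repeats k G free x))))) (count-repeats n (suc k))

-- Energy decrement for integer-valued kernels

Step : ℕ → Set
Step n = Bool × Bool × Vec Bool n × Vec Bool n

-- The first flag tells whether anything happens and the second selects the operation: lower the
-- kernel on a rectangle, or raise it wherever it lies below θ. A rectangle costs 2n bits to record,
-- while the level set is determined by the current kernel, so a bounded number of steps has a code
-- of O(n) bits.
apply : ∀ {n} → ℕ → ℕ → Step n → Kernel n → Kernel n
apply θ M (false , _ , _ , _) W x y = W x y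
apply θ M (true , false , S , R) W x y = W x y ∸ ⟦ lookup S x ∧ lookup R y ⟧
apply θ M (true , true , _ , _) W x y = M ⊓ (W x y + ⟦ W x y <ᵇ θ ⟧)

run : ∀ {n} → ℕ → ℕ → List (Step n) → Kernel n
run θ M [] x y = 0
run θ M (s ∷ l) = apply θ M s (run θ M l)

run-bounded : ∀ {n} θ M (l : List (Step n)) → Bounded M (run θ M l)
run-bounded θ M [] x y = z≤n
run-bounded θ M ((false , _) ∷ l) x y = run-bounded θ M l x y
run-bounded θ M ((true , false , S , R) ∷ l) x y = ≤-trans (m∸n≤m (run θ M l x y) ⟦ lookup S x ∧ lookup R y ⟧) (run-bounded θ M l x y)
run-bounded θ M ((true , true , S , R) ∷ l) x y = m⊓n≤m M _

-- The square of M * g - w for an edge indicator g, written by cases because subtraction is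
-- truncated.
sqdist : ℕ → Bool → ℕ → ℕ
sqdist M true w = (M ∸ w) * (M ∸ w)
sqdist M false w = w * w

-- The square is expanded after a change of w by one; where w is already 0 it stays unchanged and
-- the inequality has slack.
sqdist-down : ∀ M g b w → w ≤ M → sqdist M g (w ∸ ⟦ b ⟧) + 2 * (⟦ b ⟧ * w) ≤ sqdist M g w + (2 * (⟦ b ⟧ * (M * ⟦ g ⟧)) + ⟦ b ⟧)
sqdist-down M g false w h = ≤-refl
sqdist-down M false true zero h = z≤n
sqdist-down M true true zero h = +-monoʳ-≤ (M * M) z≤n
sqdist-down M false true (suc v) h = ≤-trans (≤-reflexive (eq v)) (+-monoʳ-≤ (suc v * suc v) (m≤n+m 1 _))
  where
  eq : ∀ v → v * v + 2 * (1 * (1 + v)) ≡ (1 + v) * (1 + v) + 1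
  eq = solve-∀
sqdist-down M true true (suc v) h = subst (λ M → (M ∸ v) * (M ∸ v) + 2 * (1 * suc v) ≤ (M ∸ suc v) * (M ∸ suc v) + (2 * (1 * (M * 1)) + 1)) (m+[n∸m]≡n h) (go v (M ∸ suc v))
  where
  go : ∀ v c → (suc v + c ∸ v) * (suc v + c ∸ v) + 2 * (1 * suc v) ≤ (suc v + c ∸ suc v) * (suc v + c ∸ suc v) + (2 * (1 * ((suc v + c) * 1)) + 1)
  go v c = subst₂ (λ a b → a * a + 2 * (1 * suc v) ≤ b * b + (2 * (1 * ((suc v + c) * 1)) + 1)) (sym e₁) (sym (m+n∸m≡n v c)) (≤-reflexive (eq v c))
    where
    e₁ : suc v + c ∸ v ≡ suc c
    e₁ = trans (cong (_∸ v) (sym (+-suc v c))) (m+n∸m≡n v (suc c))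
    eq : ∀ v c → (1 + c) * (1 + c) + 2 * (1 * (1 + v)) ≡ c * c + (2 * (1 * ((1 + v + c) * 1)) + 1)
    eq = solve-∀

-- The expansion for an increase by one. Capping at M does no harm, because both possible targets 0
-- and M are at most M.
sqdist-up : ∀ M g b w → w ≤ M → sqdist M g (M ⊓ (w + ⟦ b ⟧)) + 2 * (⟦ b ⟧ * (M * ⟦ g ⟧)) ≤ sqdist M g w + (2 * (⟦ b ⟧ * w) + ⟦ b ⟧)
sqdist-up M g false w h rewrite +-identityʳ w | m≥n⇒m⊓n≡n h = ≤-refl
sqdist-up M false true w h = ≤-trans (≤-trans (≤-reflexive (cong₂ _+_ refl (eq₀ M))) (≤-reflexive (+-identityʳ _))) (≤-trans (*-mono-≤ (m⊓n≤n M (w + 1)) (m⊓n≤n M (w + 1))) (≤-reflexive (eq w)))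
  where
  eq₀ : ∀ M → 2 * (1 * (M * 0)) ≡ 0
  eq₀ = solve-∀
  eq : ∀ w → (w + 1) * (w + 1) ≡ w * w + (2 * (1 * w) + 1)
  eq = solve-∀
sqdist-up M true true w h with m≤n⇒m<n∨m≡n h
... | inj₂ refl rewrite m≤n⇒m⊓n≡m (m≤m+n w 1) | n∸n≡0 w = ≤-trans (≤-reflexive (eq w)) (m≤m+n _ 1)
  where
  eq : ∀ w → 2 * (1 * (w * 1)) ≡ 2 * (1 * w)
  eq = solve-∀
... | inj₁ w<M = subst (λ M → (M ∸ (M ⊓ (w + 1))) * (M ∸ (M ⊓ (w + 1))) + 2 * (1 * (M * 1)) ≤ (M ∸ w) * (M ∸ w) + (2 * (1 * w) + 1)) (m+[n∸m]≡n w<M) (go w (M ∸ suc w))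
  where
  go : ∀ w c → (suc w + c ∸ ((suc w + c) ⊓ (w + 1))) * (suc w + c ∸ ((suc w + c) ⊓ (w + 1))) + 2 * (1 * ((suc w + c) * 1)) ≤ (suc w + c ∸ w) * (suc w + c ∸ w) + (2 * (1 * w) + 1)
  go w c = subst₂ (λ a b → a * a + 2 * (1 * ((suc w + c) * 1)) ≤ b * b + (2 * (1 * w) + 1)) (sym e₁) (sym e₂) (≤-reflexive (eq w c))
    where
    e₁ : suc w + c ∸ ((suc w + c) ⊓ (w + 1)) ≡ c
    e₁ = trans (cong (suc w + c ∸_) (trans (cong ((suc w + c) ⊓_) (+-comm w 1)) (m≥n⇒m⊓n≡n (s≤s (m≤m+n w c))))) (m+n∸m≡n w c)
    e₂ : suc w + c ∸ w ≡ suc c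
    e₂ = trans (cong (_∸ w) (sym (+-suc w c))) (m+n∸m≡n w (suc c))
    eq : ∀ w c → c * c + 2 * (1 * ((1 + w + c) * 1)) ≡ (1 + c) * (1 + c) + (2 * (1 * w) + 1)
    eq = solve-∀

Violates : ∀ {n} → Kernel n → Kernel n → (Fin n → Fin n → Bool) → Set
Violates {n} P Q X = ∑ (λ x → ∑ (λ y → ⟦ X x y ⟧ * Q x y)) + n * n ≤ ∑ (λ x → ∑ (λ y → ⟦ X x y ⟧ * P x y))

-- On a violating set the linear terms of the expanded squares gain at least 2n², whereas the
-- quadratic terms lose at most 1 per pair; the difference is at least n².
potential-drop : ∀ {n} (φ φ′ P Q : Kernel n) (X : Fin n → Fin n → Bool) →
  (∀ x y → φ′ x y + 2 * (⟦ X x y ⟧ * P x y) ≤ φ x y + (2 * (⟦ X x y ⟧ * Q x y) + ⟦ X x y ⟧)) → Violates P Q X →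
  ∑ (λ x → ∑ (φ′ x)) + n * n ≤ ∑ (λ x → ∑ (φ x))
potential-drop {n} φ φ′ P Q X h viol = lin 0 (+-mono-≤ (+-mono-≤ summed (*-monoʳ-≤ 2 viol)) count) (eq Φ′ Φ p q c (n * n))
  where
  Φ = ∑ (λ x → ∑ (φ x))
  Φ′ = ∑ (λ x → ∑ (φ′ x))
  p = ∑ (λ x → ∑ (λ y → ⟦ X x y ⟧ * P x y))
  q = ∑ (λ x → ∑ (λ y → ⟦ X x y ⟧ * Q x y))
  c = ∑ (λ x → ∑ (λ y → ⟦ X x y ⟧))
  count : c ≤ n * n
  count = ∑-bound (λ x → ∑-⟦⟧≤ (X x))
  summed : Φ′ + 2 * p ≤ Φ + (2 * q + c)
  summed = subst₂ _≤_ (trans (∑∑-+ _ _) (cong (Φ′ +_) (∑∑-*ˡ 2 _))) (trans (∑∑-+ _ _) (cong (Φ +_) (trans (∑∑-+ _ _) (cong (_+ c) (∑∑-*ˡ 2 _))))) (∑∑-mono h)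
  eq : ∀ Φ′ Φ p q c N → Φ′ + N + (Φ + (2 * q + c) + 2 * p + N) + 0 ≡ Φ + ((Φ′ + 2 * p) + 2 * (q + N) + c)
  eq = solve-∀

-- `cut` transfers the scarcity of closed walks from G to W, and `level` bounds the edges of G that
-- are lost when the pairs with W below θ are discarded.
record Approximates {n} (θ M : ℕ) (G : Mat n) (W : Kernel n) : Set where
  field
    cut : CutBelow (n * n) W (λ x y → M * adj G x y)
    level : ∑ (λ x → ∑ (λ y → ⟦ W x y <ᵇ θ ⟧ * (M * adj G x y))) ≤ ∑ (λ x → ∑ (λ y → ⟦ W x y <ᵇ θ ⟧ * W x y)) + n * n

-- As long as one of the two conditions fails, a step lowers the squared distance between W and M
-- times the adjacency matrix by n². It starts at no more than M² n², so at most M² steps occur.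
approximation : ∀ {n} θ M (G : Mat n) → 0 < n → ¬ ¬ (∃ λ (l : List (Step n)) → length l ≡ M * M × Approximates θ M G (run θ M l))
approximation {n} θ M G n>0 = go (M * M) [] refl start
  where
  U : Kernel n
  U x y = M * adj G x y
  Φ : Kernel n → ℕ
  Φ W = ∑ (λ x → ∑ (λ y → sqdist M (edge G x y) (W x y)))
  start : Φ (run θ M []) ≤ M * M * (n * n)
  start = ≤-trans (∑∑-bound (λ x y → bound (edge G x y))) (≤-reflexive (eq n (M * M)))
    where
    bound : ∀ g → sqdist M g 0 ≤ M * M
    bound true = ≤-refl
    bound false = z≤n
    eq : ∀ n c → n * (n * c) ≡ c * (n * n)
    eq = solve-∀
  Result = ∃ λ (l : List (Step n)) → length l ≡ M * M × Approximates θ M G (run θ M l)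
  -- Idle steps bring every code to length exactly M², so that the codes are vectors of one fixed
  -- length and easy to count.
  pad : ∀ j l → length l + j ≡ M * M → Approximates θ M G (run θ M l) → Result
  pad zero l e a = l , trans (sym (+-identityʳ _)) e , a
  pad (suc j) l e a = pad j ((false , false , tabulate (λ _ → false) , tabulate (λ _ → false)) ∷ l) (trans (sym (+-suc (length l) j)) e) (record { Approximates a })
  go : ∀ j l → length l + j ≡ M * M → Φ (run θ M l) ≤ j * (n * n) → ¬ ¬ Result
  next : ∀ j l (s : Step n) → length l + j ≡ M * M → Φ (run θ M l) ≤ j * (n * n) → Φ (run θ M (s ∷ l)) + n * n ≤ Φ (run θ M l) → ¬ ¬ Result
  -- The budget is used up: a further drop by n² > 0 would take the potential below 0.
  next zero l s e b d = ⊥-elim (<⇒≱ (*-mono-≤ n>0 n>0) (≤-trans (m≤n+m _ _) (≤-trans d b)))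
  next (suc j) l s e b d = go j (s ∷ l) (trans (sym (+-suc (length l) j)) e) (+-cancelʳ-≤ (n * n) _ _ (≤-trans d (≤-trans b (≤-reflexive (+-comm (n * n) _)))))
  go j l e b =
    classical (∃ λ S → ∃ λ R → Violates W U (λ x y → lookup S x ∧ lookup R y)) >>= λ
    { (inj₁ (S , R , v)) → next j l (true , false , S , R) e b (potential-drop (λ x y → sqdist M (edge G x y) (W x y)) (λ x y → sqdist M (edge G x y) (W x y ∸ ⟦ lookup S x ∧ lookup R y ⟧)) W U (λ x y → lookup S x ∧ lookup R y) (λ x y → sqdist-down M (edge G x y) (lookup S x ∧ lookup R y) (W x y) (run-bounded θ M l x y)) v)
    ; (inj₂ noRect) → classical (Violates U W (λ x y → W x y <ᵇ θ)) >>= λ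
      { (inj₁ v) → next j l (true , true , tabulate (λ _ → false) , tabulate (λ _ → false)) e b (potential-drop (λ x y → sqdist M (edge G x y) (W x y)) (λ x y → sqdist M (edge G x y) (M ⊓ (W x y + ⟦ W x y <ᵇ θ ⟧))) U W (λ x y → W x y <ᵇ θ) (λ x y → sqdist-up M (edge G x y) (W x y <ᵇ θ) (W x y) (run-bounded θ M l x y)) v)
      ; (inj₂ noLevel) → return (pad j l e (record
          { cut = λ S R → <⇒≤ (≰⇒> λ v → noRect (tabulate S , tabulate R , subst₂ (λ a b → a + n * n ≤ b) (retab S R U) (retab S R W) v))
          ; level = <⇒≤ (≰⇒> noLevel) })) } }
    where
    W = run θ M l
    retab : ∀ S R (V : Kernel n) → ∑ (λ x → ∑ (λ y → ⟦ S x ∧ R y ⟧ * V x y)) ≡ ∑ (λ x → ∑ (λ y → ⟦ lookup (tabulate S) x ∧ lookup (tabulate R) y ⟧ * V x y))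
    retab S R V = ∑∑-cong (λ x y → cong (λ b → ⟦ b ⟧ * V x y) (cong₂ _∧_ (sym (lookup∘tabulate S x)) (sym (lookup∘tabulate R y))))

-- θ is the density threshold, in units of 1/M, above which a pair enters the container.
container : ∀ {n} → ℕ → ℕ → List (Step n) → Fin n → Fin n → Bool
container θ M l x y = (θ ≤ᵇ run θ M l x y) ∧ not (eqᵇ x y)

⟪_⟫ : ∀ {n} → (Fin n → Fin n → Bool) → Kernel n
⟪ D ⟫ x y = ⟦ D x y ⟧

outside : ∀ {n} → Mat n → (Fin n → Fin n → Bool) → ℕ
outside G D = ∑ (λ x → ∑ (λ y → ⟦ edge G x y ∧ not (D x y) ⟧))

private
  T⇒≡ : ∀ {b} → T b → b ≡ true
  T⇒≡ = Equivalence.to T-≡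
  ≡⇒T : ∀ {b} → b ≡ true → T b
  ≡⇒T = Equivalence.from T-≡

θD≤W : ∀ {n} θ M (l : List (Step n)) x y → θ * ⟦ container θ M l x y ⟧ ≤ run θ M l x y
θD≤W θ M l x y with θ ≤ᵇ run θ M l x y in e | not (eqᵇ x y)
... | true | true = ≤-trans (≤-reflexive (*-identityʳ θ)) (≤ᵇ⇒≤ _ _ (≡⇒T e))
... | true | false = ≤-trans (≤-reflexive (*-zeroʳ θ)) z≤n
... | false | _ = ≤-trans (≤-reflexive (*-zeroʳ θ)) z≤n

outside≤below : ∀ {n} θ M (G : Mat n) → IsDigraph G → ∀ l x y → ⟦ edge G x y ∧ not (container θ M l x y) ⟧ ≤ ⟦ run θ M l x y <ᵇ θ ⟧ * adj G x y
outside≤below θ M G dig l x y with edge G x y in g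
... | false = z≤n
... | true with x FP.≟ y
... | yes refl = ⊥-elim (dig x g)
... | no _ with θ ≤ᵇ run θ M l x y in e
... | true = z≤n
... | false = ≤-reflexive (sym (trans (*-identityʳ ⟦ run θ M l x y <ᵇ θ ⟧) (cong ⟦_⟧ (T⇒≡ {run θ M l x y <ᵇ θ} (<⇒<ᵇ (≰⇒> {θ} {run θ M l x y} λ le → subst T e (≤⇒≤ᵇ le)))))))

below≤ : ∀ w θ → ⟦ w <ᵇ θ ⟧ * w ≤ θ
below≤ w θ with w <ᵇ θ in e
... | true = ≤-trans (≤-reflexive (+-identityʳ w)) (<⇒≤ (<ᵇ⇒< w θ (≡⇒T e)))
... | false = z≤n

containers-explicit : ∀ j E → 0 < E → ∃ λ θ → ∃ λ M → ∃ λ N → ∀ n → N ≤ n → ∀ (G : Mat n) → IsDigraph G → CkFree (3 + j) G →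
  ¬ ¬ (∃ λ l → length l ≡ M * M × E * outside G (container θ M l) ≤ n * n × E * tr (pow ⟪ container θ M l ⟫ (3 + j)) ≤ n ^ (3 + j))
containers-explicit j E E>0 = θ , M , N , main
  where
  k = 3 + j
  -- The threshold density θ / M is 1 / (2E), so discarding pairs below it costs n² / (2E) edges,
  -- and θ ≥ 1 absorbs the rounding error n². Raising W to the threshold scale divides the number of
  -- closed walks by θ^k, while the cut error is k M^(k-1) n^k; θ contains the factor m k m^(k-1) in
  -- order that this error is n^k / m after the division. The bound N does the same for the
  -- O(n^(k-1)) closed walks of G.
  m = 2 * E
  θ = m * (k * m ^ (2 + j))
  M = θ * m
  N = 1 + m * (m ^ k * (k * k))
  m>0 : 0 < m
  m>0 = *-mono-≤ {1} {2} (s≤s z≤n) E>0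
  θ>0 : 0 < θ
  θ>0 = *-mono-≤ m>0 (*-mono-≤ {1} {k} (s≤s z≤n) (m^n>0 m {{>-nonZero m>0}} (2 + j)))
  main : ∀ n → N ≤ n → ∀ (G : Mat n) → IsDigraph G → CkFree (3 + j) G →
    ¬ ¬ (∃ λ l → length l ≡ M * M × E * outside G (container θ M l) ≤ n * n × E * tr (pow ⟪ container θ M l ⟫ (3 + j)) ≤ n ^ (3 + j))
  main n n≥N G dig free = approximation θ M G n>0 >>= λ { (l , len , a) → return (l , len , out l a , cyc l a) }
    where
    n>0 : 0 < n
    n>0 = ≤-trans (s≤s z≤n) n≥N
    out : ∀ l → Approximates θ M G (run θ M l) → E * outside G (container θ M l) ≤ n * n
    out l a = *-cancelˡ-≤ (2 * θ) {{>-nonZero (*-mono-≤ {1} {2} (s≤s z≤n) θ>0)}} (begin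
      2 * θ * (E * outside G D) ≡⟨ eq₁ θ E (outside G D) ⟩
      M * outside G D ≤⟨ *-monoʳ-≤ M (∑∑-mono (outside≤below θ M G dig l)) ⟩
      M * ∑ (λ x → ∑ (λ y → ⟦ W x y <ᵇ θ ⟧ * adj G x y)) ≡⟨ trans (sym (∑∑-*ˡ M _)) (∑∑-cong (λ x y → eq₂ M ⟦ W x y <ᵇ θ ⟧ (adj G x y))) ⟩
      ∑ (λ x → ∑ (λ y → ⟦ W x y <ᵇ θ ⟧ * (M * adj G x y))) ≤⟨ Approximates.level a ⟩
      ∑ (λ x → ∑ (λ y → ⟦ W x y <ᵇ θ ⟧ * W x y)) + n * n ≤⟨ +-monoˡ-≤ (n * n) (∑∑-bound (λ x y → below≤ (W x y) θ)) ⟩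
      n * (n * θ) + n * n ≤⟨ +-monoʳ-≤ (n * (n * θ)) (*-monoʳ-≤ n (≤-trans (≤-reflexive (sym (*-identityʳ n))) (*-monoʳ-≤ n θ>0))) ⟩
      n * (n * θ) + n * (n * θ) ≡⟨ eq₃ n θ ⟩
      2 * θ * (n * n) ∎)
      where
      open ≤-Reasoning
      D = container θ M l
      W = run θ M l
      eq₁ : ∀ θ E o → 2 * θ * (E * o) ≡ θ * (2 * E) * o
      eq₁ = solve-∀
      eq₂ : ∀ M b g → M * (b * g) ≡ b * (M * g)
      eq₂ = solve-∀
      eq₃ : ∀ n θ → n * (n * θ) + n * (n * θ) ≡ 2 * θ * (n * n)
      eq₃ = solve-∀
    cyc : ∀ l → Approximates θ M G (run θ M l) → E * tr (pow ⟪ container θ M l ⟫ k) ≤ n ^ k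
    cyc l a = *-cancelˡ-≤ (2 * θ ^ k) {{>-nonZero (*-mono-≤ {1} {2} (s≤s z≤n) (m^n>0 θ {{>-nonZero θ>0}} k))}} (begin
      2 * θ ^ k * (E * t) ≡⟨ eq₁ (θ ^ k) E t ⟩
      m * (θ ^ k * t) ≤⟨ *-monoʳ-≤ m chain ⟩
      m * ((θ * m) ^ k * (k * k * n ^ (2 + j)) + k * (n * (M ^ suc j * n ^ j * (M * (n * n))))) ≡⟨ cong₂ (λ u v → m * (u * (k * k * n ^ (2 + j)) + k * (n * (v * n ^ j * (M * (n * n)))))) (^-distribʳ-* k θ m) (^-distribʳ-* (suc j) θ m) ⟩
      m * ((θ ^ k * m ^ k) * (k * k * n ^ (2 + j)) + k * (n * ((θ ^ suc j * m ^ suc j) * n ^ j * (M * (n * n))))) ≡⟨ eq₂ m (θ ^ suc j) θ (m ^ suc j) k n (n ^ j) (m ^ k) ⟩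
      θ ^ k * (m * (m ^ k * (k * k)) * n ^ (2 + j)) + θ * θ ^ suc j * (m * (k * m ^ (2 + j))) * n ^ k ≤⟨ +-mono-≤ (*-monoʳ-≤ (θ ^ k) (*-monoˡ-≤ (n ^ (2 + j)) (<⇒≤ n≥N))) (≤-reflexive (cong (_* n ^ k) (*-comm (θ ^ (2 + j)) θ))) ⟩
      θ ^ k * (n * n ^ (2 + j)) + θ * θ ^ (2 + j) * n ^ k ≡⟨ eq₃ (θ ^ k) (n ^ k) ⟩
      2 * θ ^ k * n ^ k ∎)
      where
      open ≤-Reasoning
      D = container θ M l
      W = run θ M l
      U : Kernel n
      U x y = M * adj G x y
      t = tr (pow ⟪ D ⟫ k)
      trG : tr (pow (adj G) k) ≤ k * k * n ^ (2 + j)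
      trG = *-cancelˡ-≤ n {{>-nonZero n>0}} (≤-trans (tr-CkFree (2 + j) G free) (≤-reflexive (eq n (k * k) (n ^ (2 + j)))))
        where
        eq : ∀ n c p → c * (n * p) ≡ n * (c * p)
        eq = solve-∀
      chain : θ ^ k * t ≤ (θ * m) ^ k * (k * k * n ^ (2 + j)) + k * (n * (M ^ suc j * n ^ j * (M * (n * n))))
      chain = begin
        θ ^ k * t ≡⟨ sym (tr-scale θ ⟪ D ⟫ k) ⟩
        tr (pow (λ x y → θ * ⟪ D ⟫ x y) k) ≤⟨ tr-mono (pow-mono (θD≤W θ M l) k) ⟩
        tr (pow W k) ≤⟨ tr-pow-cut (n * n) W U (Approximates.cut a) M (run-bounded θ M l) (λ x y → ≤-trans (*-monoʳ-≤ M (⟦⟧≤1 (edge G x y))) (≤-reflexive (*-identityʳ M))) j ⟩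
        tr (pow U k) + k * (n * (M ^ suc j * n ^ j * (M * (n * n)))) ≤⟨ +-monoˡ-≤ _ (≤-trans (≤-reflexive (tr-scale M (adj G) k)) (*-monoʳ-≤ (M ^ k) trG)) ⟩
        (θ * m) ^ k * (k * k * n ^ (2 + j)) + k * (n * (M ^ suc j * n ^ j * (M * (n * n)))) ∎
      eq₁ : ∀ a E t → 2 * a * (E * t) ≡ 2 * E * (a * t)
      eq₁ = solve-∀
      eq₂ : ∀ m a θ b k n p q → m * ((θ * (θ * a) * q) * (k * k * (n * (n * p))) + k * (n * ((a * b) * p * (θ * m * (n * n))))) ≡ θ * (θ * a) * (m * (q * (k * k)) * (n * (n * p))) + θ * a * (m * (k * (m * b))) * (n * (n * (n * p)))
      eq₂ = solve-∀
      eq₃ : ∀ a b → a * b + a * b ≡ 2 * a * b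
      eq₃ = solve-∀

-- Opaque, because unfolding the constants θ, M and N makes type checking very slow.
opaque
  containers : ∀ j E → 0 < E → ∃ λ θ → ∃ λ M → ∃ λ N → ∀ n → N ≤ n → ∀ (G : Mat n) → IsDigraph G → CkFree (3 + j) G →
    ¬ ¬ (∃ λ l → length l ≡ M * M × E * outside G (container θ M l) ≤ n * n × E * tr (pow ⟪ container θ M l ⟫ (3 + j)) ≤ n ^ (3 + j))
  containers = containers-explicit

-- Alternating walks

Digraph : ℕ → Set
Digraph n = Fin n → Fin n → Bool

infix 8 _ᵀ
_ᵀ : ∀ {n} → Kernel n → Kernel n
(C ᵀ) x y = C y x

-- Walks of length j from x that use the edges of the bipartite graph C alternately forwards and backwards.
alt : ∀ {n} → Kernel n → ℕ → Fin n → ℕ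
alt C zero x = 1
alt C (suc j) x = ∑ (λ y → C x y * alt (C ᵀ) j y)

-- An edge is moved from the walk counted by one factor to the walk counted by the other; the common
-- starting vertex thereby changes sides.
alt-adjoint : ∀ {n} (C : Kernel n) i j → ∑ (λ x → alt C (suc i) x * alt C j x) ≡ ∑ (λ y → alt (C ᵀ) i y * alt (C ᵀ) (suc j) y)
alt-adjoint C i j = begin
  ∑ (λ x → ∑ (λ y → C x y * alt (C ᵀ) i y) * alt C j x) ≡⟨ ∑-cong (λ x → sym (∑-*ʳ (alt C j x) (λ y → C x y * alt (C ᵀ) i y))) ⟩
  ∑ (λ x → ∑ (λ y → C x y * alt (C ᵀ) i y * alt C j x)) ≡⟨ ∑-swap _ ⟩
  ∑ (λ y → ∑ (λ x → C x y * alt (C ᵀ) i y * alt C j x)) ≡⟨ ∑∑-cong (λ y x → eq (C x y) (alt (C ᵀ) i y) (alt C j x)) ⟩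
  ∑ (λ y → ∑ (λ x → alt (C ᵀ) i y * (C x y * alt C j x))) ≡⟨ ∑-cong (λ y → ∑-*ˡ (alt (C ᵀ) i y) (λ x → C x y * alt C j x)) ⟩
  ∑ (λ y → alt (C ᵀ) i y * ∑ (λ x → C x y * alt C j x)) ∎
  where
  open ≡-Reasoning
  eq : ∀ a b c → a * b * c ≡ b * (a * c)
  eq = solve-∀

-- Keeps track of the side of the bipartite graph from which a walk starts, which depends on the
-- parity of the number of edges moved.
turn : ∀ {n} → ℕ → Kernel n → Kernel n
turn zero C = C
turn (suc i) C = turn i (C ᵀ)

turn-ᵀ : ∀ {n} i (C : Kernel n) → turn i (C ᵀ) ≡ turn i C ᵀ
turn-ᵀ zero C = refl
turn-ᵀ (suc i) C = turn-ᵀ i (C ᵀ)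

turn-turn : ∀ {n} i (C : Kernel n) → turn i (turn i C) ≡ C
turn-turn zero C = refl
turn-turn (suc i) C = trans (cong (turn i) (sym (turn-ᵀ i (C ᵀ)))) (turn-turn i C)

-- Two alternating walks from a common vertex, one of them reversed, make up a single alternating
-- walk.
alt-inner : ∀ {n} i j (C : Kernel n) → ∑ (λ x → alt C i x * alt C j x) ≡ ∑ (alt (turn i C) (i + j))
alt-inner zero j C = ∑-cong (λ x → +-identityʳ (alt C j x))
alt-inner (suc i) j C = trans (alt-adjoint C i j) (trans (alt-inner i (suc j) (C ᵀ)) (cong (λ m → ∑ (alt (turn i (C ᵀ)) m)) (+-suc i j)))

Dense : ∀ {n} → ℕ → Kernel n → Set
Dense {n} F C = n * n ≤ F * ∑ (λ x → ∑ (C x))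

turn-dense : ∀ {n} F i (C : Kernel n) → Dense F C → Dense F (turn i C)
turn-dense F zero C d = d
turn-dense F (suc i) C d = turn-dense F i (C ᵀ) (≤-trans d (≤-reflexive (cong (F *_) (∑-swap C))))

-- The lower bound for walks in a graph of density 1 / F, proved by doubling: a walk of length 2P
-- consists of two walks of length P from its middle vertex, and the Cauchy-Schwarz inequality over
-- that vertex squares the bound.
alt-lower-2^ : ∀ {n} F → 0 < n → ∀ r (C : Kernel n) → Dense F C → n ^ suc (2 ^ r) ≤ F ^ (2 ^ r) * ∑ (alt C (2 ^ r))
alt-lower-2^ {n} F n>0 zero C d = ≤-trans (≤-reflexive (eq₁ n)) (≤-trans d (≤-reflexive (cong₂ _*_ (sym (*-identityʳ F)) (∑∑-cong (λ x y → sym (*-identityʳ (C x y)))))))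
  where
  eq₁ : ∀ n → n * (n * 1) ≡ n * n
  eq₁ = solve-∀
alt-lower-2^ {n} F n>0 (suc r) C d = *-cancelˡ-≤ n {{>-nonZero n>0}} (begin
  n * n ^ suc (2 ^ suc r) ≡⟨ cong (n *_) (cong (n *_) (split n)) ⟩
  n * (n * (n ^ P * n ^ P)) ≡⟨ eq₁ n (n ^ P) ⟩
  n * n ^ P * (n * n ^ P) ≤⟨ *-mono-≤ ih ih ⟩
  F ^ P * S * (F ^ P * S) ≡⟨ eq₂ (F ^ P) S ⟩
  F ^ P * F ^ P * (S * S) ≤⟨ *-monoʳ-≤ (F ^ P * F ^ P) (cauchy-schwarz (alt C′ P)) ⟩
  F ^ P * F ^ P * (n * ∑ (λ x → alt C′ P x * alt C′ P x)) ≡⟨ cong₂ (λ u v → u * (n * v)) (sym (split F)) (trans (alt-inner P P C′) (cong₂ (λ K m → ∑ (alt K m)) (turn-turn P C) (cong (P +_) (sym (+-identityʳ P))))) ⟩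
  F ^ (2 ^ suc r) * (n * ∑ (alt C (2 ^ suc r))) ≡⟨ eq₃ (F ^ (2 ^ suc r)) n (∑ (alt C (2 ^ suc r))) ⟩
  n * (F ^ (2 ^ suc r) * ∑ (alt C (2 ^ suc r))) ∎)
  where
  open ≤-Reasoning
  P = 2 ^ r
  C′ = turn P C
  S = ∑ (alt C′ P)
  ih : n ^ suc P ≤ F ^ P * S
  ih = alt-lower-2^ F n>0 r C′ (turn-dense F P C d)
  split : ∀ b → b ^ (2 ^ suc r) ≡ b ^ P * b ^ P
  split b = trans (cong (b ^_) (cong (P +_) (+-identityʳ P))) (^-distribˡ-+-* b P P)
  eq₁ : ∀ n p → n * (n * (p * p)) ≡ n * p * (n * p)
  eq₁ = solve-∀
  eq₂ : ∀ a s → a * s * (a * s) ≡ a * a * (s * s)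
  eq₂ = solve-∀
  eq₃ : ∀ a n s → a * (n * s) ≡ n * (a * s)
  eq₃ = solve-∀

alt-bound : ∀ {n} (C : Kernel n) → Bounded 1 C → ∀ i x → alt C i x ≤ n ^ i
alt-bound C b zero x = ≤-refl
alt-bound {n} C b (suc i) x = ∑-bound (λ y → ≤-trans (*-mono-≤ (b x y) (alt-bound (C ᵀ) (λ u v → b v u) i y)) (≤-reflexive (+-identityʳ (n ^ i))))

alt-truncate : ∀ {n} (C : Kernel n) → Bounded 1 C → ∀ j i x → alt C (j + i) x ≤ n ^ i * alt C j x
alt-truncate C b zero i x = ≤-trans (alt-bound C b i x) (≤-reflexive (sym (*-identityʳ _)))
alt-truncate {n} C b (suc j) i x = ≤-trans (∑-mono (λ y → ≤-trans (*-monoʳ-≤ (C x y) (alt-truncate (C ᵀ) (λ u v → b v u) j i y)) (≤-reflexive (eq (C x y) (n ^ i) (alt (C ᵀ) j y))))) (≤-reflexive (∑-*ˡ (n ^ i) _))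
  where
  eq : ∀ a b c → a * (b * c) ≡ b * (a * c)
  eq = solve-∀

n≤2^n : ∀ n → n ≤ 2 ^ n
n≤2^n zero = z≤n
n≤2^n (suc n) = ≤-trans (+-mono-≤ (m^n>0 2 n) (n≤2^n n)) (≤-reflexive (cong (2 ^ n +_) (sym (+-identityʳ (2 ^ n)))))

-- Walks of length 2^j are cut off after j edges, each discarded edge accounting for at most a
-- factor n. The constant F^(2^j) is wasteful but independent of n.
alt-lower : ∀ {n} F → 0 < n → (C : Kernel n) → Bounded 1 C → Dense F C → ∀ j → n ^ suc j ≤ F ^ (2 ^ j) * ∑ (alt C j)
alt-lower {n} F n>0 C b d j = *-cancelˡ-≤ (n ^ i) {{>-nonZero (m^n>0 n {{>-nonZero n>0}} i)}} (begin
  n ^ i * n ^ suc j ≡⟨ trans (sym (^-distribˡ-+-* n i (suc j))) (cong (n ^_) (trans (+-suc i j) (cong suc (m∸n+n≡m (n≤2^n j))))) ⟩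
  n ^ suc (2 ^ j) ≤⟨ alt-lower-2^ F n>0 j C d ⟩
  F ^ (2 ^ j) * ∑ (alt C (2 ^ j)) ≡⟨ cong (λ m → F ^ (2 ^ j) * ∑ (alt C m)) (sym (m+[n∸m]≡n (n≤2^n j))) ⟩
  F ^ (2 ^ j) * ∑ (alt C (j + i)) ≤⟨ *-monoʳ-≤ (F ^ (2 ^ j)) (≤-trans (∑-mono (alt-truncate C b j i)) (≤-reflexive (∑-*ˡ (n ^ i) _))) ⟩
  F ^ (2 ^ j) * (n ^ i * ∑ (alt C j)) ≡⟨ eq (F ^ (2 ^ j)) (n ^ i) (∑ (alt C j)) ⟩
  n ^ i * (F ^ (2 ^ j) * ∑ (alt C j)) ∎)
  where
  open ≤-Reasoning
  i = 2 ^ j ∸ j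
  eq : ∀ a b c → a * (b * c) ≡ b * (a * c)
  eq = solve-∀

module _ {n} (D : Digraph n) (w : Fin n) where

  -- The edges of C are double edges of D, so an alternating walk is a directed walk of D. After an
  -- odd number of edges it is on the far side, where every vertex that has been reached sends an
  -- edge to w.
  alt-odd≤pow : (C : Kernel n) → (∀ u v → C u v ≤ ⟦ D u v ⟧ * ⟦ D v w ⟧) → (∀ u v → C u v ≤ ⟦ D u v ⟧) → (∀ u v → C u v ≤ ⟦ D v u ⟧) →
    ∀ m u → alt C (suc (m + m)) u ≤ pow ⟪ D ⟫ (2 + (m + m)) u w
  alt-odd≤pow C end fwd bwd zero u = ∑-mono (λ v → ≤-trans (≤-reflexive (*-identityʳ (C u v))) (≤-trans (end u v) (*-monoʳ-≤ ⟦ D u v ⟧ (≤-reflexive (sym (·-δ ⟪ D ⟫ v w))))))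
  alt-odd≤pow C end fwd bwd (suc m) u = ∑-mono (λ v → *-mono-≤ (fwd u v)
    (subst (λ i → alt (C ᵀ) i v ≤ pow ⟪ D ⟫ (suc i) v w) (sym (+-suc (suc m) m)) (∑-mono (λ u′ → *-mono-≤ (bwd u′ v) (alt-odd≤pow C end fwd bwd m u′)))))

  -- Here the edges into w leave the starting side, which an alternating walk of even length reaches
  -- again.
  alt-even≤pow : (C : Kernel n) → (∀ u v → C u v ≤ ⟦ D v u ⟧ * ⟦ D u w ⟧) → (∀ u v → C u v ≤ ⟦ D u v ⟧) → (∀ u v → C u v ≤ ⟦ D v u ⟧) →
    ∀ m u → alt C (2 + (m + m)) u ≤ pow ⟪ D ⟫ (3 + (m + m)) u w
  alt-even≤pow C end fwd bwd m u = ∑-mono (λ v → *-mono-≤ (fwd u v) (alt-odd≤pow (C ᵀ) (λ x y → end y x) (λ x y → bwd y x) (λ x y → fwd y x) m v))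

alt-start : ∀ {n} (D : Digraph n) w (C : Kernel n) (g : Fin n → ℕ) j → (∀ u v → C u v ≤ ⟦ D w u ⟧) → (∀ u → alt C (suc j) u ≤ g u) → ∀ u → alt C (suc j) u ≤ ⟦ D w u ⟧ * g u
alt-start {n} D w C g j s h u with D w u in e
... | true = ≤-trans (h u) (≤-reflexive (sym (+-identityʳ (g u))))
... | false = ≤-reflexive (trans (∑-cong (λ v → cong (_* alt (C ᵀ) j v) (n≤0⇒n≡0 (subst (λ b → C u v ≤ ⟦ b ⟧) e (s u v))))) (∑-zero n))

-- Turns "many configurations force many closed walks" into "few closed walks force few
-- configurations": (F + 1) T ≤ N and N ≤ F T exclude each other for positive N.
few : ∀ F T {N X Y} → 0 < N → suc F * T ≤ N → (Y ≤ X → N ≤ F * T) → X ≤ Y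
few F T {N} {X} {Y} N>0 h imp with Y ≤? X
... | no ¬p = <⇒≤ (≰⇒> ¬p)
... | yes p with T
... | zero = contradiction (≤-trans N>0 (≤-trans (imp p) (≤-reflexive (*-zeroʳ F)))) λ ()
... | suc t = contradiction (≤-trans h (imp p)) (<⇒≱ (*-monoˡ-< (suc t) (n<1+n F)))

-- A directed triangle whose edge uv is double. For fixed w this is a bipartite graph between
-- out-neighbours u and in-neighbours v of w, which is the form that alternating walks need.
dtri : ∀ {n} → Digraph n → Fin n → Fin n → Fin n → Bool
dtri D w u v = (D w u ∧ D v w) ∧ (D u v ∧ D v u)

∑₃ : ∀ {n} → (Fin n → Fin n → Fin n → ℕ) → ℕ
∑₃ f = ∑ (λ x → ∑ (λ y → ∑ (f x y)))

#dtri : ∀ {n} → Digraph n → ℕ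
#dtri D = ∑₃ (λ w u v → ⟦ dtri D w u v ⟧)

dbl : ∀ {n} → Digraph n → Fin n → Fin n → Bool
dbl D x y = D x y ∧ D y x

#dbl : ∀ {n} → Digraph n → ℕ
#dbl D = ∑ (λ x → ∑ (λ y → ⟦ dbl D x y ⟧))

-- A closed walk of length k arises from w and an alternating walk of length k - 2 in C w.
many-closed : ∀ {n} (D : Digraph n) E j (C : Fin n → Kernel n) → 0 < n → (∀ w → Bounded 1 (C w)) →
  (∀ w u v → C w u v ≤ ⟦ D w u ⟧) → (∀ w u → alt (C w) (suc j) u ≤ pow ⟪ D ⟫ (2 + j) u w) →
  n * (n * n) ≤ E * ∑ (λ w → ∑ (λ u → ∑ (C w u))) → n ^ (3 + j) ≤ 2 * E * (2 * E) ^ (2 ^ suc j) * tr (pow ⟪ D ⟫ (3 + j))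
many-closed {n} D E j C n>0 b s p d = ≤-trans (rich-average E (n * n) (n ^ (2 + j)) (λ w → ∑ (λ u → ∑ (C w u))) g (*-mono-≤ n>0 n>0)
    (λ w → ≤-trans (∑∑-bound (b w)) (≤-reflexive (cong (n *_) (*-identityʳ n)))) d rich) (≤-reflexive (trans (cong (2 * E *_) (∑-*ˡ ((2 * E) ^ (2 ^ suc j)) _)) (sym (*-assoc (2 * E) ((2 * E) ^ (2 ^ suc j)) _))))
  where
  g : Fin n → ℕ
  g w = (2 * E) ^ (2 ^ suc j) * ∑ (λ u → ⟦ D w u ⟧ * pow ⟪ D ⟫ (2 + j) u w)
  rich : ∀ w → n * n ≤ 2 * E * ∑ (λ u → ∑ (C w u)) → n ^ (2 + j) ≤ g w
  rich w h = ≤-trans (alt-lower (2 * E) n>0 (C w) (b w) h (suc j)) (*-monoʳ-≤ ((2 * E) ^ (2 ^ suc j)) (∑-mono (alt-start D w (C w) _ j (s w) (p w))))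

-- For odd k an alternating walk of length k - 2 leads from an out-neighbour of w to an in-neighbour
-- of w, and the two edges at w close it.
few-dtri-odd : ∀ m E → ∃ λ F → ∀ n → 0 < n → (D : Digraph n) → F * tr (pow ⟪ D ⟫ (3 + (m + m))) ≤ n ^ (3 + (m + m)) → E * #dtri D ≤ n * (n * n)
few-dtri-odd m E = suc (2 * E * (2 * E) ^ (2 ^ suc (m + m))) , λ n n>0 D h →
  few (2 * E * (2 * E) ^ (2 ^ suc (m + m))) (tr (pow ⟪ D ⟫ (3 + (m + m)))) (m^n>0 n {{>-nonZero n>0}} (3 + (m + m))) h (λ le → many-closed D E (m + m) (λ w u v → ⟦ dtri D w u v ⟧) n>0 (λ w u v → ⟦⟧≤1 _)
    (λ w u v → ≤ᵇ⇒≤ _ _ (taut 4 (λ a b c d → ⟦ (a ∧ b) ∧ (c ∧ d) ⟧ ≤ᵇ ⟦ a ⟧) tt (D w u) (D v w) (D u v) (D v u)))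
    (λ w → alt-odd≤pow D w (λ u v → ⟦ dtri D w u v ⟧)
      (λ u v → ≤ᵇ⇒≤ _ _ (taut 4 (λ a b c d → ⟦ (a ∧ b) ∧ (c ∧ d) ⟧ ≤ᵇ ⟦ c ⟧ * ⟦ b ⟧) tt (D w u) (D v w) (D u v) (D v u)))
      (λ u v → ≤ᵇ⇒≤ _ _ (taut 4 (λ a b c d → ⟦ (a ∧ b) ∧ (c ∧ d) ⟧ ≤ᵇ ⟦ c ⟧) tt (D w u) (D v w) (D u v) (D v u)))
      (λ u v → ≤ᵇ⇒≤ _ _ (taut 4 (λ a b c d → ⟦ (a ∧ b) ∧ (c ∧ d) ⟧ ≤ᵇ ⟦ d ⟧) tt (D w u) (D v w) (D u v) (D v u))) m)
    le)

dbl-sym : ∀ {n} (D : Digraph n) x y → dbl D x y ≡ dbl D y x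
dbl-sym D x y = ∧-comm (D x y) (D y x)

-- For even k the alternating walk uses double edges that leave double neighbours u of w. It has the
-- even length k - 2, hence ends again at a double neighbour of w.
few-dbl-even : ∀ m E → ∃ λ F → ∀ n → 0 < n → (D : Digraph n) → F * tr (pow ⟪ D ⟫ (4 + (m + m))) ≤ n ^ (4 + (m + m)) → E * #dbl D ≤ n * n
few-dbl-even m E = suc (2 * (E * E) * (2 * (E * E)) ^ (2 ^ (2 + (m + m)))) , λ n n>0 D h →
  few (2 * (E * E) * (2 * (E * E)) ^ (2 ^ (2 + (m + m)))) (tr (pow ⟪ D ⟫ (4 + (m + m)))) (m^n>0 n {{>-nonZero n>0}} (4 + (m + m))) h (λ le → many-closed D (E * E) (suc (m + m)) (λ w u v → ⟦ dbl D w u ∧ dbl D u v ⟧) n>0 (λ w u v → ⟦⟧≤1 _)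
    (λ w u v → ≤ᵇ⇒≤ _ _ (taut 4 (λ a b c d → ⟦ (a ∧ b) ∧ (c ∧ d) ⟧ ≤ᵇ ⟦ a ⟧) tt (D w u) (D u w) (D u v) (D v u)))
    (λ w → alt-even≤pow D w (λ u v → ⟦ dbl D w u ∧ dbl D u v ⟧)
      (λ u v → ≤ᵇ⇒≤ _ _ (taut 4 (λ a b c d → ⟦ (a ∧ b) ∧ (c ∧ d) ⟧ ≤ᵇ ⟦ d ⟧ * ⟦ b ⟧) tt (D w u) (D u w) (D u v) (D v u)))
      (λ u v → ≤ᵇ⇒≤ _ _ (taut 4 (λ a b c d → ⟦ (a ∧ b) ∧ (c ∧ d) ⟧ ≤ᵇ ⟦ c ⟧) tt (D w u) (D u w) (D u v) (D v u)))
      (λ u v → ≤ᵇ⇒≤ _ _ (taut 4 (λ a b c d → ⟦ (a ∧ b) ∧ (c ∧ d) ⟧ ≤ᵇ ⟦ d ⟧) tt (D w u) (D u w) (D u v) (D v u))) m)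
    (dense n n>0 D le))
  where
  -- The Cauchy-Schwarz inequality over the middle vertex makes the number of paths with two double
  -- edges at least the square of the number of double edges divided by n; this is the origin of E *
  -- E.
  dense : ∀ n → 0 < n → (D : Digraph n) → n * n ≤ E * #dbl D → n * (n * n) ≤ E * E * ∑ (λ w → ∑ (λ u → ∑ (λ v → ⟦ dbl D w u ∧ dbl D u v ⟧)))
  dense n n>0 D le = *-cancelˡ-≤ n {{>-nonZero n>0}} (begin
    n * (n * (n * n)) ≡⟨ eq₁ n ⟩
    n * n * (n * n) ≤⟨ *-mono-≤ le le ⟩
    E * #dbl D * (E * #dbl D) ≡⟨ eq₂ E (#dbl D) ⟩
    E * E * (#dbl D * #dbl D) ≤⟨ *-monoʳ-≤ (E * E) (cauchy-schwarz β) ⟩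
    E * E * (n * ∑ (λ u → β u * β u)) ≡⟨ cong (λ z → E * E * (n * z)) squares ⟩
    E * E * (n * S) ≡⟨ eq₃ (E * E) n S ⟩
    n * (E * E * S) ∎)
    where
    open ≤-Reasoning
    β : Fin n → ℕ
    β u = ∑ (λ v → ⟦ dbl D u v ⟧)
    S = ∑ (λ w → ∑ (λ u → ∑ (λ v → ⟦ dbl D w u ∧ dbl D u v ⟧)))
    squares : ∑ (λ u → β u * β u) ≡ S
    squares = sym (trans (∑-swap _) (∑-cong (λ u → trans (∑∑-cong (λ w v → trans (⟦∧⟧ (dbl D w u) (dbl D u v)) (cong (λ b → ⟦ b ⟧ * ⟦ dbl D u v ⟧) (dbl-sym D w u)))) (∑-prod (λ w → ⟦ dbl D u w ⟧) (λ v → ⟦ dbl D u v ⟧)))))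
    eq₁ : ∀ n → n * (n * (n * n)) ≡ n * n * (n * n)
    eq₁ = solve-∀
    eq₂ : ∀ a s → a * s * (a * s) ≡ a * a * (s * s)
    eq₂ = solve-∀
    eq₃ : ∀ a n s → a * (n * s) ≡ n * (a * s)
    eq₃ = solve-∀

-- Double edges and degrees

Loopless : ∀ {n} → Digraph n → Set
Loopless D = ∀ x → D x x ≡ false

deg : ∀ {n} → Digraph n → Fin n → Fin n → ℕ
deg D x y = ⟦ D x y ⟧ + ⟦ D y x ⟧

size : ∀ {n} → (Fin n → Bool) → ℕ
size U = ∑ (λ x → ⟦ U x ⟧)

leq : ∀ {a b} → T (a ≤ᵇ b) → a ≤ b
leq {a} {b} = ≤ᵇ⇒≤ a b

δ-true : ∀ {n} {x y : Fin n} → x ≡ y → δ x y ≡ 1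
δ-true {x = x} refl = δ-refl x

δ-false : ∀ {n} {x y : Fin n} → x ≢ y → δ x y ≡ 0
δ-false {x = x} {y} x≢y with x FP.≟ y
... | yes p = contradiction p x≢y
... | no _ = refl

δ-iff : ∀ {m n} {x y : Fin m} {u v : Fin n} → (x ≡ y → u ≡ v) → (u ≡ v → x ≡ y) → δ x y ≡ δ u v
δ-iff {x = x} {y} {u} {v} f g with x FP.≟ y
... | yes p = sym (δ-true (f p))
... | no ¬p = sym (δ-false (λ q → ¬p (g q)))

∑-δ′ : ∀ {n} (y : Fin n) → ∑ (λ x → δ x y) ≡ 1
∑-δ′ y = trans (∑-cong (λ x → sym (+-identityʳ (δ x y)))) (∑-δ (λ _ → 1) y)

∑-involution : ∀ {n} (π : Fin n → Fin n) → (∀ x → π (π x) ≡ x) → ∀ f → ∑ (λ x → f (π x)) ≡ ∑ f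
∑-involution π inv f = begin
  ∑ (λ x → f (π x)) ≡⟨ ∑-cong (λ x → sym (∑-δ f (π x))) ⟩
  ∑ (λ x → ∑ (λ z → f z * δ z (π x))) ≡⟨ ∑-swap _ ⟩
  ∑ (λ z → ∑ (λ x → f z * δ z (π x))) ≡⟨ ∑∑-cong (λ z x → cong (f z *_) (δ-iff {x = z} {π x} {x} {π z} (λ e → trans (sym (inv x)) (cong π (sym e))) (λ e → trans (sym (inv z)) (cong π (sym e))))) ⟩
  ∑ (λ z → ∑ (λ x → f z * δ x (π z))) ≡⟨ ∑-cong (λ z → ∑-δ (λ _ → f z) (π z)) ⟩
  ∑ f ∎
  where open ≡-Reasoning

-- A matching as an involution: its edges are the 2-cycles and its uncovered vertices the fixed
-- points, so sums can be reindexed by π without distinguishing the two.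
record MaximalMatching {n} (Good : Fin n → Fin n → Set) : Set where
  field
    π : Fin n → Fin n
    inv : ∀ x → π (π x) ≡ x
    good : ∀ x → π x ≢ x → Good x (π x)
    maximal : ∀ x y → π x ≡ x → π y ≡ y → ¬ Good x y

maximalMatching : ∀ {n} (Good : Fin n → Fin n → Set) → (∀ {x y} → Good x y → Good y x) → (∀ x → ¬ Good x x) → ¬ ¬ MaximalMatching Good
maximalMatching {n} Good gsym irr = go n id (λ _ → refl) (λ x ne → contradiction refl ne) (≤-trans (≤-reflexive (trans (∑-cong (λ x → δ-refl x)) (∑-const n 1))) (≤-reflexive (*-identityʳ n)))
  where
  fix : (Fin n → Fin n) → ℕ
  fix π = ∑ (λ x → δ (π x) x)
  go : ∀ c π → (∀ x → π (π x) ≡ x) → (∀ x → π x ≢ x → Good x (π x)) → fix π ≤ c → ¬ ¬ MaximalMatching Good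
  go c π inv good b = classical (∃ λ x → ∃ λ y → π x ≡ x × π y ≡ y × Good x y) >>= λ
    { (inj₂ none) → return (record { π = π ; inv = inv ; good = good ; maximal = λ x y ex ey g → none (x , y , ex , ey , g) })
    ; (inj₁ (x , y , ex , ey , g)) → enlarge c x y ex ey g b }
    where
    enlarge : ∀ c x y → π x ≡ x → π y ≡ y → Good x y → fix π ≤ c → ¬ ¬ MaximalMatching Good
    enlarge c x y ex ey g b = rest c b
      where
      x≢y : x ≢ y
      x≢y refl = irr x g
      π′ : Fin n → Fin n
      π′ z with z FP.≟ x
      ... | yes _ = y
      ... | no _ with z FP.≟ y
      ... | yes _ = x
      ... | no _ = π z
      π′x : π′ x ≡ y
      π′x with x FP.≟ x
      ... | yes _ = refl
      ... | no q = contradiction refl q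
      π′y : π′ y ≡ x
      π′y with y FP.≟ x
      ... | yes q = contradiction (sym q) x≢y
      ... | no _ with y FP.≟ y
      ... | yes _ = refl
      ... | no q = contradiction refl q
      π′z : ∀ z → z ≢ x → z ≢ y → π′ z ≡ π z
      π′z z a b with z FP.≟ x
      ... | yes q = contradiction q a
      ... | no _ with z FP.≟ y
      ... | yes q = contradiction q b
      ... | no _ = refl
      cases : ∀ {P : Fin n → Set} → P x → P y → (∀ z → z ≢ x → z ≢ y → P z) → ∀ z → P z
      cases px py pz z with z FP.≟ x
      ... | yes refl = px
      ... | no a with z FP.≟ y
      ... | yes refl = py
      ... | no b = pz z a b
      inv′ : ∀ z → π′ (π′ z) ≡ z
      inv′ = cases (trans (cong π′ π′x) π′y) (trans (cong π′ π′y) π′x) λ z a b →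
        trans (cong π′ (π′z z a b)) (trans (π′z (π z) (λ e → a (trans (sym (inv z)) (trans (cong π e) ex))) (λ e → b (trans (sym (inv z)) (trans (cong π e) ey)))) (inv z))
      good′ : ∀ z → π′ z ≢ z → Good z (π′ z)
      good′ = cases {λ z → π′ z ≢ z → Good z (π′ z)} (λ _ → subst (Good x) (sym π′x) g) (λ _ → subst (Good y) (sym π′y) (gsym g))
        λ z a b ne → subst (Good z) (sym (π′z z a b)) (good z (λ e → ne (trans (π′z z a b) e)))
      -- Both x and y cease to be fixed; recording x alone suffices for termination.
      drop : fix π′ + 1 ≤ fix π
      drop = ≤-trans (≤-reflexive (trans (cong (fix π′ +_) (sym (∑-δ′ x))) (sym (∑-+ _ _)))) (∑-mono (cases {λ z → δ (π′ z) z + δ z x ≤ δ (π z) z}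
        (≤-reflexive (trans (cong₂ _+_ (δ-false (λ e → x≢y (trans (sym e) π′x))) (δ-refl x)) (sym (δ-true ex))))
        (≤-trans (≤-reflexive (cong₂ _+_ (δ-false (λ e → x≢y (trans (sym π′y) e))) (δ-false (x≢y ∘ sym)))) z≤n)
        (λ z a b → ≤-reflexive (trans (cong₂ _+_ (cong (λ u → δ u z) (π′z z a b)) (δ-false a)) (+-identityʳ _)))))
      rest : ∀ c → fix π ≤ c → ¬ ¬ MaximalMatching Good
      rest zero b = ⊥-elim (<⇒≱ (≤-trans (m≤n+m 1 (fix π′)) drop) b)
      rest (suc c) b = go c π′ inv′ good′ (≤-pred (≤-trans (≤-trans (≤-reflexive (+-comm 1 (fix π′))) drop) b))

threshold : ∀ n b c → n * ⟦ b ∧ (n <ᵇ c) ⟧ ≤ c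
threshold n false c = ≤-trans (≤-reflexive (*-zeroʳ n)) z≤n
threshold n true c with n <ᵇ c in e
... | false = ≤-trans (≤-reflexive (*-zeroʳ n)) z≤n
... | true = ≤-trans (≤-reflexive (*-identityʳ n)) (<⇒≤ (<ᵇ⇒< n _ (Equivalence.from T-≡ e)))

<ᵇ-true : ∀ {n c} → n < c → (n <ᵇ c) ≡ true
<ᵇ-true lt = Equivalence.to T-≡ (<⇒<ᵇ lt)

-- For two uncovered vertices of U: if they were joined by two edges, this double edge would fail to
-- be good by maximality, so the last term pays for it.
light : ∀ n u v a b c → (u ≡ true → v ≡ true → a ∧ b ≡ true → ¬ c ≤ n) → ⟦ u ∧ v ⟧ * (⟦ a ⟧ + ⟦ b ⟧) ≤ ⟦ u ∧ v ⟧ + ⟦ (a ∧ b) ∧ (n <ᵇ c) ⟧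
light n false v a b c h = z≤n
light n true false a b c h = z≤n
light n true true false false c h = z≤n
light n true true false true c h = ≤-refl
light n true true true false c h = ≤-refl
light n true true true true c h = ≤-reflexive (cong (λ b → 1 + ⟦ b ⟧) (sym (<ᵇ-true (≰⇒> (h refl refl refl)))))

module _ {n} (D : Digraph n) (U : Fin n → Bool) where

  degIn : Fin n → Fin n → ℕ
  degIn x y = ⟦ U x ∧ U y ⟧ * deg D x y

  #degIn : ℕ
  #degIn = ∑ (λ x → ∑ (degIn x))

  β : Fin n → Fin n → Fin n → ℕ
  β x x′ w = ⟦ dtri D w x x′ ⟧ + ⟦ dtri D w x′ x ⟧

  bad : Fin n → Fin n → ℕ
  bad x y = ∑ (β x y)

  -- Three edges between w and the ends of a double edge contain one into w from one end and one out
  -- of w to the other, and these close a triangle with the double edge.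
  β-bound : ∀ x x′ w → dbl D x x′ ≡ true → deg D w x + deg D w x′ ≤ 2 + 2 * β x x′ w
  β-bound x x′ w e = leq (taut′ (D w x) (D x w) (D w x′) (D x′ w) (D x x′) (D x′ x) e)
    where
    taut′ : ∀ a a′ b b′ c c′ → c ∧ c′ ≡ true → T ((⟦ a ⟧ + ⟦ a′ ⟧) + (⟦ b ⟧ + ⟦ b′ ⟧) ≤ᵇ 2 + 2 * (⟦ (a ∧ b′) ∧ (c ∧ c′) ⟧ + ⟦ (b ∧ a′) ∧ (c′ ∧ c) ⟧))
    taut′ a a′ b b′ true true _ = taut 4 (λ a a′ b b′ → (⟦ a ⟧ + ⟦ a′ ⟧) + (⟦ b ⟧ + ⟦ b′ ⟧) ≤ᵇ 2 + 2 * (⟦ (a ∧ b′) ∧ true ⟧ + ⟦ (b ∧ a′) ∧ true ⟧)) tt a a′ b b′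

  deg-sym : ∀ x y → deg D x y ≡ deg D y x
  deg-sym x y = +-comm ⟦ D x y ⟧ ⟦ D y x ⟧

  -- A double edge xx′ spans at most two edges with a vertex w, unless w closes a triangle with it;
  -- hence averaging deg over the orbits of a maximal matching π of double edges gives at most 1.
  degIn-sum : ∀ E → 0 < n → Loopless D → 16 * (E * E) * #dtri D ≤ n * (n * n) → ¬ ¬ (E * #degIn ≤ E * (size U * size U) + n * n)
  degIn-sum E n>0 loopless few-dtri = maximalMatching Good Good-sym Good-irr >>= λ m → return (bound m)
    where
    F₁ = 4 * E
    Good : Fin n → Fin n → Set
    -- The bound on `bad` lets a matched edge lie in triangles with at most n / (4E) vertices.
    -- Double edges beyond that bound cannot be matched, but they are few by Markov's inequality,
    -- which is `Γ-bound`.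
    Good x y = U x ≡ true × U y ≡ true × dbl D x y ≡ true × F₁ * bad x y ≤ n
    Good-sym : ∀ {x y} → Good x y → Good y x
    Good-sym {x} {y} (a , b , c , d) = b , a , trans (dbl-sym D y x) c , subst (λ z → F₁ * z ≤ n) (∑-cong (λ w → +-comm ⟦ dtri D w x y ⟧ _)) d
    Good-irr : ∀ x → ¬ Good x x
    Good-irr x (_ , _ , c , _) with D x x | loopless x
    Good-irr x (_ , _ , () , _) | false | _
    bound : MaximalMatching Good → E * #degIn ≤ E * (size U * size U) + n * n
    bound mm = final
      where
      open MaximalMatching mm
      Uπ : ∀ x → U (π x) ≡ U x
      Uπ x with π x FP.≟ x
      ... | yes e = cong U e
      ... | no ne with good x ne
      ... | a , b , _ = trans b (sym a)
      β′ : Fin n → Fin n → ℕ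
      β′ x y with π x FP.≟ x
      ... | yes _ = 0
      ... | no _ = β x (π x) y
      β′-sum : ∀ x → F₁ * ∑ (β′ x) ≤ n
      β′-sum x with π x FP.≟ x
      ... | yes _ = ≤-trans (≤-reflexive (trans (cong (F₁ *_) (∑-zero n)) (*-zeroʳ F₁))) z≤n
      ... | no ne = proj₂ (proj₂ (proj₂ (good x ne)))
      γ : Fin n → Fin n → ℕ
      γ x y = ⟦ dbl D x y ∧ (n <ᵇ F₁ * bad x y) ⟧
      γ-bound : ∀ x y → n * γ x y ≤ F₁ * bad x y
      γ-bound x y = threshold n (dbl D x y) (F₁ * bad x y)
      err : Fin n → Fin n → ℕ
      err x y = 2 * (β′ x y + β′ x (π y)) + 2 * (β′ y x + β′ y (π x)) + 4 * γ x y
      matched : ∀ x → π x ≢ x → ∀ y → degIn x y + degIn (π x) y ≤ 2 * ⟦ U x ∧ U y ⟧ + 2 * β′ x y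
      matched x ne y with π x FP.≟ x
      ... | yes e = contradiction e ne
      ... | no _ rewrite Uπ x with U x ∧ U y
      ... | false = z≤n
      ... | true = ≤-trans (≤-reflexive (cong₂ _+_ (trans (+-identityʳ (deg D x y)) (deg-sym x y)) (trans (+-identityʳ (deg D (π x) y)) (deg-sym (π x) y)))) (β-bound x (π x) y (proj₁ (proj₂ (proj₂ (good x ne)))))
      degIn-sym : ∀ x y → degIn x y ≡ degIn y x
      degIn-sym x y = cong₂ _*_ (cong ⟦_⟧ (∧-comm (U x) (U y))) (deg-sym x y)
      -- The four pairs formed from the orbits of x and y. Summed over all x and y, each pair is
      -- counted four times.
      orbit : Fin n → Fin n → ℕ
      orbit x y = (degIn x y + degIn (π x) y) + (degIn x (π y) + degIn (π x) (π y))
      unmatched : ∀ x y → π x ≡ x → π y ≡ y → degIn x y ≤ ⟦ U x ∧ U y ⟧ + γ x y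
      unmatched x y ex ey = light n (U x) (U y) (D x y) (D y x) (F₁ * bad x y) (λ a b c d → maximal x y ex ey (a , b , c , d))
      point : ∀ x y → orbit x y ≤ 4 * ⟦ U x ∧ U y ⟧ + err x y
      point x y = go (π x FP.≟ x) (π y FP.≟ y)
        where
        Goal = orbit x y ≤ 4 * ⟦ U x ∧ U y ⟧ + err x y
        eq₁ : ∀ u a b c d → ((2 * u + 2 * a) + (2 * u + 2 * b)) + (c + d) ≡ 4 * u + (2 * (a + b) + c + d)
        eq₁ = solve-∀
        eq₂ : ∀ u a b c d → ((2 * u + 2 * a) + (2 * u + 2 * b)) + (c + d) ≡ 4 * u + (c + 2 * (a + b) + d)
        eq₂ = solve-∀
        eq₃ : ∀ u g c d → (((u + g) + (u + g)) + ((u + g) + (u + g))) + (c + d) ≡ 4 * u + (c + d + 4 * g)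
        eq₃ = solve-∀
        go : Dec (π x ≡ x) → Dec (π y ≡ y) → Goal
        go (no ne) _ = ≤-trans (+-mono-≤ (matched x ne y) (matched x ne (π y))) (≤-trans (≤-reflexive (cong (λ b → (2 * ⟦ U x ∧ U y ⟧ + 2 * β′ x y) + (2 * ⟦ U x ∧ b ⟧ + 2 * β′ x (π y))) (Uπ y)))
             (≤-trans (m≤m+n _ (2 * (β′ y x + β′ y (π x)) + 4 * γ x y)) (≤-reflexive (eq₁ ⟦ U x ∧ U y ⟧ (β′ x y) (β′ x (π y)) (2 * (β′ y x + β′ y (π x))) (4 * γ x y)))))
        go (yes ex) (no ne) = ≤-trans (≤-reflexive (trans (cong₂ _+_ (cong₂ _+_ (degIn-sym x y) (degIn-sym (π x) y)) (cong₂ _+_ (degIn-sym x (π y)) (degIn-sym (π x) (π y)))) (+-interchange (degIn y x) (degIn y (π x)) (degIn (π y) x) (degIn (π y) (π x)))))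
             (≤-trans (+-mono-≤ (matched y ne x) (matched y ne (π x))) (≤-trans (≤-reflexive (cong₂ (λ b c → (2 * ⟦ b ⟧ + 2 * β′ y x) + (2 * ⟦ c ⟧ + 2 * β′ y (π x))) (∧-comm (U y) (U x)) (trans (cong (U y ∧_) (Uπ x)) (∧-comm (U y) (U x)))))
             (≤-trans (m≤m+n _ (2 * (β′ x y + β′ x (π y)) + 4 * γ x y)) (≤-reflexive (eq₂ ⟦ U x ∧ U y ⟧ (β′ y x) (β′ y (π x)) (2 * (β′ x y + β′ x (π y))) (4 * γ x y))))))
        go (yes ex) (yes ey) = ≤-trans (≤-reflexive (cong₂ (λ x′ y′ → (degIn x y + degIn x′ y) + (degIn x y′ + degIn x′ y′)) ex ey)) (≤-trans (+-mono-≤ (+-mono-≤ u u) (+-mono-≤ u u)) (≤-trans (m≤m+n _ (2 * (β′ x y + β′ x (π y)) + 2 * (β′ y x + β′ y (π x)))) (≤-reflexive (eq₃ ⟦ U x ∧ U y ⟧ (γ x y) (2 * (β′ x y + β′ x (π y))) (2 * (β′ y x + β′ y (π x)))))))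
          where
          u = unmatched x y ex ey
      B = ∑ (λ x → ∑ (β′ x))
      Γ = ∑ (λ x → ∑ (γ x))
      B-bound : F₁ * B ≤ n * n
      B-bound = ≤-trans (≤-reflexive (sym (∑-*ˡ F₁ (λ x → ∑ (β′ x))))) (∑-bound β′-sum)
      err-sum : ∑ (λ x → ∑ (err x)) ≡ 8 * B + 4 * Γ
      err-sum = trans (∑∑-+ _ _) (trans (cong₂ _+_ (∑∑-+ _ _) (∑∑-*ˡ 4 γ)) (trans (cong (λ z → z + 4 * Γ) (cong₂ _+_ (trans (∑∑-*ˡ 2 _) (cong (2 *_) s₁)) (trans (∑∑-*ˡ 2 _) (cong (2 *_) s₂)))) (eq B Γ)))
        where
        πsum : ∑ (λ x → ∑ (λ y → β′ x (π y))) ≡ B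
        πsum = ∑-cong (λ x → ∑-involution π inv (β′ x))
        s₁ : ∑ (λ x → ∑ (λ y → β′ x y + β′ x (π y))) ≡ B + B
        s₁ = trans (∑∑-+ _ _) (cong (B +_) πsum)
        s₂ : ∑ (λ x → ∑ (λ y → β′ y x + β′ y (π x))) ≡ B + B
        s₂ = trans (∑-swap _) s₁
        eq : ∀ b g → 2 * (b + b) + 2 * (b + b) + 4 * g ≡ 8 * b + 4 * g
        eq = solve-∀
      orbit-sum : ∑ (λ x → ∑ (orbit x)) ≡ 4 * #degIn
      orbit-sum = trans (∑∑-+ _ _) (trans (cong₂ _+_ (trans (∑∑-+ _ _) (cong (#degIn +_) (∑-involution π inv (λ x → ∑ (degIn x))))) (trans (∑∑-+ _ _) (cong₂ _+_ (∑-cong (λ x → ∑-involution π inv (degIn x))) (trans (∑-involution π inv (λ x → ∑ (λ y → degIn x (π y)))) (∑-cong (λ x → ∑-involution π inv (degIn x))))))) (eq #degIn))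
        where
        eq : ∀ s → (s + s) + (s + s) ≡ 4 * s
        eq = solve-∀
      total : 4 * #degIn ≤ 4 * (size U * size U) + (8 * B + 4 * Γ)
      total = subst₂ _≤_ orbit-sum (trans (∑∑-+ _ _) (cong₂ _+_ (trans (∑∑-*ˡ 4 _) (cong (4 *_) (trans (∑∑-cong (λ x y → ⟦∧⟧ (U x) (U y))) (∑-prod (λ x → ⟦ U x ⟧) (λ y → ⟦ U y ⟧))))) err-sum)) (∑∑-mono point)
      bad-sum : ∑ (λ x → ∑ (bad x)) ≡ 2 * #dtri D
      bad-sum = trans (∑-cong (λ x → ∑-cong (λ y → ∑-+ (λ w → ⟦ dtri D w x y ⟧) (λ w → ⟦ dtri D w y x ⟧)))) (trans (∑∑-+ _ _) (trans (cong₂ _+_ rot (trans (∑-swap _) rot)) (cong (#dtri D +_) (sym (+-identityʳ _)))))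
        where
        rot : ∑ (λ x → ∑ (λ y → ∑ (λ w → ⟦ dtri D w x y ⟧))) ≡ #dtri D
        rot = trans (∑-cong (λ x → ∑-swap _)) (∑-swap _)
      Γ-bound : 2 * E * Γ ≤ n * n
      Γ-bound = *-cancelˡ-≤ n {{>-nonZero n>0}} (begin
        n * (2 * E * Γ) ≡⟨ eq₁ n E Γ ⟩
        2 * E * (n * Γ) ≡⟨ cong (2 * E *_) (sym (∑∑-*ˡ n γ)) ⟩
        2 * E * ∑ (λ x → ∑ (λ y → n * γ x y)) ≤⟨ *-monoʳ-≤ (2 * E) (∑∑-mono γ-bound) ⟩
        2 * E * ∑ (λ x → ∑ (λ y → F₁ * bad x y)) ≡⟨ cong (2 * E *_) (trans (∑∑-*ˡ F₁ bad) (cong (F₁ *_) bad-sum)) ⟩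
        2 * E * (F₁ * (2 * #dtri D)) ≡⟨ eq₂ E (#dtri D) ⟩
        16 * (E * E) * #dtri D ≤⟨ few-dtri ⟩
        n * (n * n) ∎)
        where
        open ≤-Reasoning
        eq₁ : ∀ n E g → n * (2 * E * g) ≡ 2 * E * (n * g)
        eq₁ = solve-∀
        eq₂ : ∀ E t → 2 * E * (4 * E * (2 * t)) ≡ 16 * (E * E) * t
        eq₂ = solve-∀
      final : E * #degIn ≤ E * (size U * size U) + n * n
      final = *-cancelˡ-≤ 16 (lin 0 (+-mono-≤ (*-monoʳ-≤ (4 * E) total) (+-mono-≤ (*-monoʳ-≤ 8 B-bound) (*-monoʳ-≤ 8 Γ-bound))) (eq E #degIn (size U * size U) B Γ (n * n)))
        where
        eq : ∀ E s u b g N → 16 * (E * s) + (4 * E * (4 * u + (8 * b + 4 * g)) + (8 * N + 8 * N)) + 0 ≡ 16 * (E * u + N) + (4 * E * (4 * s) + (8 * (4 * E * b) + 8 * (2 * E * g)))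
        eq = solve-∀

floor : ∀ L n → 0 < L → ∃ λ q → L * q ≤ n × n < L * suc q
floor L zero L>0 = 0 , ≤-reflexive (*-zeroʳ L) , ≤-trans L>0 (≤-reflexive (sym (*-identityʳ L)))
floor L (suc n) L>0 with floor L n L>0
... | q , a , b with L * suc q ≤? suc n
... | yes p = suc q , p , ≤-trans (s≤s b) (≤-trans (+-monoˡ-≤ (L * suc q) L>0) (≤-reflexive (sym (*-suc L (suc q)))))
... | no ¬p = q , ≤-trans a (n≤1+n n) , ≰⇒> ¬p

subset : ∀ {n} (X : Fin n → Bool) m → m ≤ size X → ∃ λ (Y : Fin n → Bool) → size Y ≡ m × (∀ x → Y x ≡ true → X x ≡ true)
subset {n} X zero h = (λ _ → false) , ∑-zero n , λ _ ()
subset {zero} X (suc m) h = contradiction (≤-trans h (≤-reflexive (∑-empty _))) λ ()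
subset {suc n} X (suc m) h with X zero in e
... | true with subset (X ∘ suc) m (≤-pred (≤-trans h (≤-reflexive (trans (∑-suc _) (cong (λ b → ⟦ b ⟧ + size (X ∘ suc)) e)))))
... | Y , s , i = (λ { zero → true ; (suc x) → Y x }) , trans (∑-suc _) (cong suc s) , λ { zero _ → e ; (suc x) y → i x y }
subset {suc n} X (suc m) h | false with subset (X ∘ suc) (suc m) (≤-trans h (≤-reflexive (trans (∑-suc _) (cong (λ b → ⟦ b ⟧ + size (X ∘ suc)) e))))
... | Y , s , i = (λ { zero → false ; (suc x) → Y x }) , trans (∑-suc _) s , λ { zero () ; (suc x) y → i x y }

module _ {n} (D : Digraph n) where

  degree : Fin n → ℕ
  degree x = ∑ (deg D x)

  #deg : ℕ
  #deg = ∑ degree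

  deficit : Fin n → ℕ
  deficit x = n ∸ degree x

  #deficit : ℕ
  #deficit = ∑ deficit

  excess : Fin n → ℕ
  excess x = degree x ∸ n

  #excess : ℕ
  #excess = ∑ excess

  non : Fin n → Fin n → Bool
  non x y = not (D x y) ∧ not (D y x)

  tri : Fin n → Fin n → Fin n → Bool
  tri p q z = D p q ∧ (D q z ∧ D z p)

  #tri : ℕ
  #tri = ∑₃ (λ p q z → ⟦ tri p q z ⟧)

  -- Outside triangles w sends at most two edges to a double edge zx, and in a near-extremal digraph
  -- it usually sends two. Here at least one is lacking.
  exceptional : Fin n → Fin n → Fin n → Bool
  exceptional z x w = dbl D z x ∧ ((deg D w z + deg D w x) <ᵇ 2)

  #exceptional : ℕ
  #exceptional = ∑₃ (λ z x w → ⟦ exceptional z x w ⟧)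

  n≤degree+deficit : ∀ x → n ≤ degree x + deficit x
  n≤degree+deficit x = m≤n+m∸n n (degree x)

  deg-row-sym : ∀ x → ∑ (λ w → deg D w x) ≡ degree x
  deg-row-sym x = ∑-cong (λ w → +-comm ⟦ D w x ⟧ _)

  deg-total : ∀ E → 0 < n → Loopless D → 16 * (E * E) * #dtri D ≤ n * (n * n) → ∀ U → E * #degIn D U ≤ E * (size U * size U) + n * n
  deg-total E n>0 l h U = decidable-stable (_ ≤? _) (degIn-sum D U E n>0 l h)

  -- The degrees of z and x add up to 2n minus their deficits, while a vertex w contributes at most
  -- 2 unless it closes a triangle. Contributions below 2 must therefore be rare.
  #exceptional≤ : #exceptional ≤ 2 * (n * #deficit) + 4 * #dtri D
  #exceptional≤ = begin
    #exceptional ≤⟨ ∑∑-mono pair ⟩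
    ∑ (λ z → ∑ (λ x → deficit z + deficit x + 2 * closing z x)) ≡⟨ trans (∑∑-+ _ _) (cong₂ _+_ (trans (∑∑-+ _ _) (cong₂ _+_ (trans (∑-cong (λ z → ∑-const n (deficit z))) (∑-*ˡ n deficit)) (∑-const n #deficit))) (trans (∑∑-*ˡ 2 _) (cong (2 *_) bad-sum))) ⟩
    n * #deficit + n * #deficit + 2 * (2 * #dtri D) ≡⟨ eq (n * #deficit) (#dtri D) ⟩
    2 * (n * #deficit) + 4 * #dtri D ∎
    where
    open ≤-Reasoning
    U : Fin n → Bool
    U _ = true
    closing : Fin n → Fin n → ℕ
    closing z x = ∑ (λ w → ⟦ dtri D w z x ⟧ + ⟦ dtri D w x z ⟧)
    eq : ∀ a b → a + a + 2 * (2 * b) ≡ 2 * a + 4 * b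
    eq = solve-∀
    bad-sum : ∑ (λ x → ∑ (closing x)) ≡ 2 * #dtri D
    bad-sum = trans (∑-cong (λ x → ∑-cong (λ y → ∑-+ (λ w → ⟦ dtri D w x y ⟧) (λ w → ⟦ dtri D w y x ⟧)))) (trans (∑∑-+ _ _) (trans (cong₂ _+_ rot (trans (∑-swap _) rot)) (cong (#dtri D +_) (sym (+-identityʳ _)))))
      where
      rot : ∑ (λ x → ∑ (λ y → ∑ (λ w → ⟦ dtri D w x y ⟧))) ≡ #dtri D
      rot = trans (∑-cong (λ x → ∑-swap _)) (∑-swap _)
    small : ∀ s b → s ≤ 2 + 2 * b → ⟦ s <ᵇ 2 ⟧ + s ≤ 2 + 2 * b
    small zero b h = s≤s z≤n
    small (suc zero) b h = s≤s (s≤s z≤n)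
    small (suc (suc s)) b h = h
    pair : ∀ z x → ∑ (λ w → ⟦ exceptional z x w ⟧) ≤ deficit z + deficit x + 2 * closing z x
    pair z x = go (dbl D z x) refl
      where
      eq′ : ∀ s a b c d n t → s + ((2 * n + 2 * t) + ((a + c) + (b + d))) + 0 ≡ (c + d + 2 * t) + ((s + (a + b)) + (n + n))
      eq′ = solve-∀
      go : ∀ b → dbl D z x ≡ b → ∑ (λ w → ⟦ b ∧ ((deg D w z + deg D w x) <ᵇ 2) ⟧) ≤ deficit z + deficit x + 2 * closing z x
      go false e = ≤-trans (≤-reflexive (∑-zero n)) z≤n
      go true e = lin 0 (+-mono-≤ summed (+-mono-≤ (n≤degree+deficit z) (n≤degree+deficit x))) (eq′ (∑ (λ w → ⟦ (deg D w z + deg D w x) <ᵇ 2 ⟧)) (degree z) (degree x) (deficit z) (deficit x) n (closing z x))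
        where
        summed : ∑ (λ w → ⟦ (deg D w z + deg D w x) <ᵇ 2 ⟧) + (degree z + degree x) ≤ 2 * n + 2 * closing z x
        summed = subst₂ _≤_ (trans (∑-+ _ _) (cong (∑ (λ w → ⟦ (deg D w z + deg D w x) <ᵇ 2 ⟧) +_) (trans (∑-+ _ _) (cong₂ _+_ (deg-row-sym z) (deg-row-sym x))))) (trans (∑-+ _ _) (cong₂ _+_ (trans (∑-const n 2) (*-comm n 2)) (∑-*ˡ 2 _))) (∑-mono (λ w → small (deg D w z + deg D w x) (⟦ dtri D w z x ⟧ + ⟦ dtri D w x z ⟧) (β-bound D U z x w e)))

  -- If m vertices had degree below n - n / L, deleting them would remove so few edges that the
  -- remaining set U had degree sum above |U|² by more than `deg-total` allows. Hence fewer than m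
  -- vertices are that poor, and all others have deficit at most n / L.
  few-deficit : ∀ E → 0 < E → 2 * E ≤ n → Loopless D →
    (let K = 16 * (E * E) in 16 * (K * K) * #dtri D ≤ n * (n * n) → K * (n * n) ≤ K * #deg + n * n → E * #deficit ≤ n * n)
  few-deficit E E>0 n≥ l h₁ h₂ with floor (2 * E) n (*-mono-≤ {1} {2} (s≤s z≤n) E>0)
  ... | zero , _ , b = contradiction (≤-trans b (≤-reflexive (*-identityʳ (2 * E)))) (≤⇒≯ n≥)
  ... | m@(suc _) , Lm≤n , n< = result
    where
    L = 2 * E
    -- K = 4L². The comparison in `key` leaves K m ≤ 2 L n, and n < 2 L m makes the right side
    -- smaller than 4 L² m.
    K = 16 * (E * E)
    L>0 : 0 < L
    L>0 = *-mono-≤ {1} {2} (s≤s z≤n) E>0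
    n>0 : 0 < n
    n>0 = ≤-trans L>0 n≥
    low : Fin n → Bool
    low x = L * degree x + n <ᵇ L * n
    n<2Lm : n < 2 * (L * m)
    n<2Lm = ≤-trans n< (≤-trans (≤-reflexive (*-suc L m)) (≤-trans (+-monoˡ-≤ (L * m) (≤-trans (≤-reflexive (sym (*-identityʳ L))) (*-monoʳ-≤ L {1} {m} (s≤s z≤n)))) (≤-reflexive (cong (L * m +_) (sym (+-identityʳ (L * m)))))))
    impossible : ¬ m ≤ size low
    impossible le with subset low m le
    ... | Y , sY , Y⊆ = <⇒≱ gap (*-cancelʳ-≤ (K * m) (2 * L * n) n {{>-nonZero n>0}} key)
      where
      open ≤-Reasoning
      -- The complement of the m poor vertices; `split` counts every edge at a poor vertex at least
      -- once through its row or its column.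
      U : Fin n → Bool
      U x = not (Y x)
      u = size U
      d = ∑ (λ x → ⟦ Y x ⟧ * degree x)
      sizes : u + m ≡ n
      sizes = trans (cong (u +_) (sym sY)) (trans (sym (∑-+ _ _)) (trans (∑-cong (λ x → one (Y x))) (trans (∑-const n 1) (*-identityʳ n))))
        where
        one : ∀ b → ⟦ not b ⟧ + ⟦ b ⟧ ≡ 1
        one true = refl
        one false = refl
      low-sum : L * d + m * n ≤ m * (L * n)
      low-sum = subst₂ _≤_ (trans (∑-+ _ _) (cong₂ _+_ (∑-*ˡ L _) (trans (∑-*ʳ n _) (cong (_* n) sY)))) (trans (∑-*ʳ (L * n) _) (cong (_* (L * n)) sY)) (∑-mono point)
        where
        point : ∀ x → L * (⟦ Y x ⟧ * degree x) + ⟦ Y x ⟧ * n ≤ ⟦ Y x ⟧ * (L * n)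
        point x with Y x in e
        ... | false = ≤-trans (≤-reflexive (trans (+-identityʳ _) (*-zeroʳ L))) z≤n
        ... | true = subst₂ _≤_ (cong₂ (λ a b → L * a + b) (sym (+-identityʳ (degree x))) (sym (+-identityʳ n))) (sym (+-identityʳ (L * n))) (<⇒≤ (<ᵇ⇒< _ _ (Equivalence.from T-≡ (Y⊆ x e))))
      split : #deg ≤ #degIn D U + (d + d)
      split = ≤-trans (∑∑-mono point) (≤-reflexive (trans (∑∑-+ _ _) (cong (#degIn D U +_) (trans (∑∑-+ _ _) (cong₂ _+_ rows (trans (∑-swap _) (trans (∑∑-cong (λ y x → cong (⟦ Y y ⟧ *_) (+-comm ⟦ D x y ⟧ ⟦ D y x ⟧))) rows)))))))
        where
        rows : ∑ (λ x → ∑ (λ y → ⟦ Y x ⟧ * deg D x y)) ≡ d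
        rows = ∑-cong (λ x → ∑-*ˡ ⟦ Y x ⟧ (deg D x))
        cover : ∀ a b s → s ≤ ⟦ not a ∧ not b ⟧ * s + (⟦ a ⟧ * s + ⟦ b ⟧ * s)
        cover true b s = ≤-trans (≤-reflexive (sym (+-identityʳ s))) (m≤m+n _ _)
        cover false true s = ≤-reflexive (sym (+-identityʳ s))
        cover false false s = ≤-reflexive (sym (trans (+-identityʳ (s + 0)) (+-identityʳ s)))
        point : ∀ x y → deg D x y ≤ degIn D U x y + (⟦ Y x ⟧ * deg D x y + ⟦ Y y ⟧ * deg D x y)
        point x y = cover (Y x) (Y y) (deg D x y)
      inside : K * #degIn D U ≤ K * (u * u) + n * n
      inside = deg-total K n>0 l h₁ U
      key : K * m * n ≤ 2 * L * n * n
      key = lin 0 (+-mono-≤ (+-mono-≤ (+-mono-≤ (*-monoʳ-≤ L h₂) (*-monoʳ-≤ (L * K) split)) (*-monoʳ-≤ L inside)) (+-mono-≤ (*-monoʳ-≤ (2 * K) low-sum) (*-monoʳ-≤ (K * m) Lm≤n)))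
              (subst (λ n → K * m * n + (((L * (K * #deg + n * n) + L * K * (#degIn D U + (d + d))) + L * (K * (u * u) + n * n)) + (2 * K * (m * (L * n)) + K * m * n)) + 0 ≡ 2 * L * n * n + (((L * (K * (n * n)) + L * K * #deg) + L * (K * #degIn D U)) + (2 * K * (L * d + m * n) + K * m * (L * m)))) sizes (eq L K #deg (#degIn D U) d u m))
        where
        eq : ∀ L K S I d u m → K * m * (u + m) + (((L * (K * S + (u + m) * (u + m)) + L * K * (I + (d + d))) + L * (K * (u * u) + (u + m) * (u + m))) + (2 * K * (m * (L * (u + m))) + K * m * (u + m))) + 0 ≡ 2 * L * (u + m) * (u + m) + (((L * (K * ((u + m) * (u + m))) + L * K * S) + L * (K * I)) + (2 * K * (L * d + m * (u + m)) + K * m * (L * m)))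
        eq = solve-∀
      gap : 2 * L * n < K * m
      gap = ≤-trans (*-monoʳ-< (2 * L) {{>-nonZero (*-mono-≤ {1} {2} (s≤s z≤n) L>0)}} n<2Lm) (≤-reflexive (eq E m))
        where
        eq : ∀ E m → 2 * (2 * E) * (2 * (2 * E * m)) ≡ 16 * (E * E) * m
        eq = solve-∀
    low-small : L * size low ≤ n
    low-small = ≤-trans (*-monoʳ-≤ L (<⇒≤ (≰⇒> impossible))) Lm≤n
    result : E * #deficit ≤ n * n
    result = *-cancelˡ-≤ 2 (begin
      2 * (E * #deficit) ≡⟨ trans (sym (*-assoc 2 E #deficit)) (sym (∑-*ˡ L deficit)) ⟩
      ∑ (λ x → L * deficit x) ≤⟨ ∑-mono point ⟩
      ∑ (λ x → L * n * ⟦ low x ⟧ + n) ≡⟨ trans (∑-+ _ _) (cong₂ _+_ (∑-*ˡ (L * n) _) (∑-const n n)) ⟩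
      L * n * size low + n * n ≤⟨ +-monoˡ-≤ (n * n) (≤-trans (≤-reflexive (eq L n (size low))) (*-monoʳ-≤ n low-small)) ⟩
      n * n + n * n ≡⟨ cong (n * n +_) (sym (+-identityʳ (n * n))) ⟩
      2 * (n * n) ∎)
      where
      open ≤-Reasoning
      eq : ∀ L n s → L * n * s ≡ n * (L * s)
      eq = solve-∀
      point : ∀ x → L * deficit x ≤ L * n * ⟦ low x ⟧ + n
      point x with L * degree x + n <ᵇ L * n in e
      ... | true = ≤-trans (*-monoʳ-≤ L (m∸n≤m n (degree x))) (≤-trans (≤-reflexive (sym (*-identityʳ (L * n)))) (m≤m+n _ n))
      ... | false = ≤-trans (≤-reflexive (*-distribˡ-∸ L n (degree x))) (≤-trans (m≤n+o⇒m∸n≤o (L * n) (L * degree x) (≮⇒≥ (λ lt → subst T e (<⇒<ᵇ lt)))) (m≤n+m n _))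

-- Directed triangles

∑₄ : ∀ {n} → (Fin n → Fin n → Fin n → Fin n → ℕ) → ℕ
∑₄ f = ∑ (λ x → ∑₃ (f x))

∑₃-mono : ∀ {n} {f g : Fin n → Fin n → Fin n → ℕ} → (∀ x y z → f x y z ≤ g x y z) → ∑₃ f ≤ ∑₃ g
∑₃-mono h = ∑-mono (λ x → ∑∑-mono (h x))

∑₃-cong : ∀ {n} {f g : Fin n → Fin n → Fin n → ℕ} → (∀ x y z → f x y z ≡ g x y z) → ∑₃ f ≡ ∑₃ g
∑₃-cong h = ∑-cong (λ x → ∑∑-cong (h x))

∑₃-+ : ∀ {n} (f g : Fin n → Fin n → Fin n → ℕ) → ∑₃ (λ x y z → f x y z + g x y z) ≡ ∑₃ f + ∑₃ g
∑₃-+ f g = trans (∑-cong (λ x → ∑∑-+ (f x) (g x))) (∑-+ _ _)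

∑₄-mono : ∀ {n} {f g : Fin n → Fin n → Fin n → Fin n → ℕ} → (∀ x y z w → f x y z w ≤ g x y z w) → ∑₄ f ≤ ∑₄ g
∑₄-mono h = ∑-mono (λ x → ∑₃-mono (h x))

∑₄-+ : ∀ {n} (f g : Fin n → Fin n → Fin n → Fin n → ℕ) → ∑₄ (λ x y z w → f x y z w + g x y z w) ≡ ∑₄ f + ∑₄ g
∑₄-+ f g = trans (∑-cong (λ x → ∑₃-+ (f x) (g x))) (∑-+ _ _)

rotate₃ : ∀ {n} (f : Fin n → Fin n → Fin n → ℕ) → ∑₃ (λ x y z → f y z x) ≡ ∑₃ f
rotate₃ f = trans (∑-swap _) (∑-cong (λ y → ∑-swap _))

swap₃ : ∀ {n} (f : Fin n → Fin n → Fin n → ℕ) → ∑₃ (λ x y z → f x z y) ≡ ∑₃ f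
swap₃ f = ∑-cong (λ x → ∑-swap _)

free₁ : ∀ {n} (f : Fin n → Fin n → Fin n → ℕ) → ∑₄ (λ _ x y z → f x y z) ≡ n * ∑₃ f
free₁ {n} f = ∑-const n (∑₃ f)

free₄ : ∀ {n} (f : Fin n → Fin n → Fin n → ℕ) → ∑₄ (λ x y z _ → f x y z) ≡ n * ∑₃ f
free₄ {n} f = trans (∑₃-cong (λ x y z → ∑-const n (f x y z))) (trans (∑-cong (λ x → ∑∑-*ˡ n (f x))) (∑-*ˡ n _))

free₃ : ∀ {n} (f : Fin n → Fin n → Fin n → ℕ) → ∑₄ (λ x y _ w → f x y w) ≡ n * ∑₃ f
free₃ {n} f = trans (∑-cong (λ x → ∑-cong (λ y → ∑-swap _))) (free₄ f)

free₂ : ∀ {n} (f : Fin n → Fin n → Fin n → ℕ) → ∑₄ (λ x _ z w → f x z w) ≡ n * ∑₃ f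
free₂ {n} f = trans (∑-cong (λ x → ∑-const n _)) (∑-*ˡ n _)

≤-part₁ : ∀ {a b} x {N} → (a + b) * x ≤ N → a * x ≤ N
≤-part₁ {a} {b} x h = ≤-trans (*-monoˡ-≤ x (m≤m+n a b)) h

≤-part₂ : ∀ {a b} x {N} → (a + b) * x ≤ N → b * x ≤ N
≤-part₂ {a} {b} x h = ≤-trans (*-monoˡ-≤ x (m≤n+m b a)) h

-- With an edge into w from both ends of every edge of C, an alternating walk may stop on either
-- side, so its length can have any parity.
alt-sym≤pow : ∀ {n} (D : Digraph n) w j (C : Kernel n) → (∀ u v → C u v ≤ ⟦ D u v ⟧ * ⟦ D v w ⟧) → (∀ u v → C u v ≤ ⟦ D v u ⟧ * ⟦ D u w ⟧) →
  ∀ u → alt C (suc j) u ≤ pow ⟪ D ⟫ (2 + j) u w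
alt-sym≤pow D w zero C f b u = ∑-mono (λ v → ≤-trans (≤-reflexive (*-identityʳ (C u v))) (≤-trans (f u v) (*-monoʳ-≤ ⟦ D u v ⟧ (≤-reflexive (sym (·-δ ⟪ D ⟫ v w))))))
alt-sym≤pow D w (suc j) C f b u = ∑-mono (λ v → *-mono-≤ (≤-trans (f u v) (≤-trans (*-monoʳ-≤ ⟦ D u v ⟧ (⟦⟧≤1 (D v w))) (≤-reflexive (*-identityʳ ⟦ D u v ⟧)))) (alt-sym≤pow D w j (C ᵀ) (λ x y → b y x) (λ x y → f y x) v))

module _ {n} (D : Digraph n) where

  through : Fin n → Fin n → Fin n → Bool
  through p q z = D q z ∧ D z p

  -- Two directed triangles over the same edge pq whose third vertices z and x are joined by a
  -- double edge. A walk can go back and forth between such vertices before it returns to p.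
  diamond : Fin n → Fin n → Fin n → Fin n → Bool
  diamond p q z x = D p q ∧ (((D q z ∧ D z p) ∧ (D q x ∧ D x p)) ∧ dbl D z x)

  #diamond : ℕ
  #diamond = ∑₄ (λ p q z x → ⟦ diamond p q z x ⟧)

  -- For a pair pq with many diamonds the double edges between third vertices form a dense graph.
  -- Its alternating walks, preceded by p, q and followed by the edge into p, are closed walks of
  -- length 4 + j.
  diamond-closed : ∀ E j → 0 < n → n * (n * (n * n)) ≤ E * #diamond → n ^ (4 + j) ≤ 2 * E * (2 * (2 * E) * (2 * (2 * E)) ^ (2 ^ suc j)) * tr (pow ⟪ D ⟫ (4 + j))
  diamond-closed E j n>0 h = ≤-trans
    (rich-average E (n * (n * n)) (n ^ (3 + j)) (λ p → ∑₃ (λ q z x → ⟦ diamond p q z x ⟧)) (λ p → K * ∑ (walks p)) (*-mono-≤ n>0 (*-mono-≤ n>0 n>0))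
      (λ p → ∑-bound (λ q → pairs p q)) h
      (λ p rp → ≤-trans (rich-average (2 * E) (n * n) (n ^ (2 + j)) (λ q → ∑ (λ z → ∑ (λ x → ⟦ diamond p q z x ⟧))) (λ q → P * walks p q) (*-mono-≤ n>0 n>0) (pairs p) rp (rich p))
        (≤-reflexive (trans (cong (2 * (2 * E) *_) (∑-*ˡ P (walks p))) (sym (*-assoc (2 * (2 * E)) P _))))))
    (≤-reflexive (trans (cong (2 * E *_) (∑-*ˡ K (λ p → ∑ (walks p)))) (sym (*-assoc (2 * E) K _))))
    where
    P = (2 * (2 * E)) ^ (2 ^ suc j)
    K = 2 * (2 * E) * P
    walks : Fin n → Fin n → ℕ
    walks p q = ⟦ D p q ⟧ * ∑ (λ z → ⟦ D q z ⟧ * pow ⟪ D ⟫ (2 + j) z p)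
    pairs : ∀ p q → ∑ (λ z → ∑ (λ x → ⟦ diamond p q z x ⟧)) ≤ n * n
    pairs p q = ∑-bound (λ z → ∑-⟦⟧≤ (λ x → diamond p q z x))
    rich : ∀ p q → n * n ≤ 2 * (2 * E) * ∑ (λ z → ∑ (λ x → ⟦ diamond p q z x ⟧)) → n ^ (2 + j) ≤ P * walks p q
    rich p q d = ≤-trans (alt-lower (2 * (2 * E)) n>0 C (λ z x → ⟦⟧≤1 _) d (suc j)) (*-monoʳ-≤ P total)
      where
      C : Kernel n
      C z x = ⟦ diamond p q z x ⟧
      total : ∑ (alt C (suc j)) ≤ walks p q
      total = ≤-trans (∑-mono point) (≤-reflexive (∑-*ˡ ⟦ D p q ⟧ _))
        where
        f₁ : ∀ a b c d e f g → T (⟦ a ∧ (((b ∧ c) ∧ (d ∧ e)) ∧ (f ∧ g)) ⟧ ≤ᵇ ⟦ f ⟧ * ⟦ e ⟧)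
        f₁ = taut 7 (λ a b c d e f g → ⟦ a ∧ (((b ∧ c) ∧ (d ∧ e)) ∧ (f ∧ g)) ⟧ ≤ᵇ ⟦ f ⟧ * ⟦ e ⟧) tt
        f₂ : ∀ a b c d e f g → T (⟦ a ∧ (((b ∧ c) ∧ (d ∧ e)) ∧ (f ∧ g)) ⟧ ≤ᵇ ⟦ g ⟧ * ⟦ c ⟧)
        f₂ = taut 7 (λ a b c d e f g → ⟦ a ∧ (((b ∧ c) ∧ (d ∧ e)) ∧ (f ∧ g)) ⟧ ≤ᵇ ⟦ g ⟧ * ⟦ c ⟧) tt
        f₃ : ∀ a b c d e f g → T (⟦ a ∧ (((b ∧ c) ∧ (d ∧ e)) ∧ (f ∧ g)) ⟧ ≤ᵇ ⟦ a ∧ b ⟧)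
        f₃ = taut 7 (λ a b c d e f g → ⟦ a ∧ (((b ∧ c) ∧ (d ∧ e)) ∧ (f ∧ g)) ⟧ ≤ᵇ ⟦ a ∧ b ⟧) tt
        point : ∀ z → alt C (suc j) z ≤ ⟦ D p q ⟧ * (⟦ D q z ⟧ * pow ⟪ D ⟫ (2 + j) z p)
        point z = ≤-trans (alt-start (λ _ z → D p q ∧ D q z) z C (λ z → pow ⟪ D ⟫ (2 + j) z p) j
            (λ z x → leq (f₃ (D p q) (D q z) (D z p) (D q x) (D x p) (D z x) (D x z)))
            (alt-sym≤pow D p j C (λ z x → leq (f₁ (D p q) (D q z) (D z p) (D q x) (D x p) (D z x) (D x z))) (λ z x → leq (f₂ (D p q) (D q z) (D z p) (D q x) (D x p) (D z x) (D x z)))) z)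
          (≤-reflexive (trans (cong (_* pow ⟪ D ⟫ (2 + j) z p) (⟦∧⟧ (D p q) (D q z))) (*-assoc ⟦ D p q ⟧ _ _)))

  -- Let z be a vertex of a directed triangle p q z with no double edge at z to p or q. If zx is
  -- double and not exceptional, both q and p must be adjacent to x, and an orientation other than q
  -- → x → p would put zx in a triangle. So p q z x is a diamond.
  tri-dbl : ∀ p q z x → ⟦ tri D p q z ∧ dbl D z x ⟧ ≤ ⟦ diamond p q z x ⟧ + (((⟦ dtri D p q z ⟧ + ⟦ dtri D q z p ⟧) + (⟦ exceptional D z x q ⟧ + ⟦ exceptional D z x p ⟧)) + (⟦ dtri D q z x ⟧ + ⟦ dtri D p x z ⟧))
  tri-dbl p q z x = go (D p q) (D q z) (D z p) (D z x) (D x z) (D z q) (D p z) (D q x) (D x q) (D p x) (D x p)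
    where
    go : ∀ pq qz zp zx xz zq pz qx xq px xp → ⟦ (pq ∧ (qz ∧ zp)) ∧ (zx ∧ xz) ⟧ ≤ ⟦ pq ∧ (((qz ∧ zp) ∧ (qx ∧ xp)) ∧ (zx ∧ xz)) ⟧ + (((⟦ (pq ∧ zp) ∧ (qz ∧ zq) ⟧ + ⟦ (qz ∧ pq) ∧ (zp ∧ pz) ⟧) + (⟦ (zx ∧ xz) ∧ (((⟦ qz ⟧ + ⟦ zq ⟧) + (⟦ qx ⟧ + ⟦ xq ⟧)) <ᵇ 2) ⟧ + ⟦ (zx ∧ xz) ∧ (((⟦ pz ⟧ + ⟦ zp ⟧) + (⟦ px ⟧ + ⟦ xp ⟧)) <ᵇ 2) ⟧)) + (⟦ (qz ∧ xq) ∧ (zx ∧ xz) ⟧ + ⟦ (px ∧ zp) ∧ (xz ∧ zx) ⟧))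
    go false qz zp zx xz zq pz qx xq px xp = z≤n
    go true false zp zx xz zq pz qx xq px xp = z≤n
    go true true false zx xz zq pz qx xq px xp = z≤n
    go true true true false xz zq pz qx xq px xp = z≤n
    go true true true true false zq pz qx xq px xp = z≤n
    go true true true true true zq pz qx xq px xp = leq (taut 6 (λ zq pz qx xq px xp → 1 ≤ᵇ ⟦ (qx ∧ xp) ∧ true ⟧ + (((⟦ zq ⟧ + ⟦ pz ⟧) + (⟦ (((1 + ⟦ zq ⟧) + (⟦ qx ⟧ + ⟦ xq ⟧)) <ᵇ 2) ⟧ + ⟦ (((⟦ pz ⟧ + 1) + (⟦ px ⟧ + ⟦ xp ⟧)) <ᵇ 2) ⟧)) + (⟦ xq ∧ true ⟧ + ⟦ (px ∧ true) ∧ true ⟧))) tt zq pz qx xq px xp)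

  nbrs : Fin n → ℕ
  nbrs z = ∑ (λ x → ⟦ dbl D z x ⟧)

  strangers : Fin n → ℕ
  strangers z = ∑ (λ x → ⟦ non D z x ⟧)

  degree-balance : ∀ z → degree D z + strangers z ≡ n + nbrs z
  degree-balance z = trans (sym (∑-+ _ _)) (trans (∑-cong (λ x → point (D z x) (D x z))) (trans (∑-+ _ _) (cong (_+ nbrs z) (trans (∑-const n 1) (*-identityʳ n)))))
    where
    point : ∀ a b → (⟦ a ⟧ + ⟦ b ⟧) + ⟦ not a ∧ not b ⟧ ≡ 1 + ⟦ a ∧ b ⟧
    point true true = refl
    point true false = refl
    point false true = refl
    point false false = refl

  -- A vertex that lacks neighbours must make up for them by double edges, unless its degree falls
  -- short of n.
  strangers≤ : ∀ z → strangers z ≤ nbrs z + deficit D z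
  strangers≤ z = lin 0 (+-mono-≤ (≤-reflexive (degree-balance z)) (n≤degree+deficit D z)) (eq (strangers z) (nbrs z) (deficit D z) (degree D z) n)
    where
    eq : ∀ s b d g n → s + ((n + b) + (g + d)) + 0 ≡ (b + d) + ((g + s) + n)
    eq = solve-∀

  #tri-nbrs : ℕ
  #tri-nbrs = ∑₃ (λ p q z → ⟦ tri D p q z ⟧ * nbrs z)

  #tri-strangers : ℕ
  #tri-strangers = ∑₃ (λ p q z → ⟦ tri D p q z ⟧ * strangers z)

  tri-nbrs≤ : #tri-nbrs ≤ #diamond + (4 * (n * #dtri D) + 2 * (n * #exceptional D))
  tri-nbrs≤ = begin
    #tri-nbrs ≡⟨ ∑₃-cong (λ p q z → trans (sym (∑-*ˡ ⟦ tri D p q z ⟧ _)) (∑-cong (λ x → sym (⟦∧⟧ (tri D p q z) (dbl D z x))))) ⟩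
    ∑₄ (λ p q z x → ⟦ tri D p q z ∧ dbl D z x ⟧) ≤⟨ ∑₄-mono tri-dbl ⟩
    ∑₄ (λ p q z x → ⟦ diamond p q z x ⟧ + (((⟦ dtri D p q z ⟧ + ⟦ dtri D q z p ⟧) + (⟦ exceptional D z x q ⟧ + ⟦ exceptional D z x p ⟧)) + (⟦ dtri D q z x ⟧ + ⟦ dtri D p x z ⟧)))
      ≡⟨ trans (∑₄-+ _ _) (cong (#diamond +_) (trans (∑₄-+ _ _) (cong₂ _+_ (trans (∑₄-+ _ _) (cong₂ _+_ (trans (∑₄-+ _ _) (cong₂ _+_ (free₄ t) (trans (free₄ (λ p q z → t q z p)) (cong (n *_) (rotate₃ t))))) (trans (∑₄-+ _ _) (cong₂ _+_ (trans (free₁ (λ q z x → e z x q)) (cong (n *_) (rotate₃ e))) (trans (free₂ (λ p z x → e z x p)) (cong (n *_) (rotate₃ e))))))) (trans (∑₄-+ _ _) (cong₂ _+_ (free₁ t) (trans (free₂ (λ p z x → t p x z)) (cong (n *_) (swap₃ t)))))))) ⟩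
    #diamond + (((n * #dtri D + n * #dtri D) + (n * #exceptional D + n * #exceptional D)) + (n * #dtri D + n * #dtri D)) ≡⟨ cong (#diamond +_) (eq (n * #dtri D) (n * #exceptional D)) ⟩
    #diamond + (4 * (n * #dtri D) + 2 * (n * #exceptional D)) ∎
    where
    open ≤-Reasoning
    t : Fin n → Fin n → Fin n → ℕ
    t w u v = ⟦ dtri D w u v ⟧
    e : Fin n → Fin n → Fin n → ℕ
    e z x w = ⟦ exceptional D z x w ⟧
    eq : ∀ a b → ((a + a) + (b + b)) + (a + a) ≡ 4 * a + 2 * b
    eq = solve-∀

  -- By `strangers≤` the strangers of z are outnumbered by its double neighbours, up to the deficit,
  -- and most double neighbours of a triangle vertex give diamonds.
  tri-strangers≤ : #tri-strangers ≤ #diamond + (12 * (n * #dtri D) + 5 * (n * (n * #deficit D)))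
  tri-strangers≤ = begin
    #tri-strangers ≤⟨ ∑₃-mono (λ p q z → point ⟦ tri D p q z ⟧ (⟦⟧≤1 (tri D p q z)) z) ⟩
    ∑₃ (λ p q z → ⟦ tri D p q z ⟧ * nbrs z + deficit D z) ≡⟨ trans (∑₃-+ _ _) (cong (#tri-nbrs +_) (trans (∑-const n _) (cong (n *_) (∑-const n _)))) ⟩
    #tri-nbrs + n * (n * #deficit D) ≤⟨ +-monoˡ-≤ _ tri-nbrs≤ ⟩
    #diamond + (4 * (n * #dtri D) + 2 * (n * #exceptional D)) + n * (n * #deficit D) ≤⟨ +-monoˡ-≤ _ (+-monoʳ-≤ #diamond (+-monoʳ-≤ (4 * (n * #dtri D)) (*-monoʳ-≤ 2 (*-monoʳ-≤ n (#exceptional≤ D))))) ⟩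
    #diamond + (4 * (n * #dtri D) + 2 * (n * (2 * (n * #deficit D) + 4 * #dtri D))) + n * (n * #deficit D) ≡⟨ eq #diamond n (#dtri D) (#deficit D) ⟩
    #diamond + (12 * (n * #dtri D) + 5 * (n * (n * #deficit D))) ∎
    where
    open ≤-Reasoning
    point : ∀ b → b ≤ 1 → ∀ z → b * strangers z ≤ b * nbrs z + deficit D z
    point b b≤1 z = ≤-trans (*-monoʳ-≤ b (strangers≤ z)) (≤-trans (≤-reflexive (*-distribˡ-+ b (nbrs z) (deficit D z))) (+-monoʳ-≤ (b * nbrs z) (≤-trans (*-monoˡ-≤ (deficit D z) b≤1) (≤-reflexive (+-identityʳ _)))))
    eq : ∀ a n t d → a + (4 * (n * t) + 2 * (n * (2 * (n * d) + 4 * t))) + n * (n * d) ≡ a + (12 * (n * t) + 5 * (n * (n * d)))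
    eq = solve-∀

-- The constants of `semicomplete-walks`: a set of density 1/A contains vertices whose
-- out-neighbourhood in the set has density 1 / (8A²).
sparsity growth : ℕ → ℕ → ℕ
sparsity zero A = 0
sparsity (suc j) A = 2 * (A * A) + sparsity j (2 * (4 * (A * A)))
growth zero A = A
growth (suc j) A = 2 * (4 * (A * A)) * growth j (2 * (4 * (A * A)))

module _ {n} (D : Digraph n) where

  gaps : (Fin n → Bool) → ℕ
  gaps Z = ∑ (λ z → ∑ (λ y → ⟦ (Z z ∧ Z y) ∧ non D z y ⟧))

  -- If almost all pairs of Z are adjacent, the out-degrees inside Z average about |Z| / 2. Many
  -- vertices thus have a large out-neighbourhood in Z, to which the induction applies since it is
  -- again a subset of Z with few gaps. The last vertex of the walk lies in Z and so has its edge to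
  -- p.
  semicomplete-walks : 0 < n → ∀ p j A (Z : Fin n → Bool) → (∀ z → Z z ≡ true → D z p ≡ true) → n ≤ A * size Z → sparsity j A * gaps Z ≤ n * n →
    n ^ suc j ≤ growth j A * ∑ (λ z → ⟦ Z z ⟧ * pow ⟪ D ⟫ (suc j) z p)
  semicomplete-walks n>0 p zero A Z Zp h g = ≤-trans (≤-reflexive (*-identityʳ n)) (≤-trans h (*-monoʳ-≤ A (∑-mono point)))
    where
    point : ∀ z → ⟦ Z z ⟧ ≤ ⟦ Z z ⟧ * (⟪ D ⟫ · δ) z p
    point z with Z z in e
    ... | false = z≤n
    ... | true = ≤-reflexive (sym (trans (+-identityʳ _) (trans (·-δ ⟪ D ⟫ z p) (cong ⟦_⟧ (Zp z e)))))
  semicomplete-walks n>0 p (suc j) A Z Zp h g = ≤-trans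
    (rich-average (4 * (A * A)) n (n ^ suc j) f (λ z → C * w z) n>0 f≤n dense rich)
    (≤-reflexive (trans (cong (A′ *_) (∑-*ˡ C w)) (sym (*-assoc A′ C _))))
    where
    A′ = 2 * (4 * (A * A))
    C = growth j A′
    w : Fin n → ℕ
    w z = ⟦ Z z ⟧ * ∑ (λ y → ⟦ D z y ⟧ * pow ⟪ D ⟫ (suc j) y p)
    Out : Fin n → Fin n → Bool
    Out z y = Z y ∧ D z y
    f : Fin n → ℕ
    f z = ⟦ Z z ⟧ * size (Out z)
    f≤n : ∀ z → f z ≤ n
    f≤n z = ≤-trans (*-mono-≤ (⟦⟧≤1 (Z z)) (∑-⟦⟧≤ (Out z))) (≤-reflexive (+-identityʳ n))
    square : size Z * size Z ≤ ∑ f + ∑ f + gaps Z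
    square = ≤-trans (≤-reflexive (sym (∑-prod (λ z → ⟦ Z z ⟧) (λ z → ⟦ Z z ⟧)))) (≤-trans (∑∑-mono point) (≤-reflexive (trans (∑∑-+ _ _) (cong (_+ gaps Z) (trans (∑∑-+ _ _) (cong₂ _+_ rows (trans (∑-swap _) rows)))))))
      where
      rows : ∑ (λ z → ∑ (λ y → ⟦ Z z ⟧ * ⟦ Out z y ⟧)) ≡ ∑ f
      rows = ∑-cong (λ z → ∑-*ˡ ⟦ Z z ⟧ _)
      point : ∀ z y → ⟦ Z z ⟧ * ⟦ Z y ⟧ ≤ ⟦ Z z ⟧ * ⟦ Z y ∧ D z y ⟧ + ⟦ Z y ⟧ * ⟦ Z z ∧ D y z ⟧ + ⟦ (Z z ∧ Z y) ∧ non D z y ⟧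
      point z y = leq (taut 4 (λ a b c d → ⟦ a ⟧ * ⟦ b ⟧ ≤ᵇ ⟦ a ⟧ * ⟦ b ∧ c ⟧ + ⟦ b ⟧ * ⟦ a ∧ d ⟧ + ⟦ (a ∧ b) ∧ (not c ∧ not d) ⟧) tt (Z z) (Z y) (D z y) (D y z))
    dense : n * n ≤ 4 * (A * A) * ∑ f
    dense = lin 0 (+-mono-≤ (+-mono-≤ (*-monoʳ-≤ 2 (*-mono-≤ h h)) (*-monoʳ-≤ (2 * (A * A)) square)) (≤-part₁ {2 * (A * A)} {sparsity j A′} (gaps Z) g)) (eq A n (size Z) (∑ f) (gaps Z))
      where
      eq : ∀ A n s f g → n * n + (2 * (A * s * (A * s)) + 2 * (A * A) * (f + f + g) + n * n) + 0 ≡ 4 * (A * A) * f + (2 * (n * n) + 2 * (A * A) * (s * s) + 2 * (A * A) * g)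
      eq = solve-∀
    rich : ∀ z → n ≤ A′ * f z → n ^ suc j ≤ C * w z
    rich z r = go (Z z) refl r
      where
      go : ∀ b → Z z ≡ b → n ≤ A′ * (⟦ b ⟧ * size (Out z)) → n ^ suc j ≤ C * (⟦ b ⟧ * ∑ (λ y → ⟦ D z y ⟧ * pow ⟪ D ⟫ (suc j) y p))
      go false e r = contradiction (≤-trans n>0 (≤-trans r (≤-reflexive (*-zeroʳ A′)))) λ ()
      go true e r = ≤-trans (semicomplete-walks n>0 p j A′ (Out z) (λ y o → Zp y (fst o)) (≤-trans r (*-monoʳ-≤ A′ (≤-reflexive (+-identityʳ _))))
          (≤-trans (*-monoʳ-≤ (sparsity j A′) (∑∑-mono mono)) (≤-part₂ {2 * (A * A)} (gaps Z) g)))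
        (*-monoʳ-≤ C (≤-trans (∑-mono (λ y → *-monoˡ-≤ (pow ⟪ D ⟫ (suc j) y p) (leq {⟦ Z y ∧ D z y ⟧} {⟦ D z y ⟧} (taut 2 (λ a b → ⟦ a ∧ b ⟧ ≤ᵇ ⟦ b ⟧) tt (Z y) (D z y))))) (≤-reflexive (sym (+-identityʳ _)))))
        where
        fst : ∀ {a b} → a ∧ b ≡ true → a ≡ true
        fst {true} _ = refl
        mono : ∀ x y → ⟦ (Out z x ∧ Out z y) ∧ non D x y ⟧ ≤ ⟦ (Z x ∧ Z y) ∧ non D x y ⟧
        mono x y = leq (taut 5 (λ a b c d e → ⟦ ((a ∧ b) ∧ (c ∧ d)) ∧ e ⟧ ≤ᵇ ⟦ (a ∧ c) ∧ e ⟧) tt (Z x) (D z x) (Z y) (D z y) (non D x y))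

  module _ (E B j : ℕ) (n>0 : 0 < n) where

    private
      A = 2 * (2 * (2 * E))
      C = growth (suc j) A

    -- The third vertices z of the triangles over an edge pq form a set with few gaps, apart from
    -- rare pairs pq. Walks inside this set, preceded by p → q → z and followed by an edge into p,
    -- are closed walks of length 4 + j.
    tri-closed : B ≡ sparsity (suc j) A → 2 * E * B * #tri-strangers D ≤ n * (n * (n * n)) → n * (n * n) ≤ E * #tri D →
      n ^ (4 + j) ≤ 2 * (2 * E) * (A * C) * tr (pow ⟪ D ⟫ (4 + j))
    tri-closed B≡ V h = ≤-trans
      (rich-average (2 * E) (n * n) (n ^ (3 + j)) (λ p → ∑ (f p)) (λ p → A * C * ∑ (walks p)) (*-mono-≤ n>0 n>0) (λ p → ∑-bound (f≤ p)) dense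
        (λ p rp → ≤-trans (rich-average (2 * (2 * E)) n (n ^ (2 + j)) (f p) (λ q → C * walks p q) n>0 (f≤ p) rp (rich p)) (≤-reflexive (trans (cong (A *_) (∑-*ˡ C (walks p))) (sym (*-assoc A C _))))))
      (≤-reflexive (trans (cong (2 * (2 * E) *_) (∑-*ˡ (A * C) (λ p → ∑ (walks p)))) (sym (*-assoc (2 * (2 * E)) (A * C) _))))
      where
      walks : Fin n → Fin n → ℕ
      walks p q = ⟦ D p q ⟧ * ∑ (λ z → ⟦ D q z ⟧ * pow ⟪ D ⟫ (2 + j) z p)
      ν : Fin n → Fin n → ℕ
      ν p q = ∑ (λ z → ⟦ tri D p q z ⟧ * strangers D z)
      -- Pairs whose triangle vertices have too many strangers in total; by Markov's inequality they
      -- carry at most half of the triangles.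
      heavy : Fin n → Fin n → Bool
      heavy p q = n * n <ᵇ B * ν p q
      f : Fin n → Fin n → ℕ
      f p q = ⟦ not (heavy p q) ⟧ * size (tri D p q)
      f≤ : ∀ p q → f p q ≤ n
      f≤ p q = ≤-trans (*-mono-≤ (⟦⟧≤1 (not (heavy p q))) (∑-⟦⟧≤ (tri D p q))) (≤-reflexive (+-identityʳ n))
      b = ∑ (λ p → ∑ (λ q → ⟦ heavy p q ⟧))
      X = ∑ (λ p → ∑ (f p))
      split : #tri D ≤ X + n * b
      split = ≤-trans (∑∑-mono (λ p q → point (heavy p q) (size (tri D p q)) (∑-⟦⟧≤ (tri D p q)))) (≤-reflexive (trans (∑∑-+ _ _) (cong (X +_) (∑∑-*ˡ n _))))
        where
        point : ∀ c s → s ≤ n → s ≤ ⟦ not c ⟧ * s + n * ⟦ c ⟧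
        point true s le = ≤-trans le (≤-reflexive (sym (*-identityʳ n)))
        point false s le = ≤-trans (≤-reflexive (sym (+-identityʳ s))) (m≤m+n _ _)
      heavy-few : 2 * E * b ≤ n * n
      heavy-few = *-cancelˡ-≤ (n * n) {{>-nonZero (*-mono-≤ n>0 n>0)}} (begin
        n * n * (2 * E * b) ≡⟨ eq₁ (n * n) E b ⟩
        2 * E * (n * n * b) ≡⟨ cong (2 * E *_) (sym (∑∑-*ˡ (n * n) _)) ⟩
        2 * E * ∑ (λ p → ∑ (λ q → n * n * ⟦ heavy p q ⟧)) ≤⟨ *-monoʳ-≤ (2 * E) (∑∑-mono (λ p q → threshold (n * n) true (B * ν p q))) ⟩
        2 * E * ∑ (λ p → ∑ (λ q → B * ν p q)) ≡⟨ trans (cong (2 * E *_) (∑∑-*ˡ B ν)) (sym (*-assoc (2 * E) B _)) ⟩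
        2 * E * B * #tri-strangers D ≤⟨ V ⟩
        n * (n * (n * n)) ≡⟨ eq₂ n ⟩
        n * n * (n * n) ∎)
        where
        open ≤-Reasoning
        eq₁ : ∀ N E b → N * (2 * E * b) ≡ 2 * E * (N * b)
        eq₁ = solve-∀
        eq₂ : ∀ n → n * (n * (n * n)) ≡ n * n * (n * n)
        eq₂ = solve-∀
      dense : n * (n * n) ≤ 2 * E * X
      dense = lin 0 (+-mono-≤ (+-mono-≤ (*-monoʳ-≤ 2 h) (*-monoʳ-≤ (2 * E) split)) (*-monoʳ-≤ n heavy-few)) (eq n E X b (#tri D))
        where
        eq : ∀ n E X b t → n * (n * n) + (2 * (E * t) + 2 * E * (X + n * b) + n * (n * n)) + 0 ≡ 2 * E * X + (2 * (n * (n * n)) + 2 * E * t + n * (2 * E * b))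
        eq = solve-∀
      rich : ∀ p q → n ≤ A * f p q → n ^ (2 + j) ≤ C * walks p q
      rich p q r = go (heavy p q) refl r
        where
        go : ∀ c → heavy p q ≡ c → n ≤ A * (⟦ not c ⟧ * size (tri D p q)) → n ^ (2 + j) ≤ C * walks p q
        go true e r = contradiction (≤-trans n>0 (≤-trans r (≤-reflexive (*-zeroʳ A)))) λ ()
        go false e r = ≤-trans (semicomplete-walks n>0 p (suc j) A (tri D p q) (λ z t → third (D p q) (D q z) t) (≤-trans r (*-monoʳ-≤ A (≤-reflexive (+-identityʳ _)))) gap)
          (*-monoʳ-≤ C (≤-trans (∑-mono point) (≤-reflexive (∑-*ˡ ⟦ D p q ⟧ _))))
          where
          third : ∀ a b {c} → a ∧ (b ∧ c) ≡ true → c ≡ true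
          third true true e = e
          gap : sparsity (suc j) A * gaps (tri D p q) ≤ n * n
          gap = subst (λ B → B * gaps (tri D p q) ≤ n * n) B≡ (≤-trans (*-monoʳ-≤ B (∑-mono (λ z → ≤-trans (∑-mono (λ y → mono (tri D p q z) (tri D p q y) (non D z y))) (≤-reflexive (∑-*ˡ ⟦ tri D p q z ⟧ _))))) (≮⇒≥ (λ lt → subst T e (<⇒<ᵇ lt))))
            where
            mono : ∀ a b c → ⟦ (a ∧ b) ∧ c ⟧ ≤ ⟦ a ⟧ * ⟦ c ⟧
            mono a b c = leq (taut 3 (λ a b c → ⟦ (a ∧ b) ∧ c ⟧ ≤ᵇ ⟦ a ⟧ * ⟦ c ⟧) tt a b c)
          point : ∀ z → ⟦ tri D p q z ⟧ * pow ⟪ D ⟫ (2 + j) z p ≤ ⟦ D p q ⟧ * (⟦ D q z ⟧ * pow ⟪ D ⟫ (2 + j) z p)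
          point z = ≤-trans (*-monoˡ-≤ (pow ⟪ D ⟫ (2 + j) z p) (leq {⟦ tri D p q z ⟧} {⟦ D p q ⟧ * ⟦ D q z ⟧} (taut 3 (λ a b c → ⟦ a ∧ (b ∧ c) ⟧ ≤ᵇ ⟦ a ⟧ * ⟦ b ⟧) tt (D p q) (D q z) (D z p)))) (≤-reflexive (*-assoc ⟦ D p q ⟧ ⟦ D q z ⟧ (pow ⟪ D ⟫ (2 + j) z p)))

few-tri : ∀ j E → ∃ λ F → ∀ n → 0 < n → (D : Digraph n) → F * tr (pow ⟪ D ⟫ (4 + j)) ≤ n ^ (4 + j) → F * #dtri D ≤ n * (n * n) → F * #deficit D ≤ n * n → E * #tri D ≤ n * (n * n)
few-tri j E = (suc Ka + suc Kd) + (36 * Q + 15 * Q) , λ n n>0 D h t d →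
  few Ka (tr (pow ⟪ D ⟫ (4 + j))) (m^n>0 n {{>-nonZero n>0}} (4 + j)) (≤-part₁ {suc Ka} {suc Kd} _ (≤-part₁ {suc Ka + suc Kd} {36 * Q + 15 * Q} _ h))
    (tri-closed D E B j n>0 refl (strangers-few n D
      (few Kd (tr (pow ⟪ D ⟫ (4 + j))) (m^n>0 n {{>-nonZero n>0}} (4 + j)) (≤-part₂ {suc Ka} {suc Kd} _ (≤-part₁ {suc Ka + suc Kd} {36 * Q + 15 * Q} _ h)) (diamond-closed D (3 * Q) j n>0))
      (≤-part₁ {36 * Q} {15 * Q} _ (≤-part₂ {suc Ka + suc Kd} {36 * Q + 15 * Q} _ t))
      (≤-part₂ {36 * Q} {15 * Q} _ (≤-part₂ {suc Ka + suc Kd} {36 * Q + 15 * Q} _ d))))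
  where
  A = 2 * (2 * (2 * E))
  B = sparsity (suc j) A
  -- The sparsity of pairs of a triangle and a stranger that `tri-closed` asks for. The three terms
  -- of `tri-strangers≤` are each made at most a third of it, which gives the factors 3, 36 = 3 * 12
  -- and 15 = 3 * 5.
  Q = 2 * E * B
  Ka = 2 * (2 * E) * (A * growth (suc j) A)
  Kd = 2 * (3 * Q) * (2 * (2 * (3 * Q)) * (2 * (2 * (3 * Q))) ^ (2 ^ suc j))
  strangers-few : ∀ n → (D : Digraph n) → 3 * Q * #diamond D ≤ n * (n * (n * n)) → 36 * Q * #dtri D ≤ n * (n * n) → 15 * Q * #deficit D ≤ n * n → Q * #tri-strangers D ≤ n * (n * (n * n))
  strangers-few n D a b c = *-cancelˡ-≤ 3 (lin 0 (+-mono-≤ (+-mono-≤ (*-monoʳ-≤ (3 * Q) (tri-strangers≤ D)) a) (+-mono-≤ (*-monoʳ-≤ n b) (*-monoʳ-≤ n (*-monoʳ-≤ n c)))) (eq Q n (#tri-strangers D) (#diamond D) (#dtri D) (#deficit D)))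
    where
    eq : ∀ Q n V a t d → 3 * (Q * V) + ((3 * Q * (a + (12 * (n * t) + 5 * (n * (n * d)))) + n * (n * (n * n))) + (n * (n * (n * n)) + n * (n * (n * n)))) + 0 ≡ 3 * (n * (n * (n * n))) + ((3 * Q * V + 3 * Q * a) + (n * (36 * Q * t) + n * (n * (15 * Q * d))))
    eq = solve-∀

-- Ordering by height

sq-cancel : ∀ {a b} → a * a ≤ b * b → a ≤ b
sq-cancel {a} {b} h with a ≤? b
... | yes p = p
... | no ¬p = contradiction h (<⇒≱ (*-mono-< (≰⇒> ¬p) (≰⇒> ¬p)))

module _ {n} (D : Digraph n) where

  #dtri≤#tri : #dtri D ≤ #tri D
  #dtri≤#tri = ∑₃-mono (λ w u v → leq (taut 4 (λ a b c d → ⟦ (a ∧ b) ∧ (c ∧ d) ⟧ ≤ᵇ ⟦ a ∧ (c ∧ b) ⟧) tt (D w u) (D v w) (D u v) (D v u)))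

  -- The difference of the degrees is shifted by n to stay a natural number. In this form a double
  -- neighbour and a stranger both contribute 1, so height does not distinguish them.
  indeg codeg height : Fin n → ℕ
  indeg v = ∑ (λ w → ⟦ D w v ⟧)
  codeg v = ∑ (λ w → ⟦ not (D v w) ⟧)
  height v = indeg v + codeg v

  missing : Fin n → Fin n → Fin n → Bool
  missing p q w = not (D q w) ∧ not (D w p)

  κ τ : Fin n → Fin n → ℕ
  κ p q = ∑ (λ w → ⟦ missing p q w ⟧)
  τ p q = ∑ (λ w → ⟦ through D p q w ⟧)

  -- Inclusion and exclusion for the out-neighbours of q and the in-neighbours of p. For an edge pq
  -- the number `τ p q` counts the directed triangles over it.
  κ-τ : ∀ p q → κ p q + indeg p ≡ codeg q + τ p q
  κ-τ p q = trans (sym (∑-+ _ _)) (trans (∑-cong (λ w → point (D q w) (D w p))) (∑-+ _ _))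
    where
    point : ∀ a b → ⟦ not a ∧ not b ⟧ + ⟦ b ⟧ ≡ ⟦ not a ⟧ + ⟦ a ∧ b ⟧
    point true true = refl
    point true false = refl
    point false true = refl
    point false false = refl

  codeg≤ : ∀ v → codeg v ≤ indeg v + deficit D v
  codeg≤ v = +-cancelˡ-≤ o _ _ (≤-trans (≤-reflexive out) (≤-trans (n≤degree+deficit D v) (≤-reflexive (trans (cong (_+ deficit D v) deg≡) (+-assoc o (indeg v) (deficit D v))))))
    where
    o = ∑ (λ w → ⟦ D v w ⟧)
    out : o + codeg v ≡ n
    out = trans (sym (∑-+ _ _)) (trans (∑-cong (λ w → one (D v w))) (trans (∑-const n 1) (*-identityʳ n)))
      where
      one : ∀ b → ⟦ b ⟧ + ⟦ not b ⟧ ≡ 1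
      one true = refl
      one false = refl
    deg≡ : degree D v ≡ o + indeg v
    deg≡ = ∑-+ _ _

  -- Along an edge p → q the height rises by at least 2κ, up to deficits and triangles. So an edge
  -- that gains little height has few vertices missing both connections.
  κ-height : ∀ p q → 2 * κ p q + height p ≤ height q + (deficit D p + deficit D q + 2 * τ p q)
  κ-height p q = lin 0 (+-mono-≤ (≤-reflexive (cong (2 *_) (κ-τ p q))) (+-mono-≤ (codeg≤ q) (codeg≤ p))) (eq (κ p q) (indeg p) (codeg p) (indeg q) (codeg q) (deficit D p) (deficit D q) (τ p q))
    where
    eq : ∀ k ip cp iq cq dp dq t → 2 * k + (ip + cp) + (2 * (cq + t) + ((iq + dq) + (ip + dp))) + 0 ≡ iq + cq + (dp + dq + 2 * t) + (2 * (k + ip) + (cq + cp))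
    eq = solve-∀

  nbrs≤ : ∀ q → nbrs D q ≤ strangers D q + excess D q
  nbrs≤ q = +-cancelˡ-≤ n _ _ (≤-trans (≤-reflexive (sym (degree-balance D q))) (≤-trans (+-monoˡ-≤ (strangers D q) (m≤n+m∸n (degree D q) n)) (≤-reflexive (eq n (excess D q) (strangers D q)))))
    where
    eq : ∀ n e s → n + e + s ≡ n + (s + e)
    eq = solve-∀

  module _ (Z : ℕ) where

    -- Besides the single edges that go down, edges that rise by at most n / Z are included; the
    -- slack is spent when vertices of nearly equal height are later grouped into classes.
    tie : Fin n → Fin n → Bool
    tie p q = D p q ∧ (not (D q p) ∧ (Z * height q ≤ᵇ Z * height p + n))

    #tie tieκ tieNbrs tieProd : ℕ
    #tie = ∑ (λ p → size (tie p))
    tieκ = ∑ (λ p → ∑ (λ q → ⟦ tie p q ⟧ * κ p q))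
    tieNbrs = ∑ (λ p → ∑ (λ q → ⟦ tie p q ⟧ * nbrs D q))
    tieProd = ∑ (λ p → ∑ (λ q → ⟦ tie p q ⟧ * (nbrs D q * strangers D q)))

    tieκ≤ : 2 * Z * tieκ ≤ n * (n * n) + (2 * Z * (n * #deficit D) + 2 * Z * #tri D)
    tieκ≤ = subst₂ _≤_ (∑∑-*ˡ (2 * Z) _) total (∑∑-mono point)
      where
      point : ∀ p q → 2 * Z * (⟦ tie p q ⟧ * κ p q) ≤ n + (Z * (deficit D p + deficit D q) + 2 * Z * (⟦ D p q ⟧ * τ p q))
      point p q = go (D p q) (D q p) (Z * height q ≤ᵇ Z * height p + n) refl
        where
        zero≤ : ∀ {m} → 2 * Z * 0 ≤ m
        zero≤ = ≤-trans (≤-reflexive (*-zeroʳ (2 * Z))) z≤n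
        go : ∀ a b c → (Z * height q ≤ᵇ Z * height p + n) ≡ c → 2 * Z * (⟦ a ∧ (not b ∧ c) ⟧ * κ p q) ≤ n + (Z * (deficit D p + deficit D q) + 2 * Z * (⟦ a ⟧ * τ p q))
        go false b c e = zero≤
        go true true c e = zero≤
        go true false false e = zero≤
        go true false true e = lin 0 (+-mono-≤ (*-monoʳ-≤ Z (κ-height p q)) (≤ᵇ⇒≤ _ _ (Equivalence.from T-≡ e))) (eq Z (κ p q) (height p) (height q) (deficit D p) (deficit D q) (τ p q) n)
          where
          eq : ∀ Z k hp hq dp dq t n → 2 * Z * (1 * k) + (Z * (hq + (dp + dq + 2 * t)) + (Z * hp + n)) + 0 ≡ n + (Z * (dp + dq) + 2 * Z * (1 * t)) + (Z * (2 * k + hp) + Z * hq)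
          eq = solve-∀
      total : ∑ (λ p → ∑ (λ q → n + (Z * (deficit D p + deficit D q) + 2 * Z * (⟦ D p q ⟧ * τ p q)))) ≡ n * (n * n) + (2 * Z * (n * #deficit D) + 2 * Z * #tri D)
      total = trans (∑∑-+ _ _) (cong₂ _+_ (trans (∑-const n _) (cong (n *_) (∑-const n n))) (trans (∑∑-+ _ _) (cong₂ _+_
        (trans (∑∑-*ˡ Z _) (trans (cong (Z *_) (trans (∑∑-+ _ _) (cong₂ _+_ (trans (∑-cong (λ p → ∑-const n _)) (∑-*ˡ n _)) (∑-const n _)))) (eq Z (n * #deficit D))))
        (trans (∑∑-*ˡ (2 * Z) _) (cong (2 * Z *_) (∑∑-cong (λ p q → trans (sym (∑-*ˡ ⟦ D p q ⟧ _)) (∑-cong (λ z → sym (⟦∧⟧ (D p q) (through D p q z))))))))))) 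
        where
        eq : ∀ Z d → Z * (d + d) ≡ 2 * Z * d
        eq = solve-∀

    -- Let x be a double neighbour and w a stranger of q, with w → p. As qx is not exceptional for
    -- w, the pair wx is double; as it is not exceptional for p, the vertex p is adjacent to x.
    -- Either direction of that edge yields a directed triangle, p x w or p q x.
    tieProd≤ : tieProd ≤ n * tieκ + (2 * (n * #exceptional D) + 2 * (n * #tri D))
    tieProd≤ = begin
      tieProd ≡⟨ ∑∑-cong (λ p q → trans (cong (⟦ tie p q ⟧ *_) (sym (∑-prod (λ x → ⟦ dbl D q x ⟧) (λ w → ⟦ non D q w ⟧)))) (trans (sym (∑-*ˡ ⟦ tie p q ⟧ _)) (∑-cong (λ x → sym (∑-*ˡ ⟦ tie p q ⟧ _))))) ⟩
      ∑₄ (λ p q x w → ⟦ tie p q ⟧ * (⟦ dbl D q x ⟧ * ⟦ non D q w ⟧)) ≤⟨ ∑₄-mono point ⟩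
      ∑₄ (λ p q x w → ⟦ tie p q ⟧ * ⟦ missing p q w ⟧ + ((⟦ exceptional D q x w ⟧ + ⟦ exceptional D q x p ⟧) + (⟦ tri D p q x ⟧ + ⟦ tri D p x w ⟧)))
        ≡⟨ trans (∑₄-+ _ _) (cong₂ _+_ (trans (free₃ (λ p q w → ⟦ tie p q ⟧ * ⟦ missing p q w ⟧)) (cong (n *_) (∑∑-cong (λ p q → ∑-*ˡ ⟦ tie p q ⟧ _)))) (trans (∑₄-+ _ _) (cong₂ _+_ (trans (∑₄-+ _ _) (cong₂ _+_ (free₁ e) (trans (free₄ (λ p q x → e q x p)) (cong (n *_) (rotate₃ e))))) (trans (∑₄-+ _ _) (cong₂ _+_ (free₄ t) (free₂ t)))))) ⟩
      n * tieκ + ((n * #exceptional D + n * #exceptional D) + (n * #tri D + n * #tri D)) ≡⟨ cong (n * tieκ +_) (eq (n * #exceptional D) (n * #tri D)) ⟩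
      n * tieκ + (2 * (n * #exceptional D) + 2 * (n * #tri D)) ∎
      where
      open ≤-Reasoning
      e t : Fin n → Fin n → Fin n → ℕ
      e z x w = ⟦ exceptional D z x w ⟧
      t p q z = ⟦ tri D p q z ⟧
      eq : ∀ a b → (a + a) + (b + b) ≡ 2 * a + 2 * b
      eq = solve-∀
      point : ∀ p q x w → ⟦ tie p q ⟧ * (⟦ dbl D q x ⟧ * ⟦ non D q w ⟧) ≤ ⟦ tie p q ⟧ * ⟦ missing p q w ⟧ + ((⟦ exceptional D q x w ⟧ + ⟦ exceptional D q x p ⟧) + (⟦ tri D p q x ⟧ + ⟦ tri D p x w ⟧))
      point p q x w = go (D p q) (D q p) (Z * height q ≤ᵇ Z * height p + n) (D q x) (D x q) (D q w) (D w q) (D w p) (D w x) (D x w) (D p x) (D x p)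
        where
        zero≤ : ∀ a {m} → a * 0 ≤ m
        zero≤ a = ≤-trans (≤-reflexive (*-zeroʳ a)) z≤n
        go : ∀ pq qp c qx xq qw wq wp wx xw px xp → ⟦ pq ∧ (not qp ∧ c) ⟧ * (⟦ qx ∧ xq ⟧ * ⟦ not qw ∧ not wq ⟧) ≤ ⟦ pq ∧ (not qp ∧ c) ⟧ * ⟦ not qw ∧ not wp ⟧ + ((⟦ (qx ∧ xq) ∧ (((⟦ wq ⟧ + ⟦ qw ⟧) + (⟦ wx ⟧ + ⟦ xw ⟧)) <ᵇ 2) ⟧ + ⟦ (qx ∧ xq) ∧ (((⟦ pq ⟧ + ⟦ qp ⟧) + (⟦ px ⟧ + ⟦ xp ⟧)) <ᵇ 2) ⟧) + (⟦ pq ∧ (qx ∧ xp) ⟧ + ⟦ px ∧ (xw ∧ wp) ⟧))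
        go false qp c qx xq qw wq wp wx xw px xp = z≤n
        go true true c qx xq qw wq wp wx xw px xp = z≤n
        go true false false qx xq qw wq wp wx xw px xp = z≤n
        go true false true false xq qw wq wp wx xw px xp = z≤n
        go true false true true false qw wq wp wx xw px xp = z≤n
        go true false true true true true wq wp wx xw px xp = z≤n
        go true false true true true false true wp wx xw px xp = z≤n
        go true false true true true false false wp wx xw px xp = leq (taut 5 (λ wp wx xw px xp → 1 ≤ᵇ 1 * ⟦ not wp ⟧ + ((⟦ (⟦ wx ⟧ + ⟦ xw ⟧) <ᵇ 2 ⟧ + ⟦ (1 + (⟦ px ⟧ + ⟦ xp ⟧)) <ᵇ 2 ⟧) + (⟦ xp ⟧ + ⟦ px ∧ (xw ∧ wp) ⟧))) tt wp wx xw px xp)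

    -- For two ties p → q and p → q′ either qq′ is double, or one of its directions is absent; in
    -- that case q′ is missing for pq or q is missing for pq′, because ties are single edges.
    tie-square : ∑ (λ p → size (tie p) * size (tie p)) ≤ tieNbrs + 2 * tieκ
    tie-square = begin
      ∑ (λ p → size (tie p) * size (tie p)) ≡⟨ ∑-cong (λ p → sym (∑-prod (λ q → ⟦ tie p q ⟧) (λ q → ⟦ tie p q ⟧))) ⟩
      ∑₃ (λ p q q′ → ⟦ tie p q ⟧ * ⟦ tie p q′ ⟧) ≤⟨ ∑₃-mono point ⟩
      ∑₃ (λ p q q′ → ⟦ tie p q ⟧ * ⟦ dbl D q q′ ⟧ + (⟦ tie p q ⟧ * ⟦ missing p q q′ ⟧ + ⟦ tie p q′ ⟧ * ⟦ missing p q′ q ⟧)) ≡⟨ trans (∑₃-+ _ _) (cong₂ _+_ (∑∑-cong (λ p q → ∑-*ˡ ⟦ tie p q ⟧ _)) (trans (∑₃-+ _ _) (cong₂ _+_ k (trans (swap₃ _) k)))) ⟩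
      tieNbrs + (tieκ + tieκ) ≡⟨ cong (λ z → tieNbrs + (tieκ + z)) (sym (+-identityʳ tieκ)) ⟩
      tieNbrs + 2 * tieκ ∎
      where
      open ≤-Reasoning
      k : ∑₃ (λ p q q′ → ⟦ tie p q ⟧ * ⟦ missing p q q′ ⟧) ≡ tieκ
      k = ∑∑-cong (λ p q → ∑-*ˡ ⟦ tie p q ⟧ _)
      point : ∀ p q q′ → ⟦ tie p q ⟧ * ⟦ tie p q′ ⟧ ≤ ⟦ tie p q ⟧ * ⟦ dbl D q q′ ⟧ + (⟦ tie p q ⟧ * ⟦ missing p q q′ ⟧ + ⟦ tie p q′ ⟧ * ⟦ missing p q′ q ⟧)
      point p q q′ = leq (taut 8 (λ a b c a′ b′ c′ d d′ → ⟦ a ∧ (not b ∧ c) ⟧ * ⟦ a′ ∧ (not b′ ∧ c′) ⟧ ≤ᵇ ⟦ a ∧ (not b ∧ c) ⟧ * ⟦ d ∧ d′ ⟧ + (⟦ a ∧ (not b ∧ c) ⟧ * ⟦ not d ∧ not b′ ⟧ + ⟦ a′ ∧ (not b′ ∧ c′) ⟧ * ⟦ not d′ ∧ not b ⟧)) tt (D p q) (D q p) (Z * height q ≤ᵇ Z * height p + n) (D p q′) (D q′ p) (Z * height q′ ≤ᵇ Z * height p + n) (D q q′) (D q′ q))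

    -- The inequality 2ab ≤ a² + b² with a = n and b = L * `nbrs D q`, followed by `nbrs≤` for one
    -- of the two factors of the square.
    tieNbrs≤ : ∀ L → 2 * L * (n * tieNbrs) ≤ n * (n * (n * n)) + L * L * (tieProd + n * (n * #excess D))
    tieNbrs≤ L = begin
      2 * L * (n * tieNbrs) ≡⟨ trans (sym (*-assoc (2 * L) n tieNbrs)) (sym (∑∑-*ˡ (2 * L * n) _)) ⟩
      ∑ (λ p → ∑ (λ q → 2 * L * n * (⟦ tie p q ⟧ * nbrs D q))) ≤⟨ ∑∑-mono point ⟩
      ∑ (λ p → ∑ (λ q → n * n + L * L * (⟦ tie p q ⟧ * (nbrs D q * strangers D q) + n * excess D q))) ≡⟨ trans (∑∑-+ _ _) (cong₂ _+_ (trans (∑-const n _) (cong (n *_) (∑-const n _))) (trans (∑∑-*ˡ (L * L) _) (cong (L * L *_) (trans (∑∑-+ _ _) (cong (tieProd +_) (trans (∑-const n _) (cong (n *_) (∑-*ˡ n _)))))))) ⟩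
      n * (n * (n * n)) + L * L * (tieProd + n * (n * #excess D)) ∎
      where
      open ≤-Reasoning
      point : ∀ p q → 2 * L * n * (⟦ tie p q ⟧ * nbrs D q) ≤ n * n + L * L * (⟦ tie p q ⟧ * (nbrs D q * strangers D q) + n * excess D q)
      point p q with tie p q
      ... | false = ≤-trans (≤-reflexive (*-zeroʳ (2 * L * n))) z≤n
      ... | true = begin
        2 * L * n * (1 * b) ≡⟨ eq₁ L n b ⟩
        2 * (n * (L * b)) ≤⟨ 2ab≤ n (L * b) ⟩
        n * n + L * b * (L * b) ≡⟨ eq₂ n L b ⟩
        n * n + L * L * (b * b) ≤⟨ +-monoʳ-≤ (n * n) (*-monoʳ-≤ (L * L) (≤-trans (*-monoʳ-≤ b (nbrs≤ q)) (≤-trans (≤-reflexive (*-distribˡ-+ b (strangers D q) (excess D q))) (+-mono-≤ (≤-reflexive (sym (+-identityʳ _))) (*-monoˡ-≤ (excess D q) (∑-⟦⟧≤ (dbl D q))))))) ⟩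
        n * n + L * L * (1 * (b * strangers D q) + n * excess D q) ∎
        where
        b = nbrs D q
        eq₁ : ∀ L n b → 2 * L * n * (1 * b) ≡ 2 * (n * (L * b))
        eq₁ = solve-∀
        eq₂ : ∀ n L b → n * n + L * b * (L * b) ≡ n * n + L * L * (b * b)
        eq₂ = solve-∀

-- This is 4L² with L = 2E². After the Cauchy-Schwarz inequality the double neighbours of tie heads
-- must be at most n³ / L, and for that the products in `tieProd` must be at most about n⁴ / L².
tieWidth : ℕ → ℕ
tieWidth E = 4 * (2 * (E * E) * (2 * (E * E)))

few-ties : ∀ E → 0 < E → ∀ n → 0 < n → (D : Digraph n) → (let F = 10 * tieWidth E in F * #tri D ≤ n * (n * n) → F * #deficit D ≤ n * n → F * #excess D ≤ n * n → E * #tie D (tieWidth E) ≤ n * n)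
few-ties E E>0 n n>0 D ht hd he = sq-cancel (begin
  E * #tie D Z * (E * #tie D Z) ≡⟨ eq₁ E (#tie D Z) ⟩
  E * E * (#tie D Z * #tie D Z) ≤⟨ *-monoʳ-≤ (E * E) (≤-trans (cauchy-schwarz (λ p → size (tie D Z p))) (*-monoʳ-≤ n (tie-square D Z))) ⟩
  E * E * (n * (tieNbrs D Z + 2 * tieκ D Z)) ≤⟨ final ⟩
  n * n * (n * n) ∎)
  where
  open ≤-Reasoning
  Z = tieWidth E
  L = 2 * (E * E)
  L>0 : 0 < L
  L>0 = *-mono-≤ {1} {2} (s≤s z≤n) (*-mono-≤ E>0 E>0)
  t = #tri D
  d = #deficit D
  x = #excess D
  k = tieκ D Z
  b = tieNbrs D Z
  eq₁ : ∀ E t → E * t * (E * t) ≡ E * E * (t * t)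
  eq₁ = solve-∀
  κ-few : Z * k ≤ n * (n * n)
  κ-few = *-cancelˡ-≤ 20 (lin (6 * (n * (n * n))) (+-mono-≤ (*-monoʳ-≤ 10 (tieκ≤ D Z)) (+-mono-≤ (*-monoʳ-≤ 2 (*-monoʳ-≤ n hd)) (*-monoʳ-≤ 2 ht))) (eq Z k n t d))
    where
    eq : ∀ Z k n t d → 20 * (Z * k) + (10 * (n * (n * n) + (2 * Z * (n * d) + 2 * Z * t)) + (2 * (n * (n * n)) + 2 * (n * (n * n)))) + 6 * (n * (n * n)) ≡ 20 * (n * (n * n)) + (10 * (2 * Z * k) + (2 * (n * (10 * Z * d)) + 2 * (10 * Z * t)))
    eq = solve-∀
  prod-few : L * L * (tieProd D Z + n * (n * x)) ≤ n * (n * (n * n))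
  prod-few = *-cancelˡ-≤ 40 (lin (15 * (n * (n * (n * n)))) (+-mono-≤ (+-mono-≤ (*-monoʳ-≤ (10 * Z) (tieProd≤ D Z)) (*-monoʳ-≤ (20 * Z * n) (≤-trans (#exceptional≤ D) (+-monoʳ-≤ (2 * (n * d)) (*-monoʳ-≤ 4 (#dtri≤#tri D)))))) (+-mono-≤ (+-mono-≤ (*-monoʳ-≤ (10 * n) κ-few) (*-monoʳ-≤ (10 * n) ht)) (+-mono-≤ (*-monoʳ-≤ (4 * (n * n)) hd) (*-monoʳ-≤ (n * n) he)))) (eq L (tieProd D Z) n k (#exceptional D) t d x))
    where
    eq : ∀ L P n k e t d x → 40 * (L * L * (P + n * (n * x))) + ((10 * (4 * (L * L)) * (n * k + (2 * (n * e) + 2 * (n * t))) + 20 * (4 * (L * L)) * n * (2 * (n * d) + 4 * t)) + ((10 * n * (n * (n * n)) + 10 * n * (n * (n * n))) + (4 * (n * n) * (n * n) + n * n * (n * n)))) + 15 * (n * (n * (n * n)))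
      ≡ 40 * (n * (n * (n * n))) + ((10 * (4 * (L * L)) * P + 20 * (4 * (L * L)) * n * e) + ((10 * n * (4 * (L * L) * k) + 10 * n * (10 * (4 * (L * L)) * t)) + (4 * (n * n) * (10 * (4 * (L * L)) * d) + n * n * (10 * (4 * (L * L)) * x))))
    eq = solve-∀
  nbrs-few : L * b ≤ n * (n * n)
  nbrs-few = *-cancelˡ-≤ (2 * n) {{>-nonZero (*-mono-≤ {1} {2} (s≤s z≤n) n>0)}} (lin 0 (+-mono-≤ (tieNbrs≤ D Z L) prod-few) (eq L n b (L * L * (tieProd D Z + n * (n * x)))))
    where
    eq : ∀ L n b p → 2 * n * (L * b) + ((n * (n * (n * n)) + p) + n * (n * (n * n))) + 0 ≡ 2 * n * (n * (n * n)) + (2 * L * (n * b) + p)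
    eq = solve-∀
  2L≤Z : 2 * L ≤ Z
  2L≤Z = *-mono-≤ {2} {4} (s≤s (s≤s z≤n)) (≤-trans (≤-reflexive (sym (*-identityʳ L))) (*-monoʳ-≤ L L>0))
  final : E * E * (n * (b + 2 * k)) ≤ n * n * (n * n)
  final = *-cancelˡ-≤ 2 (lin 0 (+-mono-≤ (*-monoʳ-≤ n nbrs-few) (*-monoʳ-≤ n (≤-trans (*-monoˡ-≤ k 2L≤Z) κ-few))) (eq E n b k))
    where
    eq : ∀ E n b k → 2 * (E * E * (n * (b + 2 * k))) + (n * (n * (n * n)) + n * (n * (n * n))) + 0 ≡ 2 * (n * n * (n * n)) + (n * (2 * (E * E) * b) + n * (2 * (2 * (E * E)) * k))
    eq = solve-∀

-- Orderings from keys

sum-allFin : ∀ {n} (f : Fin n → ℕ) → sum (map f (allFin n)) ≡ ∑ f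
sum-allFin {n} f = trans (cong sum (map-tabulate id f)) (go f)
  where
  go : ∀ {n} (f : Fin n → ℕ) → sum (List.tabulate f) ≡ ∑ f
  go {zero} f = sym (∑-empty f)
  go {suc n} f = trans (cong (f zero +_) (go (f ∘ suc))) (sym (∑-suc f))

rank : ∀ {n} → (Fin n → ℕ) → Fin n → ℕ
rank K v = ∑ (λ w → ⟦ K w <ᵇ K v ⟧)

⟦<⟧-mono : ∀ k {a b} → a ≤ b → ⟦ k <ᵇ a ⟧ ≤ ⟦ k <ᵇ b ⟧
⟦<⟧-mono k {a} {b} le with k <ᵇ a in e
... | false = z≤n
... | true = ≤-reflexive (cong ⟦_⟧ (sym (<ᵇ-true (<-≤-trans (<ᵇ⇒< k a (Equivalence.from T-≡ e)) le))))

rank-mono : ∀ {n} (K : Fin n → ℕ) u v → K u ≤ K v → rank K u ≤ rank K v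
rank-mono K u v le = ∑-mono (λ w → ⟦<⟧-mono (K w) le)

<ᵇ-irrefl : ∀ k → (k <ᵇ k) ≡ false
<ᵇ-irrefl zero = refl
<ᵇ-irrefl (suc k) = <ᵇ-irrefl k

rank-strict : ∀ {n} (K : Fin n → ℕ) u v → K u < K v → rank K u < rank K v
rank-strict K u v lt = ≤-trans (≤-reflexive (trans (+-comm 1 (rank K u)) (trans (cong (rank K u +_) (sym (∑-δ′ u))) (sym (∑-+ _ _))))) (∑-mono point)
  where
  point : ∀ w → ⟦ K w <ᵇ K u ⟧ + δ w u ≤ ⟦ K w <ᵇ K v ⟧
  point w with w FP.≟ u
  ... | no _ = ≤-trans (≤-reflexive (+-identityʳ _)) (⟦<⟧-mono (K w) (<⇒≤ lt))
  ... | yes refl = ≤-reflexive (trans (cong (λ b → ⟦ b ⟧ + 1) (<ᵇ-irrefl (K u))) (cong ⟦_⟧ (sym (<ᵇ-true lt))))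

rank<n : ∀ {n} (K : Fin n → ℕ) v → rank K v < n
rank<n {n} K v = ≤-trans (≤-reflexive (trans (+-comm 1 (rank K v)) (trans (cong (rank K v +_) (sym (∑-δ′ v))) (sym (∑-+ _ _))))) (≤-trans (∑-bound point) (≤-reflexive (*-identityʳ n)))
  where
  point : ∀ w → ⟦ K w <ᵇ K v ⟧ + δ w v ≤ 1
  point w with w FP.≟ v
  ... | no _ = ≤-trans (≤-reflexive (+-identityʳ _)) (⟦⟧≤1 (K w <ᵇ K v))
  ... | yes refl = ≤-reflexive (cong (λ b → ⟦ b ⟧ + 1) (<ᵇ-irrefl (K v)))

rankFin : ∀ {n} → (Fin n → ℕ) → Fin n → Fin n
rankFin K v = fromℕ< (rank<n K v)

rankFin-< : ∀ {n} (K : Fin n → ℕ) u v → toℕ (rankFin K u) < toℕ (rankFin K v) → K u < K v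
rankFin-< K u v lt = ≰⇒> (λ le → <⇒≱ (subst₂ _<_ (FP.toℕ-fromℕ< (rank<n K u)) (FP.toℕ-fromℕ< (rank<n K v)) lt) (rank-mono K v u le))

<-rankFin : ∀ {n} (K : Fin n → ℕ) u v → K u < K v → toℕ (rankFin K u) < toℕ (rankFin K v)
<-rankFin K u v lt = subst₂ _<_ (sym (FP.toℕ-fromℕ< (rank<n K u))) (sym (FP.toℕ-fromℕ< (rank<n K v))) (rank-strict K u v lt)

rankFin-≡ : ∀ {n} (K : Fin n → ℕ) u v → rankFin K u ≡ rankFin K v → K u ≡ K v
rankFin-≡ K u v e with <-cmp (K u) (K v)
... | tri< lt _ _ = contradiction (cong toℕ e) (<⇒≢ (<-rankFin K u v lt))
... | tri≈ _ eq _ = eq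
... | tri> _ _ gt = contradiction (cong toℕ (sym e)) (<⇒≢ (<-rankFin K v u gt))

injective-endo : ∀ {n} (f : Fin n → Fin n) → (∀ {x y} → f x ≡ f y → x ≡ y) → Σ (Permutation′ n) λ σ → ∀ x → σ ⟨$⟩ʳ x ≡ f x
injective-endo {n} f inj = permutation f (proj₁ ∘ preimage) (λ y → proj₂ (preimage y)) (λ x → inj (proj₂ (preimage (f x)))) , λ _ → refl
  where
  onto : ∀ {n} (f : Fin n → Fin n) → (∀ {x y} → f x ≡ f y → x ≡ y) → ∀ y → ∃ λ x → f x ≡ y
  onto {suc n} f inj y with FP.any? (λ x → f x FP.≟ y)
  ... | yes p = p
  ... | no ¬p = contradiction (FP.injective⇒≤ {f = λ x → punchOut {i = y} {j = f x} (λ e → ¬p (x , sym e))} (λ {a} {b} e → inj (FP.punchOut-injective (λ e → ¬p (a , sym e)) (λ e → ¬p (b , sym e)) e))) 1+n≰n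
  preimage = onto f inj

ordering : ∀ {n} (K : Fin n → ℕ) → (∀ {u v} → K u ≡ K v → u ≡ v) → Σ (Permutation′ n) λ σ → ∀ u v → toℕ (σ ⟨$⟩ʳ u) < toℕ (σ ⟨$⟩ʳ v) → K u < K v
ordering K inj with injective-endo (rankFin K) (λ {u} {v} e → inj (rankFin-≡ K u v e))
... | σ , h = σ , λ u v lt → rankFin-< K u v (subst₂ (λ a b → toℕ a < toℕ b) (h u) (h v) lt)

backwards-∑ : ∀ {n} (G : Mat n) (σ : Permutation′ n) → backwards G σ ≡ ∑ (λ i → ∑ (λ j → ⟦ edge G i j ∧ (toℕ (σ ⟨$⟩ʳ j) <ᵇ toℕ (σ ⟨$⟩ʳ i)) ⟧))
backwards-∑ G σ = trans (sum-allFin _) (∑-cong (λ i → trans (sum-allFin _) (∑-cong (λ j → ite (edge G i j ∧ (toℕ (σ ⟨$⟩ʳ j) <ᵇ toℕ (σ ⟨$⟩ʳ i)))))))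
  where
  ite : ∀ b → (if b then 1 else 0) ≡ ⟦ b ⟧
  ite true = refl
  ite false = refl

-- The number a * n + i encodes the pair (a, i) lexicographically; keys of this form break equal
-- heights by the vertex index.
lex-≤ : ∀ {n} a b (i j : Fin n) → a * n + toℕ i < b * n + toℕ j → a ≤ b
lex-≤ {n} a b i j lt with a ≤? b
... | yes p = p
... | no ¬p = contradiction lt (≤⇒≯ (≤-trans (+-monoʳ-≤ (b * n) (<⇒≤ (FP.toℕ<n j))) (≤-trans (≤-trans (≤-reflexive (+-comm (b * n) n)) (*-monoˡ-≤ n (≰⇒> ¬p))) (m≤m+n (a * n) (toℕ i)))))

lex-injective : ∀ {n} a b (i j : Fin n) → a * n + toℕ i ≡ b * n + toℕ j → a ≡ b × i ≡ j
lex-injective {n} a b i j e = a≡b , FP.toℕ-injective (+-cancelˡ-≡ (a * n) (toℕ i) (toℕ j) (trans e (cong (λ c → c * n + toℕ j) (sym a≡b))))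
  where
  half : ∀ a b (i j : Fin n) → a * n + toℕ i ≡ b * n + toℕ j → a ≤ b
  half a b i j e with a ≤? b
  ... | yes p = p
  ... | no ¬p = contradiction (sym e) (<⇒≢ (≤-trans (+-monoʳ-< (b * n) (FP.toℕ<n j)) (≤-trans (≤-trans (≤-reflexive (+-comm (b * n) n)) (*-monoˡ-≤ n (≰⇒> ¬p))) (m≤m+n (a * n) (toℕ i)))))
  a≡b : a ≡ b
  a≡b = ≤-antisym (half a b i j e) (half b a j i (sym e))

-- A backwards edge inside D that is not double goes down in height, or stays level, and therefore
-- is a tie for every Z.
backwards≤ : ∀ {n} (G : Mat n) (D : Digraph n) Z (σ : Permutation′ n) → (∀ u v → toℕ (σ ⟨$⟩ʳ u) < toℕ (σ ⟨$⟩ʳ v) → height D u * n + toℕ u < height D v * n + toℕ v) →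
  backwards G σ ≤ outside G D + (#tie D Z + #dbl D)
backwards≤ {n} G D Z σ ord = ≤-trans (≤-reflexive (backwards-∑ G σ)) (≤-trans (∑∑-mono point) (≤-reflexive (trans (∑∑-+ _ _) (cong (outside G D +_) (∑∑-+ _ _)))))
  where
  point : ∀ i j → ⟦ edge G i j ∧ (toℕ (σ ⟨$⟩ʳ j) <ᵇ toℕ (σ ⟨$⟩ʳ i)) ⟧ ≤ ⟦ edge G i j ∧ not (D i j) ⟧ + (⟦ tie D Z i j ⟧ + ⟦ dbl D i j ⟧)
  point i j = go (edge G i j) (D i j) (D j i) (toℕ (σ ⟨$⟩ʳ j) <ᵇ toℕ (σ ⟨$⟩ʳ i)) (Z * height D j ≤ᵇ Z * height D i + n)
    (λ t → Equivalence.to T-≡ (≤⇒≤ᵇ (≤-trans (*-monoʳ-≤ Z (lex-≤ (height D j) (height D i) j i (ord j i (<ᵇ⇒< _ _ (Equivalence.from T-≡ t))))) (m≤m+n _ n))))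
    where
    go : ∀ g a b c t → (c ≡ true → t ≡ true) → ⟦ g ∧ c ⟧ ≤ ⟦ g ∧ not a ⟧ + (⟦ a ∧ (not b ∧ t) ⟧ + ⟦ a ∧ b ⟧)
    go false a b c t h = z≤n
    go true a b false t h = z≤n
    go true a b true t h rewrite h refl = leq (taut 2 (λ a b → 1 ≤ᵇ ⟦ not a ⟧ + (⟦ a ∧ (not b ∧ true) ⟧ + ⟦ a ∧ b ⟧)) tt a b)

near-transitive : ∀ {n} (G : Mat n) (D : Digraph n) Z → Σ (Permutation′ n) λ σ → backwards G σ ≤ outside G D + (#tie D Z + #dbl D)
near-transitive {n} G D Z = proj₁ o , backwards≤ G D Z (proj₁ o) (proj₂ o)
  where
  o = ordering (λ v → height D v * n + toℕ v) (λ {u} {v} e → proj₂ (lex-injective (height D u) (height D v) u v e))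

-- Classes of double edges

∧-true : ∀ {a b} → a ∧ b ≡ true → a ≡ true × b ≡ true
∧-true {true} {true} _ = refl , refl

∧-intro : ∀ {a b} → a ≡ true → b ≡ true → a ∧ b ≡ true
∧-intro refl refl = refl

not-true : ∀ {a} → not a ≡ true → a ≡ false
not-true {false} _ = refl

¬true⇒false : ∀ {b} → ¬ b ≡ true → b ≡ false
¬true⇒false {true} h = contradiction refl h
¬true⇒false {false} h = refl

true≢false : true ≢ false
true≢false ()

≤ᵇ-sound : ∀ {a b} → (a ≤ᵇ b) ≡ true → a ≤ b
≤ᵇ-sound {a} {b} e = ≤ᵇ⇒≤ a b (Equivalence.from T-≡ e)

≤ᵇ-complete : ∀ {a b} → a ≤ b → (a ≤ᵇ b) ≡ true
≤ᵇ-complete le = Equivalence.to T-≡ (≤⇒≤ᵇ le)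

cover₃ : ∀ l {a b c} → (l ≡ true → a ≡ true ⊎ b ≡ true ⊎ c ≡ true) → ⟦ l ⟧ ≤ ⟦ a ⟧ + (⟦ b ⟧ + ⟦ c ⟧)
cover₃ false h = z≤n
cover₃ true {a} {b} {c} h with h refl
... | inj₁ refl = s≤s z≤n
... | inj₂ (inj₁ refl) = ≤-trans (s≤s z≤n) (m≤n+m _ ⟦ a ⟧)
... | inj₂ (inj₂ refl) = ≤-trans (m≤n+m 1 ⟦ b ⟧) (m≤n+m _ ⟦ a ⟧)

-- The four ways in which w can send exactly two edges to a double edge uv without closing a
-- triangle: both single and outgoing, both single and incoming, or a double edge to one end and no
-- edge to the other.
regular : Bool → Bool → Bool → Bool → Bool
regular wu uw wv vw = ((wu ∧ not uw) ∧ (wv ∧ not vw)) ∨ (((not wu ∧ uw) ∧ (not wv ∧ vw)) ∨ (((wu ∧ uw) ∧ (not wv ∧ not vw)) ∨ ((not wu ∧ not uw) ∧ (wv ∧ vw))))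

regular-dbl₁ : ∀ {a a′ b b′} → regular a a′ b b′ ≡ true → a ∧ a′ ≡ true → b ≡ false × b′ ≡ false
regular-dbl₁ {true} {true} {false} {false} _ _ = refl , refl

regular-dbl₂ : ∀ {a a′ b b′} → regular a a′ b b′ ≡ true → b ∧ b′ ≡ true → a ≡ false × a′ ≡ false
regular-dbl₂ {false} {false} {true} {true} _ _ = refl , refl
regular-dbl₂ {true} {true} {true} {true} () _
regular-dbl₂ {true} {false} {true} {true} () _
regular-dbl₂ {false} {true} {true} {true} () _

regular-non₁ : ∀ {a a′ b b′} → regular a a′ b b′ ≡ true → a ≡ false → a′ ≡ false → b ∧ b′ ≡ true
regular-non₁ {false} {false} {true} {true} _ _ _ = refl

regular-non₂ : ∀ {a a′ b b′} → regular a a′ b b′ ≡ true → b ≡ false → b′ ≡ false → a ∧ a′ ≡ true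
regular-non₂ {true} {true} {false} {false} _ _ _ = refl
regular-non₂ {true} {false} {false} {false} () _ _
regular-non₂ {false} {true} {false} {false} () _ _

_⊻_ : Bool → Bool → Bool
true ⊻ b = not b
false ⊻ b = b

eqᵇ-refl : ∀ {n} {x y : Fin n} → x ≡ y → eqᵇ x y ≡ true
eqᵇ-refl {x = x} refl with x FP.≟ x
... | yes _ = refl
... | no q = contradiction refl q

module _ {n} (D : Digraph n) where

  irregular : Fin n → Fin n → Fin n → Bool
  irregular u v w = not (regular (D w u) (D u w) (D w v) (D v w))

  ε : Fin n → Fin n → ℕ
  ε u v = size (irregular u v)

  irregular-sym : ∀ u v w → irregular u v w ≡ irregular v u w
  irregular-sym u v w = cong not (go (D w u) (D u w) (D w v) (D v w))
    where
    same : ∀ a b → T (not (a ⊻ b)) → a ≡ b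
    same true true _ = refl
    same false false _ = refl
    go : ∀ a b c d → regular a b c d ≡ regular c d a b
    go a b c d = same _ _ (taut 4 (λ a b c d → not (regular a b c d ⊻ regular c d a b)) tt a b c d)

  irregular≤ : ∀ u v w → dbl D u v ≡ true → ⟦ irregular u v w ⟧ ≤ ⟦ exceptional D u v w ⟧ + (⟦ dtri D w u v ⟧ + ⟦ dtri D w v u ⟧)
  irregular≤ u v w e = go (D w u) (D u w) (D w v) (D v w) (D u v) (D v u) e
    where
    go : ∀ a a′ b b′ c c′ → c ∧ c′ ≡ true → ⟦ not (regular a a′ b b′) ⟧ ≤ ⟦ (c ∧ c′) ∧ (((⟦ a ⟧ + ⟦ a′ ⟧) + (⟦ b ⟧ + ⟦ b′ ⟧)) <ᵇ 2) ⟧ + (⟦ (a ∧ b′) ∧ (c ∧ c′) ⟧ + ⟦ (b ∧ a′) ∧ (c′ ∧ c) ⟧)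
    go a a′ b b′ true true _ = leq (taut 4 (λ a a′ b b′ → ⟦ not (regular a a′ b b′) ⟧ ≤ᵇ ⟦ ((⟦ a ⟧ + ⟦ a′ ⟧) + (⟦ b ⟧ + ⟦ b′ ⟧)) <ᵇ 2 ⟧ + (⟦ (a ∧ b′) ∧ true ⟧ + ⟦ (b ∧ a′) ∧ true ⟧)) tt a a′ b b′)

  height-≡ : ∀ v → height D v ≡ ∑ (λ w → ⟦ D w v ⟧ + ⟦ not (D v w) ⟧)
  height-≡ v = sym (∑-+ _ _)

  -- A regular w contributes equally to both heights, since a double neighbour counts as much as a
  -- stranger.
  height-close : ∀ u v → height D u ≤ height D v + 2 * ε u v
  height-close u v = subst₂ _≤_ (sym (height-≡ u)) (trans (∑-+ _ _) (cong₂ _+_ (sym (height-≡ v)) (∑-*ˡ 2 _))) (∑-mono (λ w → leq (taut 4 (λ a a′ b b′ → ⟦ a ⟧ + ⟦ not a′ ⟧ ≤ᵇ ⟦ b ⟧ + ⟦ not b′ ⟧ + 2 * ⟦ not (regular a a′ b b′) ⟧) tt (D w u) (D u w) (D w v) (D v w))))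

  module _ (Z : ℕ) where

    good : Fin n → Fin n → Bool
    good u v = Z * ε u v ≤ᵇ n

    J nonJ : Fin n → Fin n → Bool
    J u v = dbl D u v ∧ good u v
    nonJ u v = dbl D u v ∧ not (good u v)

    clean : Fin n → Bool
    clean u = Z * size (nonJ u) ≤ᵇ n

    -- Good double edges at whose ends nearly all double edges are good. Cleanliness matters when
    -- such a pair becomes the seed of a class: the neighbours of u and v that a class fails to
    -- collect are then few.
    J₂ : Fin n → Fin n → Bool
    J₂ u v = J u v ∧ (clean u ∧ clean v)

    good-sym : ∀ u v → good u v ≡ good v u
    good-sym u v = cong (λ s → Z * s ≤ᵇ n) (∑-cong (λ w → cong ⟦_⟧ (irregular-sym u v w)))

    J-sym : ∀ u v → J u v ≡ J v u
    J-sym u v = cong₂ _∧_ (dbl-sym D u v) (good-sym u v)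

    nonJ-sym : ∀ u v → nonJ u v ≡ nonJ v u
    nonJ-sym u v = cong₂ (λ a b → a ∧ not b) (dbl-sym D u v) (good-sym u v)

    J₂-sym : ∀ u v → J₂ u v ≡ J₂ v u
    J₂-sym u v = cong₂ _∧_ (J-sym u v) (∧-comm (clean u) (clean v))

    J-height : ∀ u v → J u v ≡ true → Z * height D u ≤ Z * height D v + 2 * n
    J-height u v j = ≤-trans (*-monoʳ-≤ Z (height-close u v)) (≤-trans (≤-reflexive (eq Z (height D v) (ε u v))) (+-monoʳ-≤ (Z * height D v) (*-monoʳ-≤ 2 {Z * ε u v} {n} (≤ᵇ-sound {Z * ε u v} {n} (proj₂ (∧-true {dbl D u v} j))))))
      where
      eq : ∀ Z h e → Z * (h + 2 * e) ≡ Z * h + 2 * (Z * e)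
      eq = solve-∀

    #nonJ : ℕ
    #nonJ = ∑ (λ u → size (nonJ u))

    #nonJ≤ : n * #nonJ ≤ Z * (#exceptional D + 2 * #dtri D)
    #nonJ≤ = begin
      n * #nonJ ≡⟨ sym (∑∑-*ˡ n _) ⟩
      ∑ (λ u → ∑ (λ v → n * ⟦ nonJ u v ⟧)) ≤⟨ ∑∑-mono point ⟩
      ∑ (λ u → ∑ (λ v → Z * ∑ (λ w → bound u v w))) ≡⟨ ∑∑-*ˡ Z _ ⟩
      Z * ∑₃ bound ≡⟨ cong (Z *_) (trans (∑₃-+ _ _) (cong (#exceptional D +_) (trans (∑₃-+ _ _) (trans (cong₂ _+_ (rotate₃′ t) (trans (∑-swap _) (rotate₃′ t))) (cong (#dtri D +_) (sym (+-identityʳ _))))))) ⟩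
      Z * (#exceptional D + 2 * #dtri D) ∎
      where
      open ≤-Reasoning
      t : Fin n → Fin n → Fin n → ℕ
      t w u v = ⟦ dtri D w u v ⟧
      bound : Fin n → Fin n → Fin n → ℕ
      bound u v w = ⟦ exceptional D u v w ⟧ + (⟦ dtri D w u v ⟧ + ⟦ dtri D w v u ⟧)
      rotate₃′ : ∀ (f : Fin n → Fin n → Fin n → ℕ) → ∑₃ (λ u v w → f w u v) ≡ ∑₃ f
      rotate₃′ f = trans (∑-cong (λ u → ∑-swap _)) (∑-swap _)
      point : ∀ u v → n * ⟦ nonJ u v ⟧ ≤ Z * ∑ (bound u v)
      point u v = go (dbl D u v) refl
        where
        go : ∀ b → dbl D u v ≡ b → n * ⟦ b ∧ not (good u v) ⟧ ≤ Z * ∑ (bound u v)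
        go false e = ≤-trans (≤-reflexive (*-zeroʳ n)) z≤n
        go true e with Z * ε u v ≤? n
        ... | yes p = ≤-trans (≤-reflexive (trans (cong (λ b → n * ⟦ not b ⟧) (≤ᵇ-complete p)) (*-zeroʳ n))) z≤n
        ... | no ¬p = ≤-trans (*-monoʳ-≤ n (⟦⟧≤1 (not (good u v)))) (≤-trans (≤-reflexive (*-identityʳ n)) (≤-trans (<⇒≤ (≰⇒> ¬p)) (*-monoʳ-≤ Z (∑-mono (λ w → irregular≤ u v w e)))))

    #unclean : ℕ
    #unclean = ∑ (λ u → ⟦ not (clean u) ⟧)

    #unclean≤ : n * #unclean ≤ Z * #nonJ
    #unclean≤ = subst₂ _≤_ (∑-*ˡ n _) (∑-*ˡ Z _) (∑-mono point)
      where
      point : ∀ u → n * ⟦ not (clean u) ⟧ ≤ Z * size (nonJ u)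
      point u with Z * size (nonJ u) ≤? n
      ... | yes p = ≤-trans (≤-reflexive (trans (cong (λ b → n * ⟦ not b ⟧) (≤ᵇ-complete p)) (*-zeroʳ n))) z≤n
      ... | no ¬p = ≤-trans (*-monoʳ-≤ n (⟦⟧≤1 (not (clean u)))) (≤-trans (≤-reflexive (*-identityʳ n)) (<⇒≤ (≰⇒> ¬p)))

    #dbl∖J₂ : ℕ
    #dbl∖J₂ = ∑ (λ u → ∑ (λ v → ⟦ dbl D u v ∧ not (J₂ u v) ⟧))

    #dbl∖J₂≤ : #dbl∖J₂ ≤ #nonJ + 2 * (n * #unclean)
    #dbl∖J₂≤ = ≤-trans (∑∑-mono (λ u v → leq (taut 4 (λ d g a b → ⟦ d ∧ not ((d ∧ g) ∧ (a ∧ b)) ⟧ ≤ᵇ ⟦ d ∧ not g ⟧ + (⟦ not a ⟧ + ⟦ not b ⟧)) tt (dbl D u v) (good u v) (clean u) (clean v))))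
      (≤-reflexive (trans (∑∑-+ _ _) (cong (#nonJ +_) (trans (∑∑-+ _ _) (trans (cong₂ _+_ (trans (∑-cong (λ u → ∑-const n _)) (∑-*ˡ n _)) (∑-const n _)) (cong (n * #unclean +_) (sym (+-identityʳ _))))))))

    OK : (Fin n → Fin n) → (Fin n → Bool) → Fin n → Fin n → Bool
    OK rep side x y = eqᵇ (rep x) (rep y) ∧ (side x ⊻ side y)

    OK-sym : ∀ rep side x y → OK rep side x y ≡ OK rep side y x
    OK-sym rep side x y = cong₂ _∧_ (eqᵇ-sym (rep x) (rep y)) (⊻-sym (side x) (side y))
      where
      eqᵇ-sym : ∀ (a b : Fin n) → eqᵇ a b ≡ eqᵇ b a
      eqᵇ-sym a b with a FP.≟ b | b FP.≟ a
      ... | yes _ | yes _ = refl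
      ... | no _ | no _ = refl
      ... | yes refl | no q = contradiction refl q
      ... | no q | yes refl = contradiction refl q
      ⊻-sym : ∀ a b → (a ⊻ b) ≡ (b ⊻ a)
      ⊻-sym true true = refl
      ⊻-sym true false = refl
      ⊻-sym false true = refl
      ⊻-sym false false = refl

    lost : (Fin n → Fin n) → (Fin n → Bool) → (Fin n → Bool) → Fin n → Fin n → Bool
    lost rep side U x y = U y ∧ (J₂ x y ∧ not (OK rep side x y))

    #lost : (Fin n → Fin n) → (Fin n → Bool) → (Fin n → Bool) → ℕ
    #lost rep side U = ∑ (λ x → ∑ (λ y → ⟦ U x ∧ lost rep side U x y ⟧))

    -- The vertex `rep x` names the class of x, and `side` its half. The heights within a class
    -- agree up to a multiple of n / Z, which later allows the classes to be ordered by the heights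
    -- of their names.
    record Classes (U : Fin n → Bool) : Set where
      field
        rep : Fin n → Fin n
        side : Fin n → Bool
        above : ∀ x → Z * height D x ≤ Z * height D (rep x) + 4 * n
        below : ∀ x → Z * height D (rep x) ≤ Z * height D x + 4 * n
        few-lost : Z * #lost rep side U ≤ 6 * (size U * n)

    -- Removing a class X ∪ Y: for a pair uv with J₂ the double neighbourhoods of the members of X
    -- agree with Y, and those of the members of Y with X, up to 3n/Z vertices.
    extend : ∀ (U : Fin n → Bool) u v → U u ≡ true → U v ≡ true → J₂ u v ≡ true →
      let X = λ x → U x ∧ J x v
          Y = λ y → U y ∧ (J u y ∧ not (X y))
          U′ = λ x → U x ∧ not (X x ∨ Y x)
      in Classes U′ → Classes U
    extend U u v Uu Uv juv c = record { rep = rep ; side = side ; above = above ; below = below ; few-lost = few-lost }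
      where
      module c = Classes c
      X Y C U′ : Fin n → Bool
      X x = U x ∧ J x v
      Y y = U y ∧ (J u y ∧ not (X y))
      C x = X x ∨ Y x
      U′ x = U x ∧ not (C x)
      rep : Fin n → Fin n
      rep x = if C x then u else c.rep x
      side : Fin n → Bool
      side x = if C x then X x else c.side x
      Juv : J u v ≡ true
      Juv = proj₁ (∧-true juv)
      cleans : clean u ∧ clean v ≡ true
      cleans = proj₂ (∧-true {J u v} juv)
      C-cases : ∀ x → C x ≡ true → X x ≡ true ⊎ Y x ≡ true
      C-cases x e with X x
      ... | true = inj₁ refl
      ... | false = inj₂ e
      J-of-Y : ∀ {x} → Y x ≡ true → J u x ≡ true
      J-of-Y {x} e = proj₁ (∧-true {J u x} (proj₂ (∧-true {U x} e)))
      J-of-X : ∀ {x} → X x ≡ true → J x v ≡ true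
      J-of-X {x} e = proj₂ (∧-true {U x} e)
      -- A vertex of X is joined to v, not to u, so its height is compared with that of u in two
      -- steps of 2n each.
      up : ∀ {a b c} → a ≤ b + 2 * n → b ≤ c + 2 * n → a ≤ c + 4 * n
      up {a} {b} {c} p q = lin 0 (+-mono-≤ p q) (eq a b c n)
        where
        eq : ∀ a b c n → a + (b + 2 * n + (c + 2 * n)) + 0 ≡ c + 4 * n + (a + b)
        eq = solve-∀
      up′ : ∀ {a b} → a ≤ b + 2 * n → a ≤ b + 4 * n
      up′ {a} {b} p = ≤-trans p (+-monoʳ-≤ b (*-monoˡ-≤ n {2} {4} (s≤s (s≤s z≤n))))
      above : ∀ x → Z * height D x ≤ Z * height D (rep x) + 4 * n
      above x with C x in e
      ... | false = c.above x
      ... | true with C-cases x e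
      ... | inj₁ q = up {Z * height D x} {Z * height D v} {Z * height D u} (J-height x v (J-of-X q)) (J-height v u (trans (J-sym v u) Juv))
      ... | inj₂ q = up′ {Z * height D x} {Z * height D u} (J-height x u (trans (J-sym x u) (J-of-Y q)))
      below : ∀ x → Z * height D (rep x) ≤ Z * height D x + 4 * n
      below x with C x in e
      ... | false = c.below x
      ... | true with C-cases x e
      ... | inj₁ q = up {Z * height D u} {Z * height D v} {Z * height D x} (J-height u v Juv) (J-height v x (trans (J-sym v x) (J-of-X q)))
      ... | inj₂ q = up′ {Z * height D u} {Z * height D x} (J-height u x (J-of-Y q))
      OK-intro : ∀ x z → C x ≡ true → C z ≡ true → (X x ⊻ X z) ≡ true → OK rep side x z ≡ true
      OK-intro x z ex ez d rewrite ex | ez = ∧-intro (eqᵇ-refl {x = u} refl) d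
      lost-parts : ∀ x z → lost rep side U x z ≡ true → U z ≡ true × dbl D x z ≡ true × OK rep side x z ≡ false
      lost-parts x z e with ∧-true {U z} e
      ... | Uz , r with ∧-true {J₂ x z} r
      ... | j , k = Uz , proj₁ (∧-true (proj₁ (∧-true {J x z} j))) , not-true k
      reg-cases : ∀ a b w → irregular a b w ≡ true ⊎ regular (D w a) (D a w) (D w b) (D b w) ≡ true
      reg-cases a b w with regular (D w a) (D a w) (D w b) (D b w)
      ... | true = inj₂ refl
      ... | false = inj₁ refl
      dbl-false : ∀ {a b} → a ∧ b ≡ true → a ≡ false → ⊥
      dbl-false {true} _ ()
      nonJ-intro : ∀ a b → dbl D a b ≡ true → J a b ≡ false → nonJ a b ≡ true
      nonJ-intro a b d j with dbl D a b | good a b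
      ... | true | false = refl
      -- A double neighbour z of x that is regular for xv is a stranger of v; if it is also regular
      -- for uv, it is a double neighbour of u. When that double edge is good, z was put into Y and
      -- the pair xz is not lost.
      X-lost : ∀ x z → X x ≡ true → lost rep side U x z ≡ true → irregular x v z ≡ true ⊎ irregular u v z ≡ true ⊎ nonJ u z ≡ true
      X-lost x z ex l with lost-parts x z l | reg-cases x v z | reg-cases u v z
      ... | _ | inj₁ i | _ = inj₁ i
      ... | _ | inj₂ _ | inj₁ i = inj₂ (inj₁ i)
      ... | Uz , d , nok | inj₂ r₁ | inj₂ r₂ = inj₂ (inj₂ (nonJ-intro u z duz notJ))
        where
        zv : D z v ≡ false × D v z ≡ false
        zv = regular-dbl₁ {D z x} {D x z} {D z v} {D v z} r₁ (trans (dbl-sym D z x) d)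
        duz : dbl D u z ≡ true
        duz = trans (dbl-sym D u z) (regular-non₂ {D z u} {D u z} {D z v} {D v z} r₂ (proj₁ zv) (proj₂ zv))
        notX : X z ≡ false
        notX = ¬true⇒false (λ e → dbl-false (proj₁ (∧-true {dbl D z v} (J-of-X e))) (proj₁ zv))
        notJ : J u z ≡ false
        notJ = ¬true⇒false (λ e → true≢false (trans (sym (OK-intro x z (cong (_∨ Y x) ex) (trans (cong (_∨ Y z) notX) (∧-intro Uz (∧-intro e (cong not notX)))) (cong₂ _⊻_ ex notX))) nok))
      Y-lost : ∀ y z → Y y ≡ true → lost rep side U y z ≡ true → irregular u y z ≡ true ⊎ irregular u v z ≡ true ⊎ nonJ v z ≡ true
      Y-lost y z ey l with lost-parts y z l | reg-cases u y z | reg-cases u v z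
      ... | _ | inj₁ i | _ = inj₁ i
      ... | _ | inj₂ _ | inj₁ i = inj₂ (inj₁ i)
      ... | Uz , d , nok | inj₂ r₁ | inj₂ r₂ = inj₂ (inj₂ (trans (nonJ-sym v z) (nonJ-intro z v dzv notJ)))
        where
        zu : D z u ≡ false × D u z ≡ false
        zu = regular-dbl₂ {D z u} {D u z} {D z y} {D y z} r₁ (trans (dbl-sym D z y) d)
        dzv : dbl D z v ≡ true
        dzv = regular-non₁ {D z u} {D u z} {D z v} {D v z} r₂ (proj₁ zu) (proj₂ zu)
        notXy : X y ≡ false
        notXy = not-true (proj₂ (∧-true {J u y} (proj₂ (∧-true {U y} ey))))
        Cy : C y ≡ true
        Cy = trans (cong (_∨ Y y) notXy) ey
        notJ : J z v ≡ false
        notJ = ¬true⇒false (λ e → true≢false (trans (sym (OK-intro y z Cy (cong (_∨ Y z) (Xz e)) (cong₂ _⊻_ notXy (Xz e)))) nok))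
          where
          Xz : J z v ≡ true → X z ≡ true
          Xz e = ∧-intro Uz e
      three : ∀ {a b c} → Z * a ≤ n → Z * b ≤ n → Z * c ≤ n → Z * (a + (b + c)) ≤ 3 * n
      three {a} {b} {c} p q r = lin 0 (+-mono-≤ p (+-mono-≤ q r)) (eq Z a b c n)
        where
        eq : ∀ Z a b c n → Z * (a + (b + c)) + (n + (n + n)) + 0 ≡ 3 * n + (Z * a + (Z * b + Z * c))
        eq = solve-∀
      J-small : ∀ a b → J a b ≡ true → Z * ε a b ≤ n
      J-small a b j = ≤ᵇ-sound (proj₂ (∧-true {dbl D a b} j))
      lost-row : ∀ x → C x ≡ true → Z * size (lost rep side U x) ≤ 3 * n
      lost-row x e with C-cases x e
      ... | inj₁ ex = ≤-trans (*-monoʳ-≤ Z (≤-trans (∑-mono (λ z → cover₃ (lost rep side U x z) (X-lost x z ex))) (≤-reflexive (trans (∑-+ _ _) (cong (ε x v +_) (∑-+ _ _))))))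
                        (three {ε x v} {ε u v} {size (nonJ u)} (J-small x v (J-of-X ex)) (J-small u v Juv) (≤ᵇ-sound (proj₁ (∧-true cleans))))
      ... | inj₂ ey = ≤-trans (*-monoʳ-≤ Z (≤-trans (∑-mono (λ z → cover₃ (lost rep side U x z) (Y-lost x z ey))) (≤-reflexive (trans (∑-+ _ _) (cong (ε u x +_) (∑-+ _ _))))))
                        (three {ε u x} {ε u v} {size (nonJ v)} (J-small u x (J-of-Y ey)) (J-small u v Juv) (≤ᵇ-sound (proj₂ (∧-true {clean u} cleans))))
      lostC : ℕ
      lostC = ∑ (λ x → ⟦ C x ⟧ * size (lost rep side U x))
      C⊆U : ∀ x → C x ≡ true → U x ≡ true
      C⊆U x e with C-cases x e
      ... | inj₁ q = proj₁ (∧-true q)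
      ... | inj₂ q = proj₁ (∧-true q)
      lostC≤ : Z * lostC ≤ 3 * (size C * n)
      lostC≤ = ≤-trans (≤-reflexive (sym (∑-*ˡ Z _))) (≤-trans (∑-mono point) (≤-reflexive (trans (∑-*ʳ (3 * n) _) (eq (size C) n))))
        where
        eq : ∀ c n → c * (3 * n) ≡ 3 * (c * n)
        eq = solve-∀
        point : ∀ x → Z * (⟦ C x ⟧ * size (lost rep side U x)) ≤ ⟦ C x ⟧ * (3 * n)
        point x = go (C x) refl
          where
          go : ∀ b → C x ≡ b → Z * (⟦ b ⟧ * size (lost rep side U x)) ≤ ⟦ b ⟧ * (3 * n)
          go false e = ≤-reflexive (*-zeroʳ Z)
          go true e = ≤-trans (≤-reflexive (cong (Z *_) (+-identityʳ (size (lost rep side U x))))) (≤-trans (lost-row x e) (≤-reflexive (sym (+-identityʳ (3 * n)))))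
      split : #lost rep side U ≤ #lost c.rep c.side U′ + (lostC + lostC)
      split = ≤-trans (∑∑-mono point) (≤-reflexive (trans (∑∑-+ _ _) (cong (#lost c.rep c.side U′ +_) (trans (∑∑-+ _ _) (cong₂ _+_ rows (trans (∑-swap _) rows))))))
        where
        rows : ∑ (λ x → ∑ (λ y → ⟦ C x ⟧ * ⟦ lost rep side U x y ⟧)) ≡ lostC
        rows = ∑-cong (λ x → ∑-*ˡ ⟦ C x ⟧ _)
        point : ∀ x y → ⟦ U x ∧ lost rep side U x y ⟧ ≤ ⟦ U′ x ∧ lost c.rep c.side U′ x y ⟧ + (⟦ C x ⟧ * ⟦ lost rep side U x y ⟧ + ⟦ C y ⟧ * ⟦ lost rep side U y x ⟧)
        point x y = go (C x) (C y) refl refl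
          where
          go : ∀ a b → C x ≡ a → C y ≡ b → ⟦ U x ∧ lost rep side U x y ⟧ ≤ ⟦ (U x ∧ not a) ∧ ((U y ∧ not b) ∧ (J₂ x y ∧ not (OK c.rep c.side x y))) ⟧ + (⟦ a ⟧ * ⟦ lost rep side U x y ⟧ + ⟦ b ⟧ * ⟦ lost rep side U y x ⟧)
          go true b ex ey = ≤-trans (leq {⟦ U x ∧ lost rep side U x y ⟧} {⟦ lost rep side U x y ⟧ + 0} (taut 2 (λ a b → ⟦ a ∧ b ⟧ ≤ᵇ ⟦ b ⟧ + 0) tt (U x) (lost rep side U x y))) (≤-trans (m≤m+n _ (⟦ b ⟧ * ⟦ lost rep side U y x ⟧)) (m≤n+m _ ⟦ (U x ∧ false) ∧ ((U y ∧ not b) ∧ (J₂ x y ∧ not (OK c.rep c.side x y))) ⟧))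
          go false true ex ey = ≤-trans (≤-trans (leq {⟦ U x ∧ (U y ∧ (J₂ x y ∧ not (OK rep side x y))) ⟧} {⟦ U x ∧ (J₂ x y ∧ not (OK rep side x y)) ⟧} (taut 3 (λ a b c → ⟦ a ∧ (b ∧ c) ⟧ ≤ᵇ ⟦ a ∧ c ⟧) tt (U x) (U y) (J₂ x y ∧ not (OK rep side x y)))) (≤-reflexive (trans (cong₂ (λ a b → ⟦ U x ∧ (a ∧ not b) ⟧) (J₂-sym x y) (OK-sym rep side x y)) (sym (+-identityʳ _))))) (m≤n+m _ ⟦ (U x ∧ true) ∧ ((U y ∧ false) ∧ (J₂ x y ∧ not (OK c.rep c.side x y))) ⟧)
          go false false ex ey = ≤-trans (≤-reflexive (cong ⟦_⟧ (trans (cong (λ o → U x ∧ (U y ∧ (J₂ x y ∧ not o))) same) (cong₂ (λ a b → a ∧ (b ∧ (J₂ x y ∧ not (OK c.rep c.side x y)))) (pad (U x)) (pad (U y)))))) (m≤m+n _ _)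
            where
            pad : ∀ a → a ≡ a ∧ true
            pad true = refl
            pad false = refl
            same : OK rep side x y ≡ OK c.rep c.side x y
            same rewrite ex | ey = refl
      sizes : size U′ + size C ≡ size U
      sizes = trans (sym (∑-+ _ _)) (∑-cong (λ x → go (U x) (C x) (C⊆U x)))
        where
        go : ∀ a b → (b ≡ true → a ≡ true) → ⟦ a ∧ not b ⟧ + ⟦ b ⟧ ≡ ⟦ a ⟧
        go true true h = refl
        go true false h = refl
        go false true h = contradiction (h refl) λ ()
        go false false h = refl
      -- A removed vertex loses at most 3n / Z partners, and each lost pair may be counted from
      -- either end, whence 6.
      few-lost : Z * #lost rep side U ≤ 6 * (size U * n)
      few-lost = lin 0 (+-mono-≤ (+-mono-≤ (*-monoʳ-≤ Z split) c.few-lost) (*-monoʳ-≤ 2 lostC≤)) (subst (λ s → Z * #lost rep side U + (Z * (#lost c.rep c.side U′ + (lostC + lostC)) + 6 * (size U′ * n) + 2 * (3 * (size C * n))) + 0 ≡ 6 * (s * n) + (Z * #lost rep side U + Z * #lost c.rep c.side U′ + 2 * (Z * lostC))) sizes (eq Z (#lost rep side U) (#lost c.rep c.side U′) lostC (size U′) (size C) n))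
        where
        eq : ∀ Z l l′ c u s n → Z * l + (Z * (l′ + (c + c)) + 6 * (u * n) + 2 * (3 * (s * n))) + 0 ≡ 6 * ((u + s) * n) + (Z * l + Z * l′ + 2 * (Z * c))
        eq = solve-∀

    classes : ∀ c (U : Fin n → Bool) → size U ≤ c → ¬ ¬ Classes U
    classes c U b = classical (∃ λ u → ∃ λ v → U u ≡ true × U v ≡ true × J₂ u v ≡ true) >>= λ
      -- No seed is left: singleton classes lose nothing, since every pair of the remaining set is
      -- outside `J₂`.
      { (inj₂ none) → return (record { rep = id ; side = λ _ → true ; above = λ x → m≤m+n _ _ ; below = λ x → m≤m+n _ _
          ; few-lost = ≤-trans (≤-reflexive (trans (cong (Z *_) (trans (∑-cong (λ x → trans (∑-cong (λ y → cong ⟦_⟧ (vanish none x y))) (∑-zero n))) (∑-zero n))) (*-zeroʳ Z))) z≤n })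
      ; (inj₁ (u , v , Uu , Uv , j)) → step c b u v Uu Uv j }
      where
      vanish : ¬ (∃ λ u → ∃ λ v → U u ≡ true × U v ≡ true × J₂ u v ≡ true) → ∀ x y → U x ∧ lost id (λ _ → true) U x y ≡ false
      vanish none x y with U x in ux | U y in uy | J₂ x y in j
      ... | false | _ | _ = refl
      ... | true | false | _ = refl
      ... | true | true | false = refl
      ... | true | true | true = ⊥-elim (none (x , y , ux , uy , j))
      step : ∀ c → size U ≤ c → ∀ u v → U u ≡ true → U v ≡ true → J₂ u v ≡ true → ¬ ¬ Classes U
      step c b u v Uu Uv j = go c b
        where
        X Y U′ : Fin n → Bool
        X x = U x ∧ J x v
        Y y = U y ∧ (J u y ∧ not (X y))
        U′ x = U x ∧ not (X x ∨ Y x)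
        -- The seed vertex u belongs to X, because uv itself is good.
        smaller : size U′ < size U
        smaller = ≤-trans (≤-reflexive (trans (+-comm 1 (size U′)) (trans (cong (size U′ +_) (sym (∑-δ′ u))) (sym (∑-+ _ _))))) (∑-mono point)
          where
          point : ∀ w → ⟦ U′ w ⟧ + δ w u ≤ ⟦ U w ⟧
          point w with w FP.≟ u
          ... | no _ = ≤-trans (≤-reflexive (+-identityʳ _)) (leq (taut 2 (λ a b → ⟦ a ∧ b ⟧ ≤ᵇ ⟦ a ⟧) tt (U w) (not (X w ∨ Y w))))
          ... | yes refl rewrite Uu | proj₁ (∧-true {J w v} j) = ≤-refl
        go : ∀ c → size U ≤ c → ¬ ¬ Classes U
        go zero b = ⊥-elim (<⇒≱ (≤-trans (s≤s z≤n) smaller) b)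
        go (suc c) b = classes c U′ (≤-pred (≤-trans smaller b)) >>= λ r → return (extend U u v Uu Uv j r)

-- Balancing and blow-ups

rankIn : ∀ {n} → (Fin n → Bool) → Fin n → ℕ
rankIn S x = ∑ (λ w → ⟦ S w ∧ (toℕ w <ᵇ toℕ x) ⟧)

-- The ranks of the members of S are 0, ..., |S| - 1, each taken once.
count-rank : ∀ {n} (S : Fin n → Bool) r → ∑ (λ x → ⟦ S x ∧ (r ≤ᵇ rankIn S x) ⟧) ≡ size S ∸ r
count-rank {zero} S r = trans (∑-empty _) (sym (trans (cong (_∸ r) (∑-empty _)) (0∸n≡0 r)))
count-rank {suc n} S r = trans (∑-suc _) (trans (cong₂ _+_ (cong (λ k → ⟦ S zero ∧ (r ≤ᵇ k) ⟧) rank0) (∑-cong (λ x → cong (λ k → ⟦ S (suc x) ∧ (r ≤ᵇ k) ⟧) (rankSuc x)))) (trans (go (S zero) r) (cong (_∸ r) (sym (∑-suc _)))))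
  where
  ∧-false : ∀ a → a ∧ false ≡ false
  ∧-false true = refl
  ∧-false false = refl
  ∧-true′ : ∀ a → a ∧ true ≡ a
  ∧-true′ true = refl
  ∧-true′ false = refl
  rank0 : rankIn S zero ≡ 0
  rank0 = trans (∑-cong (λ w → cong ⟦_⟧ (∧-false (S w)))) (∑-zero (suc n))
  rankSuc : ∀ x → rankIn S (suc x) ≡ ⟦ S zero ⟧ + rankIn (S ∘ suc) x
  rankSuc x = trans (∑-suc _) (cong (_+ rankIn (S ∘ suc) x) (cong ⟦_⟧ (∧-true′ (S zero))))
  go : ∀ a r → ⟦ a ∧ (r ≤ᵇ 0) ⟧ + ∑ (λ x → ⟦ S (suc x) ∧ (r ≤ᵇ ⟦ a ⟧ + rankIn (S ∘ suc) x) ⟧) ≡ (⟦ a ⟧ + size (S ∘ suc)) ∸ r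
  go false r = count-rank (S ∘ suc) r
  go true zero = cong suc (∑-cong (λ x → cong ⟦_⟧ (∧-true′ (S (suc x)))))
  go true (suc zero) = count-rank (S ∘ suc) zero
  go true (suc (suc r)) = count-rank (S ∘ suc) (suc r)

eqᵇ-sound : ∀ {n} {x y : Fin n} → eqᵇ x y ≡ true → x ≡ y
eqᵇ-sound {x = x} {y} e with x FP.≟ y
... | yes p = p

eqᵇ-complete : ∀ {n} {x y : Fin n} → eqᵇ x y ≡ false → x ≢ y
eqᵇ-complete {x = x} {y} e p = true≢false (trans (sym (eqᵇ-refl p)) e)

⊻-diff : ∀ {a b} → (a ⊻ b) ≡ true → a ≢ b
⊻-diff {true} {false} _ ()
⊻-diff {false} {true} _ ()

diff-⊻ : ∀ {a b} → a ≢ b → (a ⊻ b) ≡ true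
diff-⊻ {true} {true} h = contradiction refl h
diff-⊻ {true} {false} h = refl
diff-⊻ {false} {true} h = refl
diff-⊻ {false} {false} h = contradiction refl h

matrix : ∀ {n} → (Fin n → Fin n → Bool) → Mat n
matrix D = tabulate (λ x → tabulate (D x))

edge-matrix : ∀ {n} (D : Fin n → Fin n → Bool) x y → edge (matrix D) x y ≡ D x y
edge-matrix D x y = trans (cong (λ r → lookup r y) (lookup∘tabulate (λ x → tabulate (D x)) x)) (lookup∘tabulate (D x) y)

length-filter-allFin : ∀ {n} {P : Fin n → Set} (P? : ∀ x → Dec (P x)) → length (filter P? (allFin n)) ≡ ∑ (λ x → ⟦ does (P? x) ⟧)
length-filter-allFin P? = go id P?
  where
  go : ∀ {m n} {P : Fin n → Set} (f : Fin m → Fin n) (P? : ∀ x → Dec (P x)) → length (filter P? (List.tabulate f)) ≡ ∑ (λ x → ⟦ does (P? (f x)) ⟧)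
  go {zero} f P? = sym (∑-empty _)
  go {suc m} f P? with does (P? (f zero)) in e
  ... | true = trans (cong suc (go (f ∘ suc) P?)) (sym (trans (∑-suc _) (cong (λ b → ⟦ b ⟧ + ∑ (λ x → ⟦ does (P? (f (suc x))) ⟧)) e)))
  ... | false = trans (go (f ∘ suc) P?) (sym (trans (∑-suc _) (cong (λ b → ⟦ b ⟧ + ∑ (λ x → ⟦ does (P? (f (suc x))) ⟧)) e)))

module _ {n} (rep : Fin n → Fin n) (side : Fin n → Bool) (level : Fin n → ℕ) where

  halfClass : Fin n → Bool → Fin n → Bool
  halfClass r b x = eqᵇ (rep x) r ∧ not (side x ⊻ b)

  cnt : Fin n → Bool → ℕ
  cnt r b = size (halfClass r b)

  -- The members of the larger half whose rank is at least the size of the smaller half; without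
  -- them the two halves are equally large.
  surplus : Fin n → Bool
  surplus x = cnt (rep x) (not (side x)) ≤ᵇ rankIn (halfClass (rep x) (side x)) x

  halfClass-parts : ∀ {r b x} → halfClass r b x ≡ true → rep x ≡ r × side x ≡ b
  halfClass-parts {r} {b} {x} h with ∧-true {eqᵇ (rep x) r} h
  ... | p , q = eqᵇ-sound p , same q
    where
    same : ∀ {a b} → not (a ⊻ b) ≡ true → a ≡ b
    same {true} {true} _ = refl
    same {false} {false} _ = refl

  surplus-halfClass : ∀ r b → ∑ (λ x → ⟦ halfClass r b x ∧ surplus x ⟧) ≡ cnt r b ∸ cnt r (not b)
  surplus-halfClass r b = trans (∑-cong (λ x → point x (halfClass r b x) refl)) (count-rank (halfClass r b) (cnt r (not b)))
    where
    point : ∀ x c → halfClass r b x ≡ c → ⟦ c ∧ surplus x ⟧ ≡ ⟦ c ∧ (cnt r (not b) ≤ᵇ rankIn (halfClass r b) x) ⟧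
    point x false e = refl
    point x true e with halfClass-parts {r} {b} {x} e
    ... | refl , refl = refl

  gapOf sizeOf : Fin n → ℕ
  gapOf r = (cnt r true ∸ cnt r false) + (cnt r false ∸ cnt r true)
  sizeOf r = ∑ (λ x → ⟦ eqᵇ (rep x) r ⟧)

  surplus-class : ∀ r → ∑ (λ x → ⟦ eqᵇ (rep x) r ∧ surplus x ⟧) ≡ gapOf r
  surplus-class r = trans (∑-cong (λ x → point (eqᵇ (rep x) r) (side x) (surplus x))) (trans (∑-+ _ _) (cong₂ _+_ (surplus-halfClass r true) (surplus-halfClass r false)))
    where
    point : ∀ a s e → ⟦ a ∧ e ⟧ ≡ ⟦ (a ∧ not (s ⊻ true)) ∧ e ⟧ + ⟦ (a ∧ not (s ⊻ false)) ∧ e ⟧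
    point true true true = refl
    point true true false = refl
    point true false true = refl
    point true false false = refl
    point false s e = refl

  fibre : ∀ (g : Fin n → ℕ) → ∑ g ≡ ∑ (λ r → ∑ (λ x → ⟦ eqᵇ (rep x) r ⟧ * g x))
  fibre g = sym (trans (∑-swap _) (∑-cong (λ x → trans (∑-*ʳ (g x) _) (trans (cong (_* g x) (∑-δ″ (rep x))) (+-identityʳ (g x))))))
    where
    ∑-δ″ : ∀ (y : Fin n) → ∑ (λ r → ⟦ eqᵇ y r ⟧) ≡ 1
    ∑-δ″ y = trans (∑-cong (λ r → δ-iff {x = y} {r} {r} {y} sym sym)) (∑-δ′ y)

  surplusPairs : ℕ
  surplusPairs = ∑ (λ x → ∑ (λ y → ⟦ eqᵇ (rep x) (rep y) ∧ surplus x ⟧))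

  surplusPairs-≡ : surplusPairs ≡ ∑ (λ r → gapOf r * sizeOf r)
  surplusPairs-≡ = trans (∑-cong row) (trans (fibre _) (∑-cong class))
    where
    row : ∀ x → ∑ (λ y → ⟦ eqᵇ (rep x) (rep y) ∧ surplus x ⟧) ≡ ⟦ surplus x ⟧ * sizeOf (rep x)
    row x = trans (∑-cong (λ y → trans (⟦∧⟧ (eqᵇ (rep x) (rep y)) (surplus x)) (trans (*-comm _ ⟦ surplus x ⟧) (cong (⟦ surplus x ⟧ *_) (δ-iff {x = rep x} {rep y} {rep y} {rep x} sym sym))))) (∑-*ˡ ⟦ surplus x ⟧ _)
    class : ∀ r → ∑ (λ x → ⟦ eqᵇ (rep x) r ⟧ * (⟦ surplus x ⟧ * sizeOf (rep x))) ≡ gapOf r * sizeOf r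
    class r = trans (∑-cong (λ x → point x (eqᵇ (rep x) r) refl)) (trans (∑-*ʳ (sizeOf r) _) (cong (_* sizeOf r) (surplus-class r)))
      where
      point : ∀ x c → eqᵇ (rep x) r ≡ c → ⟦ c ⟧ * (⟦ surplus x ⟧ * sizeOf (rep x)) ≡ ⟦ c ∧ surplus x ⟧ * sizeOf r
      point x false e = refl
      point x true e = trans (+-identityʳ _) (cong (λ z → ⟦ surplus x ⟧ * sizeOf z) (eqᵇ-sound e))

  imbalance : ℕ
  imbalance = ∑ (λ r → gapOf r * gapOf r)

  -- For a class, 2L * gap * size ≤ L² gap² + size². The sizes add up to n, so their squares add up
  -- to at most n².
  surplusPairs≤ : ∀ L → 2 * L * surplusPairs ≤ L * L * imbalance + n * n
  surplusPairs≤ L = begin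
    2 * L * surplusPairs ≡⟨ cong (2 * L *_) surplusPairs-≡ ⟩
    2 * L * ∑ (λ r → gapOf r * sizeOf r) ≡⟨ sym (∑-*ˡ (2 * L) _) ⟩
    ∑ (λ r → 2 * L * (gapOf r * sizeOf r)) ≤⟨ ∑-mono point ⟩
    ∑ (λ r → L * L * (gapOf r * gapOf r) + n * sizeOf r) ≡⟨ trans (∑-+ _ _) (cong₂ _+_ (∑-*ˡ (L * L) _) (trans (∑-*ˡ n _) (cong (n *_) total))) ⟩
    L * L * imbalance + n * n ∎
    where
    open ≤-Reasoning
    total : ∑ sizeOf ≡ n
    total = trans (∑-cong (λ r → ∑-cong (λ x → sym (*-identityʳ _)))) (trans (sym (fibre (λ _ → 1))) (trans (∑-const n 1) (*-identityʳ n)))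
    eq₁ : ∀ L b s → 2 * L * (b * s) ≡ 2 * (L * b * s)
    eq₁ = solve-∀
    eq₂ : ∀ L b s → L * b * (L * b) + s * s ≡ L * L * (b * b) + s * s
    eq₂ = solve-∀
    point : ∀ r → 2 * L * (gapOf r * sizeOf r) ≤ L * L * (gapOf r * gapOf r) + n * sizeOf r
    point r = ≤-trans (≤-reflexive (eq₁ L (gapOf r) (sizeOf r))) (≤-trans (2ab≤ (L * gapOf r) (sizeOf r)) (≤-trans (≤-reflexive (eq₂ L (gapOf r) (sizeOf r))) (+-monoʳ-≤ (L * L * (gapOf r * gapOf r)) (*-monoˡ-≤ (sizeOf r) (∑-⟦⟧≤ (λ x → eqᵇ (rep x) r))))))

  key : Fin n → ℕ
  key x = level (rep x) * n + toℕ (rep x)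

  -- The blow-up given by the classes before their halves have been made equal.
  rough : Fin n → Fin n → Bool
  rough x y = if eqᵇ (rep x) (rep y) then side x ⊻ side y else key x <ᵇ key y

  rough-deg : ∀ x y → deg rough x y + ⟦ eqᵇ (rep x) (rep y) ∧ not (side x ⊻ side y) ⟧ ≡ 1 + ⟦ eqᵇ (rep x) (rep y) ∧ (side x ⊻ side y) ⟧
  rough-deg x y = go (eqᵇ (rep x) (rep y)) (eqᵇ (rep y) (rep x)) (δ-eq) refl
    where
    δ-eq : eqᵇ (rep x) (rep y) ≡ eqᵇ (rep y) (rep x)
    δ-eq with rep x FP.≟ rep y | rep y FP.≟ rep x
    ... | yes _ | yes _ = refl
    ... | no _ | no _ = refl
    ... | yes p | no q = contradiction (sym p) q
    ... | no q | yes p = contradiction (sym p) q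
    go : ∀ a b → a ≡ b → eqᵇ (rep x) (rep y) ≡ a → ⟦ if a then side x ⊻ side y else key x <ᵇ key y ⟧ + ⟦ if b then side y ⊻ side x else key y <ᵇ key x ⟧ + ⟦ a ∧ not (side x ⊻ side y) ⟧ ≡ 1 + ⟦ a ∧ (side x ⊻ side y) ⟧
    go true true refl e with side x | side y
    ... | true | true = refl
    ... | true | false = refl
    ... | false | true = refl
    ... | false | false = refl
    go false false refl e = trans (+-identityʳ _) (one (key x) (key y) (λ k → eqᵇ-complete e (proj₂ (lex-injective (level (rep x)) (level (rep y)) (rep x) (rep y) k))))
      where
      one : ∀ a b → a ≢ b → ⟦ a <ᵇ b ⟧ + ⟦ b <ᵇ a ⟧ ≡ 1
      one zero zero h = contradiction refl h
      one zero (suc b) h = refl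
      one (suc a) zero h = refl
      one (suc a) (suc b) h = one a b (h ∘ cong suc)

  classPairs : ∀ (P : Bool → Bool → Bool) →
    (∀ r x y → ⟦ eqᵇ (rep x) r ⟧ * (⟦ eqᵇ (rep y) r ⟧ * ⟦ P (side x) (side y) ⟧) ≡ ⟦ halfClass r true x ⟧ * ⟦ halfClass r (P true true) y ⟧ + ⟦ halfClass r false x ⟧ * ⟦ halfClass r (P false true) y ⟧) →
    ∑ (λ x → ∑ (λ y → ⟦ eqᵇ (rep x) (rep y) ∧ P (side x) (side y) ⟧)) ≡ ∑ (λ r → cnt r true * cnt r (P true true) + cnt r false * cnt r (P false true))
  classPairs P h = begin
    ∑ (λ x → ∑ (λ y → ⟦ eqᵇ (rep x) (rep y) ∧ P (side x) (side y) ⟧)) ≡⟨ fibre _ ⟩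
    ∑ (λ r → ∑ (λ x → ⟦ eqᵇ (rep x) r ⟧ * ∑ (λ y → ⟦ eqᵇ (rep x) (rep y) ∧ P (side x) (side y) ⟧))) ≡⟨ ∑-cong (λ r → ∑-cong (λ x → trans (sym (∑-*ˡ ⟦ eqᵇ (rep x) r ⟧ _)) (∑-cong (λ y → trans (point r x y (eqᵇ (rep x) r) refl) (h r x y))))) ⟩
    ∑ (λ r → ∑ (λ x → ∑ (λ y → ⟦ halfClass r true x ⟧ * ⟦ halfClass r (P true true) y ⟧ + ⟦ halfClass r false x ⟧ * ⟦ halfClass r (P false true) y ⟧))) ≡⟨ ∑-cong (λ r → trans (∑∑-+ _ _) (cong₂ _+_ (∑-prod _ _) (∑-prod _ _))) ⟩
    ∑ (λ r → cnt r true * cnt r (P true true) + cnt r false * cnt r (P false true)) ∎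
    where
    open ≡-Reasoning
    point : ∀ r x y c → eqᵇ (rep x) r ≡ c → ⟦ c ⟧ * ⟦ eqᵇ (rep x) (rep y) ∧ P (side x) (side y) ⟧ ≡ ⟦ c ⟧ * (⟦ eqᵇ (rep y) r ⟧ * ⟦ P (side x) (side y) ⟧)
    point r x y false e = refl
    point r x y true e = cong (_+ 0) (trans (⟦∧⟧ (eqᵇ (rep x) (rep y)) (P (side x) (side y))) (cong (_* ⟦ P (side x) (side y) ⟧) (δ-iff {x = rep x} {rep y} {rep y} {r} (λ p → trans (sym p) (eqᵇ-sound e)) (λ p → trans (eqᵇ-sound e) (sym p)))))

  -- A class with halves X and Y has degree sum 4XY, which falls short of (X + Y)² by (X - Y)², and
  -- pairs from different classes contribute exactly one edge. So the loss of degree measures the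
  -- imbalance.
  rough-total : #deg rough + imbalance ≡ n * n
  rough-total = +-cancelʳ-≡ opp _ _ (begin
    #deg rough + imbalance + opp ≡⟨ trans (+-assoc (#deg rough) imbalance opp) (cong (#deg rough +_) (trans (sym (∑-+ _ _)) (∑-cong (λ r → square (cnt r true) (cnt r false))))) ⟩
    #deg rough + same ≡⟨ cong (#deg rough +_) (sym same-≡) ⟩
    #deg rough + ∑ (λ x → ∑ (λ y → ⟦ eqᵇ (rep x) (rep y) ∧ not (side x ⊻ side y) ⟧)) ≡⟨ sym (∑∑-+ _ _) ⟩
    ∑ (λ x → ∑ (λ y → deg rough x y + ⟦ eqᵇ (rep x) (rep y) ∧ not (side x ⊻ side y) ⟧)) ≡⟨ ∑∑-cong rough-deg ⟩
    ∑ (λ x → ∑ (λ y → 1 + ⟦ eqᵇ (rep x) (rep y) ∧ (side x ⊻ side y) ⟧)) ≡⟨ trans (∑∑-+ _ _) (cong₂ _+_ (trans (∑-const n _) (cong (n *_) (trans (∑-const n 1) (*-identityʳ n)))) opp-≡) ⟩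
    n * n + opp ∎)
    where
    open ≡-Reasoning
    opp same : ℕ
    opp = ∑ (λ r → cnt r true * cnt r false + cnt r false * cnt r true)
    same = ∑ (λ r → cnt r true * cnt r true + cnt r false * cnt r false)
    same-≡ : ∑ (λ x → ∑ (λ y → ⟦ eqᵇ (rep x) (rep y) ∧ not (side x ⊻ side y) ⟧)) ≡ same
    same-≡ = classPairs (λ a b → not (a ⊻ b)) (λ r x y → point (eqᵇ (rep x) r) (eqᵇ (rep y) r) (side x) (side y))
      where
      point : ∀ a b s t → ⟦ a ⟧ * (⟦ b ⟧ * ⟦ not (s ⊻ t) ⟧) ≡ ⟦ a ∧ not (s ⊻ true) ⟧ * ⟦ b ∧ not (t ⊻ true) ⟧ + ⟦ a ∧ not (s ⊻ false) ⟧ * ⟦ b ∧ not (t ⊻ false) ⟧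
      point a b s t = ≡ᵇ⇒≡ _ _ (taut 4 (λ a b s t → (⟦ a ⟧ * (⟦ b ⟧ * ⟦ not (s ⊻ t) ⟧)) ≡ᵇ (⟦ a ∧ not (s ⊻ true) ⟧ * ⟦ b ∧ not (t ⊻ true) ⟧ + ⟦ a ∧ not (s ⊻ false) ⟧ * ⟦ b ∧ not (t ⊻ false) ⟧)) tt a b s t)
    opp-≡ : ∑ (λ x → ∑ (λ y → ⟦ eqᵇ (rep x) (rep y) ∧ (side x ⊻ side y) ⟧)) ≡ opp
    opp-≡ = classPairs _⊻_ (λ r x y → point (eqᵇ (rep x) r) (eqᵇ (rep y) r) (side x) (side y))
      where
      point : ∀ a b s t → ⟦ a ⟧ * (⟦ b ⟧ * ⟦ s ⊻ t ⟧) ≡ ⟦ a ∧ not (s ⊻ true) ⟧ * ⟦ b ∧ not (t ⊻ false) ⟧ + ⟦ a ∧ not (s ⊻ false) ⟧ * ⟦ b ∧ not (t ⊻ true) ⟧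
      point a b s t = ≡ᵇ⇒≡ _ _ (taut 4 (λ a b s t → (⟦ a ⟧ * (⟦ b ⟧ * ⟦ s ⊻ t ⟧)) ≡ᵇ (⟦ a ∧ not (s ⊻ true) ⟧ * ⟦ b ∧ not (t ⊻ false) ⟧ + ⟦ a ∧ not (s ⊻ false) ⟧ * ⟦ b ∧ not (t ⊻ true) ⟧)) tt a b s t)
    square : ∀ X Y → ((X ∸ Y) + (Y ∸ X)) * ((X ∸ Y) + (Y ∸ X)) + (X * Y + Y * X) ≡ X * X + Y * Y
    square X Y with ≤-total X Y
    ... | inj₁ le = subst (λ Y → ((X ∸ Y) + (Y ∸ X)) * ((X ∸ Y) + (Y ∸ X)) + (X * Y + Y * X) ≡ X * X + Y * Y) (m+[n∸m]≡n le) (go X (Y ∸ X))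
      where
      go : ∀ X d → ((X ∸ (X + d)) + (X + d ∸ X)) * ((X ∸ (X + d)) + (X + d ∸ X)) + (X * (X + d) + (X + d) * X) ≡ X * X + (X + d) * (X + d)
      go X d rewrite m≤n⇒m∸n≡0 (m≤m+n X d) | m+n∸m≡n X d = eq X d
        where
        eq : ∀ X d → d * d + (X * (X + d) + (X + d) * X) ≡ X * X + (X + d) * (X + d)
        eq = solve-∀
    ... | inj₂ le = subst (λ X → ((X ∸ Y) + (Y ∸ X)) * ((X ∸ Y) + (Y ∸ X)) + (X * Y + Y * X) ≡ X * X + Y * Y) (m+[n∸m]≡n le) (go Y (X ∸ Y))
      where
      go : ∀ Y d → ((Y + d ∸ Y) + (Y ∸ (Y + d))) * ((Y + d ∸ Y) + (Y ∸ (Y + d))) + ((Y + d) * Y + Y * (Y + d)) ≡ (Y + d) * (Y + d) + Y * Y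
      go Y d rewrite m≤n⇒m∸n≡0 (m≤m+n Y d) | m+n∸m≡n Y d = eq Y d
        where
        eq : ∀ Y d → (d + 0) * (d + 0) + ((Y + d) * Y + Y * (Y + d)) ≡ (Y + d) * (Y + d) + Y * Y
        eq = solve-∀

module _ {n} (rep : Fin n → Fin n) (side : Fin n → Bool) (level : Fin n → ℕ) where

  private
    sur = surplus rep side level
    key₀ = key rep side level
    cnt₀ = cnt rep side level

  -- The value 0 is shared by the vertices that stay in their class, and every surplus vertex gets a
  -- positive value of its own.
  offset : Fin n → Fin (suc n)
  offset x = if sur x then suc x else zero

  -- surplus vertices become singleton parts placed directly after their class
  key′ : Fin n → ℕ
  key′ x = key₀ x * suc n + toℕ (offset x)

  part : Fin n → Fin n
  part = rankFin key′

  balanced : Fin n → Fin n → Bool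
  balanced x y = if eqᵇ (part x) (part y) then side x ⊻ side y else toℕ (part x) <ᵇ toℕ (part y)

  rough-key : ∀ x y → key₀ x < key₀ y → key′ x < key′ y
  rough-key x y lt = ≤-trans (+-monoʳ-< (key₀ x * suc n) (FP.toℕ<n (offset x))) (≤-trans (≤-trans (≤-reflexive (+-comm (key₀ x * suc n) (suc n))) (*-monoˡ-≤ (suc n) lt)) (m≤m+n _ (toℕ (offset y))))

  part-key : ∀ {x y} → key′ x ≡ key′ y → part x ≡ part y
  part-key {x} {y} e = FP.toℕ-injective (≤-antisym (≮⇒≥ (λ lt → <⇒≢ (rankFin-< key′ y x lt) (sym e))) (≮⇒≥ (λ lt → <⇒≢ (rankFin-< key′ x y lt) e)))

  part-≡ : ∀ {x y} → part x ≡ part y → rep x ≡ rep y × offset x ≡ offset y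
  part-≡ {x} {y} e with lex-injective (key₀ x) (key₀ y) (offset x) (offset y) (rankFin-≡ key′ x y e)
  ... | k , o = proj₂ (lex-injective (level (rep x)) (level (rep y)) (rep x) (rep y) k) , o

  rough⇒balanced : ∀ x y → ⟦ rough rep side level x y ∧ not (balanced x y) ⟧ ≤ ⟦ eqᵇ (rep x) (rep y) ∧ sur x ⟧ + ⟦ eqᵇ (rep x) (rep y) ∧ sur y ⟧
  rough⇒balanced x y = go (eqᵇ (rep x) (rep y)) refl
    where
    kill : ∀ a b → (a ≡ true → b ≡ true) → ∀ {m} → ⟦ a ∧ not b ⟧ ≤ m
    kill false b h = z≤n
    kill true b h rewrite h refl = z≤n
    go : ∀ c → eqᵇ (rep x) (rep y) ≡ c → ⟦ (if c then side x ⊻ side y else key₀ x <ᵇ key₀ y) ∧ not (balanced x y) ⟧ ≤ ⟦ c ∧ sur x ⟧ + ⟦ c ∧ sur y ⟧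
    go false e = kill (key₀ x <ᵇ key₀ y) (balanced x y) λ lt → less (<-rankFin key′ x y (rough-key x y (<ᵇ⇒< _ _ (Equivalence.from T-≡ lt))))
      where
      less : toℕ (part x) < toℕ (part y) → balanced x y ≡ true
      less lt with part x FP.≟ part y
      ... | yes p = contradiction (cong toℕ p) (<⇒≢ lt)
      ... | no _ = <ᵇ-true lt
    go true e = both (sur x) (sur y) refl refl
      where
      both : ∀ a b → sur x ≡ a → sur y ≡ b → ⟦ (side x ⊻ side y) ∧ not (balanced x y) ⟧ ≤ ⟦ a ⟧ + ⟦ b ⟧
      both true b _ _ = ≤-trans (⟦⟧≤1 _) (m≤m+n 1 ⟦ b ⟧)
      both false true _ _ = ⟦⟧≤1 _
      both false false ex ey = kill (side x ⊻ side y) (balanced x y) λ d → same d (part-key (cong₂ (λ k o → k * suc n + toℕ o) (cong (λ r → level r * n + toℕ r) (eqᵇ-sound e)) off))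
        where
        off : offset x ≡ offset y
        off = trans (cong (λ b → if b then suc x else zero) ex) (sym (cong (λ b → if b then suc y else zero) ey))
        same : (side x ⊻ side y) ≡ true → part x ≡ part y → balanced x y ≡ true
        same d p with part x FP.≟ part y
        ... | yes _ = d
        ... | no q = contradiction p q

  blowUp : Mat n
  blowUp = matrix balanced

  blowUp-edge : ∀ x y → Edge blowUp x y → balanced x y ≡ true
  blowUp-edge x y e = trans (sym (edge-matrix balanced x y)) e

  edge-blowUp : ∀ x y → balanced x y ≡ true → Edge blowUp x y
  edge-blowUp x y e = trans (edge-matrix balanced x y) e

  isBlowUp : IsTransitiveBipartiteBlowUp blowUp
  isBlowUp = part , side , counts , inside , forward , noBackward
    where
    inside : ∀ u v → part u ≡ part v → (Edge blowUp u v ⇔ side u ≢ side v)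
    inside u v p = mk⇔ (λ e → ⊻-diff (trans (sym bal) (blowUp-edge u v e))) (λ d → edge-blowUp u v (trans bal (diff-⊻ d)))
      where
      bal : balanced u v ≡ (side u ⊻ side v)
      bal rewrite eqᵇ-refl p = refl
    forward : ∀ u v → toℕ (part u) < toℕ (part v) → Edge blowUp u v
    forward u v lt = edge-blowUp u v bal
      where
      bal : balanced u v ≡ true
      bal with part u FP.≟ part v
      ... | yes p = contradiction (cong toℕ p) (<⇒≢ lt)
      ... | no _ = <ᵇ-true lt
    noBackward : ∀ u v → toℕ (part v) < toℕ (part u) → ¬ Edge blowUp u v
    noBackward u v lt e with part u FP.≟ part v | blowUp-edge u v e
    ... | yes p | _ = contradiction (cong toℕ (sym p)) (<⇒≢ lt)
    ... | no _ | b = <-asym lt (<ᵇ⇒< _ _ (Equivalence.from T-≡ b))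
    count-≡ : ∀ p b → classCount part side p b ≡ ∑ (λ x → ⟦ eqᵇ (part x) p ∧ not (side x ⊻ b) ⟧)
    count-≡ p b = trans (length-filter-allFin (λ v → (part v FP.≟ p) ×-dec (side v Bool.≟ b))) (∑-cong (λ x → cong (λ c → ⟦ eqᵇ (part x) p ∧ c ⟧) (same (side x) b)))
      where
      same : ∀ a b → does (a Bool.≟ b) ≡ not (a ⊻ b)
      same true true = refl
      same true false = refl
      same false true = refl
      same false false = refl
    counts : ∀ p → (classCount part side p true + classCount part side p false ≤ 1) ⊎ (classCount part side p true ≡ classCount part side p false)
    counts p with FP.any? (λ v → part v FP.≟ p)
    ... | no none = inj₁ (≤-trans (≤-reflexive (cong₂ _+_ (trans (count-≡ p true) (empty true)) (trans (count-≡ p false) (empty false)))) z≤n)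
      where
      empty : ∀ b → ∑ (λ x → ⟦ eqᵇ (part x) p ∧ not (side x ⊻ b) ⟧) ≡ 0
      empty b = trans (∑-cong (λ x → cong (λ c → ⟦ c ∧ not (side x ⊻ b) ⟧) (¬true⇒false (λ e → none (x , eqᵇ-sound e))))) (∑-zero n)
    ... | yes (v , refl) = go (sur v) refl
      where
      point : ∀ a s → ⟦ a ∧ not (s ⊻ true) ⟧ + ⟦ a ∧ not (s ⊻ false) ⟧ ≡ ⟦ a ⟧
      point true true = refl
      point true false = refl
      point false s = refl
      go : ∀ c → sur v ≡ c → (classCount part side (part v) true + classCount part side (part v) false ≤ 1) ⊎ (classCount part side (part v) true ≡ classCount part side (part v) false)
      go true e = inj₁ (≤-trans (≤-reflexive (trans (cong₂ _+_ (count-≡ (part v) true) (count-≡ (part v) false)) (trans (sym (∑-+ _ _)) (∑-cong (λ x → point (eqᵇ (part x) (part v)) (side x)))))) (≤-trans (∑-mono single) (≤-reflexive (∑-δ′ v))))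
        where
        single : ∀ x → ⟦ eqᵇ (part x) (part v) ⟧ ≤ δ x v
        single x with eqᵇ (part x) (part v) in q
        ... | false = z≤n
        ... | true = ≤-reflexive (sym (δ-true x≡v))
          where
          x≡v : x ≡ v
          x≡v with sur x | trans (proj₂ (part-≡ (eqᵇ-sound q))) (cong (λ b → if b then suc v else zero) e)
          ... | true | refl = refl
      go false e = inj₂ (trans (kept true) (trans (min-sym (cnt₀ (rep v) true) (cnt₀ (rep v) false)) (sym (kept false))))
        where
        -- After the surplus has been removed, both halves have the size of the smaller one.
        min-sym : ∀ X Y → X ∸ (X ∸ Y) ≡ Y ∸ (Y ∸ X)
        min-sym X Y with ≤-total X Y
        ... | inj₁ le = trans (cong (X ∸_) (m≤n⇒m∸n≡0 le)) (sym (m∸[m∸n]≡n le))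
        ... | inj₂ le = trans (m∸[m∸n]≡n le) (sym (cong (Y ∸_) (m≤n⇒m∸n≡0 le)))
        member : ∀ x → eqᵇ (part x) (part v) ≡ (eqᵇ (rep x) (rep v) ∧ not (sur x))
        member x with eqᵇ (part x) (part v) in q
        ... | true = sym (∧-intro (eqᵇ-refl (proj₁ (part-≡ (eqᵇ-sound q)))) (cong not (¬true⇒false λ s → contradiction (trans (sym (cong (λ b → if b then suc x else zero) s)) (trans (proj₂ (part-≡ (eqᵇ-sound q))) (cong (λ b → if b then suc v else zero) e))) λ ())))
        ... | false = sym (¬true⇒false λ h → eqᵇ-complete q (part-key (cong₂ (λ k o → k * suc n + toℕ o) (cong (λ r → level r * n + toℕ r) (eqᵇ-sound (proj₁ (∧-true h)))) (trans (cong (λ b → if b then suc x else zero) (not-true (proj₂ (∧-true {eqᵇ (rep x) (rep v)} h)))) (sym (cong (λ b → if b then suc v else zero) e))))))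
        kept : ∀ b → classCount part side (part v) b ≡ cnt₀ (rep v) b ∸ (cnt₀ (rep v) b ∸ cnt₀ (rep v) (not b))
        kept b = trans (count-≡ (part v) b) (trans (sym (m+n∸n≡m _ (cnt₀ (rep v) b ∸ cnt₀ (rep v) (not b)))) (cong (_∸ (cnt₀ (rep v) b ∸ cnt₀ (rep v) (not b))) (trans (cong (∑ (λ x → ⟦ eqᵇ (part x) (part v) ∧ not (side x ⊻ b) ⟧) +_) (sym (surplus-halfClass rep side level (rep v) b))) (trans (sym (∑-+ _ _)) (∑-cong total)))))
          where
          total : ∀ x → ⟦ eqᵇ (part x) (part v) ∧ not (side x ⊻ b) ⟧ + ⟦ halfClass rep side level (rep v) b x ∧ sur x ⟧ ≡ ⟦ halfClass rep side level (rep v) b x ⟧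
          total x = trans (cong (λ c → ⟦ c ∧ not (side x ⊻ b) ⟧ + ⟦ halfClass rep side level (rep v) b x ∧ sur x ⟧) (member x)) (pt (eqᵇ (rep x) (rep v)) (sur x) (not (side x ⊻ b)))
            where
            pt : ∀ a s c → ⟦ (a ∧ not s) ∧ c ⟧ + ⟦ (a ∧ c) ∧ s ⟧ ≡ ⟦ a ∧ c ⟧
            pt a s c = ≡ᵇ⇒≡ _ _ (taut 3 (λ a s c → (⟦ (a ∧ not s) ∧ c ⟧ + ⟦ (a ∧ c) ∧ s ⟧) ≡ᵇ ⟦ a ∧ c ⟧) tt a s c)

intersect : ∀ {n} → Mat n → (Fin n → Fin n → Bool) → Mat n
intersect G H = matrix (λ x y → edge G x y ∧ H x y)

-- Passing to the intersection only deletes edges, so a reversal never occurs and each deleted edge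
-- is charged once at its unordered pair.
changes-intersect : ∀ {n} (G : Mat n) (H : Fin n → Fin n → Bool) → changes G (intersect G H) ≤ ∑ (λ x → ∑ (λ y → ⟦ edge G x y ∧ not (H x y) ⟧))
changes-intersect {n} G H = begin
  changes G (intersect G H) ≡⟨ trans (sum-allFin _) (∑-cong (λ i → sum-allFin _)) ⟩
  ∑ (λ i → ∑ (λ j → if toℕ i <ᵇ toℕ j then pairCost (edge G i j) (edge G j i) (edge (intersect G H) i j) (edge (intersect G H) j i) else 0)) ≤⟨ ∑∑-mono point ⟩
  ∑ (λ i → ∑ (λ j → ⟦ toℕ i <ᵇ toℕ j ⟧ * r i j + ⟦ toℕ i <ᵇ toℕ j ⟧ * r j i)) ≡⟨ trans (∑∑-+ _ _) (cong (∑ (λ i → ∑ (λ j → ⟦ toℕ i <ᵇ toℕ j ⟧ * r i j)) +_) (∑-swap _)) ⟩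
  ∑ (λ i → ∑ (λ j → ⟦ toℕ i <ᵇ toℕ j ⟧ * r i j)) + ∑ (λ i → ∑ (λ j → ⟦ toℕ j <ᵇ toℕ i ⟧ * r i j)) ≡⟨ sym (∑∑-+ _ _) ⟩
  ∑ (λ i → ∑ (λ j → ⟦ toℕ i <ᵇ toℕ j ⟧ * r i j + ⟦ toℕ j <ᵇ toℕ i ⟧ * r i j)) ≤⟨ ∑∑-mono (λ i j → ≤-trans (≤-reflexive (sym (*-distribʳ-+ (r i j) ⟦ toℕ i <ᵇ toℕ j ⟧ ⟦ toℕ j <ᵇ toℕ i ⟧))) (≤-trans (*-monoˡ-≤ (r i j) (excl (toℕ i) (toℕ j))) (≤-reflexive (+-identityʳ (r i j))))) ⟩
  ∑ (λ i → ∑ (λ j → r i j)) ∎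
  where
  open ≤-Reasoning
  r : Fin n → Fin n → ℕ
  r x y = ⟦ edge G x y ∧ not (H x y) ⟧
  excl : ∀ a b → ⟦ a <ᵇ b ⟧ + ⟦ b <ᵇ a ⟧ ≤ 1
  excl zero zero = z≤n
  excl zero (suc b) = ≤-refl
  excl (suc a) zero = ≤-refl
  excl (suc a) (suc b) = excl a b
  point : ∀ i j → (if toℕ i <ᵇ toℕ j then pairCost (edge G i j) (edge G j i) (edge (intersect G H) i j) (edge (intersect G H) j i) else 0) ≤ ⟦ toℕ i <ᵇ toℕ j ⟧ * r i j + ⟦ toℕ i <ᵇ toℕ j ⟧ * r j i
  point i j rewrite edge-matrix (λ x y → edge G x y ∧ H x y) i j | edge-matrix (λ x y → edge G x y ∧ H x y) j i = go (toℕ i <ᵇ toℕ j) (edge G i j) (edge G j i) (H i j) (H j i)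
    where
    go : ∀ c g g′ h h′ → (if c then pairCost g g′ (g ∧ h) (g′ ∧ h′) else 0) ≤ ⟦ c ⟧ * ⟦ g ∧ not h ⟧ + ⟦ c ⟧ * ⟦ g′ ∧ not h′ ⟧
    go false g g′ h h′ = z≤n
    go true true true true true = ≤-refl
    go true true true true false = ≤-refl
    go true true true false true = ≤-refl
    go true true true false false = ≤-refl
    go true true false true h′ = ≤-refl
    go true true false false h′ = ≤-refl
    go true false true h true = ≤-refl
    go true false true h false = ≤-refl
    go true false false h h′ = ≤-refl

-- Near-extremal digraphs and blow-ups

shortfall : ∀ {n} → Digraph n → ℕ
shortfall {n} D = n * n ∸ #deg D

tri-trace : ∀ {n} (D : Digraph n) → tr (pow ⟪ D ⟫ 3) ≡ #tri D
tri-trace D = ∑∑-cong (λ p q → trans (sym (∑-*ˡ ⟦ D p q ⟧ _)) (∑-cong (λ z → trans (cong (λ t → ⟦ D p q ⟧ * (⟦ D q z ⟧ * t)) (·-δ ⟪ D ⟫ z p)) (trans (cong (⟦ D p q ⟧ *_) (sym (⟦∧⟧ (D q z) (D z p)))) (sym (⟦∧⟧ (D p q) (D q z ∧ D z p)))))))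

-- For k = 3 the closed walks are the directed triangles themselves, while `few-tri` needs k ≥ 4.
few-tri′ : ∀ j E → ∃ λ F → ∀ n → 0 < n → (D : Digraph n) → F * tr (pow ⟪ D ⟫ (3 + j)) ≤ n ^ (3 + j) → F * #dtri D ≤ n * (n * n) → F * #deficit D ≤ n * n → E * #tri D ≤ n * (n * n)
few-tri′ zero E = E , λ n n>0 D h _ _ → ≤-trans (≤-reflexive (cong (E *_) (sym (tri-trace D)))) (≤-trans h (≤-reflexive (eq n)))
  where
  eq : ∀ n → n * (n * (n * 1)) ≡ n * (n * n)
  eq = solve-∀
few-tri′ (suc j) E = few-tri j E

-- The degree sum exceeds n² by excess minus deficit; it is nearly bounded by n², so a small deficit
-- makes the excess small.
few-excess : ∀ E → 0 < E → ∀ n → 0 < n → (D : Digraph n) → Loopless D → 16 * (2 * E * (2 * E)) * #dtri D ≤ n * (n * n) → 2 * E * #deficit D ≤ n * n → E * #excess D ≤ n * n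
few-excess E E>0 n n>0 D l t d = *-cancelˡ-≤ 2 (lin 0 (+-mono-≤ (+-mono-≤ total d) (≤-reflexive (cong (2 * E *_) balance))) (eq E (#excess D) (#deg D) (#deficit D) (n * n)))
  where
  total : 2 * E * #deg D ≤ 2 * E * (n * n) + n * n
  total = subst₂ (λ a b → 2 * E * a ≤ 2 * E * (b * b) + n * n) (∑∑-cong (λ x y → +-identityʳ (deg D x y))) (trans (∑-const n 1) (*-identityʳ n)) (deg-total D (2 * E) n>0 l t (λ _ → true))
  balance : n * n + #excess D ≡ #deg D + #deficit D
  balance = trans (cong (_+ #excess D) (sym (∑-const n n))) (trans (sym (∑-+ _ _)) (trans (∑-cong (λ x → m+[n∸m]≡n+[m∸n] n (degree D x))) (∑-+ _ _)))
    where
    m+[n∸m]≡n+[m∸n] : ∀ m n → m + (n ∸ m) ≡ n + (m ∸ n)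
    m+[n∸m]≡n+[m∸n] zero zero = refl
    m+[n∸m]≡n+[m∸n] zero (suc n) = sym (+-identityʳ (suc n))
    m+[n∸m]≡n+[m∸n] (suc m) zero = +-identityʳ (suc m)
    m+[n∸m]≡n+[m∸n] (suc m) (suc n) = cong suc (m+[n∸m]≡n+[m∸n] m n)
  eq : ∀ E x s d N → 2 * (E * x) + ((2 * E * N + N) + N + 2 * E * (s + d)) + 0 ≡ 2 * N + (2 * E * s + 2 * E * d + 2 * E * (N + x))
  eq = solve-∀

record NearExtremal (E : ℕ) {n} (D : Digraph n) : Set where
  field
    tris : E * #tri D ≤ n * (n * n)
    deficits : E * #deficit D ≤ n * n
    excesses : E * #excess D ≤ n * n

near-extremal : ∀ j E → 0 < E → ∃ λ F → ∀ n → F ≤ n → (D : Digraph n) → Loopless D → F * tr (pow ⟪ D ⟫ (3 + j)) ≤ n ^ (3 + j) → F * #dtri D ≤ n * (n * n) → F * shortfall D ≤ n * n → NearExtremal E D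
near-extremal j E E>0 = F , λ n F≤n D l h t s →
  let n>0 = ≤-trans (s≤s z≤n) F≤n
      def = few-deficit D E₂ (s≤s z≤n) (≤-trans 2E₂≤F F≤n) l (weaken K₁≤F t) (≤-trans (≤-trans (*-monoʳ-≤ K (m≤n+m∸n (n * n) (#deg D))) (≤-reflexive (*-distribˡ-+ K (#deg D) (shortfall D)))) (+-monoʳ-≤ (K * #deg D) (weaken K≤F s)))
  in record
    { tris = proj₂ (few-tri′ j E) n n>0 D (weaken F₁≤F h) (weaken F₁≤F t) (weaken F₁≤E₂ def)
    ; deficits = weaken E≤E₂ def
    ; excesses = few-excess E E>0 n n>0 D l (weaken K₂≤F t) (weaken 2E≤E₂ def) }
  where
  F₁ = proj₁ (few-tri′ j E)
  E₂ = suc (F₁ + 2 * E)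
  K = 16 * (E₂ * E₂)
  K₁ = 16 * (K * K)
  K₂ = 16 * (2 * E * (2 * E))
  F = 1 + (2 * E₂ + (K₁ + (K + (K₂ + F₁))))
  weaken : ∀ {a b x N} → a ≤ b → b * x ≤ N → a * x ≤ N
  weaken {x = x} le h = ≤-trans (*-monoˡ-≤ x le) h
  2E₂≤F : 2 * E₂ ≤ F
  2E₂≤F = ≤-trans (m≤m+n (2 * E₂) _) (n≤1+n _)
  K₁≤F : K₁ ≤ F
  K₁≤F = ≤-trans (≤-trans (m≤m+n K₁ _) (m≤n+m _ (2 * E₂))) (n≤1+n _)
  K≤F : K ≤ F
  K≤F = ≤-trans (≤-trans (≤-trans (m≤m+n K _) (m≤n+m _ K₁)) (m≤n+m _ (2 * E₂))) (n≤1+n _)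
  K₂≤F : K₂ ≤ F
  K₂≤F = ≤-trans (≤-trans (≤-trans (≤-trans (m≤m+n K₂ _) (m≤n+m _ K)) (m≤n+m _ K₁)) (m≤n+m _ (2 * E₂))) (n≤1+n _)
  F₁≤F : F₁ ≤ F
  F₁≤F = ≤-trans (≤-trans (≤-trans (≤-trans (m≤n+m F₁ K₂) (m≤n+m _ K)) (m≤n+m _ K₁)) (m≤n+m _ (2 * E₂))) (n≤1+n _)
  F₁≤E₂ : F₁ ≤ E₂
  F₁≤E₂ = ≤-trans (m≤m+n F₁ _) (n≤1+n _)
  2E≤E₂ : 2 * E ≤ E₂
  2E≤E₂ = ≤-trans (m≤n+m (2 * E) F₁) (n≤1+n _)
  E≤E₂ : E ≤ E₂
  E≤E₂ = ≤-trans (m≤m+n E _) 2E≤E₂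

_∖_ : ∀ {n} → Digraph n → Digraph n → ℕ
D ∖ H = ∑ (λ x → ∑ (λ y → ⟦ D x y ∧ not (H x y) ⟧))

∖-triangle : ∀ {n} (D H K : Digraph n) → D ∖ K ≤ D ∖ H + H ∖ K
∖-triangle D H K = ≤-trans (∑∑-mono (λ x y → leq (taut 3 (λ d h k → ⟦ d ∧ not k ⟧ ≤ᵇ ⟦ d ∧ not h ⟧ + ⟦ h ∧ not k ⟧) tt (D x y) (H x y) (K x y)))) (≤-reflexive (∑∑-+ _ _))

module _ {n} (D : Digraph n) (Zₜ : ℕ) (c : Classes D (8 * Zₜ) (λ _ → true)) where

  open Classes c

  roughH balancedH : Digraph n
  roughH = rough rep side (height D)
  balancedH = balanced rep side (height D)

  -- A single edge of D that contradicts the order of the classes gains little height, so it is a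
  -- tie; a double edge outside the classes is not in `J₂` or is lost. Both ends differ from the
  -- names of their classes by at most 4n / Z, and Z = 8 * Zₜ makes the sum n / Zₜ.
  D∖rough : D ∖ roughH ≤ #tie D Zₜ + (#dbl∖J₂ D (8 * Zₜ) + #lost D (8 * Zₜ) rep side (λ _ → true))
  D∖rough = ≤-trans (∑∑-mono point) (≤-reflexive (trans (∑∑-+ _ _) (cong (#tie D Zₜ +_) (∑∑-+ _ _))))
    where
    Z = 8 * Zₜ
    cmp : ∀ p q → rep p ≡ rep q ⊎ ¬ (key rep side (height D) p < key rep side (height D) q) → Zₜ * height D q ≤ Zₜ * height D p + n
    cmp p q which = *-cancelˡ-≤ 8 (lin 0 (+-mono-≤ (above q) (+-mono-≤ (*-monoʳ-≤ Z (reps which)) (below p))) (eq Zₜ (height D p) (height D q) (height D (rep p)) (height D (rep q)) n))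
      where
      reps : rep p ≡ rep q ⊎ ¬ (key rep side (height D) p < key rep side (height D) q) → height D (rep q) ≤ height D (rep p)
      reps (inj₁ e) = ≤-reflexive (cong (height D) (sym e))
      reps (inj₂ ¬lt) with m≤n⇒m<n∨m≡n (≮⇒≥ ¬lt)
      ... | inj₁ lt = lex-≤ (height D (rep q)) (height D (rep p)) (rep q) (rep p) lt
      ... | inj₂ e = ≤-reflexive (proj₁ (lex-injective (height D (rep q)) (height D (rep p)) (rep q) (rep p) e))
      eq : ∀ Z hp hq rp rq n → 8 * (Z * hq) + ((8 * Z * rq + 4 * n) + (8 * Z * rp + (8 * Z * hp + 4 * n))) + 0 ≡ 8 * (Z * hp + n) + (8 * Z * hq + (8 * Z * rq + 8 * Z * rp))
      eq = solve-∀
    tied : ∀ p q → roughH p q ≡ false → (Zₜ * height D q ≤ᵇ Zₜ * height D p + n) ≡ true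
    tied p q nr = ≤ᵇ-complete (cmp p q (go (eqᵇ (rep p) (rep q)) refl nr))
      where
      go : ∀ b → eqᵇ (rep p) (rep q) ≡ b → (if b then side p ⊻ side q else key rep side (height D) p <ᵇ key rep side (height D) q) ≡ false → rep p ≡ rep q ⊎ ¬ (key rep side (height D) p < key rep side (height D) q)
      go true e _ = inj₁ (eqᵇ-sound e)
      go false e nr = inj₂ (λ lt → true≢false (trans (sym (<ᵇ-true lt)) nr))
    notOK : ∀ p q → roughH p q ≡ false → OK D Z rep side p q ≡ false
    notOK p q = go (eqᵇ (rep p) (rep q))
      where
      go : ∀ b → (if b then side p ⊻ side q else key rep side (height D) p <ᵇ key rep side (height D) q) ≡ false → b ∧ (side p ⊻ side q) ≡ false
      go true nr = nr
      go false nr = refl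
    point : ∀ p q → ⟦ D p q ∧ not (roughH p q) ⟧ ≤ ⟦ tie D Zₜ p q ⟧ + (⟦ dbl D p q ∧ not (J₂ D Z p q) ⟧ + ⟦ true ∧ lost D Z rep side (λ _ → true) p q ⟧)
    point p q = go (roughH p q) refl
      where
      go : ∀ r → roughH p q ≡ r → ⟦ D p q ∧ not r ⟧ ≤ ⟦ tie D Zₜ p q ⟧ + (⟦ dbl D p q ∧ not (J₂ D Z p q) ⟧ + ⟦ J₂ D Z p q ∧ not (OK D Z rep side p q) ⟧)
      go true e = ≤-trans (leq {⟦ D p q ∧ false ⟧} {0} (taut 1 (λ a → ⟦ a ∧ false ⟧ ≤ᵇ 0) tt (D p q))) z≤n
      go false e = subst₂ (λ t o → ⟦ D p q ∧ true ⟧ ≤ ⟦ D p q ∧ (not (D q p) ∧ t) ⟧ + (⟦ dbl D p q ∧ not (J₂ D Z p q) ⟧ + ⟦ J₂ D Z p q ∧ not o ⟧)) (sym (tied p q e)) (sym (notOK p q e))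
        (leq (taut 3 (λ a b j → ⟦ a ∧ true ⟧ ≤ᵇ ⟦ a ∧ (not b ∧ true) ⟧ + (⟦ (a ∧ b) ∧ not j ⟧ + ⟦ j ∧ true ⟧)) tt (D p q) (D q p) (J₂ D Z p q)))

  rough∖balanced : roughH ∖ balancedH ≤ 2 * surplusPairs rep side (height D)
  rough∖balanced = ≤-trans (∑∑-mono (rough⇒balanced rep side (height D))) (≤-reflexive (trans (∑∑-+ _ _) (cong (surplusPairs rep side (height D) +_) (trans (trans (∑-swap _) (∑∑-cong (λ y x → cong (λ b → ⟦ b ∧ surplus rep side (height D) y ⟧) (eqᵇ-sym (rep x) (rep y))))) (sym (+-identityʳ _))))))
    where
    eqᵇ-sym : ∀ (a b : Fin n) → eqᵇ a b ≡ eqᵇ b a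
    eqᵇ-sym a b = ⟦⟧-injective (δ-iff {x = a} {b} {b} {a} sym sym)
      where
      ⟦⟧-injective : ∀ {a b} → ⟦ a ⟧ ≡ ⟦ b ⟧ → a ≡ b
      ⟦⟧-injective {true} {true} _ = refl
      ⟦⟧-injective {false} {false} _ = refl

  deg≤rough : #deg D ≤ #deg roughH + 2 * (D ∖ roughH)
  deg≤rough = ≤-trans (∑∑-mono (λ x y → leq (taut 4 (λ a b h k → ⟦ a ⟧ + ⟦ b ⟧ ≤ᵇ (⟦ h ⟧ + ⟦ k ⟧) + (⟦ a ∧ not h ⟧ + ⟦ b ∧ not k ⟧)) tt (D x y) (D y x) (roughH x y) (roughH y x))))
    (≤-reflexive (trans (∑∑-+ _ _) (cong (#deg roughH +_) (trans (∑∑-+ _ _) (trans (cong (D ∖ roughH +_) (∑-swap _)) (cong (D ∖ roughH +_) (sym (+-identityʳ _))))))))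

  -- By `rough-total` an imbalance would push the degree sum of the blow-up, and with it that of D,
  -- below n².
  imbalance≤ : imbalance rep side (height D) ≤ shortfall D + 2 * (D ∖ roughH)
  imbalance≤ = lin 0 (+-mono-≤ (+-mono-≤ (≤-reflexive (rough-total rep side (height D))) (m≤n+m∸n (n * n) (#deg D))) deg≤rough) (eq (imbalance rep side (height D)) (shortfall D) (D ∖ roughH) (#deg roughH) (#deg D) (n * n))
    where
    eq : ∀ i s d r g N → i + ((N + (g + s)) + (r + 2 * d)) + 0 ≡ s + 2 * d + ((r + i) + N + g)
    eq = solve-∀

  -- The weighted inequality `surplusPairs≤` is taken with L = 4E; it requires an imbalance of at
  -- most n² / (16 E²), which is why the hypotheses carry 64 E².
  balanced-close : ∀ E → 64 * (E * E) * (D ∖ roughH) ≤ n * n → 64 * (E * E) * shortfall D ≤ n * n → 0 < E → E * (D ∖ balancedH) ≤ n * n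
  balanced-close E a s E>0 = *-cancelˡ-≤ 4 (lin (n * n) (+-mono-≤ (+-mono-≤ (*-monoʳ-≤ (4 * E) (≤-trans (∖-triangle D roughH balancedH) (+-monoʳ-≤ (D ∖ roughH) rough∖balanced))) (surplusPairs≤ rep side (height D) (4 * E))) (+-mono-≤ imb a′)) (eq E (D ∖ balancedH) (D ∖ roughH) (surplusPairs rep side (height D)) (imbalance rep side (height D)) (n * n)))
    where
    a′ : 4 * E * (D ∖ roughH) ≤ n * n
    a′ = ≤-trans (*-monoˡ-≤ (D ∖ roughH) (*-mono-≤ {4} {64} (s≤s (s≤s (s≤s (s≤s z≤n)))) (≤-trans (≤-reflexive (sym (*-identityʳ E))) (*-monoʳ-≤ E E>0)))) a
    imb : 16 * (E * E) * imbalance rep side (height D) ≤ n * n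
    imb = *-cancelˡ-≤ 4 (lin (n * n) (+-mono-≤ (*-monoʳ-≤ (64 * (E * E)) imbalance≤) (+-mono-≤ s (*-monoʳ-≤ 2 a))) (eq′ E (imbalance rep side (height D)) (shortfall D) (D ∖ roughH) (n * n)))
      where
      eq′ : ∀ E i s d N → 4 * (16 * (E * E) * i) + (64 * (E * E) * (s + 2 * d) + (N + 2 * N)) + N ≡ 4 * N + (64 * (E * E) * i + (64 * (E * E) * s + 2 * (64 * (E * E) * d)))
      eq′ = solve-∀
    eq : ∀ E b a p i N → 4 * (E * b) + ((4 * E * (a + 2 * p) + (4 * E * (4 * E) * i + N)) + (N + N)) + N ≡ 4 * N + ((4 * E * b + 2 * (4 * E) * p) + (16 * (E * E) * i + 4 * E * a))
    eq = solve-∀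

E≤tieWidth : ∀ E → 0 < E → E ≤ tieWidth E
E≤tieWidth E E>0 = ≤-trans (≤-trans E≤EE (m≤m+n (E * E) _)) (≤-trans (≤-trans (≤-reflexive (sym (*-identityʳ L))) (*-monoʳ-≤ L L>0)) (m≤m+n (L * L) _))
  where
  L = 2 * (E * E)
  L>0 : 0 < L
  L>0 = *-mono-≤ {1} {2} (s≤s z≤n) (*-mono-≤ E>0 E>0)
  E≤EE : E ≤ E * E
  E≤EE = ≤-trans (≤-reflexive (sym (*-identityʳ E))) (*-monoʳ-≤ E E>0)

close-to-blowUp : ∀ E → 0 < E → ∃ λ F → 0 < F × (∀ n → 0 < n → (D : Digraph n) → NearExtremal F D → F * shortfall D ≤ n * n →
  ¬ ¬ (Σ (Fin n → Fin n) λ rep → Σ (Fin n → Bool) λ side → E * (D ∖ balanced rep side (height D)) ≤ n * n))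
close-to-blowUp E E>0 = F , ≤-trans (*-mono-≤ {1} {10} {1} {Zₜ} (s≤s z≤n) Zₜ>0) (m≤m+n (10 * Zₜ) _) , λ n n>0 D ne s → classes D Z n (λ _ → true) (≤-reflexive (trans (∑-const n 1) (*-identityʳ n))) >>= λ c → return (Classes.rep c , Classes.side c , balanced-close D Zₜ c E (rough-close n n>0 D ne c) (weaken (≤-trans (m≤n+m A (12 * B)) (m≤n+m _ (10 * Zₜ))) s) E>0)
  where
  A = 64 * (E * E)
  A>0 : 0 < A
  A>0 = *-mono-≤ {1} {64} (s≤s z≤n) (*-mono-≤ E>0 E>0)
  Zₜ = tieWidth (3 * A)
  Z = 8 * Zₜ
  3A≤Zₜ : 3 * A ≤ Zₜ
  3A≤Zₜ = E≤tieWidth (3 * A) (*-mono-≤ {1} {3} (s≤s z≤n) A>0)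
  Zₜ>0 : 0 < Zₜ
  Zₜ>0 = ≤-trans (*-mono-≤ {1} {3} (s≤s z≤n) A>0) 3A≤Zₜ
  B = 3 * A * ((1 + 2 * Z) * Z)
  F = 10 * Zₜ + (12 * B + A)
  weaken : ∀ {a b x N} → a ≤ b → b * x ≤ N → a * x ≤ N
  weaken {x = x} le h = ≤-trans (*-monoˡ-≤ x le) h
  rough-close : ∀ n → 0 < n → (D : Digraph n) → NearExtremal F D → (c : Classes D Z (λ _ → true)) → A * (D ∖ roughH D Zₜ c) ≤ n * n
  rough-close n n>0 D ne c = *-cancelˡ-≤ 3 (lin 0 (+-mono-≤ (*-monoʳ-≤ (3 * A) (D∖rough D Zₜ c)) (+-mono-≤ ties (+-mono-≤ dbls losts))) (eq A (D ∖ roughH D Zₜ c) (#tie D Zₜ) dJ ℓ (n * n)))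
    where
    dJ = #dbl∖J₂ D Z
    ℓ = #lost D Z (Classes.rep c) (Classes.side c) (λ _ → true)
    10Zₜ≤F : 10 * Zₜ ≤ F
    10Zₜ≤F = m≤m+n (10 * Zₜ) _
    12B≤F : 12 * B ≤ F
    12B≤F = ≤-trans (m≤m+n (12 * B) A) (m≤n+m _ (10 * Zₜ))
    eq : ∀ A d t j l N → 3 * (A * d) + (3 * A * (t + (j + l)) + (N + (N + N))) + 0 ≡ 3 * N + (3 * A * d + (3 * A * t + (3 * A * j + 3 * A * l)))
    eq = solve-∀
    ties : 3 * A * #tie D Zₜ ≤ n * n
    ties = few-ties (3 * A) (*-mono-≤ {1} {3} (s≤s z≤n) A>0) n n>0 D (weaken 10Zₜ≤F (NearExtremal.tris ne)) (weaken 10Zₜ≤F (NearExtremal.deficits ne)) (weaken 10Zₜ≤F (NearExtremal.excesses ne))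
    losts : 3 * A * ℓ ≤ n * n
    losts = *-cancelˡ-≤ 6 (≤-trans (≤-reflexive (eq₁ A ℓ)) (≤-trans (*-monoˡ-≤ ℓ 18A≤Z) (≤-trans (Classes.few-lost c) (≤-reflexive (cong (λ s → 6 * (s * n)) (trans (∑-const n 1) (*-identityʳ n)))))))
      where
      eq₁ : ∀ A l → 6 * (3 * A * l) ≡ 6 * (3 * A) * l
      eq₁ = solve-∀
      18A≤Z : 6 * (3 * A) ≤ Z
      18A≤Z = *-mono-≤ {6} {8} (s≤s (s≤s (s≤s (s≤s (s≤s (s≤s z≤n)))))) 3A≤Zₜ
    dbls : 3 * A * dJ ≤ n * n
    dbls = *-cancelˡ-≤ n {{>-nonZero n>0}} (*-cancelˡ-≤ 12 (lin (4 * (n * (n * n))) (+-mono-≤ (+-mono-≤ (*-monoʳ-≤ (36 * A * n) (#dbl∖J₂≤ D Z)) (*-monoʳ-≤ (72 * A * n) (#unclean≤ D Z))) (+-mono-≤ (*-monoʳ-≤ (36 * A * (1 + 2 * Z)) (#nonJ≤ D Z)) (+-mono-≤ (*-monoʳ-≤ (36 * A * ((1 + 2 * Z) * Z)) (#exceptional≤ D)) (+-mono-≤ (*-monoʳ-≤ (72 * A * ((1 + 2 * Z) * Z) + 144 * A * ((1 + 2 * Z) * Z)) (#dtri≤#tri D)) (+-mono-≤ (*-monoʳ-≤ (2 * n) (weaken 12B≤F (NearExtremal.deficits ne))) (*-monoʳ-≤ 6 (weaken 12B≤F (NearExtremal.tris ne)))))))) (eq₂ A Z n dJ (#nonJ D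 Z) (#unclean D Z) (#exceptional D) (#dtri D) (#tri D) (#deficit D))))
      where
      eq₂ : ∀ A Z n j J u e t T d → 12 * (n * (3 * A * j)) + ((36 * A * n * (J + 2 * (n * u)) + 72 * A * n * (Z * J)) + (36 * A * (1 + 2 * Z) * (Z * (e + 2 * t)) + (36 * A * ((1 + 2 * Z) * Z) * (2 * (n * d) + 4 * t) + ((72 * A * ((1 + 2 * Z) * Z) + 144 * A * ((1 + 2 * Z) * Z)) * T + (2 * n * (n * n) + 6 * (n * (n * n))))))) + 4 * (n * (n * n))
        ≡ 12 * (n * (n * n)) + ((36 * A * n * j + 72 * A * n * (n * u)) + (36 * A * (1 + 2 * Z) * (n * J) + (36 * A * ((1 + 2 * Z) * Z) * e + ((72 * A * ((1 + 2 * Z) * Z) + 144 * A * ((1 + 2 * Z) * Z)) * t + (2 * n * (12 * (3 * A * ((1 + 2 * Z) * Z)) * d) + 6 * (12 * (3 * A * ((1 + 2 * Z) * Z)) * T))))))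
      eq₂ = solve-∀

-- Enumeration

opaque
  ∏ : ∀ {n} → (Fin n → ℕ) → ℕ
  ∏ {zero} f = 1
  ∏ {suc n} f = f zero * ∏ (f ∘ suc)

  ∏-empty : (f : Fin 0 → ℕ) → ∏ f ≡ 1
  ∏-empty f = refl

  ∏-suc : ∀ {n} (f : Fin (suc n) → ℕ) → ∏ f ≡ f zero * ∏ (f ∘ suc)
  ∏-suc f = refl

  ∏-cong : ∀ {n} {f g : Fin n → ℕ} → (∀ i → f i ≡ g i) → ∏ f ≡ ∏ g
  ∏-cong {zero} h = refl
  ∏-cong {suc n} h = cong₂ _*_ (h zero) (∏-cong (h ∘ suc))

  ∏-mono : ∀ {n} {f g : Fin n → ℕ} → (∀ i → f i ≤ g i) → ∏ f ≤ ∏ g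
  ∏-mono {zero} h = ≤-refl
  ∏-mono {suc n} h = *-mono-≤ (h zero) (∏-mono (h ∘ suc))

  ∏-* : ∀ {n} (f g : Fin n → ℕ) → ∏ (λ i → f i * g i) ≡ ∏ f * ∏ g
  ∏-* {zero} f g = refl
  ∏-* {suc n} f g = trans (cong (f zero * g zero *_) (∏-* (f ∘ suc) (g ∘ suc))) (eq (f zero) (g zero) (∏ (f ∘ suc)) (∏ (g ∘ suc)))
    where
    eq : ∀ a b c d → a * b * (c * d) ≡ a * c * (b * d)
    eq = solve-∀

  ∏-^ : ∀ {n} c (e : Fin n → ℕ) → ∏ (λ i → c ^ e i) ≡ c ^ ∑ e
  ∏-^ {zero} c e = cong (c ^_) (sym (∑-empty e))
  ∏-^ {suc n} c e = trans (cong (c ^ e zero *_) (∏-^ c (e ∘ suc))) (trans (sym (^-distribˡ-+-* c (e zero) (∑ (e ∘ suc)))) (cong (c ^_) (sym (∑-suc e))))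

∏∏-^ : ∀ {m n} c (e : Fin m → Fin n → ℕ) → ∏ (λ i → ∏ (λ j → c ^ e i j)) ≡ c ^ ∑ (λ i → ∑ (e i))
∏∏-^ c e = trans (∏-cong (λ i → ∏-^ c (e i))) (∏-^ c _)

∏∏-* : ∀ {m n} (f g : Fin m → Fin n → ℕ) → ∏ (λ i → ∏ (λ j → f i j * g i j)) ≡ ∏ (λ i → ∏ (f i)) * ∏ (λ i → ∏ (g i))
∏∏-* f g = trans (∏-cong (λ i → ∏-* (f i) (g i))) (∏-* _ _)

private variable
  A B : Set

∑L : List A → (A → ℕ) → ℕ
∑L [] f = 0
∑L (x ∷ xs) f = f x + ∑L xs f

∑L-++ : ∀ (xs ys : List A) f → ∑L (xs ++ ys) f ≡ ∑L xs f + ∑L ys f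
∑L-++ [] ys f = refl
∑L-++ (x ∷ xs) ys f = trans (cong (f x +_) (∑L-++ xs ys f)) (sym (+-assoc (f x) _ _))

∑L-map : ∀ (g : A → B) xs f → ∑L (map g xs) f ≡ ∑L xs (f ∘ g)
∑L-map g [] f = refl
∑L-map g (x ∷ xs) f = cong (f (g x) +_) (∑L-map g xs f)

∑L-*ˡ : ∀ c (xs : List A) f → ∑L xs (λ x → c * f x) ≡ c * ∑L xs f
∑L-*ˡ c [] f = sym (*-zeroʳ c)
∑L-*ˡ c (x ∷ xs) f = trans (cong (c * f x +_) (∑L-*ˡ c xs f)) (sym (*-distribˡ-+ c (f x) _))

∑L-+ : ∀ (xs : List A) f g → ∑L xs (λ x → f x + g x) ≡ ∑L xs f + ∑L xs g
∑L-+ [] f g = refl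
∑L-+ (x ∷ xs) f g = trans (cong (f x + g x +_) (∑L-+ xs f g)) (+-interchange (f x) (g x) _ _)

∑L-zero : ∀ (xs : List A) → ∑L xs (λ _ → 0) ≡ 0
∑L-zero [] = refl
∑L-zero (x ∷ xs) = ∑L-zero xs

∑L-swap : ∀ (xs : List A) (ys : List B) (f : A → B → ℕ) → ∑L xs (λ x → ∑L ys (f x)) ≡ ∑L ys (λ y → ∑L xs (λ x → f x y))
∑L-swap [] ys f = sym (∑L-zero ys)
∑L-swap (x ∷ xs) ys f = trans (cong (∑L ys (f x) +_) (∑L-swap xs ys f)) (sym (∑L-+ ys (f x) _))

∑L-bound : ∀ (xs : List A) f c → (∀ x → f x ≤ c) → ∑L xs f ≤ length xs * c
∑L-bound [] f c h = z≤n
∑L-bound (x ∷ xs) f c h = +-mono-≤ (h x) (∑L-bound xs f c h)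

∑L-lower : ∀ {xs : List A} {f c} → All (λ x → c ≤ f x) xs → length xs * c ≤ ∑L xs f
∑L-lower [] = z≤n
∑L-lower (p ∷ ps) = +-mono-≤ p (∑L-lower ps)

∑L-∈ : ∀ {xs : List A} {x} f → x ∈ xs → f x ≤ ∑L xs f
∑L-∈ {xs = _ ∷ xs} f (here refl) = m≤m+n _ _
∑L-∈ {xs = y ∷ xs} f (there p) = ≤-trans (∑L-∈ f p) (m≤n+m _ (f y))

∑L-length : ∀ (xs : List A) → ∑L xs (λ _ → 1) ≡ length xs
∑L-length [] = refl
∑L-length (x ∷ xs) = cong suc (∑L-length xs)

-- The substitute for summing over a subset: each member of `zs` is removed from one occurrence in
-- `ys`, and uniqueness keeps the later members available.
∑L-unique : ∀ (zs : List A) {ys} → Unique zs → All (_∈ ys) zs → ∀ f → ∑L zs f ≤ ∑L ys f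
∑L-unique [] u a f = z≤n
∑L-unique (z ∷ zs) (n ∷ u) (m ∷ a) f with ∈-∃++ m
... | ps , qs , refl = ≤-trans (+-monoʳ-≤ (f z) (∑L-unique zs u (rest zs n a) f)) (≤-reflexive (trans (cong (f z +_) (∑L-++ ps qs f)) (trans (eq (f z) (∑L ps f) (∑L qs f)) (sym (∑L-++ ps (z ∷ qs) f)))))
  where
  eq : ∀ a b c → a + (b + c) ≡ b + (a + c)
  eq = solve-∀
  rest : ∀ zs → All (z ≢_) zs → All (_∈ ps ++ [ z ] ++ qs) zs → All (_∈ ps ++ qs) zs
  rest [] [] [] = []
  rest (w ∷ zs) (n ∷ ns) (m ∷ ms) = go (∈-++⁻ ps m) ∷ rest zs ns ms
    where
    go : w ∈ ps ⊎ w ∈ z ∷ qs → w ∈ ps ++ qs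
    go (inj₁ p) = ∈-++⁺ˡ p
    go (inj₂ (here refl)) = contradiction refl n
    go (inj₂ (there q)) = ∈-++⁺ʳ ps q

length-unique : ∀ {zs ys : List A} → Unique zs → All (_∈ ys) zs → length zs ≤ length ys
length-unique {zs = zs} {ys} u a = subst₂ _≤_ (∑L-length zs) (∑L-length ys) (∑L-unique zs u a (λ _ → 1))

unique-map : ∀ {P : A → Set} {xs : List A} (f : A → B) → (∀ {x y} → P x → P y → f x ≡ f y → x ≡ y) → All P xs → Unique xs → Unique (map f xs)
unique-map f inj [] [] = []
unique-map {P = P} f inj (_∷_ {x} {xs} p ps) (n ∷ u) = go xs ps n ∷ unique-map f inj ps u
  where
  go : ∀ ys → All P ys → All (x ≢_) ys → All (f x ≢_) (map f ys)
  go [] [] [] = []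
  go (y ∷ ys) (q ∷ qs) (n ∷ ns) = (λ e → n (inj p q e)) ∷ go ys qs ns

vecs : ∀ {m} → (Fin m → List A) → List (Vec A m)
vecs {m = zero} f = [ []ᵥ ]
vecs {m = suc m} f = cartesianProductWith _∷ᵥ_ (f zero) (vecs (f ∘ suc))

allVecs-vecs : ∀ (xs : List A) m → allVecs xs m ≡ vecs {m = m} (λ _ → xs)
allVecs-vecs xs zero = refl
allVecs-vecs xs (suc m) = trans (cong (λ ys → concatMap (λ x → map (x ∷ᵥ_) ys) xs) (allVecs-vecs xs m)) (go xs)
  where
  go : ∀ ys → concatMap (λ x → map (x ∷ᵥ_) (vecs (λ _ → xs))) ys ≡ cartesianProductWith _∷ᵥ_ ys (vecs {m = m} (λ _ → xs))
  go [] = refl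
  go (y ∷ ys) = cong (map (y ∷ᵥ_) (vecs (λ _ → xs)) ++_) (go ys)

∈-vecs : ∀ {m} (f : Fin m → List A) v → (∀ i → lookup v i ∈ f i) → v ∈ vecs f
∈-vecs f []ᵥ h = here refl
∈-vecs f (x ∷ᵥ v) h = ∈-cartesianProductWith⁺ _∷ᵥ_ (h zero) (∈-vecs (f ∘ suc) v (h ∘ suc))

vecs-∈ : ∀ {m} (f : Fin m → List A) {v} → v ∈ vecs f → ∀ i → lookup v i ∈ f i
vecs-∈ {m = suc m} f p i with ∈-cartesianProductWith⁻ _∷ᵥ_ (f zero) (vecs (f ∘ suc)) p
vecs-∈ {m = suc m} f p zero | _ , _ , x , y , refl = x
vecs-∈ {m = suc m} f p (suc i) | _ , _ , x , y , refl = vecs-∈ (f ∘ suc) y i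

vecs-unique : ∀ {m} (f : Fin m → List A) → (∀ i → Unique (f i)) → Unique (vecs f)
vecs-unique {m = zero} f u = [] ∷ []
vecs-unique {m = suc m} f u = Uniq.cartesianProductWith⁺ _∷ᵥ_ (λ { refl → refl , refl }) (u zero) (vecs-unique (f ∘ suc) (u ∘ suc))

∑L-product : ∀ {C : Set} (g : A → B → C) xs ys (F : A → ℕ) (H : B → ℕ) (K : C → ℕ) → (∀ x y → K (g x y) ≡ F x * H y) → ∑L (cartesianProductWith g xs ys) K ≡ ∑L xs F * ∑L ys H
∑L-product g [] ys F H K e = refl
∑L-product g (x ∷ xs) ys F H K e = trans (∑L-++ (map (g x) ys) _ K) (trans (cong₂ _+_ (trans (∑L-map (g x) ys K) (trans (go ys) (∑L-*ˡ (F x) ys H))) (∑L-product g xs ys F H K e)) (sym (*-distribʳ-+ (∑L ys H) (F x) (∑L xs F))))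
  where
  go : ∀ ys → ∑L ys (K ∘ g x) ≡ ∑L ys (λ y → F x * H y)
  go [] = refl
  go (y ∷ ys) = cong₂ _+_ (e x y) (go ys)

∑L-vecs : ∀ {m} (f : Fin m → List A) (w : Fin m → A → ℕ) → ∑L (vecs f) (λ v → ∏ (λ i → w i (lookup v i))) ≡ ∏ (λ i → ∑L (f i) (w i))
∑L-vecs {m = zero} f w = trans (+-identityʳ _) (trans (∏-empty _) (sym (∏-empty _)))
∑L-vecs {m = suc m} f w = trans (∑L-product _∷ᵥ_ (f zero) (vecs (f ∘ suc)) (w zero) (λ v → ∏ (λ i → w (suc i) (lookup v i))) _ (λ x v → ∏-suc _)) (trans (cong (∑L (f zero) (w zero) *_) (∑L-vecs (f ∘ suc) (w ∘ suc))) (sym (∏-suc _)))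

length-vecs : ∀ {m} (f : Fin m → List A) → length (vecs f) ≡ ∏ (λ i → length (f i))
length-vecs {m = zero} f = sym (∏-empty _)
length-vecs {m = suc m} f = trans (sym (∑L-length (vecs f))) (trans (∑L-product _∷ᵥ_ (f zero) (vecs (f ∘ suc)) (λ _ → 1) (λ _ → 1) (λ _ → 1) (λ _ _ → refl)) (trans (cong₂ _*_ (∑L-length (f zero)) (trans (∑L-length (vecs (f ∘ suc))) (length-vecs (f ∘ suc)))) (sym (∏-suc _))))

bools : List Bool
bools = true ∷ false ∷ []

∈-bools : ∀ b → b ∈ bools
∈-bools true = here refl
∈-bools false = there (here refl)

bools-unique : Unique bools
bools-unique = ((λ ()) ∷ []) ∷ ([] ∷ [])

∈-allMats : ∀ {n} (G : Mat n) → G ∈ allMats n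
∈-allMats {n} G = subst (G ∈_) (sym (allVecs-vecs _ n)) (∈-vecs _ G (λ i → subst (lookup G i ∈_) (sym (allVecs-vecs _ n)) (∈-vecs _ (lookup G i) (λ j → ∈-bools _))))

allMats-unique : ∀ n → Unique (allMats n)
allMats-unique n = subst Unique (sym (allVecs-vecs _ n)) (vecs-unique {m = n} _ (λ _ → subst Unique (sym (allVecs-vecs _ n)) (vecs-unique {m = n} _ (λ _ → bools-unique))))

sublist-unique : ∀ {xs ys : List A} → xs ⊆ ys → Unique ys → Unique xs
sublist-unique []ₛ u = u
sublist-unique (y ∷ʳ s) (n ∷ u) = sublist-unique s u
sublist-unique (refl ∷ₛ s) (n ∷ u) = go s n ∷ sublist-unique s u
  where
  go : ∀ {P : A → Set} {xs ys : List A} → xs ⊆ ys → All P ys → All P xs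
  go []ₛ [] = []
  go (y ∷ʳ s) (p ∷ ps) = go s ps
  go (refl ∷ₛ s) (p ∷ ps) = p ∷ go s ps

mat-ext : ∀ {n} {G H : Mat n} → (∀ i j → edge G i j ≡ edge H i j) → G ≡ H
mat-ext {G = G} {H} h = trans (sym (tabulate∘lookup G)) (trans (tabulate-cong (λ i → trans (sym (tabulate∘lookup (lookup G i))) (trans (tabulate-cong (h i)) (tabulate∘lookup (lookup H i))))) (tabulate∘lookup H))

Edge? : ∀ {n} (G : Mat n) i j → Dec (Edge G i j)
Edge? G i j = edge G i j BP.≟ true

IsDigraph? : ∀ {n} (G : Mat n) → Dec (IsDigraph G)
IsDigraph? G = FP.all? (λ i → ¬? (Edge? G i i))

IsOriented? : ∀ {n} (G : Mat n) → Dec (IsOriented G)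
IsOriented? G = IsDigraph? G ×-dec FP.all? (λ i → FP.all? (λ j → Edge? G i j →-dec ¬? (Edge? G j i)))

CkFree? : ∀ {n} k (G : Mat n) → Dec (CkFree k G)
CkFree? {n} k G = ¬? (map′ to from (any? cyclic? (vecs {m = k} (λ _ → allFin n))))
  where
  Cyclic : (Fin k → Fin n) → Set
  Cyclic f = (∀ i j → f i ≡ f j → i ≡ j) × (∀ i j → (suc (toℕ i) ≡ toℕ j ⊎ (suc (toℕ i) ≡ k × toℕ j ≡ 0)) → Edge G (f i) (f j))
  cyclic? : ∀ v → Dec (Cyclic (lookup v))
  cyclic? v = FP.all? (λ i → FP.all? (λ j → (lookup v i FP.≟ lookup v j) →-dec (i FP.≟ j)))
    ×-dec FP.all? (λ i → FP.all? (λ j → ((suc (toℕ i) ≟ toℕ j) ⊎-dec ((suc (toℕ i) ≟ k) ×-dec (toℕ j ≟ 0))) →-dec Edge? G (lookup v i) (lookup v j)))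
  Found : Set
  Found = Any (λ v → Cyclic (lookup v)) (vecs {m = k} (λ _ → allFin n))
  to : Found → ContainsCycle k G
  to p with find p
  ... | v , _ , inj , e = lookup v , (λ {i} {j} → inj i j) , e
  from : ContainsCycle k G → Found
  from (f , inj , e) = lose (∈-vecs _ (tabulate f) (λ i → ∈-allFin _)) ((λ i j q → inj (trans (sym (lookup∘tabulate f i)) (trans q (lookup∘tabulate f j)))) , λ i j c → subst₂ (Edge G) (sym (lookup∘tabulate f i)) (sym (lookup∘tabulate f j)) (e i j c))

-- Counting graphs close to a container

lt : ∀ {n} → Fin n → Fin n → Bool
lt i j = toℕ i <ᵇ toℕ j

lt-exclusive : ∀ a b → ⟦ a <ᵇ b ⟧ + ⟦ b <ᵇ a ⟧ ≤ 1
lt-exclusive zero zero = z≤n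
lt-exclusive zero (suc b) = ≤-refl
lt-exclusive (suc a) zero = ≤-refl
lt-exclusive (suc a) (suc b) = lt-exclusive a b

lt-total : ∀ a b → a ≢ b → ⟦ a <ᵇ b ⟧ + ⟦ b <ᵇ a ⟧ ≡ 1
lt-total zero zero h = contradiction refl h
lt-total zero (suc b) h = refl
lt-total (suc a) zero h = refl
lt-total (suc a) (suc b) h = lt-total a b (h ∘ cong suc)

∑-upper : ∀ {n} (r : Fin n → Fin n → ℕ) → ∑ (λ i → ∑ (λ j → ⟦ lt i j ⟧ * (r i j + r j i))) ≡ ∑ (λ i → ∑ (λ j → (⟦ lt i j ⟧ + ⟦ lt j i ⟧) * r i j))
∑-upper r = trans (∑∑-cong (λ i j → *-distribˡ-+ ⟦ lt i j ⟧ (r i j) (r j i))) (trans (∑∑-+ _ _) (trans (cong (∑ (λ i → ∑ (λ j → ⟦ lt i j ⟧ * r i j)) +_) (∑-swap _)) (trans (sym (∑∑-+ _ _)) (∑∑-cong (λ i j → sym (*-distribʳ-+ (r i j) ⟦ lt i j ⟧ ⟦ lt j i ⟧))))))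

∑-upper≤ : ∀ {n} (r : Fin n → Fin n → ℕ) → ∑ (λ i → ∑ (λ j → ⟦ lt i j ⟧ * (r i j + r j i))) ≤ ∑ (λ i → ∑ (r i))
∑-upper≤ r = ≤-trans (≤-reflexive (∑-upper r)) (∑∑-mono (λ i j → ≤-trans (*-monoˡ-≤ (r i j) (lt-exclusive (toℕ i) (toℕ j))) (≤-reflexive (+-identityʳ (r i j)))))

∑-upper≡ : ∀ {n} (r : Fin n → Fin n → ℕ) → (∀ i → r i i ≡ 0) → ∑ (λ i → ∑ (λ j → ⟦ lt i j ⟧ * (r i j + r j i))) ≡ ∑ (λ i → ∑ (r i))
∑-upper≡ r diag = trans (∑-upper r) (∑∑-cong point)
  where
  point : ∀ i j → (⟦ lt i j ⟧ + ⟦ lt j i ⟧) * r i j ≡ r i j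
  point i j with i FP.≟ j
  ... | yes refl = trans (cong ((⟦ lt i i ⟧ + ⟦ lt i i ⟧) *_) (diag i)) (trans (*-zeroʳ (⟦ lt i i ⟧ + ⟦ lt i i ⟧)) (sym (diag i)))
  ... | no ne = trans (cong (_* r i j) (lt-total (toℕ i) (toℕ j) (ne ∘ FP.toℕ-injective))) (+-identityʳ (r i j))

#pairs : ℕ → ℕ
#pairs n = ∑ {n} (λ i → ∑ {n} (λ j → ⟦ lt i j ⟧))

#pairs-≡ : ∀ n → 2 * #pairs n + n ≡ n * n
#pairs-≡ n = begin
  2 * #pairs n + n ≡⟨ cong₂ _+_ (trans (sym (∑∑-*ˡ 2 _)) (∑∑-cong double)) (sym (trans (∑-cong (λ i → trans (∑-cong (λ j → δ-iff {x = i} {j} {j} {i} sym sym)) (∑-δ′ i))) (trans (∑-const n 1) (*-identityʳ n)))) ⟩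
  ∑ {n} (λ i → ∑ (λ j → ⟦ lt i j ⟧ * ((1 ∸ δ i j) + (1 ∸ δ j i)))) + ∑ {n} (λ i → ∑ (δ i)) ≡⟨ cong (_+ ∑ {n} (λ i → ∑ (δ i))) (∑-upper≡ (λ i j → 1 ∸ δ i j) (λ i → cong (1 ∸_) (δ-refl i))) ⟩
  ∑ {n} (λ i → ∑ (λ j → 1 ∸ δ i j)) + ∑ {n} (λ i → ∑ (δ i)) ≡⟨ sym (∑∑-+ _ _) ⟩
  ∑ {n} (λ i → ∑ (λ j → (1 ∸ δ i j) + δ i j)) ≡⟨ ∑∑-cong (λ i j → m∸n+n≡m {1} {δ i j} (⟦⟧≤1 _)) ⟩
  ∑ {n} (λ i → ∑ {n} (λ j → 1)) ≡⟨ trans (∑-const n _) (cong (n *_) (trans (∑-const n 1) (*-identityʳ n))) ⟩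
  n * n ∎
  where
  open ≡-Reasoning
  irr : ∀ k → (k <ᵇ k) ≡ false
  irr zero = refl
  irr (suc k) = irr k
  double : ∀ (i j : Fin n) → 2 * ⟦ lt i j ⟧ ≡ ⟦ lt i j ⟧ * ((1 ∸ δ i j) + (1 ∸ δ j i))
  double i j with i FP.≟ j | j FP.≟ i
  ... | yes refl | yes _ = trans (cong (λ b → 2 * ⟦ b ⟧) (irr (toℕ i))) (sym (cong (λ b → ⟦ b ⟧ * 0) (irr (toℕ i))))
  ... | no _ | no _ = *-comm 2 ⟦ lt i j ⟧
  ... | yes p | no q = contradiction (sym p) q
  ... | no q | yes p = contradiction (sym p) q

State : Set
State = Bool × Bool

states : List State
states = (true , true) ∷ (true , false) ∷ (false , true) ∷ (false , false) ∷ []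

∈-states : ∀ s → s ∈ states
∈-states (true , true) = here refl
∈-states (true , false) = there (here refl)
∈-states (false , true) = there (there (here refl))
∈-states (false , false) = there (there (there (here refl)))

-- The generating function of the number of edges outside D: such an edge has weight 1, anything
-- else weight q. For large q, graphs with few outside edges dominate the total, so no binomial
-- coefficients have to be estimated.
slot : ℕ → Bool → Bool → ℕ
slot q d x = if x ∧ not d then 1 else q

-- o = true excludes pairs of opposite edges.
pairWeight : Bool → ℕ → Bool → Bool → State → ℕ
pairWeight o q d d′ (x , y) = if o ∧ (x ∧ y) then 0 else slot q d x * slot q d′ y

-- Exponents of 2 are measured in units of 1/5, because 3 ^ 5 ≤ 2 ^ 8.
capacity exponent : Bool → Bool → Bool → ℕ
capacity o false false = 1
capacity o true false = 2
capacity o false true = 2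
capacity o true true = if o then 3 else 4
exponent o d d′ = 5 * (⟦ d ⟧ + ⟦ d′ ⟧) ∸ 2 * ⟦ o ∧ (d ∧ d′) ⟧

capacity^5 : ∀ o d d′ → capacity o d d′ ^ 5 ≤ 2 ^ exponent o d d′
capacity^5 o d d′ = leq (taut 3 (λ o d d′ → capacity o d d′ ^ 5 ≤ᵇ 2 ^ exponent o d d′) tt o d d′)

pairWeight-sum : ∀ o q d d′ → ∑L states (pairWeight o q d d′) ≤ (q + 1) ^ 2 * capacity o d d′
pairWeight-sum false q false false = ≤-reflexive (eq q)
  where
  eq : ∀ q → 1 + (1 * q + (q * 1 + (q * q + 0))) ≡ (q + 1) * ((q + 1) * 1) * 1
  eq = solve-∀
pairWeight-sum true q false false = ≤-trans (n≤1+n _) (≤-reflexive (eq q))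
  where
  eq : ∀ q → 1 + (1 * q + (q * 1 + (q * q + 0))) ≡ (q + 1) * ((q + 1) * 1) * 1
  eq = solve-∀
pairWeight-sum false q true false = ≤-trans (m≤m+n _ (2 * q + 2)) (≤-reflexive (eq q))
  where
  eq : ∀ q → q * 1 + (q * q + (q * 1 + (q * q + 0))) + (2 * q + 2) ≡ (q + 1) * ((q + 1) * 1) * 2
  eq = solve-∀
pairWeight-sum true q true false = ≤-trans (m≤m+n _ (q + 2 * q + 2)) (≤-reflexive (eq q))
  where
  eq : ∀ q → q * q + (q * 1 + (q * q + 0)) + (q + 2 * q + 2) ≡ (q + 1) * ((q + 1) * 1) * 2
  eq = solve-∀
pairWeight-sum false q false true = ≤-trans (m≤m+n _ (2 * q + 2)) (≤-reflexive (eq q))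
  where
  eq : ∀ q → 1 * q + (1 * q + (q * q + (q * q + 0))) + (2 * q + 2) ≡ (q + 1) * ((q + 1) * 1) * 2
  eq = solve-∀
pairWeight-sum true q false true = ≤-trans (m≤m+n _ (3 * q + 2)) (≤-reflexive (eq q))
  where
  eq : ∀ q → 1 * q + (q * q + (q * q + 0)) + (3 * q + 2) ≡ (q + 1) * ((q + 1) * 1) * 2
  eq = solve-∀
pairWeight-sum false q true true = ≤-trans (m≤m+n _ (8 * q + 4)) (≤-reflexive (eq q))
  where
  eq : ∀ q → q * q + (q * q + (q * q + (q * q + 0))) + (8 * q + 4) ≡ (q + 1) * ((q + 1) * 1) * 4
  eq = solve-∀
pairWeight-sum true q true true = ≤-trans (m≤m+n _ (6 * q + 3)) (≤-reflexive (eq q))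
  where
  eq : ∀ q → q * q + (q * q + (q * q + 0)) + (6 * q + 3) ≡ (q + 1) * ((q + 1) * 1) * 3
  eq = solve-∀

Code : ℕ → Set
Code n = Vec (Vec State n) n

-- A pair is recorded once, above the diagonal; the remaining entries hold a default value.
stateOf : ∀ {n} → Mat n → Fin n → Fin n → State
stateOf G i j = if lt i j then (edge G i j , edge G j i) else (false , false)

encode : ∀ {n} → Mat n → Code n
encode G = tabulate (λ i → tabulate (stateOf G i))

entry : ∀ {n} → Code n → Fin n → Fin n → State
entry m i j = lookup (lookup m i) j

entry-encode : ∀ {n} (G : Mat n) i j → entry (encode G) i j ≡ stateOf G i j
entry-encode G i j = trans (cong (λ r → lookup r j) (lookup∘tabulate (λ i → tabulate (stateOf G i)) i)) (lookup∘tabulate (stateOf G i) j)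

codes : ∀ n → List (Code n)
codes n = vecs (λ i → vecs (λ j → states))

encode-injective : ∀ {n} {G H : Mat n} → IsDigraph G → IsDigraph H → encode G ≡ encode H → G ≡ H
encode-injective {n} {G} {H} dG dH e = mat-ext same
  where
  st : ∀ i j → stateOf G i j ≡ stateOf H i j
  st i j = trans (sym (entry-encode G i j)) (trans (cong (λ m → entry m i j) e) (entry-encode H i j))
  <ᵇ′ : ∀ {a b} → a < b → (a <ᵇ b) ≡ true
  <ᵇ′ l = Equivalence.to T-≡ (<⇒<ᵇ l)
  upper : ∀ i j → toℕ i < toℕ j → edge G i j ≡ edge H i j × edge G j i ≡ edge H j i
  upper i j l with st i j
  ... | s rewrite <ᵇ′ l = cong proj₁ s , cong proj₂ s
  loop : ∀ {K : Mat n} → IsDigraph K → ∀ i → edge K i i ≡ false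
  loop {K} d i with edge K i i in e
  ... | true = contradiction e (d i)
  ... | false = refl
  same : ∀ i j → edge G i j ≡ edge H i j
  same i j with <-cmp (toℕ i) (toℕ j)
  ... | tri< l _ _ = proj₁ (upper i j l)
  ... | tri> _ _ l = proj₂ (upper j i l)
  ... | tri≈ _ q _ with FP.toℕ-injective q
  ... | refl = trans (loop {G} dG i) (sym (loop {H} dH i))

-- Below and on the diagonal only the default entry has weight 1. Vectors that have another entry
-- there weigh 0 and do not enlarge the total.
slotWeight : ∀ {n} → Bool → ℕ → Digraph n → Fin n → Fin n → State → ℕ
slotWeight o q D i j s = if lt i j then pairWeight o q (D i j) (D j i) s else ⟦ not (proj₁ s) ∧ not (proj₂ s) ⟧

weight : ∀ {n} → Bool → ℕ → Digraph n → Code n → ℕ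
weight o q D m = ∏ (λ i → ∏ (λ j → slotWeight o q D i j (entry m i j)))

wt : ∀ {n} → Bool → Digraph n → ℕ
wt o D = ∑ (λ i → ∑ (λ j → ⟦ lt i j ⟧ * exponent o (D i j) (D j i)))

Oriented : ∀ {n} → Mat n → Set
Oriented G = ∀ i j → edge G i j ∧ edge G j i ≡ false

-- Of the two slots of each pair, exactly those that hold an outside edge lack their factor q.
weight-lower : ∀ {n} o q (D : Digraph n) (G : Mat n) → (o ≡ true → Oriented G) → q ^ (2 * #pairs n) ≤ weight o q D (encode G) * q ^ ∑ (λ i → ∑ (λ j → ⟦ lt i j ⟧ * (⟦ edge G i j ∧ not (D i j) ⟧ + ⟦ edge G j i ∧ not (D j i) ⟧)))
weight-lower {n} o q D G or = ≤-reflexive (begin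
  q ^ (2 * #pairs n) ≡⟨ cong (q ^_) (sym (∑∑-*ˡ 2 _)) ⟩
  q ^ ∑ (λ i → ∑ (λ j → 2 * ⟦ lt i j ⟧)) ≡⟨ sym (∏∏-^ q _) ⟩
  ∏ (λ i → ∏ (λ j → q ^ (2 * ⟦ lt i j ⟧))) ≡⟨ ∏-cong (λ i → ∏-cong (λ j → sym (point i j))) ⟩
  ∏ (λ i → ∏ (λ j → slotWeight o q D i j (entry (encode G) i j) * q ^ (⟦ lt i j ⟧ * (⟦ edge G i j ∧ not (D i j) ⟧ + ⟦ edge G j i ∧ not (D j i) ⟧)))) ≡⟨ trans (∏∏-* _ _) (cong (weight o q D (encode G) *_) (∏∏-^ q _)) ⟩
  weight o q D (encode G) * q ^ ∑ (λ i → ∑ (λ j → ⟦ lt i j ⟧ * (⟦ edge G i j ∧ not (D i j) ⟧ + ⟦ edge G j i ∧ not (D j i) ⟧))) ∎)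
  where
  open ≡-Reasoning
  slot-q : ∀ d x → slot q d x * q ^ ⟦ x ∧ not d ⟧ ≡ q
  slot-q true true = *-identityʳ q
  slot-q true false = *-identityʳ q
  slot-q false true = trans (+-identityʳ _) (*-identityʳ q)
  slot-q false false = *-identityʳ q
  allowed : ∀ o → (o ≡ true → Oriented G) → ∀ i j → o ∧ (edge G i j ∧ edge G j i) ≡ false
  allowed false or i j = refl
  allowed true or i j = or refl i j
  point : ∀ i j → slotWeight o q D i j (entry (encode G) i j) * q ^ (⟦ lt i j ⟧ * (⟦ edge G i j ∧ not (D i j) ⟧ + ⟦ edge G j i ∧ not (D j i) ⟧)) ≡ q ^ (2 * ⟦ lt i j ⟧)
  point i j rewrite entry-encode G i j with lt i j
  ... | false = refl
  ... | true rewrite allowed o or i j = trans (cong (slot q (D i j) x * slot q (D j i) y *_) (trans (cong (q ^_) (+-identityʳ (⟦ x ∧ not (D i j) ⟧ + ⟦ y ∧ not (D j i) ⟧))) (^-distribˡ-+-* q ⟦ x ∧ not (D i j) ⟧ ⟦ y ∧ not (D j i) ⟧))) (trans (eq (slot q (D i j) x) (slot q (D j i) y) (q ^ ⟦ x ∧ not (D i j) ⟧) (q ^ ⟦ y ∧ not (D j i) ⟧)) (trans (cong₂ _*_ (slot-q (D i j) x) (slot-q (D j i) y)) (cong (q *_) (sym (*-identityʳ q)))))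
    where
    x = edge G i j
    y = edge G j i
    eq : ∀ a b c d → a * b * (c * d) ≡ a * c * (b * d)
    eq = solve-∀

^5-cancel : ∀ {a b} → a ^ 5 ≤ b ^ 5 → a ≤ b
^5-cancel {a} {b} h with a ≤? b
... | yes p = p
... | no ¬p = contradiction h (<⇒≱ (^-monoˡ-< 5 (≰⇒> ¬p)))

-- The total weight is a product over pairs. The factor (q + 1)² of a pair allows for outside edges,
-- and `capacity` is the number of states that the pair admits inside D.
weight-total : ∀ {n} o q (D : Digraph n) w → wt o D ≤ 5 * w → ∑L (codes n) (weight o q D) ≤ (q + 1) ^ (2 * #pairs n) * 2 ^ w
weight-total {n} o q D w h = begin
  ∑L (codes n) (weight o q D) ≡⟨ ∑L-vecs (λ i → vecs (λ j → states)) (λ i r → ∏ (λ j → slotWeight o q D i j (lookup r j))) ⟩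
  ∏ (λ i → ∑L (vecs {m = n} (λ j → states)) (λ r → ∏ (λ j → slotWeight o q D i j (lookup r j)))) ≡⟨ ∏-cong (λ i → ∑L-vecs (λ j → states) (slotWeight o q D i)) ⟩
  ∏ (λ i → ∏ (λ j → ∑L states (slotWeight o q D i j))) ≤⟨ ∏-mono (λ i → ∏-mono (λ j → point i j)) ⟩
  ∏ (λ i → ∏ (λ j → (q + 1) ^ (2 * ⟦ lt i j ⟧) * cap i j)) ≡⟨ trans (∏∏-* _ _) (cong (_* ∏ (λ i → ∏ (cap i))) (trans (∏∏-^ (q + 1) _) (cong ((q + 1) ^_) (∑∑-*ˡ 2 _)))) ⟩
  (q + 1) ^ (2 * #pairs n) * ∏ (λ i → ∏ (cap i)) ≤⟨ *-monoʳ-≤ ((q + 1) ^ (2 * #pairs n)) (^5-cancel cap^5) ⟩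
  (q + 1) ^ (2 * #pairs n) * 2 ^ w ∎
  where
  open ≤-Reasoning
  cap : Fin n → Fin n → ℕ
  cap i j = if lt i j then capacity o (D i j) (D j i) else 1
  point : ∀ i j → ∑L states (slotWeight o q D i j) ≤ (q + 1) ^ (2 * ⟦ lt i j ⟧) * cap i j
  point i j with lt i j
  ... | true = pairWeight-sum o q (D i j) (D j i)
  ... | false = ≤-refl
  ∏-pow : ∀ {m} (f : Fin m → ℕ) k → ∏ f ^ k ≡ ∏ (λ i → f i ^ k)
  ∏-pow {m} f zero = sym (trans (∏-^ 1 (λ _ → 0)) (^-zeroˡ (∑ {m} (λ _ → 0))))
  ∏-pow f (suc k) = trans (cong (∏ f *_) (∏-pow f k)) (sym (∏-* f _))
  cap^5 : ∏ (λ i → ∏ (cap i)) ^ 5 ≤ (2 ^ w) ^ 5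
  cap^5 = begin
    ∏ (λ i → ∏ (cap i)) ^ 5 ≡⟨ trans (∏-pow (λ i → ∏ (cap i)) 5) (∏-cong (λ i → ∏-pow (cap i) 5)) ⟩
    ∏ (λ i → ∏ (λ j → cap i j ^ 5)) ≤⟨ ∏-mono (λ i → ∏-mono (λ j → pt i j)) ⟩
    ∏ (λ i → ∏ (λ j → 2 ^ (⟦ lt i j ⟧ * exponent o (D i j) (D j i)))) ≡⟨ ∏∏-^ 2 _ ⟩
    2 ^ wt o D ≤⟨ ^-monoʳ-≤ 2 h ⟩
    2 ^ (5 * w) ≡⟨ trans (cong (2 ^_) (*-comm 5 w)) (sym (^-*-assoc 2 w 5)) ⟩
    (2 ^ w) ^ 5 ∎
    where
    pt : ∀ i j → cap i j ^ 5 ≤ 2 ^ (⟦ lt i j ⟧ * exponent o (D i j) (D j i))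
    pt i j with lt i j
    ... | true = ≤-trans (capacity^5 o (D i j) (D j i)) (≤-reflexive (cong (2 ^_) (sym (+-identityʳ (exponent o (D i j) (D j i))))))
    ... | false = ≤-refl

-- Each graph of S has weight at least q^(2P - s) for its own container, P being the number of
-- pairs. Comparing with the total weight over all containers of small weight bounds the number of
-- graphs.
upper-count : ∀ {n} {C : Set} (Dof : C → Digraph n) (cs : List C) o q s w → 0 < q → (S : List (Mat n)) → Unique S →
  All (λ G → IsDigraph G × (o ≡ true → Oriented G) × ∃ λ c → c ∈ cs × wt o (Dof c) ≤ 5 * w × outside G (Dof c) ≤ s) S →
  length S * q ^ (2 * #pairs n) ≤ q ^ s * (length cs * ((q + 1) ^ (2 * #pairs n) * 2 ^ w))
upper-count {n} Dof cs o q s w q>0 S u all = begin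
  length S * q ^ (2 * #pairs n) ≤⟨ ∑L-lower (All.map (λ {G} → each {G}) all) ⟩
  ∑L S (λ G → q ^ s * ∑L cs (λ c → V c (encode G))) ≡⟨ trans (∑L-*ˡ (q ^ s) S _) (cong (q ^ s *_) (sym (∑L-map encode S (λ m → ∑L cs (λ c → V c m))))) ⟩
  q ^ s * ∑L (map encode S) (λ m → ∑L cs (λ c → V c m)) ≤⟨ *-monoʳ-≤ (q ^ s) (∑L-unique (map encode S) (unique-map encode encode-injective (All.map proj₁ all) u) (All-map⁺ (All.map (λ {G} _ → ∈-vecs _ (encode G) (λ i → ∈-vecs _ _ (λ j → ∈-states _))) all)) _) ⟩
  q ^ s * ∑L (codes n) (λ m → ∑L cs (λ c → V c m)) ≡⟨ cong (q ^ s *_) (∑L-swap (codes n) cs (λ m c → V c m)) ⟩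
  q ^ s * ∑L cs (λ c → ∑L (codes n) (V c)) ≤⟨ *-monoʳ-≤ (q ^ s) (∑L-bound cs _ _ total) ⟩
  q ^ s * (length cs * ((q + 1) ^ (2 * #pairs n) * 2 ^ w)) ∎
  where
  open ≤-Reasoning
  V : _ → Code n → ℕ
  -- Containers of large weight are switched off here, since `cs` lists all codes.
  V c m = if wt o (Dof c) ≤ᵇ 5 * w then weight o q (Dof c) m else 0
  total : ∀ c → ∑L (codes n) (V c) ≤ (q + 1) ^ (2 * #pairs n) * 2 ^ w
  total c with wt o (Dof c) ≤ᵇ 5 * w in e
  ... | true = weight-total o q (Dof c) w (≤ᵇ⇒≤ _ _ (Equivalence.from T-≡ e))
  ... | false = ≤-trans (≤-reflexive (∑L-zero (codes n))) z≤n
  each : ∀ {G} → IsDigraph G × (o ≡ true → Oriented G) × (∃ λ c → c ∈ cs × wt o (Dof c) ≤ 5 * w × outside G (Dof c) ≤ s) → q ^ (2 * #pairs n) ≤ q ^ s * ∑L cs (λ c → V c (encode G))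
  each {G} (d , or , c , c∈ , le , out) = begin
    q ^ (2 * #pairs n) ≤⟨ weight-lower o q (Dof c) G or ⟩
    weight o q (Dof c) (encode G) * q ^ ∑ (λ i → ∑ (λ j → ⟦ lt i j ⟧ * (⟦ edge G i j ∧ not (Dof c i j) ⟧ + ⟦ edge G j i ∧ not (Dof c j i) ⟧))) ≤⟨ *-monoʳ-≤ (weight o q (Dof c) (encode G)) (^-monoʳ-≤ q {{>-nonZero q>0}} (≤-trans (∑-upper≤ (λ i j → ⟦ edge G i j ∧ not (Dof c i j) ⟧)) out)) ⟩
    weight o q (Dof c) (encode G) * q ^ s ≡⟨ *-comm _ (q ^ s) ⟩
    q ^ s * weight o q (Dof c) (encode G) ≤⟨ *-monoʳ-≤ (q ^ s) (≤-trans (≤-reflexive (cong (λ b → if b then weight o q (Dof c) (encode G) else 0) (sym (Equivalence.to T-≡ (≤⇒≤ᵇ le))))) (∑L-∈ (λ c → V c (encode G)) c∈)) ⟩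
    q ^ s * ∑L cs (λ c → V c (encode G)) ∎

wt-≡ : ∀ {n} o (D : Digraph n) → Loopless D → 2 * wt o D + 2 * (⟦ o ⟧ * #dbl D) ≡ 5 * #deg D
wt-≡ {n} o D l = begin
  2 * wt o D + 2 * (⟦ o ⟧ * #dbl D) ≡⟨ cong₂ _+_ half (trans (cong (2 *_) (sym (∑∑-*ˡ ⟦ o ⟧ _))) (sym (∑∑-*ˡ 2 _))) ⟩
  ∑ (λ i → ∑ (g i)) + ∑ (λ i → ∑ (λ j → 2 * (⟦ o ⟧ * ⟦ dbl D i j ⟧))) ≡⟨ sym (∑∑-+ _ _) ⟩
  ∑ (λ i → ∑ (λ j → g i j + 2 * (⟦ o ⟧ * ⟦ dbl D i j ⟧))) ≡⟨ ∑∑-cong (λ i j → point o (D i j) (D j i)) ⟩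
  ∑ (λ i → ∑ (λ j → 5 * deg D i j)) ≡⟨ ∑∑-*ˡ 5 _ ⟩
  5 * #deg D ∎
  where
  open ≡-Reasoning
  g : Fin n → Fin n → ℕ
  g i j = exponent o (D i j) (D j i)
  point : ∀ o a b → exponent o a b + 2 * (⟦ o ⟧ * ⟦ a ∧ b ⟧) ≡ 5 * (⟦ a ⟧ + ⟦ b ⟧)
  point o a b = ≡ᵇ⇒≡ _ _ (taut 3 (λ o a b → (exponent o a b + 2 * (⟦ o ⟧ * ⟦ a ∧ b ⟧)) ≡ᵇ (5 * (⟦ a ⟧ + ⟦ b ⟧))) tt o a b)
  g-sym : ∀ o a b → exponent o a b ≡ exponent o b a
  g-sym o a b = ≡ᵇ⇒≡ _ _ (taut 3 (λ o a b → exponent o a b ≡ᵇ exponent o b a) tt o a b)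
  g-diag : ∀ i → g i i ≡ 0
  g-diag i = trans (cong (λ b → exponent o b b) (l i)) (≡ᵇ⇒≡ _ _ (taut 1 (λ o → exponent o false false ≡ᵇ 0) tt o))
  half : 2 * wt o D ≡ ∑ (λ i → ∑ (g i))
  half = trans (sym (∑∑-*ˡ 2 _)) (trans (∑∑-cong (λ i j → trans (eq ⟦ lt i j ⟧ (g i j)) (cong (λ z → ⟦ lt i j ⟧ * (g i j + z)) (g-sym o (D i j) (D j i))))) (∑-upper≡ g g-diag))
    where
    eq : ∀ a b → 2 * (a * b) ≡ a * (b + b)
    eq = solve-∀

-- Lists of container codes and graphs far from extremal

¬¬-All : ∀ {A : Set} {P Q : A → Set} {xs} → (∀ {x} → P x → ¬ ¬ Q x) → All P xs → ¬ ¬ All Q xs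
¬¬-All h [] = return []
¬¬-All h (p ∷ ps) = h p >>= λ q → ¬¬-All h ps >>= λ qs → return (q ∷ qs)

length-product : ∀ {A B C : Set} (g : A → B → C) xs ys → length (cartesianProductWith g xs ys) ≡ length xs * length ys
length-product g xs ys = trans (sym (∑L-length (cartesianProductWith g xs ys))) (trans (∑L-product g xs ys (λ _ → 1) (λ _ → 1) (λ _ → 1) (λ _ _ → refl)) (cong₂ _*_ (∑L-length xs) (∑L-length ys)))

∏-const : ∀ m c → ∏ {m} (λ _ → c) ≡ c ^ m
∏-const zero c = ∏-empty _
∏-const (suc m) c = trans (∏-suc _) (cong (c *_) (∏-const m c))

bitVecs : ∀ n → List (Vec Bool n)
bitVecs n = vecs (λ _ → bools)

length-bitVecs : ∀ n → length (bitVecs n) ≡ 2 ^ n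
length-bitVecs n = trans (length-vecs {m = n} (λ _ → bools)) (∏-const n 2)

steps : ∀ n → List (Step n)
steps n = cartesianProductWith _,_ bools (cartesianProductWith _,_ bools (cartesianProductWith _,_ (bitVecs n) (bitVecs n)))

∈-steps : ∀ {n} (s : Step n) → s ∈ steps n
∈-steps (a , b , S , R) = ∈-cartesianProductWith⁺ _,_ (∈-bools a) (∈-cartesianProductWith⁺ _,_ (∈-bools b) (∈-cartesianProductWith⁺ _,_ (∈-vecs _ S (λ _ → ∈-bools _)) (∈-vecs _ R (λ _ → ∈-bools _))))

length-steps : ∀ n → length (steps n) ≡ 2 ^ (2 + (n + n))
length-steps n = trans (length-product _,_ bools Q₂) (cong (2 *_) (trans (length-product _,_ bools Q₁) (cong (2 *_) (trans (length-product _,_ (bitVecs n) (bitVecs n)) (trans (cong₂ _*_ (length-bitVecs n) (length-bitVecs n)) (sym (^-distribˡ-+-* 2 n n)))))))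
  where
  Q₁ = cartesianProductWith _,_ (bitVecs n) (bitVecs n)
  Q₂ = cartesianProductWith _,_ bools Q₁

stepLists : ∀ n → ℕ → List (List (Step n))
stepLists n m = map toList (vecs {m = m} (λ _ → steps n))

∈-stepLists : ∀ {n m} (l : List (Step n)) → length l ≡ m → l ∈ stepLists n m
∈-stepLists l refl = subst (_∈ stepLists _ (length l)) (toList∘fromList l) (∈-map⁺ toList (∈-vecs _ (fromList l) (λ _ → ∈-steps _)))

length-stepLists : ∀ n m → length (stepLists n m) ≡ 2 ^ ((2 + (n + n)) * m)
length-stepLists n m = trans (length-map toList (vecs {m = m} (λ _ → steps n))) (trans (length-vecs {m = m} (λ _ → steps n)) (trans (∏-const m (length (steps n))) (trans (cong (_^ m) (length-steps n)) (^-*-assoc 2 (2 + (n + n)) m))))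

bernoulli : ∀ q j → j ≤ q → (q + 1) ^ j * (q ∸ j) ≤ q * q ^ j
bernoulli q zero h = ≤-reflexive (*-comm 1 q)
bernoulli q (suc j) h = begin
  (q + 1) * (q + 1) ^ j * (q ∸ suc j) ≡⟨ eq₁ (q + 1) ((q + 1) ^ j) (q ∸ suc j) ⟩
  (q + 1) ^ j * ((q + 1) * (q ∸ suc j)) ≤⟨ *-monoʳ-≤ ((q + 1) ^ j) step ⟩
  (q + 1) ^ j * (q * (q ∸ j)) ≡⟨ eq₁′ ((q + 1) ^ j) q (q ∸ j) ⟩
  q * ((q + 1) ^ j * (q ∸ j)) ≤⟨ *-monoʳ-≤ q (bernoulli q j (<⇒≤ h)) ⟩
  q * (q * q ^ j) ∎
  where
  open ≤-Reasoning
  eq₁ : ∀ a b c → a * b * c ≡ b * (a * c)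
  eq₁ = solve-∀
  eq₁′ : ∀ a b c → a * (b * c) ≡ b * (a * c)
  eq₁′ = solve-∀
  step : (q + 1) * (q ∸ suc j) ≤ q * (q ∸ j)
  step = ≤-trans (≤-reflexive (eq₂ q (q ∸ suc j))) (≤-trans (+-monoʳ-≤ (q * (q ∸ suc j)) (m∸n≤m q (suc j))) (≤-reflexive (trans (eq₃ q (q ∸ suc j)) (cong (q *_) (sym (+-∸-assoc 1 h))))))
    where
    eq₂ : ∀ q r → (q + 1) * r ≡ q * r + r
    eq₂ = solve-∀
    eq₃ : ∀ q r → q * r + q ≡ q * (1 + r)
    eq₃ = solve-∀

-- The bound (1 + 1/(2L))^L ≤ 2, which keeps the loss (1 + 1/q)^(2P) below 2^(2P/L).
bernoulli-2 : ∀ L → 0 < L → (2 * L + 1) ^ L ≤ 2 * (2 * L) ^ L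
bernoulli-2 L L>0 = *-cancelʳ-≤ _ _ L {{>-nonZero L>0}} (≤-trans (≤-reflexive (cong ((2 * L + 1) ^ L *_) (sym half))) (≤-trans (bernoulli (2 * L) L (m≤m+n L _)) (≤-reflexive (eq L ((2 * L) ^ L)))))
  where
  half : 2 * L ∸ L ≡ L
  half = trans (cong (_∸ L) (cong (L +_) (+-identityʳ L))) (m+n∸m≡n L L)
  eq : ∀ L p → 2 * L * p ≡ 2 * p * L
  eq = solve-∀

^-cancel : ∀ L {a b} → 0 < L → a ^ L ≤ b ^ L → a ≤ b
^-cancel L {a} {b} L>0 h with a ≤? b
... | yes p = p
... | no ¬p = contradiction h (<⇒≱ (^-monoˡ-< L {{>-nonZero L>0}} (≰⇒> ¬p)))

1+n≤2^n : ∀ n → suc n ≤ 2 ^ n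
1+n≤2^n zero = ≤-refl
1+n≤2^n (suc n) = ≤-trans (≤-trans (+-mono-≤ (s≤s z≤n) (≤-refl {suc n})) (+-mono-≤ (1+n≤2^n n) (1+n≤2^n n))) (≤-reflexive (cong (2 ^ n +_) (sym (+-identityʳ (2 ^ n)))))

-- Taking L-th powers makes all factors powers of 2 and of q = 2L. The saving u in the exponent has
-- to pay for the number of codes, the outside edges, the loss (1 + 1/q)^(2P) and the factor f + 1.
count-compare : ∀ f L X C P s w u ce → 0 < L → (let q = 2 * L in X * q ^ (2 * P) ≤ q ^ s * (C * ((q + 1) ^ (2 * P) * 2 ^ w)) → C ≤ 2 ^ ce → w + u ≡ P → L * (f + (q * s + ce)) + 2 * P ≤ L * u → suc f * X ≤ 2 ^ P)
count-compare f L X C P s w u ce L>0 h C≤ wu small = ^-cancel L L>0 (*-cancelʳ-≤ _ _ (q ^ (2 * P * L)) {{>-nonZero (m^n>0 q {{>-nonZero q>0}} (2 * P * L))}} (begin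
  (suc f * X) ^ L * q ^ (2 * P * L) ≡⟨ trans (cong ((suc f * X) ^ L *_) (sym (^-*-assoc q (2 * P) L))) (sym (^-distribʳ-* L (suc f * X) (q ^ (2 * P)))) ⟩
  (suc f * X * q ^ (2 * P)) ^ L ≤⟨ ^-monoˡ-≤ L base ⟩
  (2 ^ a * (q + 1) ^ (2 * P)) ^ L ≡⟨ trans (^-distribʳ-* L (2 ^ a) _) (cong₂ _*_ (^-*-assoc 2 a L) (trans (^-*-assoc (q + 1) (2 * P) L) (trans (cong ((q + 1) ^_) (*-comm (2 * P) L)) (sym (^-*-assoc (q + 1) L (2 * P)))))) ⟩
  2 ^ (a * L) * ((q + 1) ^ L) ^ (2 * P) ≤⟨ *-monoʳ-≤ (2 ^ (a * L)) (^-monoˡ-≤ (2 * P) (bernoulli-2 L L>0)) ⟩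
  2 ^ (a * L) * (2 * q ^ L) ^ (2 * P) ≡⟨ cong (2 ^ (a * L) *_) (trans (^-distribʳ-* (2 * P) 2 (q ^ L)) (cong (2 ^ (2 * P) *_) (trans (^-*-assoc q L (2 * P)) (cong (q ^_) (*-comm L (2 * P)))))) ⟩
  2 ^ (a * L) * (2 ^ (2 * P) * q ^ (2 * P * L)) ≡⟨ trans (sym (*-assoc (2 ^ (a * L)) _ _)) (cong (_* q ^ (2 * P * L)) (sym (^-distribˡ-+-* 2 (a * L) (2 * P)))) ⟩
  2 ^ (a * L + 2 * P) * q ^ (2 * P * L) ≤⟨ *-monoˡ-≤ (q ^ (2 * P * L)) (^-monoʳ-≤ 2 exps) ⟩
  2 ^ (P * L) * q ^ (2 * P * L) ≡⟨ cong (_* q ^ (2 * P * L)) (sym (^-*-assoc 2 P L)) ⟩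
  (2 ^ P) ^ L * q ^ (2 * P * L) ∎))
  where
  open ≤-Reasoning
  q = 2 * L
  q>0 : 0 < q
  q>0 = *-mono-≤ {1} {2} (s≤s z≤n) L>0
  a = f + (q * s + (ce + w))
  exps : a * L + 2 * P ≤ P * L
  exps = lin 0 small (subst (λ P′ → (f + (q * s + (ce + w))) * L + 2 * P + L * u + 0 ≡ P′ * L + (L * (f + (q * s + ce)) + 2 * P)) wu (eq f (q * s) ce w L u P))
    where
    eq : ∀ f x c w L u P → (f + (x + (c + w))) * L + 2 * P + L * u + 0 ≡ (w + u) * L + (L * (f + (x + c)) + 2 * P)
    eq = solve-∀
  base : suc f * X * q ^ (2 * P) ≤ 2 ^ a * (q + 1) ^ (2 * P)
  base = begin
    suc f * X * q ^ (2 * P) ≡⟨ *-assoc (suc f) X _ ⟩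
    suc f * (X * q ^ (2 * P)) ≤⟨ *-mono-≤ (1+n≤2^n f) h ⟩
    2 ^ f * (q ^ s * (C * ((q + 1) ^ (2 * P) * 2 ^ w))) ≤⟨ *-monoʳ-≤ (2 ^ f) (*-mono-≤ (≤-trans (^-monoˡ-≤ s (n≤2^n q)) (≤-reflexive (^-*-assoc 2 q s))) (*-monoˡ-≤ _ C≤)) ⟩
    2 ^ f * (2 ^ (q * s) * (2 ^ ce * ((q + 1) ^ (2 * P) * 2 ^ w))) ≡⟨ eq (2 ^ f) (2 ^ (q * s)) (2 ^ ce) ((q + 1) ^ (2 * P)) (2 ^ w) ⟩
    2 ^ f * (2 ^ (q * s) * (2 ^ ce * 2 ^ w)) * (q + 1) ^ (2 * P) ≡⟨ cong (_* (q + 1) ^ (2 * P)) (sym (trans (^-distribˡ-+-* 2 f _) (cong (2 ^ f *_) (trans (^-distribˡ-+-* 2 (q * s) _) (cong (2 ^ (q * s) *_) (^-distribˡ-+-* 2 ce w)))))) ⟩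
    2 ^ a * (q + 1) ^ (2 * P) ∎
    where
    eq : ∀ a b c d e → a * (b * (c * (d * e))) ≡ a * (b * (c * e)) * d
    eq = solve-∀

container-loopless : ∀ {n} θ M (l : List (Step n)) → Loopless (container θ M l)
container-loopless θ M l x with x FP.≟ x
... | yes _ = ∧-false (θ ≤ᵇ run θ M l x x)
  where
  ∧-false : ∀ a → a ∧ false ≡ false
  ∧-false true = refl
  ∧-false false = refl
... | no q = contradiction refl q

-- The extremal weight is that of a transitive tournament, 5 n² / 2 up to lower order.
Far : Bool → ℕ → ℕ → ∀ {n} → Mat n → Set
Far o k F {n} G = ∀ (D : Digraph n) → Loopless D → F * outside G D ≤ n * n → F * tr (pow ⟪ D ⟫ k) ≤ n ^ k → ¬ (F * (5 * (n * n) ∸ 2 * wt o D) ≤ n * n)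

-- A container of weight above 5 (P - u₀) would be nearly extremal, contrary to `Far`. So all
-- containers save u₀, a constant fraction of n², in the exponent, whereas their codes have only
-- O(n) bits.
count-far : ∀ o j F → 0 < F → ∀ f → ∃ λ N → ∀ n → N ≤ n → ∀ (S : List (Mat n)) → Unique S →
  All (λ G → IsDigraph G × (o ≡ true → Oriented G) × CkFree (3 + j) G × Far o (3 + j) F G) S → suc f * length S ≤ 2 ^ #pairs n
count-far o j F F>0 f = N , main
  where
  -- With u₀ about n² / (20F) the saving L u₀ is about 4n². The outside edges, the term 2P and the
  -- terms of lower order take at most n² each, and the last n² covers the rounding.
  L = 80 * F
  q = 2 * L
  L>0 : 0 < L
  L>0 = *-mono-≤ {1} {80} (s≤s z≤n) F>0
  q>0 : 0 < q
  q>0 = *-mono-≤ {1} {2} (s≤s z≤n) L>0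
  Lq>0 : 0 < L * q
  Lq>0 = *-mono-≤ L>0 q>0
  Ec = F + L * q
  cont = containers j Ec (≤-trans F>0 (m≤m+n F _))
  θ = proj₁ cont
  M = proj₁ (proj₂ cont)
  N₁ = proj₁ (proj₂ (proj₂ cont))
  N₂ = L * f + (L * (4 * (M * M)) + 80 * F)
  N = 1 + (N₁ + (N₂ + 20 * F))
  main : ∀ n → N ≤ n → ∀ (S : List (Mat n)) → Unique S → All (λ G → IsDigraph G × (o ≡ true → Oriented G) × CkFree (3 + j) G × Far o (3 + j) F G) S → suc f * length S ≤ 2 ^ #pairs n
  main n N≤n S u all with floor (20 * F) (n * n) (*-mono-≤ {1} {20} (s≤s z≤n) F>0) | floor (L * q) (n * n) Lq>0
  -- Here u₀ is the number of bits saved and s the number of outside edges allowed.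
  ... | u₀ , u≤ , <u | s , s≤ , <s = decidable-stable (_ ≤? _) (¬¬-All (λ {G} → code {G}) all >>= λ coded → return (count-compare f L (length S) (length cs) P s w u₀ ce L>0 (upper-count Dof cs o q s w q>0 S u coded) (≤-reflexive (length-stepLists n (M * M))) (m∸n+n≡m u₀≤P) small))
    where
    P = #pairs n
    w = P ∸ u₀
    cs = stepLists n (M * M)
    ce = (2 + (n + n)) * (M * M)
    Dof = container θ M
    n>0 : 0 < n
    n>0 = ≤-trans (s≤s z≤n) N≤n
    N₁≤n : N₁ ≤ n
    N₁≤n = ≤-trans (≤-trans (m≤m+n N₁ _) (n≤1+n _)) N≤n
    N₂≤n : N₂ ≤ n
    N₂≤n = ≤-trans (≤-trans (≤-trans (m≤m+n N₂ (20 * F)) (m≤n+m _ N₁)) (n≤1+n _)) N≤n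
    20F≤n : 20 * F ≤ n
    20F≤n = ≤-trans (≤-trans (≤-trans (m≤n+m (20 * F) N₂) (m≤n+m _ N₁)) (n≤1+n _)) N≤n
    2≤n : 2 ≤ n
    2≤n = ≤-trans (*-mono-≤ {2} {20} (s≤s (s≤s z≤n)) F>0) 20F≤n
    u₀≤P : u₀ ≤ P
    u₀≤P = *-cancelˡ-≤ 20 (*-cancelˡ-≤ 2 (lin (16 * n) (+-mono-≤ (+-mono-≤ (*-monoʳ-≤ 2 (≤-trans (*-monoˡ-≤ u₀ (≤-trans (≤-reflexive (sym (*-identityʳ 20))) (*-monoʳ-≤ 20 F>0))) u≤)) (*-monoʳ-≤ 18 (*-monoˡ-≤ n 2≤n))) (≤-reflexive (cong (20 *_) (sym (#pairs-≡ n))))) (eq u₀ P n)))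
      where
      eq : ∀ u P n → 2 * (20 * u) + ((2 * (n * n) + 18 * (n * n)) + 20 * (2 * P + n)) + 16 * n ≡ 2 * (20 * P) + ((2 * (20 * u) + 18 * (2 * n)) + 20 * (n * n))
      eq = solve-∀
    small : L * (f + (q * s + ce)) + 2 * P ≤ L * u₀
    small = lin (n * n + n) (+-mono-≤ (+-mono-≤ (*-monoʳ-≤ 4 (<⇒≤ <u)) s≤) (+-mono-≤ (≤-reflexive (#pairs-≡ n)) rest)) (eq F f s ce P u₀ n)
      where
      rest : L * f + L * ce + 80 * F ≤ n * n
      rest = ≤-trans (+-mono-≤ (+-mono-≤ (*-monoˡ′ (L * f)) (*-monoʳ-≤ L (*-monoˡ-≤ (M * M) {2 + (n + n)} {4 * n} (≤-trans (+-monoˡ-≤ (n + n) (*-monoʳ-≤ 2 n>0)) (≤-reflexive (eq₄ n)))))) (*-monoˡ′ (80 * F))) (≤-trans (≤-reflexive (eq′ (L * f) L (M * M) (80 * F) n)) (*-monoˡ-≤ n N₂≤n))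
        where
        *-monoˡ′ : ∀ a → a ≤ a * n
        *-monoˡ′ a = ≤-trans (≤-reflexive (sym (*-identityʳ a))) (*-monoʳ-≤ a n>0)
        eq₄ : ∀ n → 2 * n + (n + n) ≡ 4 * n
        eq₄ = solve-∀
        eq′ : ∀ a L m b n → a * n + L * (4 * n * m) + b * n ≡ (a + (L * (4 * m) + b)) * n
        eq′ = solve-∀
      eq : ∀ F f s ce P u n → (80 * F) * (f + (2 * (80 * F) * s + ce)) + 2 * P + ((4 * (20 * F * (1 + u)) + n * n) + (n * n + n * n)) + (n * n + n) ≡ (80 * F) * u + ((4 * (n * n) + (80 * F) * (2 * (80 * F)) * s) + ((2 * P + n) + ((80 * F) * f + (80 * F) * ce + 80 * F)))
      eq = solve-∀
    code : ∀ {G} → IsDigraph G × (o ≡ true → Oriented G) × CkFree (3 + j) G × Far o (3 + j) F G → ¬ ¬ (IsDigraph G × (o ≡ true → Oriented G) × ∃ λ c → c ∈ cs × wt o (Dof c) ≤ 5 * w × outside G (Dof c) ≤ s)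
    code {G} (d , or , free , far) = proj₂ (proj₂ (proj₂ cont)) n N₁≤n G d free >>= λ { (l , len , out , cyc) → return (d , or , l , ∈-stepLists l len , wt-small l out cyc , outs l out) }
      where
      outs : ∀ l → Ec * outside G (Dof l) ≤ n * n → outside G (Dof l) ≤ s
      outs l out = ≤-pred (*-cancelˡ-< (L * q) _ _ (<-≤-trans (≤-<-trans (≤-trans (*-monoˡ-≤ (outside G (Dof l)) (m≤n+m (L * q) F)) out) <s) ≤-refl))
      wt-small : ∀ l → Ec * outside G (Dof l) ≤ n * n → Ec * tr (pow ⟪ Dof l ⟫ (3 + j)) ≤ n ^ (3 + j) → wt o (Dof l) ≤ 5 * w
      wt-small l out cyc = ≮⇒≥ λ big → far (Dof l) (container-loopless θ M l) (≤-trans (*-monoˡ-≤ (outside G (Dof l)) (m≤m+n F (L * q))) out) (≤-trans (*-monoˡ-≤ (tr (pow ⟪ Dof l ⟫ (3 + j))) (m≤m+n F (L * q))) cyc) (near big)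
        where
        near : 5 * w < wt o (Dof l) → F * (5 * (n * n) ∸ 2 * wt o (Dof l)) ≤ n * n
        near big = ≤-trans (*-monoʳ-≤ F (m≤n+o⇒m∸n≤o (5 * (n * n)) (2 * wt o (Dof l)) gap)) final
          where
          gap : 5 * (n * n) ≤ 2 * wt o (Dof l) + (10 * u₀ + 5 * n)
          gap = lin 0 (+-mono-≤ (*-monoʳ-≤ 2 (<⇒≤ big)) (*-monoʳ-≤ 5 (≤-reflexive (trans (sym (#pairs-≡ n)) (cong (λ p → 2 * p + n) (sym (m∸n+n≡m u₀≤P))))))) (eq (wt o (Dof l)) w u₀ n)
            where
            eq : ∀ t w u n → 5 * (n * n) + (2 * t + 5 * (2 * (w + u) + n)) + 0 ≡ 2 * t + (10 * u + 5 * n) + (2 * (5 * w) + 5 * (n * n))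
            eq = solve-∀
          final : F * (10 * u₀ + 5 * n) ≤ n * n
          final = *-cancelˡ-≤ 4 (lin (n * n) (+-mono-≤ (*-monoʳ-≤ 2 u≤) (*-monoˡ-≤ n 20F≤n)) (eq F u₀ n))
            where
            eq : ∀ F u n → 4 * (F * (10 * u + 5 * n)) + (2 * (n * n) + n * n) + n * n ≡ 4 * (n * n) + (2 * (20 * F * u) + 20 * F * n)
            eq = solve-∀

-- Replacing blocks by directed cycles

≡ᵇ-sound : ∀ {a b} → (a ≡ᵇ b) ≡ true → a ≡ b
≡ᵇ-sound {a} {b} e = ≡ᵇ⇒≡ a b (Equivalence.from T-≡ e)

≡ᵇ-complete : ∀ {a b} → a ≡ b → (a ≡ᵇ b) ≡ true
≡ᵇ-complete {a} {b} e = Equivalence.to T-≡ (≡⇒≡ᵇ a b e)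

<ᵇ-sound : ∀ {a b} → (a <ᵇ b) ≡ true → a < b
<ᵇ-sound {a} {b} e = <ᵇ⇒< a b (Equivalence.from T-≡ e)

lexℕ : ∀ s a b i j → i < s → j < s → i + a * s ≡ j + b * s → a ≡ b × i ≡ j
lexℕ s a b i j i<s j<s e with lex-injective {s} a b (fromℕ< i<s) (fromℕ< j<s) (trans (cong (a * s +_) (FP.toℕ-fromℕ< i<s)) (trans (+-comm (a * s) i) (trans e (trans (+-comm j (b * s)) (cong (b * s +_) (sym (FP.toℕ-fromℕ< j<s)))))))
... | p , q = p , trans (sym (FP.toℕ-fromℕ< i<s)) (trans (cong toℕ q) (FP.toℕ-fromℕ< j<s))

Walk : ∀ {n} → Mat n → ℕ → Fin n → Fin n → Set
Walk M zero u v = u ≡ v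
Walk M (suc j) u v = ∃ λ z → Edge M u z × Walk M j z v

-- An edge on a closed walk of length k + 1. The property mentions M alone, so it can be read off
-- without knowledge of the ordering or the chosen blocks.
Cyclic : ∀ {n} → ℕ → Mat n → Fin n → Fin n → Set
Cyclic k M u v = Edge M u v × Walk M k v u

Chain : ∀ {n} → ℕ → Mat n → ℕ → Fin n → Fin n → Set
Chain k M zero u v = u ≡ v
Chain k M (suc i) u v = ∃ λ z → Cyclic k M u z × Chain k M i z v

module _ (k : ℕ) where

  private
    s = suc k

  %-shift : ∀ i a → (i + (suc a) % s) % s ≡ (suc i + a) % s
  %-shift i a = trans (%-distribˡ-+ i (suc a % s) s) (trans (cong (λ z → (i % s + z) % s) (m%n%n≡m%n (suc a) s)) (trans (sym (%-distribˡ-+ i (suc a) s)) (cong (_% s) (+-suc i a))))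

  %-absorb : ∀ i a → (i % s + a) % s ≡ (i + a) % s
  %-absorb i a = trans (%-distribˡ-+ (i % s) a s) (trans (cong (λ z → (z + a % s) % s) (m%n%n≡m%n i s)) (sym (%-distribˡ-+ i a s)))

  no-return : ∀ j a → 0 < j → j < s → a < s → (j + a) % s ≢ a
  no-return j a j>0 j<s a<s e with j + a <? s
  ... | yes lt = <⇒≢ (≤-trans (+-monoˡ-≤ a j>0) ≤-refl) (sym (trans (sym (m<n⇒m%n≡m lt)) e))
  ... | no ¬lt = <⇒≢ (+-monoˡ-< a j<s) (trans (sym (m∸n+n≡m ge)) (trans (cong (_+ s) r≡a) (+-comm a s)))
    where
    ge : s ≤ j + a
    ge = ≮⇒≥ ¬lt
    r = j + a ∸ s
    r<s : r < s
    r<s = +-cancelʳ-< s r s (≤-trans (s≤s (≤-reflexive (m∸n+n≡m ge))) (+-mono-< j<s a<s))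
    r≡a : r ≡ a
    r≡a = trans (sym (m<n⇒m%n≡m r<s)) (trans (sym ([m+n]%n≡m%n r s)) (trans (cong (_% s) (m∸n+n≡m ge)) e))

module Surgery (k t R : ℕ) (k≥3 : 3 ≤ k) {n : ℕ} (fits : t * R * suc k ≤ n) (G : Mat n) (σ : Permutation′ n) (I : Vec (Fin R) t) where

  s = suc k

  pos blk off : Fin n → ℕ
  pos v = toℕ (σ ⟨$⟩ʳ v)
  blk v = pos v / s
  off v = pos v % s

  off<s : ∀ v → off v < s
  off<s v = m%n<n (pos v) s

  pos-≡ : ∀ v → pos v ≡ off v + blk v * s
  pos-≡ v = m≡m%n+[m/n]*n (pos v) s

  pos-injective : ∀ {u v} → pos u ≡ pos v → u ≡ v
  pos-injective {u} {v} e = trans (sym (inverseˡ σ)) (trans (cong (σ ⟨$⟩ˡ_) (FP.toℕ-injective e)) (inverseˡ σ))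

  place : ∀ {u v} → blk u ≡ blk v → off u ≡ off v → u ≡ v
  place {u} {v} b o = pos-injective (trans (pos-≡ u) (trans (cong₂ (λ x y → x + y * s) o b) (sym (pos-≡ v))))

  -- Group g consists of the blocks gR, ..., gR + R - 1, so choices in different groups never
  -- collide.
  chosen : Fin t → ℕ
  chosen g = toℕ g * R + toℕ (lookup I g)

  sel : ℕ → Bool
  sel c = does (FP.any? (λ g → c ≟ chosen g))

  sel-sound : ∀ {c} → sel c ≡ true → ∃ λ g → c ≡ chosen g
  sel-sound {c} e with FP.any? (λ g → c ≟ chosen g)
  ... | yes p = p

  sel-chosen : ∀ g → sel (chosen g) ≡ true
  sel-chosen g = dec-true (FP.any? (λ g′ → chosen g ≟ chosen g′)) (g , refl)

  chosen<tR : ∀ g → chosen g < t * R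
  chosen<tR g = ≤-trans (+-monoʳ-< (toℕ g * R) (FP.toℕ<n (lookup I g))) (≤-trans (≤-reflexive (+-comm (toℕ g * R) R)) (*-monoˡ-≤ R (FP.toℕ<n g)))

  vertex : ∀ c o → sel c ≡ true → o < s → ∃ λ v → blk v ≡ c × off v ≡ o
  vertex c o e o<s with sel-sound e
  ... | g , refl = v , lexℕ s (blk v) (chosen g) (off v) o (off<s v) o<s (trans (sym (pos-≡ v)) (trans (cong toℕ (inverseʳ σ)) (FP.toℕ-fromℕ< p<n)))
    where
    p<n : o + chosen g * s < n
    p<n = ≤-trans (≤-trans (+-monoˡ-< (chosen g * s) o<s) (*-monoˡ-≤ s (chosen<tR g))) fits
    v = σ ⟨$⟩ˡ fromℕ< p<n

  forward : Fin n → Fin n → Bool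
  forward u v = edge G u v ∧ (pos u <ᵇ pos v)

  together : Fin n → Fin n → Bool
  together u v = (blk u ≡ᵇ blk v) ∧ sel (blk u)

  -- A chosen block carries the directed cycle through its vertices in order and nothing else. All
  -- other pairs, including those between different blocks, keep their forward edges.
  X : Fin n → Fin n → Bool
  X u v = if together u v then (suc (off u) % s ≡ᵇ off v) else forward u v

  X-apart : ∀ {u v} → together u v ≡ false → X u v ≡ forward u v
  X-apart {u} {v} e = cong (λ b → if b then (suc (off u) % s ≡ᵇ off v) else forward u v) e

  M : Mat n
  M = matrix X

  X-edge : ∀ {u v} → Edge M u v → X u v ≡ true
  X-edge {u} {v} e = trans (sym (edge-matrix X u v)) e

  edge-X : ∀ {u v} → X u v ≡ true → Edge M u v
  edge-X {u} {v} e = trans (edge-matrix X u v) e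

  data Step′ (u v : Fin n) : Set where
    inside : blk u ≡ blk v → sel (blk u) ≡ true → suc (off u) % s ≡ off v → Step′ u v
    across : pos u < pos v → (blk u ≡ blk v → sel (blk u) ≡ false) → Step′ u v

  view : ∀ {u v} → Edge M u v → Step′ u v
  view {u} {v} e = go (blk u ≡ᵇ blk v) (sel (blk u)) refl refl (X-edge e)
    where
    go : ∀ a b → (blk u ≡ᵇ blk v) ≡ a → sel (blk u) ≡ b → (if a ∧ b then (suc (off u) % s ≡ᵇ off v) else forward u v) ≡ true → Step′ u v
    go true true p q e = inside (≡ᵇ-sound p) q (≡ᵇ-sound e)
    go true false p q e = across (<ᵇ-sound (proj₂ (∧-true {edge G u v} e))) (λ _ → q)
    go false b p q e = across (<ᵇ-sound (proj₂ (∧-true {edge G u v} e))) (λ eq → ⊥-elim (true≢false (trans (sym (≡ᵇ-complete eq)) p)))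

  blk-mono : ∀ {u v} → Edge M u v → blk u ≤ blk v
  blk-mono e with view e
  ... | inside p _ _ = ≤-reflexive p
  ... | across lt _ = /-mono-≤ (<⇒≤ lt) ≤-refl

  walk-mono : ∀ j {u v} → Walk M j u v → blk u ≤ blk v
  walk-mono zero refl = ≤-refl
  walk-mono (suc j) (z , e , w) = ≤-trans (blk-mono e) (walk-mono j w)

  walk-pos : ∀ j {u v} → Walk M j u v → blk u ≡ blk v → sel (blk u) ≡ false → pos u ≤ pos v
  walk-pos zero refl _ _ = ≤-refl
  walk-pos (suc j) {u} {v} (z , e , w) b ns = go (view e)
    where
    uz : blk u ≡ blk z
    uz = ≤-antisym (blk-mono e) (≤-trans (walk-mono j w) (≤-reflexive (sym b)))
    go : Step′ u z → pos u ≤ pos v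
    go (inside _ q _) = ⊥-elim (true≢false (trans (sym q) ns))
    go (across lt _) = ≤-trans (<⇒≤ lt) (walk-pos j w (trans (sym uz) b) (trans (cong sel (sym uz)) ns))

  Shift : ℕ → Fin n → Fin n → Set
  Shift i u v = blk u ≡ blk v × off v ≡ (i + off u) % s

  shift-target : ∀ i u → sel (blk u) ≡ true → ∃ λ v → Shift i u v
  shift-target i u q with vertex (blk u) ((i + off u) % s) q (m%n<n (i + off u) s)
  ... | v , b , o = v , sym b , o

  shift-unique : ∀ i {u v w} → Shift i u v → Shift i u w → v ≡ w
  shift-unique i (b , o) (b′ , o′) = place (trans (sym b) b′) (trans o (sym o′))

  shift-edge : ∀ {u v} → sel (blk u) ≡ true → Shift 1 u v → Edge M u v
  shift-edge {u} {v} q (b , o) = edge-X (trans (cong (λ c → if c then (suc (off u) % s ≡ᵇ off v) else forward u v) (∧-intro (≡ᵇ-complete b) q)) (≡ᵇ-complete (sym o)))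

  shift-walk : ∀ i {u v} → sel (blk u) ≡ true → Shift i u v → Walk M i u v
  shift-walk zero {u} {v} q (b , o) = place b (sym (trans o (m<n⇒m%n≡m (off<s u))))
  shift-walk (suc i) {u} {v} q (b , o) with shift-target 1 u q
  ... | z , bz , oz = z , shift-edge q (bz , oz) , shift-walk i (trans (cong sel (sym bz)) q) (trans (sym bz) b , trans o (trans (sym (%-shift k i (off u))) (cong (λ a → (i + a) % s) (sym oz))))

  shift-cyclic : ∀ {u v} → sel (blk u) ≡ true → Shift 1 u v → Cyclic k M u v
  shift-cyclic {u} {v} q (b , o) = shift-edge q (b , o) , shift-walk k (trans (cong sel (sym b)) q) (sym b , sym (trans (cong (λ a → (k + a) % s) o) (trans (%-shift k k (off u)) (trans (cong (_% s) (+-comm s (off u))) (trans ([m+n]%n≡m%n (off u) s) (m<n⇒m%n≡m (off<s u)))))))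

  -- Edges never lead to an earlier block, so a closed walk stays in one block; in a block that was
  -- not chosen it would move strictly forward. Hence closed walks live in chosen blocks only.
  cyclic-shift : ∀ {u v} → Cyclic k M u v → sel (blk u) ≡ true × Shift 1 u v
  cyclic-shift {u} {v} (e , w) with view e
  ... | inside b q o = q , b , sym o
  ... | across lt ns = ⊥-elim (<⇒≱ lt (walk-pos k w (sym b) (trans (cong sel (sym b)) (ns b))))
    where
    b : blk u ≡ blk v
    b = ≤-antisym (blk-mono e) (walk-mono k w)

  shift-chain : ∀ i {u v} → sel (blk u) ≡ true → Shift i u v → Chain k M i u v
  shift-chain zero {u} q (b , o) = place b (sym (trans o (m<n⇒m%n≡m (off<s u))))
  shift-chain (suc i) {u} {v} q (b , o) with shift-target 1 u q
  ... | z , bz , oz = z , shift-cyclic q (bz , oz) , shift-chain i (trans (cong sel (sym bz)) q) (trans (sym bz) b , trans o (trans (sym (%-shift k i (off u))) (cong (λ a → (i + a) % s) (sym oz))))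

  chain-shift : ∀ i {u v} → Chain k M i u v → Shift i u v
  chain-shift zero {u} refl = refl , sym (m<n⇒m%n≡m (off<s u))
  chain-shift (suc i) {u} {v} (z , c , ch) with cyclic-shift c | chain-shift i ch
  ... | _ , bz , oz | b , o = trans bz b , trans o (trans (cong (λ a → (i + a) % s) oz) (%-shift k i (off u)))

  together-shift : ∀ {u v} → together u v ≡ true → ∃ λ (i : Fin s) → Shift (toℕ i) u v
  together-shift {u} {v} e with ∧-true {blk u ≡ᵇ blk v} e
  ... | p , q = fromℕ< (m%n<n d s) , ≡ᵇ-sound p , sym (trans (cong (λ i → (i + off u) % s) (FP.toℕ-fromℕ< (m%n<n d s))) (trans (%-absorb k d (off u)) (trans (cong (_% s) (trans (+-assoc (off v) (s ∸ off u) (off u)) (cong (off v +_) (m∸n+n≡m (<⇒≤ (off<s u)))))) (trans ([m+n]%n≡m%n (off v) s) (m<n⇒m%n≡m (off<s v))))))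
    where
    d = off v + (s ∸ off u)

  shift-together : ∀ i {u v} → sel (blk u) ≡ true → Shift i u v → together u v ≡ true
  shift-together i q (b , _) = ∧-intro (≡ᵇ-complete b) q

  bitsIf : ∀ u b → sel (blk u) ≡ b → Vec Bool s
  bitsIf u true q = tabulate (λ i → forward u (proj₁ (shift-target (toℕ i) u q)))
  bitsIf u false q = tabulate (λ _ → false)

  -- The forward edges from u that the surgery destroyed, indexed by the distance along the cycle
  -- and not by the position in the ordering. A decoder that sees only M can interpret this index.
  bits : Fin n → Vec Bool s
  bits u = bitsIf u (sel (blk u)) refl

  bits-shift : ∀ (i : Fin s) {u v} → sel (blk u) ≡ true → Shift (toℕ i) u v → lookup (bits u) i ≡ forward u v
  bits-shift i {u} {v} q sh = go (sel (blk u)) refl q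
    where
    go : ∀ b (e : sel (blk u) ≡ b) → b ≡ true → lookup (bitsIf u b e) i ≡ forward u v
    go true e _ = trans (lookup∘tabulate (λ i → forward u (proj₁ (shift-target (toℕ i) u e))) i) (cong (forward u) (shift-unique (toℕ i) (proj₂ (shift-target (toℕ i) u e)) sh))

  M-digraph : IsDigraph M
  M-digraph u e with view e
  ... | inside _ _ o = no-return k 1 (off u) (s≤s z≤n) (s≤s (≤-trans (s≤s z≤n) k≥3)) (off<s u) o
  ... | across lt _ = <-irrefl refl lt

  M-asymmetric : ∀ u v → Edge M u v → ¬ Edge M v u
  M-asymmetric u v e e′ with view e | view e′
  ... | inside b q o | inside _ _ o′ = no-return k 2 (off u) (s≤s z≤n) (s≤s (≤-trans (s≤s (s≤s z≤n)) k≥3)) (off<s u) (trans (sym (%-shift k 1 (off u))) (trans (cong (λ a → suc a % s) o) o′))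
  ... | inside b q _ | across _ ns = true≢false (trans (sym q) (trans (cong sel b) (ns (sym b))))
  ... | across _ ns | inside b q _ = true≢false (trans (sym q) (trans (cong sel b) (ns (sym b))))
  ... | across lt _ | across lt′ _ = <-asym lt lt′

  -- A cycle stays in one block. A block that was not chosen has forward edges only, and a chosen
  -- block is a cycle of length k + 1.
  M-CkFree : CkFree k M
  M-CkFree (f , _ , e) = go k refl f e
    where
    go : ∀ m → m ≡ k → (f : Fin m → Fin n) → (∀ i j → (suc (toℕ i) ≡ toℕ j ⊎ (suc (toℕ i) ≡ m × toℕ j ≡ 0)) → Edge M (f i) (f j)) → ⊥
    go zero eq f e = contradiction (subst (3 ≤_) (sym eq) k≥3) λ ()
    go (suc m) eq f e = decide (sel c) refl
      where
      c = blk (f zero)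
      low : ∀ i → c ≤ blk (f i)
      low = <-weakInduction (λ i → c ≤ blk (f i)) ≤-refl (λ i p → ≤-trans p (blk-mono (e (inject₁ i) (suc i) (inj₁ (cong suc (FP.toℕ-inject₁ i))))))
      high : ∀ i → blk (f i) ≤ blk (f (fromℕ m))
      high i = climb (m ∸ toℕ i) i (m+[n∸m]≡n (≤-pred (FP.toℕ<n i)))
        where
        climb : ∀ d i → toℕ i + d ≡ m → blk (f i) ≤ blk (f (fromℕ m))
        climb zero i q = ≤-reflexive (cong (blk ∘ f) (FP.toℕ-injective (trans (trans (sym (+-identityʳ (toℕ i))) q) (sym (FP.toℕ-fromℕ m)))))
        climb (suc d) i q = ≤-trans (blk-mono (e i j (inj₁ (sym j≡)))) (climb d j (trans (cong (_+ d) j≡) (trans (sym (+-suc (toℕ i) d)) q)))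
          where
          j<m : suc (toℕ i) < suc m
          j<m = s≤s (≤-trans (m≤m+n (suc (toℕ i)) d) (≤-reflexive (trans (sym (+-suc (toℕ i) d)) q)))
          j = fromℕ< j<m
          j≡ : toℕ j ≡ suc (toℕ i)
          j≡ = FP.toℕ-fromℕ< j<m
      same : ∀ i → blk (f i) ≡ c
      same i = ≤-antisym (≤-trans (high i) (blk-mono (e (fromℕ m) zero (inj₂ (cong suc (FP.toℕ-fromℕ m) , refl))))) (low i)
      rotates : sel c ≡ true → ∀ i → off (f i) ≡ (toℕ i + off (f zero)) % s
      rotates q = <-weakInduction (λ i → off (f i) ≡ (toℕ i + off (f zero)) % s) (sym (m<n⇒m%n≡m (off<s (f zero)))) (λ i p → advance (inject₁ i) (suc i) (toℕ i) (e (inject₁ i) (suc i) (inj₁ (cong suc (FP.toℕ-inject₁ i)))) (trans p (cong (λ a → (a + off (f zero)) % s) (FP.toℕ-inject₁ i))))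
        where
        advance : ∀ i j a → Edge M (f i) (f j) → off (f i) ≡ (a + off (f zero)) % s → off (f j) ≡ (suc a + off (f zero)) % s
        advance i j a ed p with view ed
        ... | inside _ _ o = trans (sym o) (trans (cong (λ z → suc z % s) p) (trans (%-absorb′ (a + off (f zero))) refl))
          where
          %-absorb′ : ∀ b → suc (b % s) % s ≡ suc b % s
          %-absorb′ b = trans (cong (_% s) (+-comm 1 (b % s))) (trans (%-absorb k b 1) (cong (_% s) (+-comm b 1)))
        ... | across _ ns = ⊥-elim (true≢false (trans (sym q) (trans (cong sel (sym (same i))) (ns (trans (same i) (sym (same j)))))))
      decide : ∀ b → sel c ≡ b → ⊥
      decide true q with view (e (fromℕ m) zero (inj₂ (cong suc (FP.toℕ-fromℕ m) , refl)))
      -- Going k steps around a cycle of k + 1 vertices does not lead back to the start.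
      ... | inside _ _ o = no-return k (suc m) (off (f zero)) (s≤s z≤n) (s≤s (≤-reflexive eq)) (off<s (f zero)) (trans (sym (trans (cong (λ z → suc z % s) (trans (rotates q (fromℕ m)) (cong (λ a → (a + off (f zero)) % s) (FP.toℕ-fromℕ m)))) (absorb (m + off (f zero))))) o)
        where
        absorb : ∀ b → suc (b % s) % s ≡ suc b % s
        absorb b = trans (cong (_% s) (+-comm 1 (b % s))) (trans (%-absorb k b 1) (cong (_% s) (+-comm b 1)))
      ... | across _ ns = true≢false (trans (sym q) (trans (cong sel (sym (same (fromℕ m)))) (ns (same (fromℕ m)))))
      decide false q = last (view (e (fromℕ m) zero (inj₂ (cong suc (FP.toℕ-fromℕ m) , refl))))
        where
        up : ∀ {i j} → Step′ (f i) (f j) → pos (f i) < pos (f j)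
        up {i} (inside _ q′ _) = ⊥-elim (true≢false (trans (sym q′) (trans (cong sel (same i)) q)))
        up (across lt _) = lt
        rises : ∀ i → pos (f zero) ≤ pos (f i)
        rises = <-weakInduction (λ i → pos (f zero) ≤ pos (f i)) ≤-refl (λ i p → ≤-trans p (<⇒≤ (up {inject₁ i} {suc i} (view (e (inject₁ i) (suc i) (inj₁ (cong suc (FP.toℕ-inject₁ i))))))))
        last : Step′ (f (fromℕ m)) (f zero) → ⊥
        last st = <⇒≱ (up {fromℕ m} {zero} st) (rises (fromℕ m))

-- Recovering the graph from its surgery

padTo : A → ∀ m → List A → Vec A m
padTo a zero l = []ᵥ
padTo a (suc m) [] = a ∷ᵥ padTo a m []
padTo a (suc m) (x ∷ l) = x ∷ᵥ padTo a m l

-- Equal lengths are required because the padding value may also occur in the lists. For the lists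
-- of bits the number of vertices on cycles, which M reveals, provides this.
padTo-injective : ∀ (a : A) m {l l′} → length l ≡ length l′ → length l ≤ m → padTo a m l ≡ padTo a m l′ → l ≡ l′
padTo-injective a m {[]} {[]} e le p = refl
padTo-injective a (suc m) {x ∷ l} {y ∷ l′} e (s≤s le) p = cong₂ _∷_ (proj₁ (∷ᵥ-injective p)) (padTo-injective a m (suc-injective e) le (proj₂ (∷ᵥ-injective p)))

padTo-∈ : ∀ (a : A) m {l x} → length l ≤ m → x ∈ l → ∃ λ i → lookup (padTo a m l) i ≡ x
padTo-∈ a (suc m) (s≤s le) (here refl) = zero , refl
padTo-∈ a (suc m) (s≤s le) (there p) with padTo-∈ a m le p
... | i , e = suc i , e

∈-padTo : ∀ (a : A) m {l} i → lookup (padTo a m l) i ≡ a ⊎ lookup (padTo a m l) i ∈ l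
∈-padTo a (suc m) {[]} zero = inj₁ refl
∈-padTo a (suc m) {[]} (suc i) with ∈-padTo a m {[]} i
... | inj₁ e = inj₁ e
∈-padTo a (suc m) {x ∷ l} zero = inj₂ (here refl)
∈-padTo a (suc m) {x ∷ l} (suc i) with ∈-padTo a m {l} i
... | inj₁ e = inj₁ e
... | inj₂ p = inj₂ (there p)

map-≡-∈ : ∀ {f g : A → B} {l x} → map f l ≡ map g l → x ∈ l → f x ≡ g x
map-≡-∈ e (here refl) = proj₁ (∷-injective e)
map-≡-∈ e (there p) = map-≡-∈ (proj₂ (∷-injective e)) p

∑L-cartesian : ∀ {C : Set} (g : A → B → C) xs ys (K : C → ℕ) → ∑L (cartesianProductWith g xs ys) K ≡ ∑L xs (λ x → ∑L ys (λ y → K (g x y)))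
∑L-cartesian g [] ys K = refl
∑L-cartesian g (x ∷ xs) ys K = trans (∑L-++ (map (g x) ys) _ K) (cong₂ _+_ (∑L-map (g x) ys K) (∑L-cartesian g xs ys K))

∑L-tabulate : ∀ {n} (h : Fin n → A) f → ∑L (List.tabulate h) f ≡ ∑ (f ∘ h)
∑L-tabulate {n = zero} h f = sym (∑-empty _)
∑L-tabulate {n = suc n} h f = trans (cong (f (h zero) +_) (∑L-tabulate (h ∘ suc) f)) (sym (∑-suc _))

length-filter : ∀ (p : A → Bool) xs → length (filter (λ x → p x BP.≟ true) xs) ≡ ∑L xs (λ x → ⟦ p x ⟧)
length-filter p [] = refl
length-filter p (x ∷ xs) with p x
... | true = cong suc (length-filter p xs)
... | false = length-filter p xs

select : ∀ {n} → (Fin n → Bool) → List (Fin n)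
select {n} p = filter (λ u → p u BP.≟ true) (allFin n)

select-cong : ∀ {n} {p q : Fin n → Bool} → (∀ u → p u ≡ q u) → select p ≡ select q
select-cong {n} {p} {q} h = go (allFin n)
  where
  go : ∀ xs → filter (λ u → p u BP.≟ true) xs ≡ filter (λ u → q u BP.≟ true) xs
  go [] = refl
  go (x ∷ xs) rewrite h x with q x
  ... | true = cong (x ∷_) (go xs)
  ... | false = go xs

bool-ext : ∀ {a b} → (a ≡ true → b ≡ true) → (b ≡ true → a ≡ true) → a ≡ b
bool-ext {true} {true} f g = refl
bool-ext {true} {false} f g = sym (f refl)
bool-ext {false} {true} f g = g refl
bool-ext {false} {false} f g = refl

pairs : ∀ n → List (Fin n × Fin n)
pairs n = cartesianProductWith _,_ (allFin n) (allFin n)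

module _ {n} (G : Mat n) (σ : Permutation′ n) where

  back : Fin n → Fin n → Bool
  back i j = edge G i j ∧ (toℕ (σ ⟨$⟩ʳ j) <ᵇ toℕ (σ ⟨$⟩ʳ i))

  backList : List (Fin n × Fin n)
  backList = filter (λ p → uncurry back p BP.≟ true) (pairs n)

  length-backList : length backList ≡ backwards G σ
  length-backList = trans (length-filter (uncurry back) (pairs n)) (trans (∑L-cartesian _,_ (allFin n) (allFin n) _) (trans (∑L-tabulate id _) (trans (∑-cong (λ i → ∑L-tabulate id _)) (sym (backwards-∑ G σ)))))

  ∈-backList : ∀ {i j} → back i j ≡ true → (i , j) ∈ backList
  ∈-backList e = ∈-filter⁺ (λ p → uncurry back p BP.≟ true) (∈-cartesianProductWith⁺ _,_ (∈-allFin _) (∈-allFin _)) e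

  backList-∈ : ∀ {i j} → (i , j) ∈ backList → back i j ≡ true
  backList-∈ p = proj₂ (∈-filter⁻ (λ p → uncurry back p BP.≟ true) {xs = pairs n} p)

-- Lists of backwards edges may differ in length, so the padding must be recognisable: the loop (z,
-- z) is never a backwards edge.
back-transfer : ∀ {n} (z : Fin n) B (G G′ : Mat n) (σ σ′ : Permutation′ n) → backwards G σ ≤ B → padTo (z , z) B (backList G σ) ≡ padTo (z , z) B (backList G′ σ′) → ∀ i j → back G σ i j ≡ true → back G′ σ′ i j ≡ true
back-transfer z B G G′ σ σ′ le eq i j e with padTo-∈ (z , z) B (≤-trans (≤-reflexive (length-backList G σ)) le) (∈-backList G σ e)
... | m , at with ∈-padTo (z , z) B {backList G′ σ′} m | trans (sym (cong (λ v → lookup v m) eq)) at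
... | inj₁ d | at′ with trans (sym d) at′
... | refl = ⊥-elim (<-irrefl {toℕ (σ ⟨$⟩ʳ z)} refl (<ᵇ-sound {toℕ (σ ⟨$⟩ʳ z)} (proj₂ (∧-true {edge G z z} e))))
back-transfer z B G G′ σ σ′ le eq i j e | m , at | inj₂ p | at′ = backList-∈ G′ σ′ (subst (_∈ backList G′ σ′) at′ p)

module Decode (k t R : ℕ) (k≥3 : 3 ≤ k) {n : ℕ} (fits : t * R * suc k ≤ n) where

  module S = Surgery k t R k≥3 fits

  inCycle : Mat n → Permutation′ n → Vec (Fin R) t → Fin n → Bool
  inCycle G σ I u = S.sel G σ I (S.blk G σ I u)

  cyclic-vertices : ∀ {G G′ σ σ′ I I′} → S.M G σ I ≡ S.M G′ σ′ I′ → ∀ u → inCycle G σ I u ≡ true → inCycle G′ σ′ I′ u ≡ true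
  cyclic-vertices {G} {G′} {σ} {σ′} {I} {I′} eq u q with S.shift-target G σ I 1 u q
  ... | v , sh = proj₁ (S.cyclic-shift G′ σ′ I′ (subst (λ M → Cyclic k M u v) eq (S.shift-cyclic G σ I q sh)))

  cyclic-vertices-≡ : ∀ {G G′ σ σ′ I I′} → S.M G σ I ≡ S.M G′ σ′ I′ → ∀ u → inCycle G σ I u ≡ inCycle G′ σ′ I′ u
  cyclic-vertices-≡ {G} {G′} {σ} {σ′} {I} {I′} eq u = bool-ext (cyclic-vertices {G} {G′} {σ} {σ′} {I} {I′} eq u) (cyclic-vertices {G′} {G} {σ′} {σ} {I′} {I} (sym eq) u)

  transfer-shift : ∀ {G G′ σ σ′ I I′} → S.M G σ I ≡ S.M G′ σ′ I′ → ∀ i {u v} → inCycle G σ I u ≡ true → S.Shift G σ I i u v → S.Shift G′ σ′ I′ i u v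
  transfer-shift {G} {G′} {σ} {σ′} {I} {I′} eq i {u} {v} q sh = S.chain-shift G′ σ′ I′ i (subst (λ M → Chain k M i u v) eq (S.shift-chain G σ I i q sh))

  transfer-together : ∀ {G G′ σ σ′ I I′} → S.M G σ I ≡ S.M G′ σ′ I′ → ∀ u v → S.together G σ I u v ≡ true → S.together G′ σ′ I′ u v ≡ true
  transfer-together {G} {G′} {σ} {σ′} {I} {I′} eq u v e with S.together-shift G σ I {u} {v} e
  ... | i , sh = S.shift-together G′ σ′ I′ (toℕ i) (cyclic-vertices {G} {G′} {σ} {σ′} {I} {I′} eq u q) (transfer-shift {G} {G′} {σ} {σ′} {I} {I′} eq (toℕ i) q sh)
    where
    q : inCycle G σ I u ≡ true
    q = proj₂ (∧-true {S.blk G σ I u ≡ᵇ S.blk G σ I v} e)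

  -- Inside a chosen block the forward edges are restored from the recorded bits, elsewhere they
  -- were left unchanged in M.
  forward-≡ : ∀ {G G′ σ σ′ I I′} → S.M G σ I ≡ S.M G′ σ′ I′ → (∀ u → inCycle G σ I u ≡ true → S.bits G σ I u ≡ S.bits G′ σ′ I′ u) → ∀ u v → S.forward G σ I u v ≡ S.forward G′ σ′ I′ u v
  forward-≡ {G} {G′} {σ} {σ′} {I} {I′} eq bits u v = go (S.together G σ I u v) refl
    where
    X≡ : S.X G σ I u v ≡ S.X G′ σ′ I′ u v
    X≡ = trans (sym (edge-matrix (S.X G σ I) u v)) (trans (cong (λ M → edge M u v) eq) (edge-matrix (S.X G′ σ′ I′) u v))
    go : ∀ b → S.together G σ I u v ≡ b → S.forward G σ I u v ≡ S.forward G′ σ′ I′ u v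
    go true e with S.together-shift G σ I {u} {v} e
    ... | i , sh = trans (sym (S.bits-shift G σ I i q sh)) (trans (cong (λ b → lookup b i) (bits u q)) (S.bits-shift G′ σ′ I′ i (cyclic-vertices {G} {G′} {σ} {σ′} {I} {I′} eq u q) (transfer-shift {G} {G′} {σ} {σ′} {I} {I′} eq (toℕ i) q sh)))
      where
      q : inCycle G σ I u ≡ true
      q = proj₂ (∧-true {S.blk G σ I u ≡ᵇ S.blk G σ I v} e)
    go false e = trans (sym (S.X-apart G σ I {u} {v} e)) (trans X≡ (S.X-apart G′ σ′ I′ {u} {v} (¬true⇒false (λ e′ → true≢false (trans (sym (transfer-together {G′} {G} {σ′} {σ} {I′} {I} (sym eq) u v e′)) e)))))

  edge-split : ∀ (G : Mat n) σ I → IsDigraph G → ∀ u v → edge G u v ≡ S.forward G σ I u v ∨ back G σ u v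
  edge-split G σ I d u v with edge G u v in e
  ... | false = refl
  ... | true with <-cmp (S.pos G σ I u) (S.pos G σ I v)
  ... | tri< lt _ _ = sym (cong (_∨ (S.pos G σ I v <ᵇ S.pos G σ I u)) (<ᵇ-true lt))
  ... | tri> _ _ gt = sym (trans (cong ((S.pos G σ I u <ᵇ S.pos G σ I v) ∨_) (<ᵇ-true gt)) (∨-true (S.pos G σ I u <ᵇ S.pos G σ I v)))
    where
    ∨-true : ∀ a → a ∨ true ≡ true
    ∨-true true = refl
    ∨-true false = refl
  ... | tri≈ _ q _ with S.pos-injective G σ I q
  ... | refl = contradiction e (d u)

  -- For a fixed ordering the vertices on cycles determine the chosen blocks, and each group
  -- contains exactly one of them.
  same-choice : ∀ G σ I I′ → (∀ u → inCycle G σ I u ≡ inCycle G σ I′ u) → I ≡ I′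
  same-choice G σ I I′ h = trans (sym (tabulate∘lookup I)) (trans (tabulate-cong choice) (tabulate∘lookup I′))
    where
    choice : ∀ g → lookup I g ≡ lookup I′ g
    choice g with S.vertex G σ I (S.chosen G σ I g) 0 (S.sel-chosen G σ I g) (s≤s z≤n)
    ... | u , b , _ with S.sel-sound G σ I′ (trans (sym (h u)) (trans (cong (S.sel G σ I) b) (S.sel-chosen G σ I g)))
    ... | g′ , e with lex-injective (toℕ g) (toℕ g′) (lookup I g) (lookup I′ g′) (trans (sym b) e)
    ... | p , r with FP.toℕ-injective p
    ... | refl = r

  cycleSize : ∀ G σ I → length (select (inCycle G σ I)) ≤ t * suc k
  cycleSize G σ I = begin
    length (select (inCycle G σ I)) ≡⟨ trans (length-filter (inCycle G σ I) (allFin n)) (∑L-tabulate id _) ⟩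
    ∑ (λ u → ⟦ inCycle G σ I u ⟧) ≤⟨ ∑-mono point ⟩
    ∑ (λ u → ∑ {t} (λ g → ∑ {suc k} (λ i → ⟦ pos u ≡ᵇ toℕ i + chosen g * suc k ⟧))) ≡⟨ trans (∑-swap _) (∑-cong (λ g → ∑-swap _)) ⟩
    ∑ {t} (λ g → ∑ {suc k} (λ i → ∑ (λ u → ⟦ pos u ≡ᵇ toℕ i + chosen g * suc k ⟧))) ≤⟨ ∑-bound (λ g → ≤-trans (∑-bound (λ i → once (toℕ i + chosen g * suc k))) (≤-reflexive (*-identityʳ (suc k)))) ⟩
    t * suc k ∎
    where
    open ≤-Reasoning
    pos = S.pos G σ I
    chosen = S.chosen G σ I
    once : ∀ p → ∑ (λ u → ⟦ pos u ≡ᵇ p ⟧) ≤ 1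
    once p with FP.any? (λ u → pos u ≟ p)
    ... | yes (u₀ , refl) = ≤-trans (∑-mono single) (≤-reflexive (∑-δ′ u₀))
      where
      single : ∀ u → ⟦ pos u ≡ᵇ pos u₀ ⟧ ≤ δ u u₀
      single u with pos u ≡ᵇ pos u₀ in e
      ... | false = z≤n
      ... | true = ≤-reflexive (sym (δ-true (S.pos-injective G σ I (≡ᵇ-sound e))))
    ... | no none = ≤-trans (≤-reflexive (trans (∑-cong (λ u → cong ⟦_⟧ (¬true⇒false (λ e → none (u , ≡ᵇ-sound e))))) (∑-zero n))) z≤n
    point : ∀ u → ⟦ inCycle G σ I u ⟧ ≤ ∑ {t} (λ g → ∑ {suc k} (λ i → ⟦ pos u ≡ᵇ toℕ i + chosen g * suc k ⟧))
    point u with inCycle G σ I u in e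
    ... | false = z≤n
    ... | true with S.sel-sound G σ I e
    ... | g , q = ≤-trans (≤-trans (≤-reflexive (cong ⟦_⟧ (sym (≡ᵇ-complete (trans (S.pos-≡ G σ I u) (cong₂ (λ a b → a + b * suc k) (sym (FP.toℕ-fromℕ< (S.off<s G σ I u))) q)))))) (∑-term (λ i → ⟦ pos u ≡ᵇ toℕ i + chosen g * suc k ⟧) (fromℕ< (S.off<s G σ I u)))) (∑-term (λ g → ∑ {suc k} (λ i → ⟦ pos u ≡ᵇ toℕ i + chosen g * suc k ⟧)) g)

  -- The pair (G, I) is encoded by the altered graph, the bits at cycle vertices and the list of
  -- backwards edges. The first two give the forward edges and the third completes G; then the
  -- ordering is known, since it is a function of G, and with it I.
  lower-count : Fin n → ∀ B (T S : List (Mat n)) (σ : Mat n → Permutation′ n) → (∀ M → IsOriented M → CkFree k M → M ∈ T) → Unique S →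
    All (λ G → IsDigraph G × backwards G (σ G) ≤ B) S → length S * R ^ t ≤ length T * (length (bitVecs (suc k)) ^ (t * suc k) * length (pairs n) ^ B)
  lower-count z B T S σ inT u all = begin
    length S * R ^ t ≡⟨ sym (trans (length-product _,_ S choices) (cong (length S *_) (trans (length-vecs {m = t} (λ _ → allFin R)) (trans (∏-const t (length (allFin R))) (cong (_^ t) (length-tabulate {n = R} id)))))) ⟩
    length inputs ≡⟨ sym (length-map code inputs) ⟩
    length (map code inputs) ≤⟨ length-unique (unique-map code (λ {x} {y} → injective {x} {y}) valid (Uniq.cartesianProductWith⁺ _,_ (λ { refl → refl , refl }) u (vecs-unique {m = t} _ (λ _ → Uniq.allFin⁺ R)))) (All-map⁺ (All.map (λ {x} _ → member x) valid)) ⟩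
    length outputs ≡⟨ trans (length-product _,_ T (cartesianProductWith _,_ bitCodes backCodes)) (cong (length T *_) (trans (length-product _,_ bitCodes backCodes) (cong₂ _*_ (trans (length-vecs {m = t * suc k} (λ _ → bitVecs (suc k))) (∏-const (t * suc k) (length (bitVecs (suc k))))) (trans (length-vecs {m = B} (λ _ → pairs n)) (∏-const B (length (pairs n))))))) ⟩
    length T * (length (bitVecs (suc k)) ^ (t * suc k) * length (pairs n) ^ B) ∎
    where
    open ≤-Reasoning
    choices : List (Vec (Fin R) t)
    choices = vecs (λ _ → allFin R)
    inputs : List (Mat n × Vec (Fin R) t)
    inputs = cartesianProductWith _,_ S choices
    outputs : List (Mat n × Vec (Vec Bool (suc k)) (t * suc k) × Vec (Fin n × Fin n) B)
    bitCodes = vecs {m = t * suc k} (λ _ → bitVecs (suc k))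
    backCodes = vecs {m = B} (λ _ → pairs n)
    outputs = cartesianProductWith _,_ T (cartesianProductWith _,_ bitCodes backCodes)
    nobits : Vec Bool (suc k)
    nobits = tabulate (λ _ → false)
    bitList : Mat n × Vec (Fin R) t → List (Vec Bool (suc k))
    bitList (G , I) = map (S.bits G (σ G) I) (select (inCycle G (σ G) I))
    code : Mat n × Vec (Fin R) t → Mat n × Vec (Vec Bool (suc k)) (t * suc k) × Vec (Fin n × Fin n) B
    code (G , I) = S.M G (σ G) I , padTo nobits (t * suc k) (bitList (G , I)) , padTo (z , z) B (backList G (σ G))
    Valid : Mat n × Vec (Fin R) t → Set
    Valid (G , I) = IsDigraph G × backwards G (σ G) ≤ B
    valid : All Valid inputs
    valid = All.tabulate λ p → go p
      where
      go : ∀ {x} → x ∈ inputs → Valid x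
      go p with ∈-cartesianProductWith⁻ _,_ S choices p
      ... | G , I , G∈ , _ , refl = All.lookup all G∈
    member : ∀ x → code x ∈ outputs
    member (G , I) = ∈-cartesianProductWith⁺ _,_ (inT _ (S.M-digraph G (σ G) I , S.M-asymmetric G (σ G) I) (S.M-CkFree G (σ G) I))
      (∈-cartesianProductWith⁺ _,_ (∈-vecs _ _ (λ i → ∈-vecs _ _ (λ j → ∈-bools _))) (∈-vecs _ _ (λ i → ∈-cartesianProductWith⁺ _,_ (∈-allFin _) (∈-allFin _))))
    injective : ∀ {x y} → Valid x → Valid y → code x ≡ code y → x ≡ y
    injective {G , I} {G′ , I′} (d , b) (d′ , b′) e = finish G≡ 
      where
      M≡ : S.M G (σ G) I ≡ S.M G′ (σ G′) I′
      M≡ = cong proj₁ e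
      sel≡ : select (inCycle G (σ G) I) ≡ select (inCycle G′ (σ G′) I′)
      sel≡ = select-cong (cyclic-vertices-≡ {G} {G′} {σ G} {σ G′} {I} {I′} M≡)
      lists : bitList (G , I) ≡ bitList (G′ , I′)
      lists = padTo-injective nobits (t * suc k) (trans (length-map _ (select (inCycle G (σ G) I))) (trans (cong length sel≡) (sym (length-map _ (select (inCycle G′ (σ G′) I′)))))) (≤-trans (≤-reflexive (length-map _ (select (inCycle G (σ G) I)))) (cycleSize G (σ G) I)) (cong (proj₁ ∘ proj₂) e)
      bits≡ : ∀ u → inCycle G (σ G) I u ≡ true → S.bits G (σ G) I u ≡ S.bits G′ (σ G′) I′ u
      bits≡ u q = map-≡-∈ (trans lists (cong (map (S.bits G′ (σ G′) I′)) (sym sel≡))) (∈-filter⁺ (λ u → inCycle G (σ G) I u BP.≟ true) (∈-allFin u) q)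
      back≡ : ∀ u v → back G (σ G) u v ≡ back G′ (σ G′) u v
      back≡ u v = bool-ext (back-transfer z B G G′ (σ G) (σ G′) b (cong (proj₂ ∘ proj₂) e) u v) (back-transfer z B G′ G (σ G′) (σ G) b′ (sym (cong (proj₂ ∘ proj₂) e)) u v)
      G≡ : G ≡ G′
      G≡ = mat-ext (λ u v → trans (edge-split G (σ G) I d u v) (trans (cong₂ _∨_ (forward-≡ {G} {G′} {σ G} {σ G′} {I} {I′} M≡ bits≡ u v) (back≡ u v)) (sym (edge-split G′ (σ G′) I′ d′ u v))))
      finish : G ≡ G′ → (G , I) ≡ (G′ , I′)
      finish refl = cong (G ,_) (same-choice G (σ G) I I′ (cyclic-vertices-≡ {G} {G} {σ G} {σ G} {I} {I′} M≡))

-- Stability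

weaken : ∀ {a b x N} → a ≤ b → b * x ≤ N → a * x ≤ N
weaken {x = x} le h = ≤-trans (*-monoˡ-≤ x le) h

#dtri≤dbl : ∀ {n} (D : Digraph n) → #dtri D ≤ n * #dbl D
#dtri≤dbl {n} D = ≤-trans (∑₃-mono (λ w u v → leq (taut 3 (λ a b c → ⟦ (a ∧ b) ∧ c ⟧ ≤ᵇ ⟦ c ⟧) tt (D w u) (D v w) (dbl D u v)))) (≤-reflexive (∑-const n (#dbl D)))

shortfall≤ : ∀ {n} o (D : Digraph n) → Loopless D → shortfall D ≤ 5 * (n * n) ∸ 2 * wt o D
shortfall≤ {n} o D l = ≤-trans (m≤m+n (shortfall D) _) (≤-trans (≤-reflexive (*-distribˡ-∸ 5 (n * n) (#deg D))) (∸-monoʳ-≤ (5 * (n * n)) (≤-trans (m≤m+n (2 * wt o D) _) (≤-reflexive (wt-≡ o D l)))))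

EvenCycle : ℕ → Set
EvenCycle j = ∃ λ m → j ≡ suc (m + m)

parity : ∀ j → (∃ λ m → j ≡ m + m) ⊎ EvenCycle j
parity zero = inj₁ (0 , refl)
parity (suc j) with parity j
... | inj₁ (m , e) = inj₂ (m , cong suc e)
... | inj₂ (m , e) = inj₁ (suc m , trans (cong suc e) (cong suc (sym (+-suc m m))))

-- For odd k and oriented graphs the degree sum is nearly bounded by n², because few double edges
-- lie in triangles. In the weight a double edge counts 8/5 instead of 2, so a nearly extremal
-- weight leaves room for few of them.
few-doubles-explicit : ∀ o j E → 0 < E → o ≡ true ⊎ EvenCycle j → ∃ λ F → ∀ n → 0 < n → (D : Digraph n) → Loopless D →
  F * tr (pow ⟪ D ⟫ (3 + j)) ≤ n ^ (3 + j) → F * (5 * (n * n) ∸ 2 * wt o D) ≤ n * n → E * #dbl D ≤ n * n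
few-doubles-explicit o j E E>0 (inj₂ (m , refl)) = proj₁ (few-dbl-even m E) , λ n n>0 D l h _ → proj₂ (few-dbl-even m E) n n>0 D h
few-doubles-explicit o j E E>0 (inj₁ refl) with parity j
... | inj₂ (m , refl) = proj₁ (few-dbl-even m E) , λ n n>0 D l h _ → proj₂ (few-dbl-even m E) n n>0 D h
... | inj₁ (m , refl) = F₁ + E₁ , λ n n>0 D l h w → dbls n n>0 D l (weaken (m≤m+n F₁ E₁) h) (weaken (m≤n+m E₁ F₁) w)
  where
  E₁ = 3 * E
  F₁ = proj₁ (few-dtri-odd m (16 * (E₁ * E₁)))
  dbls : ∀ n → 0 < n → (D : Digraph n) → Loopless D → F₁ * tr (pow ⟪ D ⟫ (3 + (m + m))) ≤ n ^ (3 + (m + m)) → E₁ * (5 * (n * n) ∸ 2 * wt true D) ≤ n * n → E * #dbl D ≤ n * n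
  dbls n n>0 D l h w = *-cancelˡ-≤ 6 (lin 0 (+-mono-≤ (+-mono-≤ (*-monoʳ-≤ E₁ (m≤n+m∸n (5 * (n * n)) (2 * wt true D))) w) (+-mono-≤ (*-monoʳ-≤ 5 total) (≤-reflexive (cong (E₁ *_) (wt-≡ true D l))))) (eq E (5 * (n * n) ∸ 2 * wt true D) (#dbl D) (#deg D) (wt true D) (n * n)))
    where
    total : E₁ * #deg D ≤ E₁ * (n * n) + n * n
    total = subst₂ (λ a b → E₁ * a ≤ E₁ * (b * b) + n * n) (∑∑-cong (λ x y → +-identityʳ (deg D x y))) (trans (∑-const n 1) (*-identityʳ n)) (deg-total D E₁ n>0 l (proj₂ (few-dtri-odd m (16 * (E₁ * E₁))) n n>0 D h) (λ _ → true))
    eq : ∀ E s d g t N → 6 * (E * d) + ((3 * E * (2 * t + s) + N) + (5 * (3 * E * N + N) + 3 * E * (5 * g))) + 0 ≡ 6 * N + ((3 * E * (5 * N) + 3 * E * s) + (5 * (3 * E * g) + 3 * E * (2 * t + 2 * (1 * d))))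
    eq = solve-∀

-- As for containers, the constants F must not be unfolded.
opaque
  few-doubles : ∀ o j E → 0 < E → o ≡ true ⊎ EvenCycle j → ∃ λ F → ∀ n → 0 < n → (D : Digraph n) → Loopless D →
    F * tr (pow ⟪ D ⟫ (3 + j)) ≤ n ^ (3 + j) → F * (5 * (n * n) ∸ 2 * wt o D) ≤ n * n → E * #dbl D ≤ n * n
  few-doubles = few-doubles-explicit

  near-extremal′ : ∀ j E → 0 < E → ∃ λ F → ∀ n → F ≤ n → (D : Digraph n) → Loopless D → F * tr (pow ⟪ D ⟫ (3 + j)) ≤ n ^ (3 + j) → F * #dtri D ≤ n * (n * n) → F * shortfall D ≤ n * n → NearExtremal E D
  near-extremal′ = near-extremal

  close-to-blowUp′ : ∀ E → 0 < E → ∃ λ F → 0 < F × (∀ n → 0 < n → (D : Digraph n) → NearExtremal F D → F * shortfall D ≤ n * n →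
    ¬ ¬ (Σ (Fin n → Fin n) λ rep → Σ (Fin n → Bool) λ side → E * (D ∖ balanced rep side (height D)) ≤ n * n))
  close-to-blowUp′ = close-to-blowUp

  few-dtri-odd′ : ∀ m E → ∃ λ F → ∀ n → 0 < n → (D : Digraph n) → F * tr (pow ⟪ D ⟫ (3 + (m + m))) ≤ n ^ (3 + (m + m)) → E * #dtri D ≤ n * (n * n)
  few-dtri-odd′ = few-dtri-odd

-- With few double edges, all three kinds of backwards edges in `backwards≤` are rare for the
-- ordering by height; each of them is given a third of the allowance.
close-to-transitive : ∀ o j d → 0 < d → o ≡ true ⊎ EvenCycle j → ∃ λ F → 0 < F × (∀ n → F ≤ n → (G : Mat n) → (∀ σ → ¬ d * backwards G σ ≤ n * n) → Far o (3 + j) F G)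
close-to-transitive o j d d>0 cond = F , s≤s z≤n , λ n F≤n G far D l out cyc w →
  let n>0 = ≤-trans (s≤s z≤n) F≤n
      dbls = proj₂ dblP n n>0 D l (weaken F₂≤F cyc) (weaken F₂≤F w)
      ne = proj₂ extP n (≤-trans F₁≤F F≤n) D l (weaken F₁≤F cyc)
             (≤-trans (*-monoʳ-≤ F₁ (#dtri≤dbl D)) (≤-trans (≤-reflexive (eq F₁ n (#dbl D))) (*-monoʳ-≤ n (weaken F₁≤E₂ dbls))))
             (≤-trans (*-monoʳ-≤ F₁ (shortfall≤ o D l)) (weaken F₁≤F w))
      ties = few-ties E E>0 n n>0 D (NearExtremal.tris ne) (NearExtremal.deficits ne) (NearExtremal.excesses ne)
      tr = near-transitive G D (tieWidth E)
  in far (proj₁ tr) (≤-trans (*-monoʳ-≤ d (proj₂ tr)) (*-cancelˡ-≤ 3 (lin 0 (+-mono-≤ (weaken E≤F out) (+-mono-≤ ties (weaken E≤E₂ dbls))) (eq₂ d (outside G D) (#tie D (tieWidth E)) (#dbl D) (n * n)))))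
  where
  E = 3 * d
  E>0 : 0 < E
  E>0 = *-mono-≤ {1} {3} (s≤s z≤n) d>0
  extP = near-extremal′ j (10 * tieWidth E) (*-mono-≤ {1} {10} (s≤s z≤n) (≤-trans E>0 (E≤tieWidth E E>0)))
  F₁ = proj₁ extP
  E₂ = F₁ + E
  dblP = few-doubles o j E₂ (≤-trans E>0 (m≤n+m E F₁)) cond
  F₂ = proj₁ dblP
  F = suc (F₁ + (F₂ + E))
  F₁≤F : F₁ ≤ F
  F₁≤F = ≤-trans (m≤m+n F₁ _) (n≤1+n _)
  F₂≤F : F₂ ≤ F
  F₂≤F = ≤-trans (≤-trans (m≤m+n F₂ E) (m≤n+m _ F₁)) (n≤1+n _)
  E≤F : E ≤ F
  E≤F = ≤-trans (≤-trans (m≤n+m E F₂) (m≤n+m _ F₁)) (n≤1+n _)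
  F₁≤E₂ : F₁ ≤ E₂
  F₁≤E₂ = m≤m+n F₁ E
  E≤E₂ : E ≤ E₂
  E≤E₂ = m≤n+m E F₁
  eq : ∀ F n b → F * (n * b) ≡ n * (F * b)
  eq = solve-∀
  eq₂ : ∀ d o t b N → 3 * (d * (o + (t + b))) + (N + (N + N)) + 0 ≡ 3 * N + (3 * d * o + (3 * d * t + 3 * d * b))
  eq₂ = solve-∀

near-blowUp : ∀ {n} (a d : ℕ) (G : Mat n) (D : Digraph n) → 0 < a → IsDigraph G → (rep : Fin n → Fin n) (side : Fin n → Bool) →
  2 * d * outside G D ≤ n * n → 2 * d * (D ∖ balanced rep side (height D)) ≤ n * n → NearBlowUp a d G
near-blowUp {n} a d G D a>0 dig rep side out cl = blowUp rep side (height D) , intersect G H , isBlowUp rep side (height D) , noLoops , sub , bound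
  where
  H = balanced rep side (height D)
  noLoops : IsDigraph (intersect G H)
  noLoops i e with edge G i i in g | trans (sym (edge-matrix (λ x y → edge G x y ∧ H x y) i i)) e
  ... | true | _ = dig i g
  sub : SubgraphOf (intersect G H) (blowUp rep side (height D))
  sub i j e = edge-blowUp rep side (height D) i j (second (edge G i j) (trans (sym (edge-matrix (λ x y → edge G x y ∧ H x y) i j)) e))
    where
    second : ∀ a {b} → a ∧ b ≡ true → b ≡ true
    second true e = e
  bound : d * changes G (intersect G H) ≤ a * (n * n)
  bound = ≤-trans (*-monoʳ-≤ d (≤-trans (changes-intersect G H) (∖-triangle (edge G) D H))) (≤-trans (*-cancelˡ-≤ 2 (lin 0 (+-mono-≤ out cl) (eq d (outside G D) (D ∖ H) (n * n)))) (≤-trans (≤-reflexive (sym (+-identityʳ (n * n)))) (*-monoˡ-≤ (n * n) a>0)))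
    where
    eq : ∀ d o c N → 2 * (d * (o + c)) + (N + N) + 0 ≡ 2 * N + (2 * d * o + 2 * d * c)
    eq = solve-∀

close-to-blow-up : ∀ m a d → 0 < a → 0 < d → ∃ λ F → 0 < F × (∀ n → F ≤ n → (G : Mat n) → IsDigraph G → ¬ NearBlowUp a d G → Far false (3 + (m + m)) F G)
close-to-blow-up m a d a>0 d>0 = F , s≤s z≤n , λ n F≤n G dig far D l out cyc w →
  let n>0 = ≤-trans (s≤s z≤n) F≤n
      short = ≤-trans (*-monoʳ-≤ F (shortfall≤ false D l)) w
      ne = proj₂ extP n (≤-trans F₁≤F F≤n) D l (weaken F₁≤F cyc) (proj₂ triP n n>0 D (weaken F₂≤F cyc)) (weaken F₁≤F short)
  in proj₂ (proj₂ blowP) n n>0 D ne (weaken F₀≤F short) λ { (rep , side , cl) → far (near-blowUp a d G D a>0 dig rep side (weaken E≤F out) cl) }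
  where
  E = 2 * d
  blowP = close-to-blowUp′ E (*-mono-≤ {1} {2} (s≤s z≤n) d>0)
  F₀ = proj₁ blowP
  extP = near-extremal′ (m + m) F₀ (proj₁ (proj₂ blowP))
  F₁ = proj₁ extP
  triP = few-dtri-odd′ m F₁
  F₂ = proj₁ triP
  F = suc (F₁ + (F₂ + (F₀ + E)))
  F₁≤F : F₁ ≤ F
  F₁≤F = ≤-trans (m≤m+n F₁ _) (n≤1+n _)
  F₂≤F : F₂ ≤ F
  F₂≤F = ≤-trans (≤-trans (m≤m+n F₂ _) (m≤n+m _ F₁)) (n≤1+n _)
  F₀≤F : F₀ ≤ F
  F₀≤F = ≤-trans (≤-trans (≤-trans (m≤m+n F₀ E) (m≤n+m _ F₂)) (m≤n+m _ F₁)) (n≤1+n _)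
  E≤F : E ≤ F
  E≤F = ≤-trans (≤-trans (≤-trans (m≤n+m E F₀) (m≤n+m _ F₂)) (m≤n+m _ F₁)) (n≤1+n _)

-- Negligible families

acyclic-CkFree : ∀ {n} k (M : Mat n) → (∀ i j → Edge M i j → toℕ i < toℕ j) → CkFree (suc k) M
acyclic-CkFree k M up (f , _ , e) = <⇒≱ (up _ _ (e (fromℕ k) zero (inj₂ (cong suc (FP.toℕ-fromℕ k) , refl)))) (rises (fromℕ k))
  where
  rises : ∀ i → toℕ (f zero) ≤ toℕ (f i)
  rises = <-weakInduction (λ i → toℕ (f zero) ≤ toℕ (f i)) ≤-refl (λ i p → ≤-trans p (<⇒≤ (up _ _ (e (inject₁ i) (suc i) (inj₁ (cong suc (FP.toℕ-inject₁ i)))))))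

upperEntry : ∀ {n} → Fin n → Fin n → List Bool
upperEntry i j = if lt i j then bools else [ false ]

uppers : ∀ n → List (Mat n)
uppers n = vecs (λ i → vecs (upperEntry i))

uppers-unique : ∀ n → Unique (uppers n)
uppers-unique n = vecs-unique _ (λ i → vecs-unique _ (λ j → entry-unique (lt i j)))
  where
  entry-unique : ∀ b → Unique (if b then bools else [ false ])
  entry-unique true = bools-unique
  entry-unique false = [] ∷ []

length-uppers : ∀ n → length (uppers n) ≡ 2 ^ #pairs n
length-uppers n = trans (length-vecs (λ i → vecs (upperEntry i))) (trans (∏-cong (λ i → trans (length-vecs (upperEntry i)) (∏-cong (λ j → entry-length (lt i j))))) (∏∏-^ 2 (λ i j → ⟦ lt i j ⟧)))
  where
  entry-length : ∀ b → length (if b then bools else [ false ]) ≡ 2 ^ ⟦ b ⟧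
  entry-length true = refl
  entry-length false = refl

uppers-increasing : ∀ {n} {M : Mat n} → M ∈ uppers n → ∀ i j → Edge M i j → toℕ i < toℕ j
uppers-increasing {n} {M} p i j e = go (lt i j) refl (vecs-∈ (upperEntry i) (vecs-∈ (λ i → vecs (upperEntry i)) p i) j)
  where
  go : ∀ b → lt i j ≡ b → edge M i j ∈ (if b then bools else [ false ]) → toℕ i < toℕ j
  go true q _ = <ᵇ-sound q
  go false q (here r) = contradiction (trans (sym e) r) λ ()

many-free : ∀ {n} k (T : List (Mat n)) → (∀ M → IsOriented M → CkFree (suc k) M → M ∈ T) → 2 ^ #pairs n ≤ length T
many-free {n} k T inT = ≤-trans (≤-reflexive (sym (length-uppers n))) (length-unique (uppers-unique n) (All.tabulate (λ {M} p → inT M (oriented p) (acyclic-CkFree k M (uppers-increasing p)))))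
  where
  oriented : ∀ {M} → M ∈ uppers n → IsOriented M
  oriented p = (λ i e → <-irrefl refl (uppers-increasing p i i e)) , λ i j e e′ → <-asym (uppers-increasing p i j e) (uppers-increasing p j i e′)

-- The decoding needs the ordering to depend on the graph alone, so witnesses given graph by graph
-- are collected into a function.
choose : ∀ {n} {C : Set} {Q : Mat n → C → Set} (c₀ : C) (S : List (Mat n)) → All (λ G → ∃ (Q G)) S → ∃ λ (f : Mat n → C) → All (λ G → Q G (f G)) S
choose c₀ [] [] = (λ _ → c₀) , []
choose {n} {C} {Q} c₀ (x ∷ S) ((c , q) ∷ qs) with choose c₀ S qs
... | f , h = f′ , subst (Q x) (sym f′x) q ∷ All.map (λ {G} → tail {G}) h
  where
  _≟ₘ_ : (G H : Mat n) → Dec (G ≡ H)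
  _≟ₘ_ = VP.≡-dec (VP.≡-dec BP._≟_)
  f′ : Mat n → C
  f′ G with G ≟ₘ x
  ... | yes _ = c
  ... | no _ = f G
  f′x : f′ x ≡ c
  f′x with x ≟ₘ x
  ... | yes _ = refl
  ... | no ne = contradiction refl ne
  tail : ∀ {G} → Q G (f G) → Q G (f′ G)
  tail {G} r with G ≟ₘ x
  ... | yes refl = q
  ... | no _ = r

-- The number of vertices of a group: R = 2^(s² + 2) blocks of s = k + 1 vertices.
blockWidth : ℕ → ℕ
blockWidth k = suc k * 2 ^ (suc k * suc k + 2)

FewBackwards : ℕ → ∀ {n} → Mat n → Set
FewBackwards q {n} G = ∃ λ (σ : Permutation′ n) → ¬ AtLeastCNOverLog 1 q n (backwards G σ)

count-few-backwards : ∀ k → 3 ≤ k → ∀ f → ∃ λ N → ∀ n → N ≤ n → ∀ (T S : List (Mat n)) → (∀ M → IsOriented M → CkFree k M → M ∈ T) → Unique S →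
  All (λ G → IsDigraph G × FewBackwards (4 * blockWidth k) G) S → suc f * length S ≤ length T
count-few-backwards k k≥3 f = W * suc f , main
  where
  s = suc k
  R = 2 ^ (s * s + 2)
  W = blockWidth k
  W>0 : 0 < W
  W>0 = *-mono-≤ {1} {s} (s≤s z≤n) (m^n>0 2 (s * s + 2))
  q = 4 * W
  main : ∀ n → W * suc f ≤ n → ∀ (T S : List (Mat n)) → (∀ M → IsOriented M → CkFree k M → M ∈ T) → Unique S → All (λ G → IsDigraph G × FewBackwards q G) S → suc f * length S ≤ length T
  main n big T S inT u all with floor W n W>0
  ... | t , Wt≤n , n< = finish (choose idₚ S (All.map (λ { (d , σ , b) → σ , d , b }) all))
    where
    n>0 : 0 < n
    n>0 = ≤-trans (*-mono-≤ W>0 (s≤s z≤n)) big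
    t>f : suc f ≤ t
    t>f = ≤-pred (*-cancelˡ-< W (suc f) (suc t) (≤-<-trans big n<))
    n≤2Wt : n ≤ t * (2 * W)
    n≤2Wt = ≤-trans (<⇒≤ n<) (≤-trans (≤-reflexive (*-suc W t)) (≤-trans (+-monoˡ-≤ (W * t) (≤-trans (≤-reflexive (sym (*-identityʳ W))) (*-monoʳ-≤ W (≤-trans (s≤s z≤n) t>f)))) (≤-reflexive (eq W t))))
      where
      eq : ∀ W t → W * t + W * t ≡ t * (2 * W)
      eq = solve-∀
    fits : t * R * suc k ≤ n
    fits = ≤-trans (≤-reflexive (eq t R s)) Wt≤n
      where
      eq : ∀ t R s → t * R * s ≡ s * R * t
      eq = solve-∀
    module Dec′ = Decode k t R k≥3 fits
    -- The lists of backwards edges are padded to a common length. The maximum over the finite list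
    -- S still satisfies the bound, being attained by one of its graphs or equal to 0.
    maxB : ∀ (b : Mat n → ℕ) (S : List (Mat n)) → All (λ G → ¬ AtLeastCNOverLog 1 q n (b G)) S → ∃ λ B → All (λ G → b G ≤ B) S × n ^ (q * B) ≤ 2 ^ (1 * n)
    maxB b [] [] = 0 , [] , ≤-trans (≤-reflexive (cong (n ^_) (*-zeroʳ q))) (m^n>0 2 (1 * n))
    maxB b (G ∷ S) (h ∷ hs) with maxB b S hs
    ... | B , bs , le with ≤-total (b G) B
    ... | inj₁ p = B , p ∷ bs , le
    ... | inj₂ p = b G , ≤-refl ∷ All.map (λ r → ≤-trans r p) bs , <⇒≤ (≰⇒> h)
    finish : (∃ λ (σ : Mat n → Permutation′ n) → All (λ G → IsDigraph G × ¬ AtLeastCNOverLog 1 q n (backwards G (σ G))) S) → suc f * length S ≤ length T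
    finish (σ , hs) with maxB (λ G → backwards G (σ G)) S (All.map proj₂ hs)
    ... | B , bs , nB = ≤-trans (*-monoˡ-≤ (length S) (≤-trans (1+n≤2^n f) (^-monoʳ-≤ 2 (<⇒≤ t>f)))) (≤-trans (≤-reflexive (*-comm (2 ^ t) (length S))) (*-cancelʳ-≤ (length S * 2 ^ t) (length T) (C₀ * 2 ^ t) {{>-nonZero (*-mono-≤ (m^n>0 2 (s * (t * s))) (m^n>0 2 t))}} (begin
      length S * 2 ^ t * (C₀ * 2 ^ t) ≡⟨ eq₁ (length S) (2 ^ t) C₀ ⟩
      length S * (C₀ * (2 ^ t * 2 ^ t)) ≡⟨ cong (length S *_) (sym R^t) ⟩
      length S * R ^ t ≤⟨ Dec′.lower-count (fromℕ< n>0) B T S σ inT u (All.zipWith (λ { ((d , _) , b) → d , b }) (hs , bs)) ⟩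
      length T * (length (bitVecs s) ^ (t * s) * length (pairs n) ^ B) ≤⟨ *-monoʳ-≤ (length T) (*-mono-≤ (≤-reflexive (trans (cong (_^ (t * s)) (length-bitVecs s)) (^-*-assoc 2 s (t * s)))) nn) ⟩
      length T * (C₀ * 2 ^ t) ∎)))
      where
      open ≤-Reasoning
      C₀ = 2 ^ (s * (t * s))
      eq₁ : ∀ l p a → l * p * (a * p) ≡ l * (a * (p * p))
      eq₁ = solve-∀
      -- The choices are accounted for as follows: 2^(s² t) pays for the bits at the t s cycle
      -- vertices, one factor 2^t for the lists of backwards edges, and the other 2^t is the gain.
      R^t : R ^ t ≡ C₀ * (2 ^ t * 2 ^ t)
      R^t = trans (^-*-assoc 2 (s * s + 2) t) (trans (cong (2 ^_) (eq₂ s t)) (trans (^-distribˡ-+-* 2 (s * (t * s)) (t + t)) (cong (C₀ *_) (^-distribˡ-+-* 2 t t))))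
        where
        eq₂ : ∀ s t → (s * s + 2) * t ≡ s * (t * s) + (t + t)
        eq₂ = solve-∀
      -- A list of B ordered pairs has n^(2B) possibilities. The assumption with denominator 4W
      -- gives n^(4WB) ≤ 2^n, and n ≤ 2Wt; the (2W)-th root is 2^t.
      nn : length (pairs n) ^ B ≤ 2 ^ t
      nn = ^-cancel (2 * W) (*-mono-≤ {1} {2} (s≤s z≤n) W>0) (begin
        (length (pairs n) ^ B) ^ (2 * W) ≡⟨ cong (λ l → (l ^ B) ^ (2 * W)) (trans (length-product _,_ (allFin n) (allFin n)) (cong₂ _*_ (length-tabulate {n = n} id) (length-tabulate {n = n} id))) ⟩
        ((n * n) ^ B) ^ (2 * W) ≡⟨ trans (^-*-assoc (n * n) B (2 * W)) (trans (^-distribʳ-* (B * (2 * W)) n n) (trans (sym (^-distribˡ-+-* n (B * (2 * W)) (B * (2 * W)))) (cong (n ^_) (eq₃ B W)))) ⟩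
        n ^ (q * B) ≤⟨ nB ⟩
        2 ^ (1 * n) ≤⟨ ^-monoʳ-≤ 2 (≤-trans (≤-reflexive (+-identityʳ n)) n≤2Wt) ⟩
        2 ^ (t * (2 * W)) ≡⟨ sym (^-*-assoc 2 t (2 * W)) ⟩
        (2 ^ t) ^ (2 * W) ∎)
        where
        eq₃ : ∀ B W → B * (2 * W) + B * (2 * W) ≡ 4 * W * B
        eq₃ = solve-∀

optimal-exists : ∀ {n} (G : Mat n) → ¬ ¬ (∃ λ σ → TransitiveOptimal G σ)
optimal-exists {n} G = go (backwards G idₚ) idₚ ≤-refl
  where
  go : ∀ m σ → backwards G σ ≤ m → ¬ ¬ (∃ λ σ → TransitiveOptimal G σ)
  go m σ le = classical (∃ λ τ → backwards G τ < backwards G σ) >>= λ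
    { (inj₂ none) → return (σ , λ τ → ≮⇒≥ (λ lt → none (τ , lt)))
    ; (inj₁ (τ , lt)) → smaller m le τ lt }
    where
    smaller : ∀ m → backwards G σ ≤ m → ∀ τ → backwards G τ < backwards G σ → ¬ ¬ (∃ λ σ → TransitiveOptimal G σ)
    smaller zero le τ lt = contradiction (≤-trans lt le) λ ()
    smaller (suc m) le τ lt = go m τ (≤-pred (≤-trans lt le))

ManyBackwards : ℕ → ℕ → ∀ {n} → Mat n → Set
ManyBackwards a d {n} G = ∀ (σ : Permutation′ n) → ¬ AtMostAlphaN² a d n (backwards G σ)

not-few : ∀ {n} q (G : Mat n) → ¬ (Σ (Permutation′ n) λ σ → TransitiveOptimal G σ × AtLeastCNOverLog 1 q n (backwards G σ)) → ¬ ¬ FewBackwards q G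
not-few q G np = optimal-exists G >>= λ { (σ , opt) → return (σ , λ L → np (σ , opt , L)) }

optimal-many : ∀ {n} a d (G : Mat n) σ → TransitiveOptimal G σ → ¬ AtMostAlphaN² a d n (backwards G σ) → ManyBackwards a d G
optimal-many a d G σ opt nu τ le = nu (≤-trans (*-monoʳ-≤ d (opt τ)) le)

not-many : ∀ {n} a d (G : Mat n) → ¬ (Σ (Permutation′ n) λ σ → TransitiveOptimal G σ × AtMostAlphaN² a d n (backwards G σ)) → ¬ ¬ ManyBackwards a d G
not-many a d G np = optimal-exists G >>= λ { (σ , opt) → return (optimal-many a d G σ opt (λ U → np (σ , opt , U))) }

not-few-or-many : ∀ {n} q a d (G : Mat n) → ¬ (Σ (Permutation′ n) λ σ → TransitiveOptimal G σ × AtLeastCNOverLog 1 q n (backwards G σ) × AtMostAlphaN² a d n (backwards G σ)) → ¬ ¬ (FewBackwards q G ⊎ ManyBackwards a d G)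
not-few-or-many {n} q a d G np = optimal-exists G >>= λ { (σ , opt) → classical (AtLeastCNOverLog 1 q n (backwards G σ)) >>= λ
  { (inj₂ nl) → return (inj₁ (σ , nl))
  ; (inj₁ L) → return (inj₂ (optimal-many a d G σ opt (λ U → np (σ , opt , L , U)))) } }

split-list : ∀ {A : Set} {P Q : A → Set} (S : List A) → Unique S → All (λ x → P x ⊎ Q x) S → ∃ λ S₁ → ∃ λ S₂ → Unique S₁ × Unique S₂ × All P S₁ × All Q S₂ × (∀ {x} → All (x ≢_) S → All (x ≢_) S₁ × All (x ≢_) S₂) × length S ≡ length S₁ + length S₂
split-list [] [] [] = [] , [] , [] , [] , [] , [] , (λ _ → [] , []) , refl
split-list (x ∷ S) (n ∷ u) (c ∷ cs) with split-list S u cs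
... | S₁ , S₂ , u₁ , u₂ , p , q , sub , len with c
... | inj₁ px = x ∷ S₁ , S₂ , proj₁ (sub n) ∷ u₁ , u₂ , px ∷ p , q , (λ { (a ∷ as) → a ∷ proj₁ (sub as) , proj₂ (sub as) }) , cong suc len
... | inj₂ qx = S₁ , x ∷ S₂ , u₁ , proj₂ (sub n) ∷ u₂ , p , qx ∷ q , (λ { (a ∷ as) → proj₁ (sub as) , a ∷ proj₂ (sub as) }) , trans (cong suc len) (sym (+-suc (length S₁) (length S₂)))

module _ (Cls : ∀ {n} → Mat n → Set) (Cls? : ∀ {n} (G : Mat n) → Dec (Cls G)) where

  members : ∀ n → List (Mat n)
  members n = filter Cls? (allMats n)

  ∈-members : ∀ {n} (G : Mat n) → Cls G → G ∈ members n
  ∈-members G c = ∈-filter⁺ Cls? (∈-allMats G) c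

  -- Smallness is required only for the fractions 1 / (f + 1), which suffices because the numerator
  -- of ε is at least 1. Uniqueness replaces being a sublist, since it survives the splitting of
  -- lists.
  Negligible : (∀ {n} → Mat n → Set) → Set
  Negligible Q = ∀ f → ∃ λ N → ∀ n → N ≤ n → ∀ (S : List (Mat n)) → Unique S → All (λ G → Cls G × Q G) S → suc f * length S ≤ length (members n)

  almostAll : ∀ (P Q : ∀ {n} → Mat n → Set) → (∀ {n} (G : Mat n) → Cls G → ¬ P G → ¬ ¬ Q G) → Negligible Q → AlmostAll Cls P
  almostAll P Q h neg e f e>0 = proj₁ (neg f) , λ n N≤n S S⊆ all → members n , filter-⊆ Cls? (allMats n) , all-filter Cls? (allMats n) ,
    ≤-trans (decidable-stable (_ ≤? _) (¬¬-All (λ {G} (c , np) → h G c np >>= λ q → return (c , q)) all >>= λ good → return (proj₂ (neg f) n N≤n S (sublist-unique S⊆ (allMats-unique n)) good)))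
      (≤-trans (≤-reflexive (sym (+-identityʳ _))) (*-monoˡ-≤ (length (members n)) e>0))

  negligible-⊎ : ∀ (Q₁ Q₂ : ∀ {n} → Mat n → Set) → Negligible Q₁ → Negligible Q₂ → Negligible (λ G → Q₁ G ⊎ Q₂ G)
  negligible-⊎ Q₁ Q₂ n₁ n₂ f = N₁ + N₂ , main
    where
    -- Then f′ + 1 = 2 (f + 1), so each of the two families takes half of the allowance.
    f′ = suc (2 * f)
    N₁ = proj₁ (n₁ f′)
    N₂ = proj₁ (n₂ f′)
    main : ∀ n → N₁ + N₂ ≤ n → ∀ (S : List (Mat n)) → Unique S → All (λ G → Cls G × (Q₁ G ⊎ Q₂ G)) S → suc f * length S ≤ length (members n)
    main n le S u all with split-list S u (All.map (λ {G} → distribute {G}) all)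
      where
      distribute : ∀ {G : Mat n} → Cls G × (Q₁ G ⊎ Q₂ G) → (Cls G × Q₁ G) ⊎ (Cls G × Q₂ G)
      distribute (c , inj₁ q) = inj₁ (c , q)
      distribute (c , inj₂ q) = inj₂ (c , q)
    ... | S₁ , S₂ , u₁ , u₂ , p₁ , p₂ , _ , len = *-cancelˡ-≤ 2 (begin
      2 * (suc f * length S) ≡⟨ cong (λ l → 2 * (suc f * l)) len ⟩
      2 * (suc f * (length S₁ + length S₂)) ≡⟨ eq f (length S₁) (length S₂) ⟩
      suc f′ * length S₁ + suc f′ * length S₂ ≤⟨ +-mono-≤ (proj₂ (n₁ f′) n (≤-trans (m≤m+n N₁ N₂) le) S₁ u₁ p₁) (proj₂ (n₂ f′) n (≤-trans (m≤n+m N₂ N₁) le) S₂ u₂ p₂) ⟩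
      length (members n) + length (members n) ≡⟨ cong (length (members n) +_) (sym (+-identityʳ _)) ⟩
      2 * length (members n) ∎)
      where
      open ≤-Reasoning
      eq : ∀ f a b → 2 * ((1 + f) * (a + b)) ≡ (2 + 2 * f) * a + (2 + 2 * f) * b
      eq = solve-∀

  module _ (j : ℕ) (cls-digraph : ∀ {n} (G : Mat n) → Cls G → IsDigraph G) (cls-free : ∀ {n} (G : Mat n) → Cls G → CkFree (3 + j) G) (free-cls : ∀ {n} (G : Mat n) → IsOriented G → CkFree (3 + j) G → Cls G) where

    few-backwards-negligible : Negligible (FewBackwards (4 * blockWidth (3 + j)))
    few-backwards-negligible f = proj₁ c , λ n N≤n S u all → proj₂ c n N≤n (members n) S (λ M o fr → ∈-members M (free-cls M o fr)) u (All.map (λ { {G} (c , q) → cls-digraph G c , q }) all)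
      where
      c = count-few-backwards (3 + j) (s≤s (s≤s (s≤s z≤n))) f

    far-negligible : ∀ o F → 0 < F → (∀ {n} (G : Mat n) → Cls G → o ≡ true → Oriented G) → (Q : ∀ {n} → Mat n → Set) → (∀ n → F ≤ n → (G : Mat n) → Cls G → Q G → Far o (3 + j) F G) → Negligible Q
    far-negligible o F F>0 or Q far f = proj₁ c + F , λ n N≤n S u all → ≤-trans (proj₂ c n (≤-trans (m≤m+n _ F) N≤n) S u (All.map (λ { {G} (cl , q) → cls-digraph G cl , or G cl , cls-free G cl , far n (≤-trans (m≤n+m F _) N≤n) G cl q }) all)) (many-free (2 + j) (members n) (λ M o fr → ∈-members M (free-cls M o fr)))
      where
      c = count-far o j F F>0 f

    many-backwards-negligible : ∀ o → (∀ {n} (G : Mat n) → Cls G → o ≡ true → Oriented G) → o ≡ true ⊎ EvenCycle j → ∀ a d → 0 < a → 0 < d → Negligible (ManyBackwards a d)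
    many-backwards-negligible o or cond a d a>0 d>0 = far-negligible o (proj₁ c) (proj₁ (proj₂ c)) or (ManyBackwards a d) λ n F≤n G cl q → proj₂ (proj₂ c) n F≤n G (λ σ le → q σ (≤-trans le (≤-trans (≤-reflexive (sym (+-identityʳ (n * n)))) (*-monoˡ-≤ (n * n) a>0))))
      where
      c = close-to-transitive o j d d>0 cond

Even⇒EvenCycle : ∀ j → Even (3 + j) → EvenCycle j
Even⇒EvenCycle j (suc (suc m) , e) = m , suc-injective (suc-injective (suc-injective (trans e (eq m))))
  where
  eq : ∀ m → 2 * (2 + m) ≡ 4 + (m + m)
  eq = solve-∀
Even⇒EvenCycle j (suc zero , ())

Odd⇒double : ∀ j → Odd (3 + j) → ∃ λ m → j ≡ m + m
Odd⇒double j (suc m , e) = m , suc-injective (suc-injective (suc-injective (trans e (eq m))))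
  where
  eq : ∀ m → 1 + 2 * (1 + m) ≡ 3 + (m + m)
  eq = solve-∀

theorem1p3 : ∀ (k : ℕ) → 3 ≤ k →
    ∃ λ p → ∃ λ q → 0 < p × 0 < q ×
    (∀ (a d : ℕ) → 0 < a → 0 < d →
    AlmostAll (λ G → IsOriented G × CkFree k G)
    (λ {n} G → Σ (Permutation′ n) λ σ → TransitiveOptimal G σ ×
    AtLeastCNOverLog p q n (backwards G σ) ×
    AtMostAlphaN² a d n (backwards G σ))
    ×
    AlmostAll (λ G → IsDigraph G × CkFree k G)
    (λ {n} G → Σ (Permutation′ n) λ σ → TransitiveOptimal G σ ×
    AtLeastCNOverLog p q n (backwards G σ))
    ×
    (Even k → AlmostAll (λ G → IsDigraph G × CkFree k G)
    (λ {n} G → Σ (Permutation′ n) λ σ → TransitiveOptimal G σ ×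
    AtMostAlphaN² a d n (backwards G σ)))
    ×
    (Odd k → AlmostAll (λ G → IsDigraph G × CkFree k G)
    (λ G → NearBlowUp a d G)))
theorem1p3 (suc (suc (suc j))) (s≤s (s≤s (s≤s z≤n))) = 1 , q , s≤s z≤n , *-mono-≤ {1} {4} (s≤s z≤n) (*-mono-≤ {1} {suc k} (s≤s z≤n) (m^n>0 2 (suc k * suc k + 2))) , λ a d a>0 d>0 →
    almostAll Ori Ori? _ (λ G → FewBackwards q G ⊎ ManyBackwards a d G) (λ G _ → not-few-or-many q a d G)
      (negligible-⊎ Ori Ori? (FewBackwards q) (ManyBackwards a d) (few-backwards-negligible Ori Ori? j od of oi) (many-backwards-negligible Ori Ori? j od of oi true (λ G c _ → oriented G (proj₁ c)) (inj₁ refl) a d a>0 d>0))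
  , almostAll Dig Dig? _ (FewBackwards q) (λ G _ → not-few q G) (few-backwards-negligible Dig Dig? j dd df di)
  , (λ ev → almostAll Dig Dig? _ (ManyBackwards a d) (λ G _ → not-many a d G) (many-backwards-negligible Dig Dig? j dd df di false (λ _ _ ()) (inj₂ (Even⇒EvenCycle j ev)) a d a>0 d>0))
  , λ odd → blow a d a>0 d>0 (Odd⇒double j odd)
  where
  k = 3 + j
  Ori Dig : ∀ {n} → Mat n → Set
  Ori G = IsOriented G × CkFree k G
  Dig G = IsDigraph G × CkFree k G
  Ori? : ∀ {n} (G : Mat n) → Dec (Ori G)
  Ori? G = IsOriented? G ×-dec CkFree? k G
  Dig? : ∀ {n} (G : Mat n) → Dec (Dig G)
  Dig? G = IsDigraph? G ×-dec CkFree? k G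
  -- The constant c = 1 / q depends on k only; α enters solely through the upper bounds.
  q = 4 * blockWidth k
  od : ∀ {n} (G : Mat n) → Ori G → IsDigraph G
  od G c = proj₁ (proj₁ c)
  of : ∀ {n} (G : Mat n) → Ori G → CkFree k G
  of G = proj₂
  oi : ∀ {n} (G : Mat n) → IsOriented G → CkFree k G → Ori G
  oi G o f = o , f
  dd : ∀ {n} (G : Mat n) → Dig G → IsDigraph G
  dd G = proj₁
  df : ∀ {n} (G : Mat n) → Dig G → CkFree k G
  df G = proj₂
  di : ∀ {n} (G : Mat n) → IsOriented G → CkFree k G → Dig G
  di G o f = proj₁ o , f
  oriented : ∀ {n} (G : Mat n) → IsOriented G → Oriented G
  oriented G (_ , asym) i j with edge G i j in e | edge G j i in e′
  ... | false | _ = refl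
  ... | true | false = refl
  ... | true | true = contradiction e′ (asym i j e)
  blow : ∀ a d → 0 < a → 0 < d → (∃ λ m → j ≡ m + m) → AlmostAll Dig (NearBlowUp a d)
  blow a d a>0 d>0 (m , e) = almostAll Dig Dig? (NearBlowUp a d) (λ G → ¬ NearBlowUp a d G) (λ _ _ → return)
    (far-negligible Dig Dig? j dd df di false (proj₁ c) (proj₁ (proj₂ c)) (λ _ _ ()) (λ G → ¬ NearBlowUp a d G) λ n F≤n G cl q → subst (λ j → Far false (3 + j) (proj₁ c) G) (sym e) (proj₂ (proj₂ c) n F≤n G (proj₁ cl) q))
    where
    c = close-to-blow-up m a d a>0 d>0
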